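{- Let $T$ be a zip-trie storing $n$ strings over an alphabet of constant size, and let $\ell$ be the length of the longest common prefix between a key $x$ and the keys stored in $T$. In the word RAM model, $T$ can perform prefix search, predecessor/successor queries, and insert/delete operations on $x$ in $\mathcal{O}\left(\frac{\ell}{\alpha}+\log n\right)$ time, using only $\mathcal{O}\left(\log\log n+\log\log\frac{\ell}{\alpha}\right)$ bits of metadata per node, w.h.p. (with high probability), where $\alpha$ is the number of characters that fit in one machine word.
   Context: Model: the alphabet has constant size $\sigma$, machine words have $w$ bits, and $\alpha=\lfloor w/\lceil\log_2\sigma\rceil\rfloor$ characters are packed per word. The word RAM performs AC$^0$ operations on machine words (e.g. bitwise XOR, most significant bit) in $\mathcal{O}(1)$ time. $\log$ denotes $\log_2$. (The standard RAM corresponds to $\alpha=1$.) Zip-trie: a binary search tree on the stored strings in lexicographic order, in which each node has a random rank $(r_1,r_2)$, compared lexicographically, where $r_1$ is drawn from a geometric distribution with success probability $1/2$ and $r_2$ independently and uniformly from a range of size $\mathcal{O}(\log^c n)$ for a small constant $c$; the tree is max-heap ordered by rank with ties broken in favor of smaller keys (a zip-zip tree). For a node $v$, let $\pi_v$ be the set of proper ancestors of $v$, and $\pi_v^-$, $\pi_v^+$ the immediate lexicographic predecessor and successor of $v$ in $\pi_v$ ($-\infty$, $\infty$ if none). Each node $v$ additionally stores (possibly approximate, lower-bound) values of the lengths $\ell_{v,\pi_v^- }$ and $\ell_{v,\pi_v^+}$ of the longest common prefixes (LCPs) of $v$ with $\pi_v^-$ and $\pi_v^+$; the LCP with $\pm\infty$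 has length $0$. The metadata of a node consists of its rank and its stored LCP-length information; child pointers are not counted as metadata. Randomness is over the choice of ranks. Prefix search on $x$: locate the (lexicographically contiguous) set of stored keys having $x$ as a prefix, without enumerating it. Predecessor/successor query: find the lexicographic predecessor/successor of $x$ among the stored keys. -}

module Defs where

open import Data.Bool using (Bool; true; false; if_then_else_; _∧_; _∨_; _xor_)
import Data.Bool.Properties as Bool
open import Data.Empty using (⊥)
open import Data.Fin as Fin using (Fin)
import Data.Fin.Properties as Fin
open import Data.Integer using (+_)
open import Data.List as List using (List; []; _∷_; _++_; length; drop; filter; foldr)
open import Data.List.Extrema.Nat using (max)
open import Data.List.Membership.Propositional using (_∈_)
import Data.List.Membership.DecPropositional as DecMembership
import Data.List.Properties as List
open import Data.List.Relation.Binary.Lex.Strict using (Lex-<)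
open import Data.List.Relation.Binary.Permutation.Propositional using (_↭_)
open import Data.List.Relation.Binary.Prefix.Heterogeneous using (Prefix)
open import Data.List.Relation.Unary.All using (All)
open import Data.List.Relation.Unary.Unique.Propositional using (Unique)
open import Data.Maybe using (Maybe; just; nothing)
open import Data.Nat
open import Data.Nat.DivMod using (_/_; _%_)
open import Data.Nat.Logarithm using (⌊log₂_⌋; ⌈log₂_⌉; ⌈log₂⌉-mono-≤)
open import Data.Nat.Properties using (m^n≢0)
open import Data.Product using (_×_; _,_; proj₁; proj₂; Σ-syntax; ∃-syntax)
open import Data.Product.Relation.Binary.Lex.Strict using (×-Lex)
open import Data.Rational as ℚ using (ℚ; 0ℚ; 1ℚ; ½)
open import Data.Sum using (_⊎_)
open import Data.Unit using (⊤)
open import Data.Vec as Vec using (Vec; []; _∷_)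
import Data.Vec.Properties as Vec
open import Relation.Binary.Definitions using (DecidableEquality)
open import Relation.Binary.PropositionalEquality using (_≡_; _≢_)
open import Relation.Nullary using (¬_; does)
open import Relation.Nullary.Decidable using (¬?)

------------------------------------------------------------------------
-- Strings

charBits : ℕ → ℕ
charBits σ = ⌈log₂ σ ⌉

charBits≢0 : ∀ σ → .{{NonTrivial σ}} → NonZero (charBits σ)
charBits≢0 σ = >-nonZero (⌈log₂⌉-mono-≤ (nonTrivial⇒n>1 σ))

-- Characters per w-bit word.
α : (σ w : ℕ) → .{{NonTrivial σ}} → ℕ
α σ w = _/_ w (charBits σ) {{charBits≢0 σ}}

Str : ℕ → Set
Str σ = List (Fin σ)

_≟ˢ_ : ∀ {σ} → DecidableEquality (Str σ)
_≟ˢ_ = List.≡-dec Fin._≟_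

-- A proper prefix of a string precedes it.
_<ˢ_ : ∀ {σ} → Str σ → Str σ → Set
_<ˢ_ = Lex-< _≡_ Fin._<_

_≤ˢ_ : ∀ {σ} → Str σ → Str σ → Set
x ≤ˢ y = x <ˢ y ⊎ x ≡ y

lcp : ∀ {σ} → Str σ → Str σ → ℕ
lcp (a ∷ x) (b ∷ y) = if does (a Fin.≟ b) then suc (lcp x y) else 0
lcp _       _       = 0

-- nothing stands for −∞ or +∞.
lcp∞ : ∀ {σ} → Str σ → Maybe (Str σ) → ℕ
lcp∞ x nothing  = 0
lcp∞ x (just y) = lcp x y

lcpWith : ∀ {σ} → Str σ → List (Str σ) → ℕ
lcpWith x ys = max 0 (List.map (lcp x) ys)

------------------------------------------------------------------------
-- Zip-tries

Rank : ℕ → Set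
Rank R = ℕ × Fin R

_<ʳ_ : ∀ {R} → Rank R → Rank R → Set
_<ʳ_ = ×-Lex _≡_ _<_ Fin._<_

Entry : (σ R : ℕ) → Set
Entry σ R = Str σ × Rank R

_Beats_ : ∀ {σ R} → Entry σ R → Entry σ R → Set
(x , r) Beats (y , s) = s <ʳ r ⊎ (r ≡ s × x <ˢ y)

-- code⁻ and code⁺ encode the stored LCP lengths of the key with its
-- immediate lexicographic predecessor and successor among the proper
-- ancestors of the node.
record Node (σ R : ℕ) : Set where
  constructor node
  field
    key         : Str σ
    rank        : Rank R
    code⁻ code⁺ : ℕ

entry : ∀ {σ R} → Node σ R → Entry σ R
entry v = Node.key v , Node.rank v

data Tree (σ R : ℕ) : Set where
  leaf   : Tree σ R
  branch : Tree σ R → Node σ R → Tree σ R → Tree σ R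

nodes : ∀ {σ R} → Tree σ R → List (Node σ R)
nodes leaf           = []
nodes (branch l v r) = nodes l ++ v ∷ nodes r

entries : ∀ {σ R} → Tree σ R → List (Entry σ R)
entries t = List.map entry (nodes t)

keys : ∀ {σ R} → List (Entry σ R) → List (Str σ)
keys = List.map proj₁

SearchTree : ∀ {σ R} → Tree σ R → Set
SearchTree leaf           = ⊤
SearchTree (branch l v r) =
    All (_<ˢ Node.key v) (keys (entries l))
  × All (Node.key v <ˢ_) (keys (entries r))
  × SearchTree l × SearchTree r

HeapOrdered : ∀ {σ R} → Tree σ R → Set
HeapOrdered leaf           = ⊤
HeapOrdered (branch l v r) =
    All (entry v Beats_) (entries l)
  × All (entry v Beats_) (entries r)
  × HeapOrdered l × HeapOrdered r

-- How a node stores an LCP length.  For a length ℓ, the value recorded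
-- is the lower bound decode (encode ℓ), and what is written in the node
-- is its code encode ℓ; by encode-decode the code carries no information
-- beyond that value.  The precision may depend on α and on an estimate L
-- of log₂ n.
record LCPCode : Set where
  field
    encode decode : (L α : ℕ) → .{{NonZero α}} → ℕ → ℕ
    lower-bound   : ∀ L α → .{{_ : NonZero α}} → ∀ ℓ →
                    decode L α (encode L α ℓ) ≤ ℓ
    encode-decode : ∀ L α → .{{_ : NonZero α}} → ∀ ℓ →
                    encode L α (decode L α (encode L α ℓ)) ≡ encode L α ℓ

-- The bounds are the immediate lexicographic predecessor and successor
-- among the ancestors already passed.
LCPsStored : ∀ {σ R} → (ℕ → ℕ) → Maybe (Str σ) → Maybe (Str σ) →
             Tree σ R → Set
LCPsStored enc lo hi leaf           = ⊤
LCPsStored enc lo hi (branch l v r) =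
    Node.code⁻ v ≡ enc (lcp∞ (Node.key v) lo)
  × Node.code⁺ v ≡ enc (lcp∞ (Node.key v) hi)
  × LCPsStored enc lo (just (Node.key v)) l
  × LCPsStored enc (just (Node.key v)) hi r

record ZipTrie {σ R} (enc : ℕ → ℕ) (E : List (Entry σ R)) (t : Tree σ R) :
               Set where
  field
    stores : entries t ↭ E
    search : SearchTree t
    heap   : HeapOrdered t
    lcps   : LCPsStored enc nothing nothing t

bits : ℕ → ℕ
bits k = suc ⌊log₂ k ⌋

metadataBits : ∀ {σ R} → Node σ R → ℕ
metadataBits v = bits (proj₁ (rank v)) + bits (Fin.toℕ (proj₂ (rank v)))
               + bits (code⁻ v) + bits (code⁺ v)
  where open Node

------------------------------------------------------------------------
-- Word RAM

-- Least significant bit first.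
Word : ℕ → Set
Word w = Vec Bool w

toℕ : ∀ {w} → Word w → ℕ
toℕ []      = 0
toℕ (b ∷ u) = (if b then 1 else 0) + 2 * toℕ u

-- Reduces modulo 2 ^ w.
fromℕ : ∀ w → ℕ → Word w
fromℕ zero    k = []
fromℕ (suc w) k = (k % 2 ≡ᵇ 1) ∷ fromℕ w (k / 2)

_≟ʷ_ : ∀ {w} → DecidableEquality (Word w)
_≟ʷ_ = Vec.≡-dec Bool._≟_

_⊕_ : ∀ {w} → Word w → Word w → Word w
u ⊕ v = fromℕ _ (toℕ u + toℕ v)

null : ∀ {w} → Word w
null = fromℕ _ 0

data Op : Set where
  add sub and or xor shl shr eq lt : Op

applyOp : ∀ {w} → Op → Word w → Word w → Word w
applyOp     add u v = u ⊕ v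
applyOp {w} sub u v = fromℕ w (toℕ u + (2 ^ w ∸ toℕ v))
applyOp     and u v = Vec.zipWith _∧_ u v
applyOp     or  u v = Vec.zipWith _∨_ u v
applyOp     xor u v = Vec.zipWith _xor_ u v
applyOp {w} shl u v = fromℕ w (toℕ u * 2 ^ toℕ v)
applyOp {w} shr u v = fromℕ w (_/_ (toℕ u) (2 ^ toℕ v) {{m^n≢0 2 (toℕ v)}})
applyOp {w} eq  u v = fromℕ w (if toℕ u ≡ᵇ toℕ v then 1 else 0)
applyOp {w} lt  u v = fromℕ w (if toℕ u <ᵇ toℕ v then 1 else 0)

-- Memory is divided into arrays of words.  A program names registers and
-- arrays by literals, so it has only constantly many of each.
Reg Array : Set
Reg   = ℕ
Array = ℕ

data Expr : Set where
  lit : ℕ → Expr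
  reg : Reg → Expr
  _[_] : Array → Expr → Expr
  op  : Op → Expr → Expr → Expr
  msb : Expr → Expr

data Cmd : Set where
  skip  : Cmd
  _≔_   : Reg → Expr → Cmd
  _[_]≔_ : Array → Expr → Expr → Cmd
  _⨾_   : Cmd → Cmd → Cmd
  cond  : Expr → Cmd → Cmd → Cmd
  while : Expr → Cmd → Cmd

record State (w : ℕ) : Set where
  constructor state
  field
    regs : Reg → Word w
    mem  : Array → Word w → Word w
open State public

⟦_⟧ : ∀ {w} → Expr → State w → Word w
⟦_⟧ {w} (lit k) s = fromℕ w k
⟦ reg r ⟧       s = regs s r
⟦ a [ e ] ⟧     s = mem s a (⟦ e ⟧ s)
⟦ op o e f ⟧    s = applyOp o (⟦ e ⟧ s) (⟦ f ⟧ s)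
⟦_⟧ {w} (msb e) s = fromℕ w ⌊log₂ toℕ (⟦ e ⟧ s) ⌋

cost : Expr → ℕ
cost (lit k)    = 1
cost (reg r)    = 1
cost (a [ e ])  = suc (cost e)
cost (op o e f) = suc (cost e + cost f)
cost (msb e)    = suc (cost e)

setReg : ∀ {w} → Reg → Word w → State w → State w
setReg r u s =
  state (λ r′ → if r′ ≡ᵇ r then u else regs s r′) (mem s)

setMem : ∀ {w} → Array → Word w → Word w → State w → State w
setMem a i u s =
  state (regs s)
        (λ a′ i′ → if (a′ ≡ᵇ a) ∧ does (i′ ≟ʷ i) then u else mem s a′ i′)

-- ⟨ c , s ⟩⇓⟨ s′ , τ ⟩: from s, c halts in s′ after τ time steps.
data ⟨_,_⟩⇓⟨_,_⟩ {w} : Cmd → State w → State w → ℕ → Set where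
  ⇓skip  : ∀ {s} → ⟨ skip , s ⟩⇓⟨ s , 0 ⟩
  ⇓reg   : ∀ {r e s} →
           ⟨ r ≔ e , s ⟩⇓⟨ setReg r (⟦ e ⟧ s) s , suc (cost e) ⟩
  ⇓mem   : ∀ {a e f s} →
           ⟨ a [ e ]≔ f , s ⟩⇓⟨ setMem a (⟦ e ⟧ s) (⟦ f ⟧ s) s
                               , suc (cost e + cost f) ⟩
  ⇓seq   : ∀ {c d s s′ s″ τ τ′} →
           ⟨ c , s ⟩⇓⟨ s′ , τ ⟩ → ⟨ d , s′ ⟩⇓⟨ s″ , τ′ ⟩ →
           ⟨ c ⨾ d , s ⟩⇓⟨ s″ , τ + τ′ ⟩
  ⇓then  : ∀ {e c d s s′ τ} → ⟦ e ⟧ s ≢ null → ⟨ c , s ⟩⇓⟨ s′ , τ ⟩ →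
           ⟨ cond e c d , s ⟩⇓⟨ s′ , suc (cost e + τ) ⟩
  ⇓else  : ∀ {e c d s s′ τ} → ⟦ e ⟧ s ≡ null → ⟨ d , s ⟩⇓⟨ s′ , τ ⟩ →
           ⟨ cond e c d , s ⟩⇓⟨ s′ , suc (cost e + τ) ⟩
  ⇓done  : ∀ {e c s} → ⟦ e ⟧ s ≡ null →
           ⟨ while e c , s ⟩⇓⟨ s , suc (cost e) ⟩
  ⇓loop  : ∀ {e c s s′ s″ τ τ′} → ⟦ e ⟧ s ≢ null →
           ⟨ c , s ⟩⇓⟨ s′ , τ ⟩ → ⟨ while e c , s′ ⟩⇓⟨ s″ , τ′ ⟩ →
           ⟨ while e c , s ⟩⇓⟨ s″ , suc (cost e + τ + τ′) ⟩

------------------------------------------------------------------------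
-- Zip-tries and packed strings in memory

-- A node is an index p ≢ null into nine parallel arrays.  The key is
-- given by the index in the text array of its first word and by its
-- length in mixed radix: fullᴬ · α + tailᴬ characters, tailᴬ < α.
-- Arrays from 10 on are scratch space.
textᴬ baseᴬ fullᴬ tailᴬ leftᴬ rightᴬ rank₁ᴬ rank₂ᴬ code⁻ᴬ code⁺ᴬ : Array
textᴬ  = 0
baseᴬ  = 1
fullᴬ  = 2
tailᴬ  = 3
leftᴬ  = 4
rightᴬ = 5
rank₁ᴬ = 6
rank₂ᴬ = 7
code⁻ᴬ = 8
code⁺ᴬ = 9

-- rootᴿ, logᴿ and αᴿ belong to the structure.  The query string is in
-- xbaseᴿ, xfullᴿ, xtailᴿ.  For an insertion, freshᴿ is an unused node
-- index and xrank₁ᴿ, xrank₂ᴿ hold the random rank of the new node.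
rootᴿ logᴿ αᴿ xbaseᴿ xfullᴿ xtailᴿ freshᴿ xrank₁ᴿ xrank₂ᴿ out₁ᴿ out₂ᴿ : Reg
rootᴿ   = 0
logᴿ    = 1
αᴿ      = 2
xbaseᴿ  = 3
xfullᴿ  = 4
xtailᴿ  = 5
freshᴿ  = 6
xrank₁ᴿ = 7
xrank₂ᴿ = 8
out₁ᴿ   = 9
out₂ᴿ   = 10

-- The first a characters, most significant first, padded with zeros.
pack : ∀ {σ} → ℕ → Str σ → ℕ
pack         zero    _       = 0
pack         (suc a) []      = 0
pack {σ = σ} (suc a) (c ∷ x) = Fin.toℕ c * 2 ^ (charBits σ * a) + pack a x

data Reach {w} (s : State w) : Word w → Word w → Set where
  here  : ∀ {p} → p ≢ null → Reach s p p
  left  : ∀ {p q} → p ≢ null → Reach s (mem s leftᴬ p) q → Reach s p q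
  right : ∀ {p q} → p ≢ null → Reach s (mem s rightᴬ p) q → Reach s p q

IsNode : ∀ {w} → State w → Word w → Set
IsNode s = Reach s (regs s rootᴿ)

module _ (σ w : ℕ) .{{_ : NonTrivial σ}} .{{_ : NonZero (α σ w)}} where

  -- Words 0, …, ⌊|x|/α⌋ are present; the last one is zero if α ∣ |x|.
  record Holds (s : State w) (base full tail : Word w) (x : Str σ) : Set where
    field
      full≡ : toℕ full ≡ length x / α σ w
      tail≡ : toℕ tail ≡ length x % α σ w
      text≡ : ∀ i → i ≤ length x / α σ w →
              mem s textᴬ (base ⊕ fromℕ w i)
                ≡ fromℕ w (pack (α σ w) (drop (i * α σ w) x))

  KeyAt : State w → Word w → Str σ → Set
  KeyAt s p =
    Holds s (mem s baseᴬ p) (mem s fullᴬ p) (mem s tailᴬ p)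

  record NodeAt {R} (s : State w) (p : Word w) (v : Node σ R) : Set where
    open Node v
    field
      nonnull : p ≢ null
      key≡    : KeyAt s p key
      rank₁≡  : toℕ (mem s rank₁ᴬ p) ≡ proj₁ rank
      rank₂≡  : toℕ (mem s rank₂ᴬ p) ≡ Fin.toℕ (proj₂ rank)
      code⁻≡  : toℕ (mem s code⁻ᴬ p) ≡ code⁻
      code⁺≡  : toℕ (mem s code⁺ᴬ p) ≡ code⁺

  TreeAt : ∀ {R} → State w → Word w → Tree σ R → Set
  TreeAt s p leaf           = p ≡ null
  TreeAt s p (branch l v r) =
    NodeAt s p v × TreeAt s (mem s leftᴬ p) l × TreeAt s (mem s rightᴬ p) r

  record Loaded {R} (L : ℕ) (s : State w) (t : Tree σ R) : Set where
    field
      tree : TreeAt s (regs s rootᴿ) t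
      log≡ : toℕ (regs s logᴿ) ≡ L
      α≡   : toℕ (regs s αᴿ) ≡ α σ w

  -- p is the node of the least key y under _≼_ among the keys in ys that
  -- satisfy P, or null if there is none.
  Finds : State w → (Str σ → Set) → (Str σ → Str σ → Set) →
          List (Str σ) → Word w → Set
  Finds s P _≼_ ys p =
      (p ≡ null × ∀ y → y ∈ ys → ¬ P y)
    ⊎ (Σ[ y ∈ Str σ ] y ∈ ys × P y × (∀ z → z ∈ ys → P z → y ≼ z)
                      × IsNode s p × KeyAt s p y)

------------------------------------------------------------------------
-- Operations

data Operation : Set where
  prefixSearch predecessor successor insert delete : Operation

module _ {σ R : ℕ} where

  open DecMembership (_≟ˢ_ {σ}) using (_∈?_)

  -- The contents after an operation on x, where r is the rank drawn for x
  -- if x is inserted.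
  result : Operation → Str σ → Rank R → List (Entry σ R) → List (Entry σ R)
  result insert x r E = if does (x ∈? keys E) then E else (x , r) ∷ E
  result delete x r E = filter (λ e → ¬? (proj₁ e ≟ˢ x)) E
  result _      x r E = E

module _ (σ w : ℕ) .{{_ : NonTrivial σ}} .{{_ : NonZero (α σ w)}} where

  InsertArgs : ∀ {R} → State w → Rank R → Set
  InsertArgs s r =
      regs s freshᴿ ≢ null
    × ¬ IsNode s (regs s freshᴿ)
    × toℕ (regs s xrank₁ᴿ) ≡ proj₁ r
    × toℕ (regs s xrank₂ᴿ) ≡ Fin.toℕ (proj₂ r)

  record Pre {R} (o : Operation) (L : ℕ) (t : Tree σ R) (x : Str σ)
             (r : Rank R) (s : State w) : Set where
    field
      loaded : Loaded σ w L s t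
      query  : Holds σ w s (regs s xbaseᴿ) (regs s xfullᴿ) (regs s xtailᴿ) x
      args   : o ≡ insert → InsertArgs s r

  -- Nodes an operation may modify, and those that may make up the tree
  -- afterwards.
  MayWrite MayUse : Operation → State w → Word w → Set
  MayWrite insert s p = IsNode s p ⊎ p ≡ regs s freshᴿ
  MayWrite delete s p = IsNode s p
  MayWrite _      s p = ⊥
  MayUse insert s p = IsNode s p ⊎ p ≡ regs s freshᴿ
  MayUse _      s p = IsNode s p

  -- Prefix search delimits its contiguous range of keys by the least and
  -- the greatest element; predecessor and successor are strict.
  Output : Operation → List (Str σ) → Str σ → State w → Set
  Output prefixSearch ys x s =
      Finds σ w s (Prefix _≡_ x) _≤ˢ_ ys (regs s out₁ᴿ)
    × Finds σ w s (Prefix _≡_ x) (λ y z → z ≤ˢ y) ys (regs s out₂ᴿ)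
  Output predecessor ys x s =
    Finds σ w s (_<ˢ x) (λ y z → z ≤ˢ y) ys (regs s out₁ᴿ)
  Output successor ys x s =
    Finds σ w s (x <ˢ_) _≤ˢ_ ys (regs s out₁ᴿ)
  Output insert ys x s = ⊤
  Output delete ys x s = ⊤

  record Post {R} (o : Operation) (L : ℕ) (enc : ℕ → ℕ)
              (E : List (Entry σ R)) (x : Str σ) (r : Rank R)
              (s s′ : State w) : Set where
    field
      tree    : Tree σ R
      zipTrie : ZipTrie enc (result o x r E) tree
      loaded  : Loaded σ w L s′ tree
      uses    : ∀ p → IsNode s′ p → MayUse o s p
      text    : ∀ i → mem s′ textᴬ i ≡ mem s textᴬ i
      frame   : ∀ a p → textᴬ < a → a ≤ code⁺ᴬ → ¬ MayWrite o s p →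
                mem s′ a p ≡ mem s a p
      output  : Output o (keys E) x s′

  -- Holds for every outcome of the ranks.
  Correct : LCPCode → (Operation → Cmd) → Set
  Correct code program =
    ∀ (o : Operation) (L R : ℕ) (E : List (Entry σ R)) (t : Tree σ R) →
    (x : Str σ) (r : Rank R) (s : State w) →
    let enc = LCPCode.encode code L (α σ w) in
    ZipTrie enc E t → Pre o L t x r s →
    Σ[ s′ ∈ State w ] ∃[ τ ]
      ⟨ program o , s ⟩⇓⟨ s′ , τ ⟩ × Post o L enc E x r s s′

  Fast : ∀ {R} → (Operation → Cmd) → (C n L : ℕ) → List (Entry σ R) →
         Tree σ R → Str σ → Rank R → Set
  Fast program C n L E t x r =
    ∀ (o : Operation) (s s′ : State w) (τ : ℕ) → Pre o L t x r s →
    ⟨ program o , s ⟩⇓⟨ s′ , τ ⟩ →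
    τ ≤ C * (1 + lcpWith x (keys E) / α σ w + ⌊log₂ n ⌋)

  -- For each node, ℓ is the LCP length of its key with the other keys.
  Compact : ∀ {R} → (C n : ℕ) → List (Entry σ R) → Tree σ R → Set
  Compact C n E t = All small (nodes t)
    where
    others : Str σ → List (Str σ)
    others k = filter (λ y → ¬? (y ≟ˢ k)) (keys E)

    small : Node σ _ → Set
    small v =
      let ℓ = lcpWith (Node.key v) (others (Node.key v)) in
      metadataBits v ≤
        C * (1 + ⌊log₂ ⌊log₂ n ⌋ ⌋ + ⌊log₂ ⌊log₂ ℓ / α σ w ⌋ ⌋)

  -- The outcome consists of the rank of x, should it be inserted,
  -- followed by the ranks of the n stored strings.
  Good : ∀ {n R} → LCPCode → (Operation → Cmd) → (C L : ℕ) →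
         Vec (Str σ) n → Str σ → Vec (Rank R) (suc n) → Set
  Good {n} {R} code program C L ks x (r ∷ ranks) =
    ∀ (t : Tree σ R) → ZipTrie (LCPCode.encode code L (α σ w)) E t →
    Fast program C n L E t x r × Compact C n E t
    where
    E = Vec.toList (Vec.zip ks ranks)

-- The parameters L (the estimate of log₂ n for which the structure is
-- set up) and R (the range of the second rank component) suit n strings.
-- They stay fixed while n changes through updates, hence the slack K.
record Tuned (c K n L R : ℕ) : Set where
  field
    log≤ : ⌊log₂ n ⌋ ≤ K * (1 + L)
    ≤log : L ≤ K * (1 + ⌊log₂ n ⌋)
    R≤   : R ≤ K * (1 + ⌊log₂ n ⌋) ^ c

------------------------------------------------------------------------
-- Random ranks

-- The probability of k failures before the first success.
geometric : ℕ → ℚ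
geometric zero    = ½
geometric (suc k) = ½ ℚ.* geometric k

prob : ∀ {R m} → .{{NonZero R}} → Vec (Rank R) m → ℚ
prob     []              = 1ℚ
prob {R} ((k , _) ∷ ρ) = geometric k ℚ.* (+ 1 ℚ./ R) ℚ.* prob ρ

-- The outcomes form a countable discrete space, so the probability of an
-- event is the supremum of the probabilities of its finite subsets.
-- Hence this says Pr[ ¬ A ] ≤ ε.
FailsWithProbability≤ : ∀ {R m} → .{{NonZero R}} → ℚ →
                        (Vec (Rank R) m → Set) → Set
FailsWithProbability≤ ε A =
  ∀ ρs → Unique ρs → All (λ ρ → ¬ A ρ) ρs →
  foldr (λ ρ → prob ρ ℚ.+_) 0ℚ ρs ℚ.≤ ε

1/_^_ : (n d : ℕ) → .{{NonZero n}} → ℚ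
1/ n ^ d = ℚ._/_ (+ 1) (n ^ d) {{m^n≢0 n d}}

{-# OPTIONS --safe #-}
module Submission where

-- LCP lengths are counted in words and stored as floating-point codes with
-- ⌊log₂ L⌋ mantissa bits, where the scale L is of order log n, so that a code
-- takes O(log log n + log log (ℓ/α)) bits and decoding loses at most a 1/L
-- fraction of the value.  A search knows the LCPs of x with both bounds of the
-- current subtree; each comparison resumes where these and the stored codes
-- allow.  Its cost is paid by the growth of the larger LCP plus the decoding
-- loss, and over O(log n) nodes the losses add up to O(ℓ/α).  Insertion and
-- deletion rearrange only nodes on search paths.  Encoding is monotone, so the
-- LCP of a new neighbouring pair, a minimum of LCPs, is encoded by the minimum
-- of the codes.
--
-- The ancestors of a boundary on one side are the keys whose rank is a weak
-- record when the keys are read away from the boundary.  For geometric ranks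
-- the weight (3/2)^(number of records) / 2^(largest rank) has expectation at most 1,
-- so Markov's inequality and a union bound give depth O(log n) w.h.p.

-- `TreeAt` does not say that distinct tree positions have distinct addresses, yet nodes are
-- overwritten in place. Separation is derived instead: the memory at an address determines its key
-- (`holds-injective`), the keys of a search tree are distinct, and no operation changes the text or
-- the key fields of a tree node. So positions with different keys never alias.
--
-- Correctness is owed for every outcome of the ranks, the time bound only for good ones. Each run
-- is therefore analysed once, with a cost depending on the depth `D` of the boundary paths of `x`;
-- probability enters only through `Shallow`. The query is fixed before the ranks are drawn, so
-- three boundaries with two sides each, that is six chains of records, suffice in the union bound,
-- instead of chains for every node.
--
-- The depth bound looks at first rank components alone. A vertex on a boundary path has a weakly
-- maximal first component however ties are resolved, so ties merely count as further records.

-- Lexicographic order, longest common prefixes and packed words.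

module StringOrder where

  open import Defs hiding (toℕ)
  open import Data.Fin as Fin using (Fin)
  import Data.Fin.Properties as Fin
  open import Data.List using ([]; _∷_; length; drop)
  open import Data.List.Properties using (length-drop)
  open import Data.List.Relation.Binary.Lex.Core using (base; halt; this; next)
  open import Data.List.Relation.Binary.Prefix.Heterogeneous using (Prefix; []; _∷_)
  open import Data.Nat
  open import Data.Nat.Divisibility using (divides-refl)
  open import Data.Nat.DivMod
  open import Data.Nat.Induction using (<-wellFounded)
  open import Data.Nat.Logarithm using (⌈log₂_⌉; ⌈log₂⌉-mono-≤; ⌈log₂⌈n/2⌉⌉≡⌈log₂n⌉∸1)
  open import Data.Nat.Properties
  open import Data.Product using (_×_; _,_)
  open import Data.Sum using (_⊎_; inj₁; inj₂)
  open import Induction.WellFounded using (Acc; acc)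
  open import Relation.Binary.Definitions using (Tri; tri<; tri≈; tri>)
  open import Relation.Binary.PropositionalEquality
  open import Relation.Nullary using (¬_; yes; no; contradiction)

  module _ {σ : ℕ} where

    <ˢ-trans : {x y z : Str σ} → x <ˢ y → y <ˢ z → x <ˢ z
    <ˢ-trans (base ())
    <ˢ-trans halt (this _) = halt
    <ˢ-trans halt (next _ _) = halt
    <ˢ-trans (this p) (this q) = this (<-trans p q)
    <ˢ-trans (this p) (next refl _) = this p
    <ˢ-trans (next refl _) (this q) = this q
    <ˢ-trans (next refl p) (next refl q) = next refl (<ˢ-trans p q)

    <ˢ-irrefl : {x : Str σ} → ¬ x <ˢ x
    <ˢ-irrefl (base ())
    <ˢ-irrefl (this p) = <-irrefl refl p
    <ˢ-irrefl (next _ p) = <ˢ-irrefl p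

    <ˢ-asym : {x y : Str σ} → x <ˢ y → ¬ y <ˢ x
    <ˢ-asym p q = <ˢ-irrefl (<ˢ-trans p q)

    <ˢ⇒≢ : {x y : Str σ} → x <ˢ y → x ≢ y
    <ˢ⇒≢ p refl = <ˢ-irrefl p

    <ˢ-cmp : (x y : Str σ) → Tri (x <ˢ y) (x ≡ y) (y <ˢ x)
    <ˢ-cmp [] [] = tri≈ <ˢ-irrefl refl <ˢ-irrefl
    <ˢ-cmp [] (_ ∷ _) = tri< halt (λ ()) (λ ())
    <ˢ-cmp (_ ∷ _) [] = tri> (λ ()) (λ ()) halt
    <ˢ-cmp (a ∷ x) (b ∷ y) with Fin.<-cmp a b
    ... | tri< p _ _ = tri< (this p) (<ˢ⇒≢ (this p)) (<ˢ-asym (this p))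
    ... | tri> _ _ p = tri> (<ˢ-asym (this p)) (λ e → <ˢ⇒≢ (this p) (sym e)) (this p)
    ... | tri≈ _ refl _ with <ˢ-cmp x y
    ...   | tri< p _ _ = tri< (next refl p) (<ˢ⇒≢ (next refl p)) (<ˢ-asym (next refl p))
    ...   | tri≈ _ refl _ = tri≈ <ˢ-irrefl refl <ˢ-irrefl
    ...   | tri> _ _ p = tri> (<ˢ-asym (next refl p)) (λ e → <ˢ⇒≢ (next refl p) (sym e)) (next refl p)

    ≤ˢ-<ˢ-trans : {x y z : Str σ} → x ≤ˢ y → y <ˢ z → x <ˢ z
    ≤ˢ-<ˢ-trans (inj₁ p) q = <ˢ-trans p q
    ≤ˢ-<ˢ-trans (inj₂ refl) q = q

    ≮ˢ⇒≥ˢ : {x y : Str σ} → ¬ x <ˢ y → y ≤ˢ x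
    ≮ˢ⇒≥ˢ {x} {y} p with <ˢ-cmp x y
    ... | tri< q _ _ = contradiction q p
    ... | tri≈ _ refl _ = inj₂ refl
    ... | tri> _ _ q = inj₁ q

    Prefix-refl : {x : Str σ} → Prefix _≡_ x x
    Prefix-refl {[]} = []
    Prefix-refl {_ ∷ _} = refl ∷ Prefix-refl

    Prefix-length : {x y : Str σ} → Prefix _≡_ x y → length x ≤ length y
    Prefix-length [] = z≤n
    Prefix-length (_ ∷ p) = s≤s (Prefix-length p)

    Prefix⇒≤ˢ : {x y : Str σ} → Prefix _≡_ x y → x ≤ˢ y
    Prefix⇒≤ˢ {y = []} [] = inj₂ refl
    Prefix⇒≤ˢ {y = _ ∷ _} [] = inj₁ halt
    Prefix⇒≤ˢ (refl ∷ p) with Prefix⇒≤ˢ p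
    ... | inj₁ q = inj₁ (next refl q)
    ... | inj₂ refl = inj₂ refl

    Prefix-< : {x y : Str σ} → Prefix _≡_ x y → length x < length y → x <ˢ y
    Prefix-< p l with Prefix⇒≤ˢ p
    ... | inj₁ q = q
    ... | inj₂ refl = contradiction l (<-irrefl refl)

    Prefix-≡ : {x y : Str σ} → Prefix _≡_ x y → length x ≡ length y → x ≡ y
    Prefix-≡ {y = []} [] _ = refl
    Prefix-≡ (refl ∷ p) e = cong (_ ∷_) (Prefix-≡ p (suc-injective e))

    -- A difference inside `x` would push `y`, and then `z`, past every extension of `x`. The
    -- extensions of `x` thus form an interval, and prefix search needs only its two ends.
    Prefix-convex : {x y z : Str σ} → Prefix _≡_ x z → x <ˢ y → y <ˢ z → Prefix _≡_ x y
    Prefix-convex [] _ _ = []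
    Prefix-convex (refl ∷ p) (this q) (this r) = contradiction (<-trans q r) (<-irrefl refl)
    Prefix-convex (refl ∷ p) (this q) (next refl r) = contradiction q (<-irrefl refl)
    Prefix-convex (refl ∷ p) (next refl q) (this r) = contradiction r (<-irrefl refl)
    Prefix-convex (refl ∷ p) (next refl q) (next _ r) = refl ∷ Prefix-convex p q r

    lcp-∷-≡ : ∀ a (x y : Str σ) → lcp (a ∷ x) (a ∷ y) ≡ suc (lcp x y)
    lcp-∷-≡ a x y with a Fin.≟ a
    ... | yes _ = refl
    ... | no ¬p = contradiction refl ¬p

    lcp-∷-≢ : ∀ {a b} → a ≢ b → (x y : Str σ) → lcp (a ∷ x) (b ∷ y) ≡ 0
    lcp-∷-≢ {a} {b} a≢b x y with a Fin.≟ b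
    ... | yes p = contradiction p a≢b
    ... | no _ = refl

    lcp-[]ʳ : (x : Str σ) → lcp x [] ≡ 0
    lcp-[]ʳ [] = refl
    lcp-[]ʳ (_ ∷ _) = refl

    lcp-comm : (x y : Str σ) → lcp x y ≡ lcp y x
    lcp-comm [] y = sym (lcp-[]ʳ y)
    lcp-comm (a ∷ x) [] = refl
    lcp-comm (a ∷ x) (b ∷ y) with a Fin.≟ b
    ... | yes refl = sym (trans (lcp-∷-≡ a y x) (cong suc (lcp-comm y x)))
    ... | no ¬p = sym (lcp-∷-≢ (λ e → ¬p (sym e)) y x)

    lcp≤lengthˡ : (x y : Str σ) → lcp x y ≤ length x
    lcp≤lengthˡ [] y = z≤n
    lcp≤lengthˡ (a ∷ x) [] = z≤n
    lcp≤lengthˡ (a ∷ x) (b ∷ y) with a Fin.≟ b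
    ... | yes _ = s≤s (lcp≤lengthˡ x y)
    ... | no _ = z≤n

    lcp≤lengthʳ : (x y : Str σ) → lcp x y ≤ length y
    lcp≤lengthʳ x y = subst (_≤ length y) (lcp-comm y x) (lcp≤lengthˡ y x)

    Prefix-lcp : {x y : Str σ} → Prefix _≡_ x y → lcp x y ≡ length x
    Prefix-lcp [] = refl
    Prefix-lcp {a ∷ x} {_ ∷ y} (refl ∷ p) = trans (lcp-∷-≡ a x y) (cong suc (Prefix-lcp {x} {y} p))

    lcp-self : (x : Str σ) → lcp x x ≡ length x
    lcp-self x = Prefix-lcp {x} {x} Prefix-refl

    -- What `x` and `z` share is shared by everything between them. That this is an equality, not
    -- merely a bound, lets deletion compute the exact codes of new neighbours from stored ones.
    lcp-between : {x y z : Str σ} → x <ˢ y → y <ˢ z → lcp x z ≡ lcp x y ⊓ lcp y z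
    lcp-between (base ())
    lcp-between halt _ = refl
    lcp-between {a ∷ x} {b ∷ y} {c ∷ z} (this p) q
      rewrite lcp-∷-≢ (Fin.<⇒≢ p) x y = lcp-∷-≢ (Fin.<⇒≢ (a<c q)) x z
      where
      a<c : (b ∷ y) <ˢ (c ∷ z) → a Fin.< c
      a<c (this r) = <-trans p r
      a<c (next refl _) = p
    lcp-between {a ∷ x} {b ∷ y} {c ∷ z} (next refl p) (this q)
      rewrite lcp-∷-≢ (Fin.<⇒≢ q) x z | lcp-∷-≢ (Fin.<⇒≢ q) y z = sym (⊓-zeroʳ _)
    lcp-between {a ∷ x} {b ∷ y} {c ∷ z} (next refl p) (next refl q)
      rewrite lcp-∷-≡ a x z | lcp-∷-≡ a x y | lcp-∷-≡ a y z = cong suc (lcp-between p q)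

    lcp-ultra : (x y z : Str σ) → lcp x y ⊓ lcp y z ≤ lcp x z
    lcp-ultra [] y z = z≤n
    lcp-ultra (a ∷ x) [] z = z≤n
    lcp-ultra (a ∷ x) (b ∷ y) [] = ≤-reflexive (⊓-zeroʳ (lcp (a ∷ x) (b ∷ y)))
    lcp-ultra (a ∷ x) (b ∷ y) (c ∷ z) with a Fin.≟ b | b Fin.≟ c
    ... | no _ | _ = z≤n
    ... | yes refl | no _ = z≤n
    ... | yes refl | yes refl rewrite lcp-∷-≡ a x z = s≤s (lcp-ultra x y z)

    -- Triangles in an ultrametric are isosceles: the two smallest of three LCPs coincide.
    lcp-ultra-< : (x y z : Str σ) → lcp x y < lcp y z → lcp x z ≡ lcp x y
    lcp-ultra-< x y z p = ≤-antisym (≮⇒≥ λ q → <⇒≱ (⊓-pres-m< q p) (lemma q)) (subst (_≤ lcp x z) (m≤n⇒m⊓n≡m (<⇒≤ p)) (lcp-ultra x y z))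
      where
      lemma : lcp x y < lcp x z → lcp x z ⊓ lcp y z ≤ lcp x y
      lemma _ = subst (λ k → lcp x z ⊓ k ≤ lcp x y) (lcp-comm z y) (lcp-ultra x z y)

    lcp-drop : ∀ n (x y : Str σ) → n ≤ lcp x y → lcp x y ≡ n + lcp (drop n x) (drop n y)
    lcp-drop zero x y _ = refl
    lcp-drop (suc n) (a ∷ x) (b ∷ y) p with a Fin.≟ b | p
    ... | yes refl | s≤s q = cong suc (lcp-drop n x y q)

    drop-< : ∀ n (x y : Str σ) → n ≤ lcp x y → drop n x <ˢ drop n y → x <ˢ y
    drop-< zero x y _ q = q
    drop-< (suc n) (a ∷ x) (b ∷ y) p q with a Fin.≟ b | p
    ... | yes refl | s≤s r = next refl (drop-< n x y r q)

    drop-Prefix : ∀ n (x y : Str σ) → n ≤ lcp x y → Prefix _≡_ (drop n x) (drop n y) → Prefix _≡_ x y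
    drop-Prefix zero x y _ q = q
    drop-Prefix (suc n) (a ∷ x) (b ∷ y) p q with a Fin.≟ b | p
    ... | yes refl | s≤s r = refl ∷ drop-Prefix n x y r q

  -- Every character fits in `charBits` bits, so packed characters are digits that do not overlap.
  n≤2^⌈log₂n⌉ : ∀ n → n ≤ 2 ^ ⌈log₂ n ⌉
  n≤2^⌈log₂n⌉ n = bound n (<-wellFounded n)
    where
    bound : ∀ n → Acc _<_ n → n ≤ 2 ^ ⌈log₂ n ⌉
    bound zero _ = z≤n
    bound (suc zero) _ = ≤-refl
    bound n@(suc (suc m)) (acc rs) = begin
      n ≡⟨ ⌊n/2⌋+⌈n/2⌉≡n n ⟨
      ⌊ n /2⌋ + ⌈ n /2⌉ ≤⟨ +-monoˡ-≤ ⌈ n /2⌉ (⌊n/2⌋≤⌈n/2⌉ n) ⟩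
      ⌈ n /2⌉ + ⌈ n /2⌉ ≤⟨ +-mono-≤ ih ih ⟩
      2 ^ ⌈log₂ ⌈ n /2⌉ ⌉ + 2 ^ ⌈log₂ ⌈ n /2⌉ ⌉ ≡⟨ cong (2 ^ ⌈log₂ ⌈ n /2⌉ ⌉ +_) (+-identityʳ _) ⟨
      2 ^ suc ⌈log₂ ⌈ n /2⌉ ⌉ ≡⟨ cong (2 ^_) (trans (cong suc (⌈log₂⌈n/2⌉⌉≡⌈log₂n⌉∸1 n)) (m+[n∸m]≡n {1} (⌈log₂⌉-mono-≤ {2} {n} (s≤s (s≤s z≤n))))) ⟩
      2 ^ ⌈log₂ n ⌉ ∎
      where
      open ≤-Reasoning
      ih = bound ⌈ n /2⌉ (rs (⌈n/2⌉<n m))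

  radix-< : ∀ {B p q} c d → p < B → q < B → c * B + p < d * B + q → c < d ⊎ (c ≡ d × p < q)
  radix-< {B} {p} {q} c d p<B q<B l with <-cmp c d
  ... | tri< c<d _ _ = inj₁ c<d
  ... | tri≈ _ refl _ = inj₂ (refl , +-cancelˡ-< (c * B) p q l)
  ... | tri> _ _ d<c = contradiction l (≤⇒≯ (begin
    d * B + q ≤⟨ +-monoʳ-≤ (d * B) (<⇒≤ q<B) ⟩
    d * B + B ≡⟨ +-comm (d * B) B ⟩
    suc d * B ≤⟨ *-monoˡ-≤ B d<c ⟩
    c * B ≤⟨ m≤m+n (c * B) p ⟩
    c * B + p ∎))
    where open ≤-Reasoning

  radix-≡ : ∀ {B p q} c d → p < B → q < B → c * B + p ≡ d * B + q → c ≡ d × p ≡ q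
  radix-≡ {B} {p} {q} c d p<B q<B e with <-cmp c d
  ... | tri≈ _ refl _ = refl , +-cancelˡ-≡ (c * B) p q e
  ... | tri< c<d _ _ = contradiction e (<⇒≢ (radix c<d p<B))
    where
    radix : c < d → p < B → c * B + p < d * B + q
    radix c<d p<B = begin-strict
      c * B + p <⟨ +-monoʳ-< (c * B) p<B ⟩
      c * B + B ≡⟨ +-comm (c * B) B ⟩
      suc c * B ≤⟨ *-monoˡ-≤ B c<d ⟩
      d * B ≤⟨ m≤m+n (d * B) q ⟩
      d * B + q ∎
      where open ≤-Reasoning
  ... | tri> _ _ d<c = contradiction (sym e) (<⇒≢ (begin-strict
      d * B + q <⟨ +-monoʳ-< (d * B) q<B ⟩
      d * B + B ≡⟨ +-comm (d * B) B ⟩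
      suc d * B ≤⟨ *-monoˡ-≤ B d<c ⟩
      c * B ≤⟨ m≤m+n (c * B) p ⟩
      c * B + p ∎))
      where open ≤-Reasoning

  module _ {σ : ℕ} where

    private
      B = charBits σ

    pack< : ∀ a (x : Str σ) → pack a x < 2 ^ (B * a)
    pack< zero x = m^n>0 2 (B * 0)
    pack< (suc a) [] = m^n>0 2 (B * suc a)
    pack< (suc a) (c ∷ x) = begin-strict
      Fin.toℕ c * 2 ^ (B * a) + pack a x <⟨ +-monoʳ-< (Fin.toℕ c * 2 ^ (B * a)) (pack< a x) ⟩
      Fin.toℕ c * 2 ^ (B * a) + 2 ^ (B * a) ≡⟨ +-comm _ (2 ^ (B * a)) ⟩
      suc (Fin.toℕ c) * 2 ^ (B * a) ≤⟨ *-monoˡ-≤ (2 ^ (B * a)) (≤-trans (Fin.toℕ<n c) (n≤2^⌈log₂n⌉ σ)) ⟩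
      2 ^ B * 2 ^ (B * a) ≡⟨ ^-distribˡ-+-* 2 B (B * a) ⟨
      2 ^ (B + B * a) ≡⟨ cong (2 ^_) (*-suc B a) ⟨
      2 ^ (B * suc a) ∎
      where open ≤-Reasoning

    -- Padding uses the digit 0, which also encodes the least character, so equal words do not mean
    -- equal strings. A strict inequality is still conclusive, because padding is at most any digit.
    pack-< : ∀ a (x y : Str σ) → pack a x < pack a y → x <ˢ y
    pack-< (suc a) [] (d ∷ y) p = halt
    pack-< (suc a) (c ∷ x) (d ∷ y) p
      with radix-< (Fin.toℕ c) (Fin.toℕ d) (pack< a x) (pack< a y) p
    ... | inj₁ c<d = this c<d
    ... | inj₂ (c≡d , q) = next (Fin.toℕ-injective c≡d) (pack-< a x y q)

    -- The comparison of lengths settles which string may end in padding, and the bound by `a`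
    -- ensures that all of `x` lies in the word.
    pack-≡-Prefix : ∀ a (x y : Str σ) → pack a x ≡ pack a y →
                    length x ≤ length y → length x ≤ a → Prefix _≡_ x y
    pack-≡-Prefix zero [] y _ _ _ = []
    pack-≡-Prefix (suc a) [] y _ _ _ = []
    pack-≡-Prefix (suc a) (c ∷ x) (d ∷ y) p (s≤s l) (s≤s m)
      with radix-≡ (Fin.toℕ c) (Fin.toℕ d) (pack< a x) (pack< a y) p
    ... | c≡d , q = Fin.toℕ-injective c≡d ∷ pack-≡-Prefix a x y q l m

    pack-≡⇒lcp : ∀ a (x y : Str σ) → pack a x ≡ pack a y →
                 a ≤ length x → a ≤ length y → a ≤ lcp x y
    pack-≡⇒lcp zero x y _ _ _ = z≤n
    pack-≡⇒lcp (suc a) (c ∷ x) (d ∷ y) p (s≤s l) (s≤s m)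
      with radix-≡ (Fin.toℕ c) (Fin.toℕ d) (pack< a x) (pack< a y) p
    ... | c≡d , q with Fin.toℕ-injective c≡d
    ...   | refl rewrite lcp-∷-≡ c x y = s≤s (pack-≡⇒lcp a x y q l m)

    lcp⇒pack-≡ : ∀ a (x y : Str σ) → a ≤ lcp x y → pack a x ≡ pack a y
    lcp⇒pack-≡ zero x y _ = refl
    lcp⇒pack-≡ (suc a) (c ∷ x) (d ∷ y) p with c Fin.≟ d | p
    ... | yes refl | s≤s q = cong (Fin.toℕ c * 2 ^ (B * a) +_) (lcp⇒pack-≡ a x y q)

    -- Characters are packed from the most significant end, so a right shift by whole digits drops
    -- the trailing ones.
    pack-truncate : ∀ t k (x : Str σ) →
                    _/_ (pack (t + k) x) (2 ^ (B * k)) {{m^n≢0 2 (B * k)}} ≡ pack t x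
    pack-truncate zero k x = m<n⇒m/n≡0 {{m^n≢0 2 (B * k)}} (pack< k x)
    pack-truncate (suc t) k [] = 0/n≡0 (2 ^ (B * k)) {{m^n≢0 2 (B * k)}}
    pack-truncate (suc t) k (c ∷ x) = begin
      (C * 2 ^ (B * (t + k)) + pack (t + k) x) / D ≡⟨ cong (λ e → (e + pack (t + k) x) / D) shape ⟩
      (C * 2 ^ (B * t) * D + pack (t + k) x) / D ≡⟨ +-distrib-/-∣ˡ (pack (t + k) x) (divides-refl (C * 2 ^ (B * t))) ⟩
      C * 2 ^ (B * t) * D / D + pack (t + k) x / D ≡⟨ cong₂ _+_ (m*n/n≡m (C * 2 ^ (B * t)) D) (pack-truncate t k x) ⟩
      C * 2 ^ (B * t) + pack t x ∎
      where
      open ≡-Reasoning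
      C = Fin.toℕ c
      D = 2 ^ (B * k)
      instance
        D≢0 : NonZero D
        D≢0 = m^n≢0 2 (B * k)
      shape : C * 2 ^ (B * (t + k)) ≡ C * 2 ^ (B * t) * D
      shape = trans (cong (C *_) (trans (cong (2 ^_) (*-distribˡ-+ B t k)) (^-distribˡ-+-* 2 (B * t) (B * k)))) (sym (*-assoc C (2 ^ (B * t)) D))

  module _ {σ : ℕ} (a : ℕ) .{{_ : NonZero a}} where

    word : Str σ → ℕ → ℕ
    word x i = pack a (drop (i * a) x)

    length-shape : (x : Str σ) → length x ≡ length x % a + length x / a * a
    length-shape x = m≡m%n+[m/n]*n (length x) a

    lcp/≤ˡ : (x y : Str σ) → lcp x y / a ≤ length x / a
    lcp/≤ˡ x y = /-monoˡ-≤ a (lcp≤lengthˡ x y)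

    lcp/≤ʳ : (x y : Str σ) → lcp x y / a ≤ length y / a
    lcp/≤ʳ x y = /-monoˡ-≤ a (lcp≤lengthʳ x y)

    private
      floor≤ : ∀ n → n / a * a ≤ n
      floor≤ n = m/n*n≤m n a

      <ceil : ∀ n → n < a + n / a * a
      <ceil n = begin-strict
        n ≡⟨ m≡m%n+[m/n]*n n a ⟩
        n % a + n / a * a <⟨ +-monoˡ-< (n / a * a) (m%n<n n a) ⟩
        a + n / a * a ∎
        where open ≤-Reasoning

      a≤drop : ∀ i (x : Str σ) → i < length x / a → a ≤ length (drop (i * a) x)
      a≤drop i x p rewrite length-drop (i * a) x =
        m+n≤o⇒m≤o∸n a (≤-trans (*-monoˡ-≤ a p) (floor≤ (length x)))

    -- Below both quotients `length / a` the words contain no padding, so their equality is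
    -- agreement on `a` characters.
    word-step : ∀ i (x y : Str σ) → i ≤ lcp x y / a → i < length x / a → i < length y / a →
                word x i ≡ word y i → suc i ≤ lcp x y / a
    word-step i x y p l m e = subst (_≤ lcp x y / a) (m*n/n≡m (suc i) a) (/-monoˡ-≤ a (begin
      a + i * a ≡⟨ +-comm a (i * a) ⟩
      i * a + a ≤⟨ +-monoʳ-≤ (i * a) (pack-≡⇒lcp a _ _ e (a≤drop i x l) (a≤drop i y m)) ⟩
      i * a + lcp (drop (i * a) x) (drop (i * a) y) ≡⟨ lcp-drop (i * a) x y i*a≤ ⟨
      lcp x y ∎))
      where
      open ≤-Reasoning
      i*a≤ : i * a ≤ lcp x y
      i*a≤ = ≤-trans (*-monoˡ-≤ a p) (floor≤ (lcp x y))

    word-≡-below : ∀ i (x y : Str σ) → suc i ≤ lcp x y / a → word x i ≡ word y i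
    word-≡-below i x y p = lcp⇒pack-≡ a _ _ (+-cancelˡ-≤ (i * a) _ _ (begin
      i * a + a ≡⟨ +-comm (i * a) a ⟩
      suc i * a ≤⟨ *-monoˡ-≤ a p ⟩
      lcp x y / a * a ≤⟨ floor≤ (lcp x y) ⟩
      lcp x y ≡⟨ lcp-drop (i * a) x y (≤-trans (*-monoˡ-≤ a (<⇒≤ p)) (floor≤ (lcp x y))) ⟩
      i * a + lcp (drop (i * a) x) (drop (i * a) y) ∎))
      where open ≤-Reasoning

    module _ (x y : Str σ) where
      private
        i = lcp x y / a
        x′ = drop (i * a) x
        y′ = drop (i * a) y
        i*a≤ : i * a ≤ lcp x y
        i*a≤ = floor≤ (lcp x y)
        i*a≤′ : i * a ≤ lcp y x
        i*a≤′ = subst (i * a ≤_) (lcp-comm x y) i*a≤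
        lcp′<a : lcp x′ y′ < a
        lcp′<a = +-cancelˡ-< (i * a) _ _ (subst₂ _<_ (lcp-drop (i * a) x y i*a≤) (+-comm a (i * a)) (<ceil (lcp x y)))
        length′-mono : length x ≤ length y → length x′ ≤ length y′
        length′-mono l rewrite length-drop (i * a) x | length-drop (i * a) y = ∸-monoˡ-≤ (i * a) l

      -- The strings agree on all words before `i` but not on the whole of word `i`, so this word
      -- decides the order.
      word-< : word x i < word y i → x <ˢ y
      word-< p = drop-< (i * a) x y i*a≤ (pack-< a x′ y′ p)

      word-> : word y i < word x i → y <ˢ x
      word-> p = drop-< (i * a) y x i*a≤′ (pack-< a y′ x′ p)

      -- Ties are settled by length: if `x` went on past this word, equality would give `a` further
      -- common characters, against the choice of `i`.
      word-≡-Prefix : word x i ≡ word y i → length x ≤ length y → Prefix _≡_ x y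
      word-≡-Prefix e l = drop-Prefix (i * a) x y i*a≤ (pack-≡-Prefix a x′ y′ e (length′-mono l)
        (≮⇒≥ λ q → <⇒≱ lcp′<a (pack-≡⇒lcp a x′ y′ e (<⇒≤ q) (≤-trans (<⇒≤ q) (length′-mono l)))))

      private
        length-x′ : i ≡ length x / a → length x′ ≡ length x % a
        length-x′ e = trans (length-drop (i * a) x) (trans (cong (λ k → length x ∸ k * a) e) (sym (m%n≡m∸m/n*n (length x) a)))

      -- With i the last word of x, only the first |x| % α characters of that
      -- word matter for deciding whether x is a prefix of y.
      tail-< : pack (length x % a) x′ < pack (length x % a) y′ → i ≡ length x / a →
               x <ˢ y × ¬ Prefix _≡_ x y
      tail-< p e = drop-< (i * a) x y i*a≤ (pack-< (length x % a) x′ y′ p)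
        , λ q → <-irrefl (lcp⇒pack-≡ (length x % a) x′ y′ (+-cancelˡ-≤ (i * a) _ _ (≤-reflexive (trans
            (trans (cong₂ (λ j k → j * a + k) e refl) (trans (+-comm _ (length x % a)) (sym (length-shape x))))
            (trans (sym (Prefix-lcp {x = x} {y} q)) (lcp-drop (i * a) x y i*a≤)))))) p

      tail-≮ : ¬ pack (length x % a) x′ < pack (length x % a) y′ → i ≡ length x / a →
               y <ˢ x ⊎ Prefix _≡_ x y
      tail-≮ p e with <-cmp (pack (length x % a) x′) (pack (length x % a) y′)
      ... | tri< q _ _ = contradiction q p
      ... | tri> _ _ q = inj₁ (drop-< (i * a) y x i*a≤′ (pack-< (length x % a) y′ x′ q))
      ... | tri≈ _ q _ with ≤-<-connex (length x′) (length y′)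
      ...   | inj₁ l = inj₂ (drop-Prefix (i * a) x y i*a≤ (pack-≡-Prefix (length x % a) x′ y′ q l (≤-reflexive (length-x′ e))))
      ...   | inj₂ l = inj₁ (drop-< (i * a) y x i*a≤′ (Prefix-< (pack-≡-Prefix (length x % a) y′ x′ (sym q) (<⇒≤ l) (≤-trans (<⇒≤ l) (≤-reflexive (length-x′ e)))) l))

      word-<-¬Prefix : word x i < word y i → i < length x / a → ¬ Prefix _≡_ x y
      word-<-¬Prefix p l q = <-irrefl (cong (_/ a) (Prefix-lcp {x = x} {y} q)) l

      -- The exit condition of the scan: a `j` below `i` would be a full word of both strings with
      -- equal contents.
      lcp/-stop : ∀ j → j ≤ i → (j < length x / a → j < length y / a → word x j ≢ word y j) → j ≡ i
      lcp/-stop j j≤i stop with m≤n⇒m<n∨m≡n j≤i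
      ... | inj₂ e = e
      ... | inj₁ j<i = contradiction (word-≡-below j x y j<i) (stop (≤-trans j<i (lcp/≤ˡ x y)) (≤-trans j<i (lcp/≤ʳ x y)))

-- Logarithms, floating-point codes and machine arithmetic.

module Words where

  open import Defs
  open import Data.Bool using (Bool; true; false; if_then_else_; _∧_; _∨_)
  open import Data.Nat
  open import Data.Nat.Divisibility using (divides-refl)
  open import Data.Nat.DivMod
  open import Data.Nat.Induction using (<-wellFounded)
  open import Data.Nat.Logarithm using (⌊log₂_⌋; ⌊log₂⌋-mono-≤; ⌊log₂⌊n/2⌋⌋≡⌊log₂n⌋∸1; ⌊log₂[2^n]⌋≡n)
  open import Data.Nat.Properties
  open import Data.Product using (_,_)
  open import Data.Sum using (inj₁; inj₂)
  open import Data.Vec using ([]; _∷_)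
  open import Induction.WellFounded using (Acc; acc)
  open import Relation.Binary.PropositionalEquality
  open import Relation.Nullary using (contradiction)

  n<2^[1+⌊log₂n⌋] : ∀ n → n < 2 ^ suc ⌊log₂ n ⌋
  n<2^[1+⌊log₂n⌋] n = bound n (<-wellFounded n)
    where
    bound : ∀ n → Acc _<_ n → n < 2 ^ suc ⌊log₂ n ⌋
    bound zero _ = s≤s z≤n
    bound (suc zero) _ = s≤s (s≤s z≤n)
    bound n@(suc (suc m)) (acc rs) = begin-strict
      n ≡⟨ ⌊n/2⌋+⌈n/2⌉≡n n ⟨
      ⌊ n /2⌋ + ⌈ n /2⌉ ≤⟨ +-monoʳ-≤ ⌊ n /2⌋ (⌊n/2⌋-mono (n≤1+n (suc n))) ⟩
      ⌊ n /2⌋ + suc ⌊ n /2⌋ <⟨ +-mono-<-≤ ih ih ⟩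
      2 ^ suc ⌊log₂ ⌊ n /2⌋ ⌋ + 2 ^ suc ⌊log₂ ⌊ n /2⌋ ⌋ ≡⟨ cong (2 ^ suc ⌊log₂ ⌊ n /2⌋ ⌋ +_) (+-identityʳ _) ⟨
      2 ^ suc (suc ⌊log₂ ⌊ n /2⌋ ⌋) ≡⟨ cong (λ k → 2 ^ suc k) (trans (cong suc (⌊log₂⌊n/2⌋⌋≡⌊log₂n⌋∸1 n)) (m+[n∸m]≡n {1} (⌊log₂⌋-mono-≤ {2} {n} (s≤s (s≤s z≤n))))) ⟩
      2 ^ suc ⌊log₂ n ⌋ ∎
      where
      open ≤-Reasoning
      ih = bound ⌊ n /2⌋ (rs (⌊n/2⌋<n (suc m)))

  2^⌊log₂n⌋≤n : ∀ n → .{{NonZero n}} → 2 ^ ⌊log₂ n ⌋ ≤ n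
  2^⌊log₂n⌋≤n n = bound n (<-wellFounded n)
    where
    bound : ∀ n → .{{NonZero n}} → Acc _<_ n → 2 ^ ⌊log₂ n ⌋ ≤ n
    bound (suc zero) _ = s≤s z≤n
    bound n@(suc (suc m)) (acc rs) = begin
      2 ^ ⌊log₂ n ⌋ ≡⟨ cong (2 ^_) (trans (cong suc (⌊log₂⌊n/2⌋⌋≡⌊log₂n⌋∸1 n)) (m+[n∸m]≡n {1} (⌊log₂⌋-mono-≤ {2} {n} (s≤s (s≤s z≤n))))) ⟨
      2 ^ ⌊log₂ ⌊ n /2⌋ ⌋ + (2 ^ ⌊log₂ ⌊ n /2⌋ ⌋ + 0) ≡⟨ cong (2 ^ ⌊log₂ ⌊ n /2⌋ ⌋ +_) (+-identityʳ _) ⟩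
      2 ^ ⌊log₂ ⌊ n /2⌋ ⌋ + 2 ^ ⌊log₂ ⌊ n /2⌋ ⌋ ≤⟨ +-mono-≤ ih ih ⟩
      ⌊ n /2⌋ + ⌊ n /2⌋ ≤⟨ +-monoʳ-≤ ⌊ n /2⌋ (⌊n/2⌋≤⌈n/2⌉ n) ⟩
      ⌊ n /2⌋ + ⌈ n /2⌉ ≡⟨ ⌊n/2⌋+⌈n/2⌉≡n n ⟩
      n ∎
      where
      open ≤-Reasoning
      ih = bound ⌊ n /2⌋ (rs (⌊n/2⌋<n (suc m)))

  n<2^n : ∀ n → n < 2 ^ n
  n<2^n zero = s≤s z≤n
  n<2^n (suc n) = begin-strict
    suc n ≤⟨ n<2^n n ⟩
    2 ^ n <⟨ m<m+n (2 ^ n) (m^n>0 2 n) ⟩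
    2 ^ n + 2 ^ n ≡⟨ cong (2 ^ n +_) (+-identityʳ _) ⟨
    2 ^ suc n ∎
    where open ≤-Reasoning

  ⌊log₂⌋≤ : ∀ n → ⌊log₂ n ⌋ ≤ n
  ⌊log₂⌋≤ n = subst (⌊log₂ n ⌋ ≤_) (⌊log₂[2^n]⌋≡n n) (⌊log₂⌋-mono-≤ (<⇒≤ (n<2^n n)))

  m<2^k⇒⌊log₂m⌋<k : ∀ {m k} → .{{NonZero k}} → m < 2 ^ k → ⌊log₂ m ⌋ < k
  m<2^k⇒⌊log₂m⌋<k {zero} {suc k} p = s≤s z≤n
  m<2^k⇒⌊log₂m⌋<k {suc m} {k} p =
    ≰⇒> λ q → <⇒≱ p (≤-trans (^-monoʳ-≤ 2 q) (2^⌊log₂n⌋≤n (suc m)))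

  -- Floating-point codes

  infixl 7 _>>_
  _>>_ : ℕ → ℕ → ℕ
  q >> k = _/_ q (2 ^ k) {{m^n≢0 2 k}}

  module _ (k : ℕ) where
    private instance
      2^k≢0 : NonZero (2 ^ k)
      2^k≢0 = m^n≢0 2 k

    >>-lower : ∀ q → (q >> k) * 2 ^ k ≤ q
    >>-lower q = m/n*n≤m q (2 ^ k)

    >>-upper : ∀ q → q < 2 ^ k + (q >> k) * 2 ^ k
    >>-upper q = begin-strict
      q ≡⟨ m≡m%n+[m/n]*n q (2 ^ k) ⟩
      q % 2 ^ k + q / 2 ^ k * 2 ^ k <⟨ +-monoˡ-< (q / 2 ^ k * 2 ^ k) (m%n<n q (2 ^ k)) ⟩
      2 ^ k + q / 2 ^ k * 2 ^ k ∎
      where open ≤-Reasoning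

    >>-mono : ∀ {p q} → p ≤ q → p >> k ≤ q >> k
    >>-mono = /-monoˡ-≤ (2 ^ k)

    >>≤ : ∀ q → q >> k ≤ q
    >>≤ q = m/n≤m q (2 ^ k)

    m≤q>>k : ∀ {m q} → m * 2 ^ k ≤ q → m ≤ q >> k
    m≤q>>k {m} {q} p = subst (_≤ q >> k) (m*n/n≡m m (2 ^ k)) (/-monoˡ-≤ (2 ^ k) p)

    q>>k<m : ∀ {m q} → q < m * 2 ^ k → q >> k < m
    q>>k<m = m<n*o⇒m/o<n

    [m*2^k]>>k : ∀ m → m * 2 ^ k >> k ≡ m
    [m*2^k]>>k m = m*n/n≡m m (2 ^ k)

    [j*2^k+m]>>k : ∀ j m → (j * 2 ^ k + m) >> k ≡ j + (m >> k)
    [j*2^k+m]>>k j m = trans (+-distrib-/-∣ˡ m (divides-refl j)) (cong (_+ m / 2 ^ k) (m*n/n≡m j (2 ^ k)))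

  module Float (b : ℕ) where

    -- The leading bit of the mantissa is not hidden but carried into the exponent field. From
    -- `2 ^ b` on, the field `c >> b` reads one more than the exponent; below `2 ^ b`, where
    -- `float q` is `q`, it reads 0. So `pred` is right in both cases, and values below `2 ^ suc b`
    -- are stored exactly.
    exponent mantissa float unfloat : ℕ → ℕ
    exponent q = ⌊log₂ q >> b ⌋
    mantissa q = q >> exponent q
    float q = exponent q * 2 ^ b + mantissa q
    unfloat c = (c ∸ pred (c >> b) * 2 ^ b) * 2 ^ pred (c >> b)

    mantissa< : ∀ q → mantissa q < 2 * 2 ^ b
    mantissa< q = q>>k<m (exponent q) (begin-strict
      q <⟨ >>-upper b q ⟩
      suc (q >> b) * 2 ^ b ≤⟨ *-monoˡ-≤ (2 ^ b) (n<2^[1+⌊log₂n⌋] (q >> b)) ⟩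
      2 * 2 ^ exponent q * 2 ^ b ≡⟨ *-assoc 2 (2 ^ exponent q) (2 ^ b) ⟩
      2 * (2 ^ exponent q * 2 ^ b) ≡⟨ cong (2 *_) (*-comm (2 ^ exponent q) (2 ^ b)) ⟩
      2 * (2 ^ b * 2 ^ exponent q) ≡⟨ *-assoc 2 (2 ^ b) (2 ^ exponent q) ⟨
      2 * 2 ^ b * 2 ^ exponent q ∎)
      where open ≤-Reasoning

    2^b≤mantissa : ∀ q → .{{NonZero (exponent q)}} → 2 ^ b ≤ mantissa q
    2^b≤mantissa q with q >> b in e
    ... | suc p = m≤q>>k ⌊log₂ suc p ⌋ (begin
      2 ^ b * 2 ^ ⌊log₂ suc p ⌋ ≡⟨ *-comm (2 ^ b) _ ⟩
      2 ^ ⌊log₂ suc p ⌋ * 2 ^ b ≤⟨ *-monoˡ-≤ (2 ^ b) (2^⌊log₂n⌋≤n (suc p)) ⟩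
      suc p * 2 ^ b ≡⟨ cong (_* 2 ^ b) e ⟨
      (q >> b) * 2 ^ b ≤⟨ >>-lower b q ⟩
      q ∎)
      where open ≤-Reasoning

    exponent*2^b≤ : ∀ q → exponent q * 2 ^ b ≤ exponent q * mantissa q
    exponent*2^b≤ q with exponent q in e
    ... | zero = z≤n
    ... | suc k = *-monoʳ-≤ (suc k) (subst (λ j → 2 ^ b ≤ q >> j) e (2^b≤mantissa q {{subst NonZero (sym e) _}}))

    private
      exponent-float : ∀ q → pred (float q >> b) ≡ exponent q
      exponent-float q = trans (cong pred ([j*2^k+m]>>k b (exponent q) (mantissa q))) (lemma (exponent q) (mantissa q >> b) (q>>k<m b (mantissa< q)) λ p → m≤q>>k b (subst (_≤ mantissa q) (sym (+-identityʳ _)) (2^b≤mantissa q {{p}})))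
        where
        lemma : ∀ k m → m < 2 → (NonZero k → 1 ≤ m) → pred (k + m) ≡ k
        lemma zero zero _ _ = refl
        lemma zero (suc zero) _ _ = refl
        lemma k (suc (suc m)) (s≤s (s≤s ())) _
        lemma (suc k) zero _ p = contradiction (p _) λ ()
        lemma (suc k) (suc zero) _ _ = +-comm k 1

    unfloat-float : ∀ q → unfloat (float q) ≡ mantissa q * 2 ^ exponent q
    unfloat-float q rewrite exponent-float q = cong (_* 2 ^ exponent q) (m+n∸m≡n (exponent q * 2 ^ b) (mantissa q))

    unfloat-float≤ : ∀ q → unfloat (float q) ≤ q
    unfloat-float≤ q = subst (_≤ q) (sym (unfloat-float q)) (>>-lower (exponent q) q)

    -- With exponent `k` and mantissa `m`, the code is at most `suc k * m`, and `suc k ≤ 2 ^ k`.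
    -- Codes therefore fit in a word whenever the lengths do.
    float≤unfloat : ∀ q → float q ≤ unfloat (float q)
    float≤unfloat q = begin
      exponent q * 2 ^ b + mantissa q ≤⟨ +-monoˡ-≤ (mantissa q) (exponent*2^b≤ q) ⟩
      exponent q * mantissa q + mantissa q ≡⟨ +-comm _ (mantissa q) ⟩
      suc (exponent q) * mantissa q ≤⟨ *-monoˡ-≤ (mantissa q) (n<2^n (exponent q)) ⟩
      2 ^ exponent q * mantissa q ≡⟨ *-comm _ (mantissa q) ⟩
      mantissa q * 2 ^ exponent q ≡⟨ unfloat-float q ⟨
      unfloat (float q) ∎
      where open ≤-Reasoning

    float≤ : ∀ q → float q ≤ q
    float≤ q = ≤-trans (float≤unfloat q) (unfloat-float≤ q)

    -- Clearing the bits below the mantissa changes neither the position of the leading bit nor the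
    -- mantissa itself.
    float-unfloat-float : ∀ q → float (unfloat (float q)) ≡ float q
    float-unfloat-float q = trans (cong float (unfloat-float q)) (cong₂ (λ k m → k * 2 ^ b + m) exp≡ man≡)
      where
      k = exponent q
      m = mantissa q
      exponent-scaled : ∀ j → k ≡ j → exponent (m * 2 ^ j) ≡ j
      exponent-scaled zero e = trans (cong exponent (trans (*-identityʳ _) (trans (cong (q >>_) e) (n/1≡n q)))) e
      exponent-scaled (suc j) e = ≤-antisym
        (s≤s⁻¹ (m<2^k⇒⌊log₂m⌋<k (q>>k<m b (begin-strict
          m * 2 ^ suc j <⟨ *-monoˡ-< (2 ^ suc j) {{m^n≢0 2 (suc j)}} (mantissa< q) ⟩
          2 * 2 ^ b * 2 ^ suc j ≡⟨ *-assoc 2 (2 ^ b) (2 ^ suc j) ⟩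
          2 * (2 ^ b * 2 ^ suc j) ≡⟨ cong (2 *_) (*-comm (2 ^ b) (2 ^ suc j)) ⟩
          2 * (2 ^ suc j * 2 ^ b) ≡⟨ *-assoc 2 (2 ^ suc j) (2 ^ b) ⟨
          2 ^ suc (suc j) * 2 ^ b ∎))))
        (subst (_≤ ⌊log₂ m * 2 ^ suc j >> b ⌋) (⌊log₂[2^n]⌋≡n (suc j)) (⌊log₂⌋-mono-≤ {2 ^ suc j} (m≤q>>k b {2 ^ suc j} (begin
          2 ^ suc j * 2 ^ b ≤⟨ *-monoʳ-≤ (2 ^ suc j) (2^b≤mantissa q {{subst NonZero (sym e) _}}) ⟩
          2 ^ suc j * m ≡⟨ *-comm _ m ⟩
          m * 2 ^ suc j ∎))))
        where open ≤-Reasoning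
      exp≡ : exponent (m * 2 ^ k) ≡ k
      exp≡ = exponent-scaled k refl
      man≡ : mantissa (m * 2 ^ k) ≡ m
      man≡ rewrite exp≡ = [m*2^k]>>k k m

    -- The loss is relative to the recovered value, not to q: this is what makes
    -- it chargeable to a shorter LCP.
    float-loss : ∀ q → (q ∸ unfloat (float q)) * 2 ^ b ≤ unfloat (float q)
    float-loss q rewrite unfloat-float q with exponent q in e
    ... | zero rewrite n/1≡n q | *-identityʳ q | n∸n≡0 q = z≤n
    ... | suc j = begin
      (q ∸ (q >> suc j) * 2 ^ suc j) * 2 ^ b ≤⟨ *-monoˡ-≤ (2 ^ b) {q ∸ (q >> suc j) * 2 ^ suc j} {2 ^ suc j} (m≤n+o⇒m∸n≤o q ((q >> suc j) * 2 ^ suc j) (subst (q ≤_) (+-comm (2 ^ suc j) _) (<⇒≤ (>>-upper (suc j) q)))) ⟩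
      2 ^ suc j * 2 ^ b ≤⟨ *-monoʳ-≤ (2 ^ suc j) (subst (λ j → 2 ^ b ≤ q >> j) e (2^b≤mantissa q {{subst NonZero (sym e) _}})) ⟩
      2 ^ suc j * (q >> suc j) ≡⟨ *-comm (2 ^ suc j) _ ⟩
      (q >> suc j) * 2 ^ suc j ∎
      where open ≤-Reasoning

    float< : ∀ q → float q < (2 + exponent q) * 2 ^ b
    float< q = begin-strict
      exponent q * 2 ^ b + mantissa q <⟨ +-monoʳ-< (exponent q * 2 ^ b) (mantissa< q) ⟩
      exponent q * 2 ^ b + 2 * 2 ^ b ≡⟨ +-comm _ (2 * 2 ^ b) ⟩
      2 * 2 ^ b + exponent q * 2 ^ b ≡⟨ *-distribʳ-+ (2 ^ b) 2 (exponent q) ⟨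
      (2 + exponent q) * 2 ^ b ∎
      where open ≤-Reasoning

    exponent-mono : ∀ {p q} → p ≤ q → exponent p ≤ exponent q
    exponent-mono p≤q = ⌊log₂⌋-mono-≤ (>>-mono b p≤q)

    exponent≤ : ∀ q → exponent q ≤ ⌊log₂ q ⌋
    exponent≤ q = ⌊log₂⌋-mono-≤ (>>≤ b q)

    -- For equal exponents the mantissas decide. Otherwise a code with exponent `k` lies below
    -- `(2 + k) * 2 ^ b`, and the explicit leading bit puts every code of a larger exponent at or
    -- above that.
    float-mono : ∀ {p q} → p ≤ q → float p ≤ float q
    float-mono {p} {q} p≤q with m≤n⇒m<n∨m≡n (exponent-mono p≤q)
    ... | inj₂ e = +-mono-≤ (*-monoˡ-≤ (2 ^ b) (exponent-mono p≤q)) (subst (λ k → mantissa p ≤ q >> k) e (>>-mono (exponent p) p≤q))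
    ... | inj₁ l = begin
      float p ≤⟨ <⇒≤ (float< p) ⟩
      (2 + exponent p) * 2 ^ b ≤⟨ *-monoˡ-≤ (2 ^ b) (s≤s l) ⟩
      2 ^ b + exponent q * 2 ^ b ≡⟨ +-comm (2 ^ b) _ ⟩
      exponent q * 2 ^ b + 2 ^ b ≤⟨ +-monoʳ-≤ (exponent q * 2 ^ b) (2^b≤mantissa q {{>-nonZero (≤-<-trans z≤n l)}}) ⟩
      float q ∎
      where open ≤-Reasoning

    float-⊓ : ∀ p q → float (p ⊓ q) ≡ float p ⊓ float q
    float-⊓ p q = mono-≤-distrib-⊓ float-mono p q

    float-0 : float 0 ≡ 0
    float-0 = n≤0⇒n≡0 (float≤ 0)

  lcpCode : LCPCode
  lcpCode = record
    { encode = λ L α ℓ → Float.float ⌊log₂ L ⌋ (ℓ / α)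
    ; decode = λ L α c → Float.unfloat ⌊log₂ L ⌋ c * α
    ; lower-bound = λ L α ℓ → ≤-trans (*-monoˡ-≤ α (Float.unfloat-float≤ ⌊log₂ L ⌋ (ℓ / α))) (m/n*n≤m ℓ α)
    ; encode-decode = λ L α ℓ → trans (cong (Float.float ⌊log₂ L ⌋) (m*n/n≡m (Float.unfloat ⌊log₂ L ⌋ (Float.float ⌊log₂ L ⌋ (ℓ / α))) α)) (Float.float-unfloat-float ⌊log₂ L ⌋ (ℓ / α))
    }

  -- Machine arithmetic

  private
    bit-%2 : ∀ k → (if (k % 2 ≡ᵇ 1) then 1 else 0) ≡ k % 2
    bit-%2 k with k % 2 | m%n<n k 2
    ... | zero | _ = refl
    ... | suc zero | _ = refl
    ... | suc (suc _) | s≤s (s≤s ())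

  toℕ< : ∀ {w} (u : Word w) → toℕ u < 2 ^ w
  toℕ< [] = s≤s z≤n
  toℕ< {suc w} (b ∷ u) = begin-strict
    (if b then 1 else 0) + 2 * toℕ u <⟨ +-monoˡ-< (2 * toℕ u) (bit<2 b) ⟩
    2 + 2 * toℕ u ≡⟨ *-suc 2 (toℕ u) ⟨
    2 * suc (toℕ u) ≤⟨ *-monoʳ-≤ 2 (toℕ< u) ⟩
    2 ^ suc w ∎
    where
    open ≤-Reasoning
    bit<2 : ∀ b → (if b then 1 else 0) < 2
    bit<2 false = s≤s z≤n
    bit<2 true = s≤s (s≤s z≤n)

  toℕ-fromℕ : ∀ w {k} → k < 2 ^ w → toℕ (fromℕ w k) ≡ k
  toℕ-fromℕ zero {zero} _ = refl
  toℕ-fromℕ zero {suc k} (s≤s ())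
  toℕ-fromℕ (suc w) {k} p = begin
    (if k % 2 ≡ᵇ 1 then 1 else 0) + 2 * toℕ (fromℕ w (k / 2)) ≡⟨ cong₂ _+_ (bit-%2 k) (cong (2 *_) (toℕ-fromℕ w (m<n*o⇒m/o<n {k} {2 ^ w} {2} (subst (k <_) (*-comm 2 (2 ^ w)) p)))) ⟩
    k % 2 + 2 * (k / 2) ≡⟨ cong (k % 2 +_) (*-comm 2 (k / 2)) ⟩
    k % 2 + k / 2 * 2 ≡⟨ m≡m%n+[m/n]*n k 2 ⟨
    k ∎
    where open ≡-Reasoning

  toℕ-injective : ∀ {w} {u v : Word w} → toℕ u ≡ toℕ v → u ≡ v
  toℕ-injective {u = []} {[]} _ = refl
  toℕ-injective {u = false ∷ u} {false ∷ v} e = cong (false ∷_) (toℕ-injective (*-cancelˡ-≡ _ _ 2 e))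
  toℕ-injective {u = true ∷ u} {true ∷ v} e = cong (true ∷_) (toℕ-injective (*-cancelˡ-≡ _ _ 2 (suc-injective e)))
  toℕ-injective {u = false ∷ u} {true ∷ v} e = contradiction e (even≢odd (toℕ u) (toℕ v))
  toℕ-injective {u = true ∷ u} {false ∷ v} e = contradiction (sym e) (even≢odd (toℕ v) (toℕ u))

  fromℕ-toℕ : ∀ {w} (u : Word w) → fromℕ w (toℕ u) ≡ u
  fromℕ-toℕ {w} u = toℕ-injective (toℕ-fromℕ w (toℕ< u))

  fromℕ-+2^w : ∀ w k → fromℕ w (k + 2 ^ w) ≡ fromℕ w k
  fromℕ-+2^w zero k = refl
  fromℕ-+2^w (suc w) k = cong₂ _∷_
    (cong (_≡ᵇ 1) (trans (cong (λ e → (k + e) % 2) (*-comm 2 (2 ^ w))) ([m+kn]%n≡m%n k (2 ^ w) 2)))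
    (trans (cong (fromℕ w) shape) (fromℕ-+2^w w (k / 2)))
    where
    shape : (k + 2 ^ suc w) / 2 ≡ k / 2 + 2 ^ w
    shape = trans (cong (λ e → (k + e) / 2) (*-comm 2 (2 ^ w))) (trans (+-distrib-/-∣ʳ k (divides-refl (2 ^ w))) (cong (k / 2 +_) (m*n/n≡m (2 ^ w) 2)))

  module _ {w : ℕ} where

    toℕ-null : toℕ (null {w}) ≡ 0
    toℕ-null = toℕ-fromℕ w (m^n>0 2 w)

    toℕ≡0⇒null : {u : Word w} → toℕ u ≡ 0 → u ≡ null
    toℕ≡0⇒null e = toℕ-injective (trans e (sym toℕ-null))

    add-toℕ : (u v : Word w) → toℕ u + toℕ v < 2 ^ w → toℕ (u ⊕ v) ≡ toℕ u + toℕ v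
    add-toℕ u v = toℕ-fromℕ w

    -- The machine adds `2 ^ w ∸ toℕ v`; without a borrow the sum is the difference plus `2 ^ w`,
    -- which `fromℕ` forgets.
    sub-toℕ : (u v : Word w) → toℕ v ≤ toℕ u → toℕ (applyOp sub u v) ≡ toℕ u ∸ toℕ v
    sub-toℕ u v p = trans (cong toℕ (trans (cong (fromℕ w) shape) (fromℕ-+2^w w (toℕ u ∸ toℕ v))))
                          (toℕ-fromℕ w (≤-<-trans (m∸n≤m (toℕ u) (toℕ v)) (toℕ< u)))
      where
      shape : toℕ u + (2 ^ w ∸ toℕ v) ≡ toℕ u ∸ toℕ v + 2 ^ w
      shape = trans (sym (+-∸-assoc (toℕ u) (<⇒≤ (toℕ< v)))) (+-∸-comm (2 ^ w) p)

    shl-toℕ : (u v : Word w) → toℕ u * 2 ^ toℕ v < 2 ^ w → toℕ (applyOp shl u v) ≡ toℕ u * 2 ^ toℕ v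
    shl-toℕ u v = toℕ-fromℕ w

    shr-toℕ : (u v : Word w) → toℕ (applyOp shr u v) ≡ toℕ u >> toℕ v
    shr-toℕ u v = toℕ-fromℕ w (≤-<-trans (>>≤ (toℕ v) (toℕ u)) (toℕ< u))

    msb-toℕ : (u : Word w) → toℕ (fromℕ w ⌊log₂ toℕ u ⌋) ≡ ⌊log₂ toℕ u ⌋
    msb-toℕ u = toℕ-fromℕ w (≤-<-trans (⌊log₂⌋≤ (toℕ u)) (toℕ< u))

    bit : Bool → Word w
    bit b = fromℕ w (if b then 1 else 0)

  module _ {w : ℕ} where

    and-bit : ∀ a b → applyOp and (bit {w} a) (bit b) ≡ bit (a ∧ b)
    and-bit a b = lemma w a b
      where
      lemma : ∀ w a b → applyOp and (bit {w} a) (bit b) ≡ bit (a ∧ b)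
      lemma zero a b = refl
      lemma (suc w) false false = cong (false ∷_) (lemma w false false)
      lemma (suc w) false true = cong (false ∷_) (lemma w false false)
      lemma (suc w) true false = cong (false ∷_) (lemma w false false)
      lemma (suc w) true true = cong (true ∷_) (lemma w false false)

    or-bit : ∀ a b → applyOp or (bit {w} a) (bit b) ≡ bit (a ∨ b)
    or-bit a b = lemma w a b
      where
      lemma : ∀ w a b → applyOp or (bit {w} a) (bit b) ≡ bit (a ∨ b)
      lemma zero a b = refl
      lemma (suc w) false false = cong (false ∷_) (lemma w false false)
      lemma (suc w) false true = cong (true ∷_) (lemma w false false)
      lemma (suc w) true false = cong (true ∷_) (lemma w false false)
      lemma (suc w) true true = cong (true ∷_) (lemma w false false)

    module _ .{{_ : NonZero w}} where

      2≤2^w : 2 ≤ 2 ^ w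
      2≤2^w = ^-monoʳ-≤ 2 {1} (>-nonZero⁻¹ w)

      toℕ-lit1 : toℕ (fromℕ w 1) ≡ 1
      toℕ-lit1 = toℕ-fromℕ w 2≤2^w

      toℕ-bit : ∀ b → toℕ (bit {w} b) ≡ (if b then 1 else 0)
      toℕ-bit false = toℕ-null {w}
      toℕ-bit true = toℕ-lit1

      bit-true : bit {w} true ≢ null
      bit-true e with trans (sym toℕ-lit1) (trans (cong toℕ e) (toℕ-null {w}))
      ... | ()

      eq0-bit : ∀ b → applyOp eq (bit {w} b) null ≡ bit (Data.Bool.not b)
      eq0-bit false rewrite toℕ-null {w} = refl
      eq0-bit true rewrite toℕ-lit1 | toℕ-null {w} = refl

-- Total correctness and running time of programs.

module ProgramLogic where

  open import Defs
  open Words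
  open import Data.Bool using (Bool; true; false; if_then_else_; _∧_; _∨_; not)
  open import Data.Empty using (⊥)
  open import Data.Nat
  open import Data.Nat.Logarithm using (⌊log₂_⌋)
  open import Data.Nat.Properties
  open import Data.Product using (_×_; _,_; Σ-syntax; ∃-syntax)
  open import Data.Unit using (⊤)
  open import Relation.Binary.PropositionalEquality
  open import Relation.Nullary using (yes; no; does; contradiction)

  module _ {w : ℕ} where

    -- The time bound is demanded of every run, while the analysis exhibits one; determinism
    -- identifies them.
    deterministic : ∀ {c} {s s₁ s₂ : State w} {τ₁ τ₂} →
                    ⟨ c , s ⟩⇓⟨ s₁ , τ₁ ⟩ → ⟨ c , s ⟩⇓⟨ s₂ , τ₂ ⟩ → s₁ ≡ s₂ × τ₁ ≡ τ₂
    deterministic ⇓skip ⇓skip = refl , refl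
    deterministic ⇓reg ⇓reg = refl , refl
    deterministic ⇓mem ⇓mem = refl , refl
    deterministic (⇓seq p q) (⇓seq p′ q′) with deterministic p p′
    ... | refl , refl with deterministic q q′
    ...   | refl , refl = refl , refl
    deterministic (⇓then _ p) (⇓then _ p′) with deterministic p p′
    ... | refl , refl = refl , refl
    deterministic (⇓then n _) (⇓else e _) = contradiction e n
    deterministic (⇓else e _) (⇓then n _) = contradiction e n
    deterministic (⇓else _ p) (⇓else _ p′) with deterministic p p′
    ... | refl , refl = refl , refl
    deterministic (⇓done _) (⇓done _) = refl , refl
    deterministic (⇓done e) (⇓loop n _ _) = contradiction e n
    deterministic (⇓loop n _ _) (⇓done e) = contradiction e n
    deterministic (⇓loop _ p q) (⇓loop _ p′ q′) with deterministic p p′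
    ... | refl , refl with deterministic q q′
    ...   | refl , refl = refl , refl

  Straight : Cmd → Set
  Straight skip         = ⊤
  Straight (r ≔ e)      = ⊤
  Straight (a [ e ]≔ f) = ⊤
  Straight (c ⨾ d)      = Straight c × Straight d
  Straight (cond e c d) = Straight c × Straight d
  Straight (while e c)  = ⊥

  -- For a loop, the cost of one iteration.
  maxCost : Cmd → ℕ
  maxCost skip         = 0
  maxCost (r ≔ e)      = suc (cost e)
  maxCost (a [ e ]≔ f) = suc (cost e + cost f)
  maxCost (c ⨾ d)      = maxCost c + maxCost d
  maxCost (cond e c d) = suc (cost e + (maxCost c + maxCost d))
  maxCost (while e c)  = suc (cost e + maxCost c)

  -- Opaque, so that costs are never evaluated.
  abstract
    timeBound : Cmd → ℕ
    timeBound = maxCost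

    timeBound≡ : ∀ c → timeBound c ≡ maxCost c
    timeBound≡ c = refl

  module _ {w : ℕ} where

    exec : Cmd → State w → State w
    exec skip         s = s
    exec (r ≔ e)      s = setReg r (⟦ e ⟧ s) s
    exec (a [ e ]≔ f) s = setMem a (⟦ e ⟧ s) (⟦ f ⟧ s) s
    exec (c ⨾ d)      s = exec d (exec c s)
    exec (cond e c d) s = if does (⟦ e ⟧ s ≟ʷ null) then exec d s else exec c s
    -- A default value: `⇓exec` is stated for `Straight` commands, which contain no loop.
    exec (while e c)  s = s

    ⇓exec : ∀ c (s : State w) → Straight c →
            Σ[ τ ∈ ℕ ] ⟨ c , s ⟩⇓⟨ exec c s , τ ⟩ × τ ≤ maxCost c
    ⇓exec skip s _ = _ , ⇓skip , ≤-refl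
    ⇓exec (r ≔ e) s _ = _ , ⇓reg , ≤-refl
    ⇓exec (a [ e ]≔ f) s _ = _ , ⇓mem , ≤-refl
    ⇓exec (c ⨾ d) s (p , q) with ⇓exec c s p | ⇓exec d (exec c s) q
    ... | _ , r , l | _ , r′ , l′ = _ , ⇓seq r r′ , +-mono-≤ l l′
    ⇓exec (cond e c d) s (p , q) with ⟦ e ⟧ s ≟ʷ null
    ... | yes z with ⇓exec d s q
    ...   | _ , r , l = _ , ⇓else z r , s≤s (+-monoʳ-≤ (cost e) (≤-trans l (m≤n+m (maxCost d) (maxCost c))))
    ⇓exec (cond e c d) s (p , q) | no z with ⇓exec c s p
    ...   | _ , r , l = _ , ⇓then z r , s≤s (+-monoʳ-≤ (cost e) (≤-trans l (m≤m+n (maxCost c) (maxCost d))))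

    -- A total-correctness triple with time: exhibiting a run also proves termination, and `Q` sees
    -- the number of steps.
    Runs : Cmd → State w → (State w → ℕ → Set) → Set
    Runs c s Q = Σ[ s′ ∈ State w ] Σ[ τ ∈ ℕ ] ⟨ c , s ⟩⇓⟨ s′ , τ ⟩ × Q s′ τ

    ⇓exec′ : ∀ c (s : State w) → Straight c →
             Σ[ τ ∈ ℕ ] ⟨ c , s ⟩⇓⟨ exec c s , τ ⟩ × τ ≤ timeBound c
    ⇓exec′ c s p with ⇓exec c s p
    ... | τ , r , l = τ , r , ≤-trans l (≤-reflexive (sym (timeBound≡ c)))

    runs-exec : ∀ c s → Straight c → Runs c s (λ s′ τ → s′ ≡ exec c s × τ ≤ timeBound c)
    runs-exec c s p with ⇓exec′ c s p
    ... | _ , r , l = _ , _ , r , refl , l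

    runs-map : ∀ {c s P Q} → (∀ {s′ τ} → P s′ τ → Q s′ τ) → Runs c s P → Runs c s Q
    runs-map f (_ , _ , r , p) = _ , _ , r , f p

    runs-seq : ∀ {c d s P} {Q : State w → ℕ → Set} → Runs c s P →
               (∀ {s₁ τ₁} → P s₁ τ₁ → Runs d s₁ (λ s′ τ₂ → Q s′ (τ₁ + τ₂))) →
               Runs (c ⨾ d) s Q
    runs-seq (_ , _ , r , p) f with f p
    ... | _ , _ , r′ , q = _ , _ , ⇓seq r r′ , q

    runs-straight : ∀ {c d s} {Q : State w → ℕ → Set} → Straight c →
                    (∀ {τ₁} → τ₁ ≤ timeBound c → Runs d (exec c s) (λ s′ τ₂ → Q s′ (τ₁ + τ₂))) →
                    Runs (c ⨾ d) s Q
    runs-straight p f = runs-seq (runs-exec _ _ p) λ { (refl , l) → f l }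

    Tests : Expr → State w → Bool → Set
    Tests e s b = ⟦ e ⟧ s ≡ bit b

  notE : Expr → Expr
  notE e = op eq e (lit 0)

  module _ {w : ℕ} .{{_ : NonZero w}} where

    tests-not : ∀ e {s : State w} {b} → Tests e s b → Tests (notE e) s (not b)
    tests-not e {b = b} p = trans (cong (λ u → applyOp eq u null) p) (eq0-bit b)

    tests-and : ∀ e f {s : State w} {b c} → Tests e s b → Tests f s c → Tests (op and e f) s (b ∧ c)
    tests-and e f {b = b} {c} p q = trans (cong₂ (applyOp and) p q) (and-bit b c)

    tests-or : ∀ e f {s : State w} {b c} → Tests e s b → Tests f s c → Tests (op or e f) s (b ∨ c)
    tests-or e f {b = b} {c} p q = trans (cong₂ (applyOp or) p q) (or-bit b c)

    tests-lt : ∀ e f {s : State w} {m n} → toℕ (⟦ e ⟧ s) ≡ m → toℕ (⟦ f ⟧ s) ≡ n → Tests (op lt e f) s (m <ᵇ n)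
    tests-lt e f p q = cong₂ (λ m n → bit (m <ᵇ n)) p q

    tests-eq : ∀ e f {s : State w} {m n} → toℕ (⟦ e ⟧ s) ≡ m → toℕ (⟦ f ⟧ s) ≡ n → Tests (op eq e f) s (m ≡ᵇ n)
    tests-eq e f p q = cong₂ (λ m n → bit (m ≡ᵇ n)) p q

    exec-cond : ∀ {e c d} {s : State w} {b} → Tests e s b →
                exec (cond e c d) s ≡ (if b then exec c s else exec d s)
    exec-cond {e} {s = s} {b} p with ⟦ e ⟧ s ≟ʷ null
    exec-cond {b = true} p | yes z = contradiction (trans (sym p) z) bit-true
    exec-cond {b = false} p | yes z = refl
    exec-cond {b = true} p | no z = refl
    exec-cond {b = false} p | no z = contradiction p z

    exec-null : ∀ {e c d} {s : State w} → ⟦ e ⟧ s ≡ null → exec (cond e c d) s ≡ exec d s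
    exec-null {e} {s = s} p with ⟦ e ⟧ s ≟ʷ null
    ... | yes _ = refl
    ... | no ¬z = contradiction p ¬z

    exec-nonnull : ∀ {e c d} {s : State w} → ⟦ e ⟧ s ≢ null → exec (cond e c d) s ≡ exec c s
    exec-nonnull {e} {s = s} p with ⟦ e ⟧ s ≟ʷ null
    ... | yes z = contradiction z p
    ... | no _ = refl

    runs-null : ∀ {e c d} {s : State w} {Q : State w → ℕ → Set} → ⟦ e ⟧ s ≡ null →
                Runs d s (λ s′ τ → Q s′ (suc (cost e + τ))) → Runs (cond e c d) s Q
    runs-null z (_ , _ , r , q) = _ , _ , ⇓else z r , q

    runs-nonnull : ∀ {e c d} {s : State w} {Q : State w → ℕ → Set} → ⟦ e ⟧ s ≢ null →
                   Runs c s (λ s′ τ → Q s′ (suc (cost e + τ))) → Runs (cond e c d) s Q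
    runs-nonnull z (_ , _ , r , q) = _ , _ , ⇓then z r , q

  -- Codes on machine words

  decodeE encodeE : Expr → Expr
  decodeE c = op shl (op sub c (op shl k b)) k
    where
    b = msb (reg logᴿ)
    h = op shr c b
    -- Subtracting the truth value of `0 < h` is `pred`, without a branch and without wrapping
    -- around at 0.
    k = op sub h (op lt (lit 0) h)
  encodeE q = op add (op shl k b) (op shr q k)
    where
    b = msb (reg logᴿ)
    k = msb (op shr q b)

  module _ {w : ℕ} .{{_ : NonZero w}} {L : ℕ} where

    open Float ⌊log₂ L ⌋

    private
      <ᵇ-pred : ∀ n → n ∸ (if 0 <ᵇ n then 1 else 0) ≡ pred n
      <ᵇ-pred zero = refl
      <ᵇ-pred (suc n) = refl

    -- No step overflows: every intermediate value is at most `q`, which fits in a word, so no shift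
    -- loses a bit.
    ⟦decodeE⟧ : ∀ e {s : State w} {q} → toℕ (regs s logᴿ) ≡ L → toℕ (⟦ e ⟧ s) ≡ float q → q < 2 ^ w →
                toℕ (⟦ decodeE e ⟧ s) ≡ unfloat (float q)
    ⟦decodeE⟧ e {s} {q} refl c≡ q< = trans (shl-toℕ u k (subst (_< 2 ^ w) (sym shl≡) (≤-<-trans (unfloat-float≤ q) q<))) shl≡
      where
      b = ⟦ msb (reg logᴿ) ⟧ s
      c = ⟦ e ⟧ s
      h = applyOp shr c b
      k = applyOp sub h (applyOp lt null h)
      v = applyOp shl k b
      u = applyOp sub c v
      B = ⌊log₂ L ⌋
      b≡ : toℕ b ≡ B
      b≡ = msb-toℕ (regs s logᴿ)
      h≡ : toℕ h ≡ float q >> B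
      h≡ = trans (shr-toℕ c b) (cong₂ _>>_ c≡ b≡)
      one : toℕ (applyOp lt null h) ≡ (if 0 <ᵇ toℕ h then 1 else 0)
      one rewrite toℕ-null {w} = toℕ-bit (0 <ᵇ toℕ h)
      one≤ : ∀ n → (if 0 <ᵇ n then 1 else 0) ≤ n
      one≤ zero = z≤n
      one≤ (suc n) = s≤s z≤n
      k≡ : toℕ k ≡ pred (float q >> B)
      k≡ = trans (sub-toℕ h (applyOp lt null h) (subst (_≤ toℕ h) (sym one) (one≤ (toℕ h)))) (trans (cong (toℕ h ∸_) one) (trans (<ᵇ-pred (toℕ h)) (cong pred h≡)))
      k2^b≤ : pred (float q >> B) * 2 ^ B ≤ float q
      k2^b≤ = ≤-trans (*-monoˡ-≤ (2 ^ B) (pred[n]≤n {float q >> B})) (>>-lower B (float q))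
      kb≡ : toℕ k * 2 ^ toℕ b ≡ pred (float q >> B) * 2 ^ B
      kb≡ = cong₂ (λ i j → i * 2 ^ j) k≡ b≡
      v≡ : toℕ v ≡ pred (float q >> B) * 2 ^ B
      v≡ = trans (shl-toℕ k b (subst (_< 2 ^ w) (sym kb≡) (≤-<-trans (≤-trans k2^b≤ (float≤ q)) q<))) kb≡
      u≡ : toℕ u ≡ float q ∸ pred (float q >> B) * 2 ^ B
      u≡ = trans (sub-toℕ c v (subst₂ _≤_ (sym v≡) (sym c≡) k2^b≤)) (cong₂ _∸_ c≡ v≡)
      shl≡ : toℕ u * 2 ^ toℕ k ≡ unfloat (float q)
      shl≡ = cong₂ (λ i j → i * 2 ^ j) u≡ k≡

    ⟦encodeE⟧ : ∀ e {s : State w} {q} → toℕ (regs s logᴿ) ≡ L → toℕ (⟦ e ⟧ s) ≡ q →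
                toℕ (⟦ encodeE e ⟧ s) ≡ float q
    ⟦encodeE⟧ e {s} refl refl = trans (add-toℕ kb m (subst (_< 2 ^ w) (sym sum≡) (≤-<-trans (float≤ q) (toℕ< c)))) sum≡
      where
      b = ⟦ msb (reg logᴿ) ⟧ s
      c = ⟦ e ⟧ s
      q = toℕ c
      k = ⟦ msb (op shr e (msb (reg logᴿ))) ⟧ s
      kb = applyOp shl k b
      m = applyOp shr c k
      B = ⌊log₂ L ⌋
      b≡ : toℕ b ≡ B
      b≡ = msb-toℕ (regs s logᴿ)
      k≡ : toℕ k ≡ exponent q
      k≡ = trans (msb-toℕ (applyOp shr c b)) (cong ⌊log₂_⌋ (trans (shr-toℕ c b) (cong (q >>_) b≡)))
      kb≡′ : toℕ k * 2 ^ toℕ b ≡ exponent q * 2 ^ B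
      kb≡′ = cong₂ (λ i j → i * 2 ^ j) k≡ b≡
      kb≡ : toℕ kb ≡ exponent q * 2 ^ B
      kb≡ = trans (shl-toℕ k b (subst (_< 2 ^ w) (sym kb≡′) (≤-<-trans (≤-trans (m≤m+n _ (mantissa q)) (float≤ q)) (toℕ< c)))) kb≡′
      sum≡ : toℕ kb + toℕ m ≡ float q
      sum≡ = cong₂ _+_ kb≡ (trans (shr-toℕ c k) (cong (q >>_) k≡))

-- The order of ranks, and zippers into zip-tries.

module Zippers where

  open import Defs
  open StringOrder
  open import Data.Bool using (Bool; true; false)
  import Data.Fin as Fin
  import Data.Fin.Properties as Fin
  open import Data.List using (List; []; _∷_; _++_; map)
  open import Data.List.Properties using (map-++; ++-assoc)
  open import Data.List.Relation.Unary.All as All using (All; []; _∷_)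
  import Data.List.Relation.Unary.All.Properties as All
  open import Data.Maybe using (Maybe; just; nothing)
  open import Data.Nat
  open import Data.Nat.Properties
  open import Data.Product using (_×_; _,_; proj₁; proj₂; Σ-syntax; ∃-syntax)
  open import Data.Sum using (_⊎_; inj₁; inj₂)
  open import Data.Unit using (⊤; tt)
  open import Relation.Binary.Definitions using (tri<; tri≈; tri>)
  open import Relation.Binary.PropositionalEquality
  open import Relation.Nullary using (¬_; contradiction)

  module _ {R : ℕ} where

    <ʳ-trans : {q r s : Rank R} → q <ʳ r → r <ʳ s → q <ʳ s
    <ʳ-trans (inj₁ p) (inj₁ q) = inj₁ (<-trans p q)
    <ʳ-trans (inj₁ p) (inj₂ (refl , _)) = inj₁ p
    <ʳ-trans (inj₂ (refl , _)) (inj₁ q) = inj₁ q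
    <ʳ-trans (inj₂ (refl , p)) (inj₂ (refl , q)) = inj₂ (refl , <-trans p q)

    <ʳ-cmp : (r s : Rank R) → r <ʳ s ⊎ r ≡ s ⊎ s <ʳ r
    <ʳ-cmp (a , b) (c , d) with <-cmp a c
    ... | tri< p _ _ = inj₁ (inj₁ p)
    ... | tri> _ _ p = inj₂ (inj₂ (inj₁ p))
    ... | tri≈ _ refl _ with Fin.<-cmp b d
    ...   | tri< p _ _ = inj₁ (inj₂ (refl , p))
    ...   | tri≈ _ refl _ = inj₂ (inj₁ refl)
    ...   | tri> _ _ p = inj₂ (inj₂ (inj₂ (refl , p)))

    module _ {σ : ℕ} where

      beats-trans : {e f g : Entry σ R} → e Beats f → f Beats g → e Beats g
      beats-trans (inj₁ p) (inj₁ q) = inj₁ (<ʳ-trans q p)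
      beats-trans (inj₁ p) (inj₂ (refl , _)) = inj₁ p
      beats-trans (inj₂ (refl , _)) (inj₁ q) = inj₁ q
      beats-trans (inj₂ (refl , p)) (inj₂ (refl , q)) = inj₂ (refl , <ˢ-trans p q)

      beats-total : (e f : Entry σ R) → proj₁ e ≢ proj₁ f → ¬ e Beats f → f Beats e
      beats-total (x , r) (y , s) x≢y ¬p with <ʳ-cmp r s
      ... | inj₁ p = inj₁ p
      ... | inj₂ (inj₂ p) = contradiction (inj₁ p) ¬p
      ... | inj₂ (inj₁ refl) with <ˢ-cmp x y
      ...   | tri< p _ _ = contradiction (inj₂ (refl , p)) ¬p
      ...   | tri≈ _ p _ = contradiction p x≢y
      ...   | tri> _ _ p = inj₂ (refl , p)

      beats⇒rank₁≥ : {e f : Entry σ R} → e Beats f → proj₁ (proj₂ f) ≤ proj₁ (proj₂ e)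
      beats⇒rank₁≥ (inj₁ (inj₁ p)) = <⇒≤ p
      beats⇒rank₁≥ (inj₁ (inj₂ (refl , _))) = ≤-refl
      beats⇒rank₁≥ (inj₂ (refl , _)) = ≤-refl

  module _ {σ : ℕ} where

    infix 4 _<₋_ _<₊_
    _<₋_ : Maybe (Str σ) → Str σ → Set
    nothing <₋ y = ⊤
    just x  <₋ y = x <ˢ y

    _<₊_ : Str σ → Maybe (Str σ) → Set
    y <₊ nothing = ⊤
    y <₊ just z  = y <ˢ z

    <₋-trans : ∀ lo {x y} → lo <₋ x → x <ˢ y → lo <₋ y
    <₋-trans nothing p q = tt
    <₋-trans (just _) p q = <ˢ-trans p q

    <₊-trans : ∀ hi {x y} → x <ˢ y → y <₊ hi → x <₊ hi
    <₊-trans nothing p q = tt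
    <₊-trans (just _) p q = <ˢ-trans p q

  -- Zippers

  module _ {σ R : ℕ} where

    open Node public

    -- dir tells whether the hole is the right child.
    record Frame : Set where
      constructor frame
      field
        dir : Bool
        vtx : Node σ R
        sib : Tree σ R

    -- The innermost frame comes first, as on a path followed upwards through parent pointers.
    Ctx : Set
    Ctx = List Frame

    fill : Frame → Tree σ R → Tree σ R
    fill (frame true v t) u = branch t v u
    fill (frame false v t) u = branch u v t

    plug : Ctx → Tree σ R → Tree σ R
    plug [] u = u
    plug (f ∷ π) u = plug π (fill f u)

    loOf hiOf : Ctx → Maybe (Str σ)
    loOf [] = nothing
    loOf (frame true v _ ∷ π) = just (key v)
    loOf (frame false v _ ∷ π) = loOf π
    hiOf [] = nothing
    hiOf (frame true v _ ∷ π) = hiOf π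
    hiOf (frame false v _ ∷ π) = just (key v)

    TAll : (Node σ R → Set) → Tree σ R → Set
    TAll P leaf = ⊤
    TAll P (branch l v r) = P v × TAll P l × TAll P r

    TAll-map : ∀ {P Q : Node σ R → Set} → (∀ {v} → P v → Q v) → ∀ t → TAll P t → TAll Q t
    TAll-map f leaf _ = tt
    TAll-map f (branch l v r) (p , q , q′) = f p , TAll-map f l q , TAll-map f r q′

    TAll⇒All : ∀ {P} t → TAll P t → All P (nodes t)
    TAll⇒All leaf _ = []
    TAll⇒All (branch l v r) (p , q , q′) = All.++⁺ (TAll⇒All l q) (p ∷ TAll⇒All r q′)

    All⇒TAll : ∀ {P} t → All P (nodes t) → TAll P t
    All⇒TAll leaf _ = tt
    All⇒TAll (branch l v r) p with All.++⁻ (nodes l) p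
    ... | q , p ∷ q′ = p , All⇒TAll l q , All⇒TAll r q′

    -- Only the root is compared; inside a heap-ordered tree transitivity extends this to all nodes
    -- (`zt-below`).
    Below : Entry σ R → Tree σ R → Set
    Below e leaf = ⊤
    Below e (branch _ v _) = e Beats entry v

    BelowC : Ctx → Entry σ R → Set
    BelowC [] e = ⊤
    BelowC (f ∷ π) e = entry (Frame.vtx f) Beats e

    BelowCT : Ctx → Tree σ R → Set
    BelowCT π leaf = ⊤
    BelowCT π (branch _ v _) = BelowC π (entry v)

    belowC-trans : ∀ π {e} t → BelowC π e → Below e t → BelowCT π t
    belowC-trans π leaf _ _ = tt
    belowC-trans [] (branch _ _ _) _ _ = tt
    belowC-trans (f ∷ π) (branch _ _ _) p q = beats-trans p q

    belowCT⇒below : ∀ {f π} t → BelowCT (f ∷ π) t → Below (entry (Frame.vtx f)) t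
    belowCT⇒below leaf _ = tt
    belowCT⇒below (branch _ _ _) p = p

    pre post : Ctx → List (Entry σ R)
    pre [] = []
    pre (frame true v l ∷ π) = pre π ++ entries l ++ entry v ∷ []
    pre (frame false v r ∷ π) = pre π
    post [] = []
    post (frame true v l ∷ π) = post π
    post (frame false v r ∷ π) = entry v ∷ entries r ++ post π

    entries-branch : ∀ l v r → entries {σ} {R} (branch l v r) ≡ entries l ++ entry v ∷ entries r
    entries-branch l v r = map-++ entry (nodes l) (v ∷ nodes r)

    entries-plug : ∀ π u → entries (plug π u) ≡ pre π ++ entries u ++ post π
    entries-plug [] u = sym (Data.List.Properties.++-identityʳ (entries u))
    entries-plug (frame true v l ∷ π) u = trans (entries-plug π (branch l v u)) (trans
      (cong (λ es → pre π ++ es ++ post π) (entries-branch l v u))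
      (trans (cong (pre π ++_) (++-assoc (entries l) (entry v ∷ entries u) (post π)))
        (sym (trans (++-assoc (pre π) (entries l ++ entry v ∷ []) (entries u ++ post π))
          (cong (pre π ++_) (++-assoc (entries l) (entry v ∷ []) (entries u ++ post π)))))))
    entries-plug (frame false v r ∷ π) u = trans (entries-plug π (branch u v r)) (cong (pre π ++_) (trans
      (cong (_++ post π) (entries-branch u v r))
      (++-assoc (entries u) (entry v ∷ entries r) (post π))))

  module _ {σ R : ℕ} (enc : ℕ → ℕ) where

    record Codes (lo hi : Maybe (Str σ)) (v : Node σ R) : Set where
      constructor codes
      field
        lo<    : lo <₋ key v
        <hi    : key v <₊ hi
        code⁻≡ : code⁻ v ≡ enc (lcp∞ (key v) lo)
        code⁺≡ : code⁺ v ≡ enc (lcp∞ (key v) hi)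

    -- A local form of `ZipTrie`: bounds travel as indices and heap order is checked between
    -- neighbours, so moving a node disturbs only conditions next to it. The global quantifiers are
    -- recovered by `zt⇒search` and `zt⇒heap`.
    data ZT (lo hi : Maybe (Str σ)) : Tree σ R → Set where
      leaf : ZT lo hi leaf
      branch : ∀ {l v r} → Codes lo hi v → Below (entry v) l → Below (entry v) r →
               ZT lo (just (key v)) l → ZT (just (key v)) hi r → ZT lo hi (branch l v r)

    data ZC : Ctx {σ} {R} → Set where
      [] : ZC []
      right : ∀ {v l π} → Codes (loOf π) (hiOf π) v → BelowC π (entry v) →
              Below (entry v) l → ZT (loOf π) (just (key v)) l → ZC π → ZC (frame true v l ∷ π)
      left : ∀ {v r π} → Codes (loOf π) (hiOf π) v → BelowC π (entry v) →
             Below (entry v) r → ZT (just (key v)) (hiOf π) r → ZC π → ZC (frame false v r ∷ π)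

    record Hole (π : Ctx {σ} {R}) (u : Tree σ R) : Set where
      constructor hole
      field
        zc  : ZC π
        zt  : ZT (loOf π) (hiOf π) u
        top : BelowCT π u

    open Hole public

    hole-plug : ∀ {π u} → Hole π u → ZT nothing nothing (plug π u)
    hole-plug (hole [] z _) = z
    hole-plug {u = u} (hole (right c b bl zl zc) z t) = hole-plug (hole zc (branch c bl (belowCT⇒below u t) zl z) b)
    hole-plug {u = u} (hole (left c b br zr zc) z t) = hole-plug (hole zc (branch c (belowCT⇒below u t) br z zr) b)

    belowCT-∷ : ∀ d (v : Node σ R) (t : Tree σ R) (π : Ctx) (u : Tree σ R) → Below (entry v) u → BelowCT (frame d v t ∷ π) u
    belowCT-∷ d v t π leaf _ = tt
    belowCT-∷ d v t π (branch _ _ _) p = p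

    hole-right : ∀ {π l v r} → Hole π (branch l v r) → Hole (frame true v l ∷ π) r
    hole-right {π} {l} {v} {r} (hole zc (branch c bl br zl zr) b) = hole (right c b bl zl zc) zr (belowCT-∷ true v l π r br)

    hole-left : ∀ {π l v r} → Hole π (branch l v r) → Hole (frame false v r ∷ π) l
    hole-left {π} {l} {v} {r} (hole zc (branch c bl br zl zr) b) = hole (left c b br zr zc) zl (belowCT-∷ false v r π l bl)

    zt-lo : ∀ {lo hi} t → ZT lo hi t → TAll (λ v → lo <₋ key v) t
    zt-lo leaf leaf = tt
    zt-lo {lo} (branch l v r) (branch c _ _ zl zr) = Codes.lo< c , zt-lo l zl ,
      TAll-map (<₋-trans lo (Codes.lo< c)) r (zt-lo r zr)

    zt-hi : ∀ {lo hi} t → ZT lo hi t → TAll (λ v → key v <₊ hi) t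
    zt-hi leaf leaf = tt
    zt-hi {hi = hi} (branch l v r) (branch c _ _ zl zr) = Codes.<hi c ,
      TAll-map (λ p → <₊-trans hi p (Codes.<hi c)) l (zt-hi l zl) , zt-hi r zr

    zt-below : ∀ {lo hi e} t → ZT lo hi t → Below e t → TAll (λ v → e Beats entry v) t
    zt-below leaf leaf _ = tt
    zt-below (branch l v r) (branch c bl br zl zr) b =
      b , TAll-map (beats-trans b) l (zt-below l zl bl) , TAll-map (beats-trans b) r (zt-below r zr br)

    private
      All-keys : ∀ {P : Str σ → Set} (t : Tree σ R) → TAll (λ v → P (key v)) t → All P (keys (entries t))
      All-keys t p = All.map⁺ (All.map⁺ (TAll⇒All t p))

    zt⇒search : ∀ {lo hi} t → ZT lo hi t → SearchTree t
    zt⇒search leaf leaf = tt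
    zt⇒search (branch l v r) (branch _ _ _ zl zr) =
      All-keys l (zt-hi l zl) , All-keys r (zt-lo r zr) , zt⇒search l zl , zt⇒search r zr

    zt⇒heap : ∀ {lo hi} t → ZT lo hi t → HeapOrdered t
    zt⇒heap leaf leaf = tt
    zt⇒heap (branch l v r) (branch _ bl br zl zr) =
      All.map⁺ (TAll⇒All l (zt-below l zl bl)) , All.map⁺ (TAll⇒All r (zt-below r zr br)) , zt⇒heap l zl , zt⇒heap r zr

    zt⇒lcps : ∀ {lo hi} t → ZT lo hi t → LCPsStored enc lo hi t
    zt⇒lcps leaf leaf = tt
    zt⇒lcps (branch l v r) (branch c _ _ zl zr) = Codes.code⁻≡ c , Codes.code⁺≡ c , zt⇒lcps l zl , zt⇒lcps r zr

    private
      keys⇒TAll : ∀ {P : Str σ → Set} (t : Tree σ R) → All P (keys (entries t)) → TAll (λ v → P (key v)) t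
      keys⇒TAll t p = All⇒TAll t (All.map⁻ (All.map⁻ p))

      below-root : ∀ {e} (t : Tree σ R) → TAll (λ v → e Beats entry v) t → Below e t
      below-root leaf _ = tt
      below-root (branch _ _ _) (p , _) = p

      TAll-both : ∀ {P Q : Node σ R → Set} t → TAll P t → TAll Q t → TAll (λ v → P v × Q v) t
      TAll-both leaf _ _ = tt
      TAll-both (branch l v r) (p , pl , pr) (q , ql , qr) = (p , q) , TAll-both l pl ql , TAll-both r pr qr

      build : ∀ {lo hi} t → TAll (λ v → lo <₋ key v) t → TAll (λ v → key v <₊ hi) t →
              SearchTree t → HeapOrdered t → LCPsStored enc lo hi t → ZT lo hi t
      build leaf _ _ _ _ _ = leaf
      build (branch l v r) (p , pl , pr) (q , ql , qr) (kl , kr , sl , sr) (hl , hr , hl′ , hr′) (c⁻ , c⁺ , cl , cr) =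
        branch (codes p q c⁻ c⁺)
          (below-root l (All⇒TAll l (All.map⁻ hl))) (below-root r (All⇒TAll r (All.map⁻ hr)))
          (build l pl (keys⇒TAll l kl) sl hl′ cl)
          (build r (keys⇒TAll r kr) qr sr hr′ cr)

      TAll-⊤ : (t : Tree σ R) → TAll (λ _ → ⊤) t
      TAll-⊤ leaf = tt
      TAll-⊤ (branch l v r) = tt , TAll-⊤ l , TAll-⊤ r

    zipTrie⇒ZT : ∀ {E t} → ZipTrie enc E t → ZT nothing nothing t
    zipTrie⇒ZT {t = t} z = build t (TAll-⊤ t) (TAll-⊤ t) (ZipTrie.search z) (ZipTrie.heap z) (ZipTrie.lcps z)

    zc-lo : ∀ {π} → ZC π → ∀ {y} → loOf π <₋ y → All (λ e → proj₁ e <ˢ y) (pre π)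
    zc-lo [] p = []
    zc-lo (right {l = l} {π = π} c b bl zl zc) {y} p = All.++⁺ (All.map (λ q → <ˢ-trans q p) (zc-lo zc (Codes.lo< c)))
      (All.++⁺ (All.map⁺ (All.map (λ q → <ˢ-trans q p) (TAll⇒All l (zt-hi l zl)))) (p ∷ []))
    zc-lo (left c b br zr zc) p = zc-lo zc p

    zc-hi : ∀ {π} → ZC π → ∀ {y} → y <₊ hiOf π → All (λ e → y <ˢ proj₁ e) (post π)
    zc-hi [] p = []
    zc-hi (right c b bl zl zc) p = zc-hi zc p
    zc-hi (left {r = r} c b br zr zc) p = p ∷ All.++⁺ (All.map⁺ (All.map (<ˢ-trans p) (TAll⇒All r (zt-lo r zr))))
      (All.map (<ˢ-trans p) (zc-hi zc (Codes.<hi c)))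

-- Comparing the query with a stored key word by word.

module Comparison where

  open import Defs renaming (_⨾_ to infixr 4 _⨾_; _≔_ to infix 5 _≔_; _[_]≔_ to infix 5 _[_]≔_)
  open StringOrder
  open Words
  open ProgramLogic
  open Zippers
  open import Data.Bool using (true; false; if_then_else_; T)
  open import Data.List using (length; drop)
  open import Data.List.Relation.Binary.Prefix.Heterogeneous using (Prefix)
  open import Data.Nat
  open import Data.Nat.DivMod
  open import Data.Nat.Logarithm using (⌊log₂_⌋)
  open import Data.Nat.Properties
  open import Data.Product using (_×_; _,_; Σ-syntax; ∃-syntax)
  open import Data.Sum using (_⊎_; inj₁; inj₂)
  open import Data.Unit using (tt)
  open import Relation.Binary.Definitions using (tri<; tri≈; tri>)
  open import Relation.Binary.PropositionalEquality hiding ([_])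
  open import Relation.Nullary using (¬_; Dec; yes; no; does; contradiction)
  open import Relation.Nullary.Decidable using (map′; _×-dec_; _⊎-dec_; ¬?)

  vᴿ prevᴿ loᴿ hiᴿ lcp⁻ᴿ lcp⁺ᴿ foundᴿ iᴿ mᴿ cᴿ : Reg
  vᴿ     = 11
  prevᴿ  = 12
  loᴿ    = 13
  hiᴿ    = 14
  lcp⁻ᴿ  = 15
  lcp⁺ᴿ  = 16
  foundᴿ = 17
  iᴿ     = 20
  mᴿ     = 21
  cᴿ     = 22

  xWordE vWordE xShorterE vShorterE vLessE xLessE equalE : Expr
  xWordE = textᴬ [ op add (reg xbaseᴿ) (reg iᴿ) ]
  vWordE = textᴬ [ op add (baseᴬ [ reg vᴿ ]) (reg iᴿ) ]
  xShorterE = op or (op lt (reg xfullᴿ) (fullᴬ [ reg vᴿ ]))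
                    (op and (op eq (reg xfullᴿ) (fullᴬ [ reg vᴿ ])) (op lt (reg xtailᴿ) (tailᴬ [ reg vᴿ ])))
  vShorterE = op or (op lt (fullᴬ [ reg vᴿ ]) (reg xfullᴿ))
                    (op and (op eq (fullᴬ [ reg vᴿ ]) (reg xfullᴿ)) (op lt (tailᴬ [ reg vᴿ ]) (reg xtailᴿ)))
  vLessE = op or (op lt vWordE xWordE) (op and (op eq vWordE xWordE) vShorterE)
  xLessE = op or (op lt xWordE vWordE) (op and (op eq xWordE vWordE) xShorterE)
  equalE = op and (op eq xWordE vWordE)
                  (op and (op eq (reg xfullᴿ) (fullᴬ [ reg vᴿ ])) (op eq (reg xtailᴿ) (tailᴬ [ reg vᴿ ])))

  -- `Op` has no multiplication; the factor will be the constant `charBits σ`, so the sum can be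
  -- unrolled into the program.
  timesE : ℕ → Expr → Expr
  timesE zero    e = lit 0
  timesE (suc k) e = op add e (timesE k e)

  -- A difference in a word that lies wholly inside `x` excludes `x` as a prefix. In the last word
  -- of `x` the shift first discards what follows the end of `x`, so that a mere extension is not
  -- taken for a difference.
  beyondE : ℕ → Expr
  beyondE σ = op or (op and (op eq (reg iᴿ) (reg xfullᴿ)) (op lt (op shr xWordE shift) (op shr vWordE shift)))
                    (op and (op lt (reg iᴿ) (reg xfullᴿ)) (op lt xWordE vWordE))
    where shift = timesE (charBits σ) (op sub (reg αᴿ) (reg xtailᴿ))

  chooseC clampC scanC compareC : Cmd
  chooseC = cond (op lt (reg lcp⁻ᴿ) (reg lcp⁺ᴿ))
    (mᴿ ≔ reg lcp⁺ᴿ ⨾ cᴿ ≔ code⁺ᴬ [ reg vᴿ ])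
    (mᴿ ≔ reg lcp⁻ᴿ ⨾ cᴿ ≔ code⁻ᴬ [ reg vᴿ ])
  clampC = cond (op lt (reg mᴿ) (reg iᴿ)) (iᴿ ≔ reg mᴿ) skip
  scanE : Expr
  scanE = op and (op and (op lt (reg iᴿ) (reg xfullᴿ)) (op lt (reg iᴿ) (fullᴬ [ reg vᴿ ])))
                 (op eq xWordE vWordE)
  scanC = while scanE (iᴿ ≔ op add (reg iᴿ) (lit 1))
  compareC = chooseC ⨾ iᴿ ≔ decodeE (reg cᴿ) ⨾ clampC ⨾ scanC

  κ-compare : ℕ
  κ-compare = (timeBound chooseC + (timeBound (iᴿ ≔ decodeE (reg cᴿ)) + timeBound clampC)) + timeBound scanC

  Mem : ℕ → Set
  Mem w = Array → Word w → Word w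

  -- `KeyAt` and `NodeAt` take a state but depend on its memory only; null registers turn a memory
  -- into a state.
  ⟪_⟫ : ∀ {w} → Mem w → State w
  ⟪ m ⟫ = state (λ _ → null) m

  -- Registers from 20 on are temporaries.
  record Same {w} (s s′ : State w) : Set where
    field
      mem≡  : mem s′ ≡ mem s
      regs≡ : ∀ r → {T (r <ᵇ 20)} → regs s′ r ≡ regs s r

  open Same public

  module _ {w : ℕ} where

    same-refl : ∀ {s : State w} → Same s s
    same-refl = record { mem≡ = refl ; regs≡ = λ _ → refl }

    same-trans : ∀ {s s′ s″ : State w} → Same s s′ → Same s′ s″ → Same s s″
    same-trans p q = record { mem≡ = trans (mem≡ q) (mem≡ p) ; regs≡ = λ r {l} → trans (regs≡ q r {l}) (regs≡ p r {l}) }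

    same-setReg : ∀ n {_ : T (19 <ᵇ n)} {u} {s : State w} → Same s (setReg n u s)
    same-setReg n {l} {u} {s} = record { mem≡ = refl ; regs≡ = λ r {l′} → lemma r l′ }
      where
      lemma : ∀ r → T (r <ᵇ 20) → (if r ≡ᵇ n then u else regs s r) ≡ regs s r
      lemma r l′ with r ≡ᵇ n in e
      ... | false = refl
      ... | true = contradiction (<ᵇ⇒< 19 n l) (<⇒≱ (s≤s (subst (_≤ 19) (≡ᵇ⇒≡ r n (subst T (sym e) tt)) (s≤s⁻¹ (<ᵇ⇒< r 20 l′)))))

    -- The word computed by `e` is tied to `does` of a decision, so that the program and the proof
    -- branch on the same datum.
    record Decides (e : Expr) (s : State w) (P : Set) : Set where
      constructor decides
      field
        dec  : Dec P
        test : Tests e s (does dec)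

    open Decides public

    decides-map : ∀ {e s} {P Q : Set} → (P → Q) → (Q → P) → Decides e s P → Decides e s Q
    decides-map f g (decides d t) = decides (map′ f g d) t

  module _ {w : ℕ} .{{_ : NonZero w}} where

    decides-lt : ∀ {e f} {s : State w} {m n} → toℕ (⟦ e ⟧ s) ≡ m → toℕ (⟦ f ⟧ s) ≡ n → Decides (op lt e f) s (m < n)
    decides-lt {e} {f} {s} {m} {n} p q = decides (m <? n) (tests-lt e f {s} p q)

    decides-eq : ∀ {e f} {s : State w} {m n} → toℕ (⟦ e ⟧ s) ≡ m → toℕ (⟦ f ⟧ s) ≡ n → Decides (op eq e f) s (m ≡ n)
    decides-eq {e} {f} {s} {m} {n} p q = decides (m ≟ n) (tests-eq e f {s} p q)

    decides-and : ∀ {e f} {s : State w} {P Q} → Decides e s P → Decides f s Q → Decides (op and e f) s (P × Q)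
    decides-and {e} {f} {s} (decides d t) (decides d′ t′) = decides (d ×-dec d′) (tests-and e f {s} t t′)

    decides-or : ∀ {e f} {s : State w} {P Q} → Decides e s P → Decides f s Q → Decides (op or e f) s (P ⊎ Q)
    decides-or {e} {f} {s} (decides d t) (decides d′ t′) = decides (d ⊎-dec d′) (tests-or e f {s} t t′)

    decides-not : ∀ {e} {s : State w} {P} → Decides e s P → Decides (notE e) s (¬ P)
    decides-not {e} {s} (decides d t) = decides (¬? d) (tests-not e {s} t)

    exec-decides : ∀ {e c d} {s : State w} {P} → (D : Decides e s P) →
                   exec (cond e c d) s ≡ (if does (dec D) then exec c s else exec d s)
    exec-decides {e} {c} {d} {s} (decides _ t) = exec-cond {e = e} {c} {d} {s} t

    timesE-toℕ : ∀ k e {s : State w} {n} → toℕ (⟦ e ⟧ s) ≡ n → k * n < 2 ^ w → toℕ (⟦ timesE k e ⟧ s) ≡ k * n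
    timesE-toℕ zero e p l = toℕ-null {w}
    timesE-toℕ (suc k) e {s} {n} p l = trans (add-toℕ (⟦ e ⟧ s) (⟦ timesE k e ⟧ s) (subst (_< 2 ^ w) (sym sum) l)) sum
      where
      sum : toℕ (⟦ e ⟧ s) + toℕ (⟦ timesE k e ⟧ s) ≡ n + k * n
      sum = cong₂ _+_ p (timesE-toℕ k e p (≤-<-trans (m≤n+m (k * n) n) l))

  module Strings (σ w : ℕ) .{{_ : NonTrivial σ}} .{{_ : NonZero (α σ w)}} where

    a : ℕ
    a = α σ w

    instance
      w≢0 : NonZero w
      w≢0 = ≢-nonZero λ { refl → ≢-nonZero⁻¹ (α σ 0) (0/n≡0 (charBits σ) {{charBits≢0 σ}}) }

    B*a≤w : charBits σ * a ≤ w
    B*a≤w = subst (_≤ w) (*-comm a (charBits σ)) (m/n*n≤m w (charBits σ) {{charBits≢0 σ}})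

    word<2^w : ∀ (x : Str σ) i → word a x i < 2 ^ w
    word<2^w x i = ≤-trans (pack< a (drop (i * a) x)) (^-monoʳ-≤ 2 B*a≤w)

    toℕ-word : ∀ {s : State w} {b f t x} → Holds σ w s b f t x → ∀ u → toℕ u ≤ length x / a →
               toℕ (mem s textᴬ (b ⊕ u)) ≡ word a x (toℕ u)
    toℕ-word {s} {b} {x = x} h u l = begin
      toℕ (mem s textᴬ (b ⊕ u)) ≡⟨ cong (λ v → toℕ (mem s textᴬ (b ⊕ v))) (fromℕ-toℕ u) ⟨
      toℕ (mem s textᴬ (b ⊕ fromℕ w (toℕ u))) ≡⟨ cong toℕ (Holds.text≡ h (toℕ u) l) ⟩
      toℕ (fromℕ w (word a x (toℕ u))) ≡⟨ toℕ-fromℕ w (word<2^w x (toℕ u)) ⟩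
      word a x (toℕ u) ∎
      where open ≡-Reasoning

    -- The word in which two such strings could part is one and the same memory cell, and with equal
    -- lengths a tie there means equality.
    holds-injective : ∀ {s : State w} {b f t x y} → Holds σ w s b f t x → Holds σ w s b f t y → x ≡ y
    holds-injective {s} {b} {f} {x = x} {y} p q = Prefix-≡ (word-≡-Prefix a x y words (≤-reflexive len)) len
      where
      full : length x / a ≡ length y / a
      full = trans (sym (Holds.full≡ p)) (Holds.full≡ q)
      tail : length x % a ≡ length y % a
      tail = trans (sym (Holds.tail≡ p)) (Holds.tail≡ q)
      len : length x ≡ length y
      len = trans (length-shape a x) (trans (cong₂ (λ i j → i + j * a) tail full) (sym (length-shape a y)))
      i = lcp x y / a
      u = fromℕ w i
      -- The index fits in a word because it is at most the number of full words, which is itself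
      -- stored in one.
      u≡ : toℕ u ≡ i
      u≡ = toℕ-fromℕ w (≤-<-trans (≤-trans (lcp/≤ˡ a x y) (≤-reflexive (sym (Holds.full≡ p)))) (toℕ< f))
      words : word a x i ≡ word a y i
      words = subst (λ i → word a x i ≡ word a y i) u≡ (trans
        (sym (toℕ-word p u (subst (_≤ length x / a) (sym u≡) (lcp/≤ˡ a x y))))
        (toℕ-word q u (subst (_≤ length y / a) (sym u≡) (lcp/≤ʳ a x y))))

    holds-mem : ∀ {s s′ : State w} {b b′ f f′ t t′ x} → (∀ i → mem s′ textᴬ i ≡ mem s textᴬ i) →
                b′ ≡ b → f′ ≡ f → t′ ≡ t → Holds σ w s b f t x → Holds σ w s′ b′ f′ t′ x
    holds-mem e refl refl refl h = record { full≡ = Holds.full≡ h ; tail≡ = Holds.tail≡ h ; text≡ = λ i l → trans (e _) (Holds.text≡ h i l) }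

    module Compare (x : Str σ) where

      Query : State w → Set
      Query s = Holds σ w s (regs s xbaseᴿ) (regs s xfullᴿ) (regs s xtailᴿ) x

      Current : State w → Str σ → Set
      Current s y = KeyAt σ w s (regs s vᴿ) y

      query-same : ∀ {s s′} → Same s s′ → Query s → Query s′
      query-same e = holds-mem (λ i → cong (λ m → m textᴬ i) (mem≡ e)) (regs≡ e xbaseᴿ) (regs≡ e xfullᴿ) (regs≡ e xtailᴿ)

      current-same : ∀ {s s′} y → Same s s′ → Current s y → Current s′ y
      current-same y e = holds-mem (λ i → cong (λ m → m textᴬ i) (mem≡ e)) (at baseᴬ) (at fullᴬ) (at tailᴬ)
        where at = λ b → cong₂ (λ m → m b) (mem≡ e) (regs≡ e vᴿ)

      private
        length-< : ∀ (y z : Str σ) → length y / a < length z / a ⊎ (length y / a ≡ length z / a × length y % a < length z % a) → length y < length z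
        length-< y z (inj₁ p) = ≰⇒> λ q → <⇒≱ p (/-monoˡ-≤ a q)
        length-< y z (inj₂ (e , p)) = subst₂ _<_ (sym (length-shape a y)) (sym (length-shape a z))
          (subst (λ i → length y % a + length y / a * a < length z % a + i * a) e (+-monoˡ-< (length y / a * a) p))

        length-<⁻ : ∀ (y z : Str σ) → length y < length z → length y / a < length z / a ⊎ (length y / a ≡ length z / a × length y % a < length z % a)
        length-<⁻ y z l with m≤n⇒m<n∨m≡n (/-monoˡ-≤ a (<⇒≤ l))
        ... | inj₁ p = inj₁ p
        ... | inj₂ e = inj₂ (e , +-cancelʳ-< (length y / a * a) _ _ (subst₂ _<_ (length-shape a y) (trans (length-shape a z) (cong (λ i → length z % a + i * a) (sym e))) l))

      module _ {s : State w} {y : Str σ} (qx : Query s) (ky : Current s y) where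

        private
          Fy≡ = Holds.full≡ ky
          Ty≡ = Holds.tail≡ ky
          Fx≡ = Holds.full≡ qx
          Tx≡ = Holds.tail≡ qx

        scan-test : ∀ {i} → toℕ (regs s iᴿ) ≡ i → i ≤ lcp x y / a →
                    Decides scanE s ((i < length x / a × i < length y / a) × word a x i ≡ word a y i)
        scan-test refl l = decides-and
          (decides-and
            (decides-lt refl Fx≡) (decides-lt refl Fy≡))
          (decides-eq (toℕ-word qx (regs s iᴿ) (≤-trans l (lcp/≤ˡ a x y))) (toℕ-word ky (regs s iᴿ) (≤-trans l (lcp/≤ʳ a x y))))

        module _ (i≡ : toℕ (regs s iᴿ) ≡ lcp x y / a) where

          private
            i = lcp x y / a
            xW : toℕ (⟦ xWordE ⟧ s) ≡ word a x i
            xW = trans (toℕ-word qx (regs s iᴿ) (subst (_≤ length x / a) (sym i≡) (lcp/≤ˡ a x y))) (cong (word a x) i≡)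
            vW : toℕ (⟦ vWordE ⟧ s) ≡ word a y i
            vW = trans (toℕ-word ky (regs s iᴿ) (subst (_≤ length y / a) (sym i≡) (lcp/≤ʳ a x y))) (cong (word a y) i≡)

            vShorter : Decides vShorterE s (length y < length x)
            vShorter = decides-map (length-< y x) (length-<⁻ y x)
              (decides-or
                (decides-lt Fy≡ Fx≡)
                (decides-and
                  (decides-eq Fy≡ Fx≡) (decides-lt Ty≡ Tx≡)))

            xShorter : Decides xShorterE s (length x < length y)
            xShorter = decides-map (length-< x y) (length-<⁻ x y)
              (decides-or
                (decides-lt Fx≡ Fy≡)
                (decides-and
                  (decides-eq Fx≡ Fy≡) (decides-lt Tx≡ Ty≡)))

            prefix-yx : word a x i ≡ word a y i → length y ≤ length x → Prefix _≡_ y x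
            prefix-yx e l = word-≡-Prefix a y x (subst (λ n → word a y (n / a) ≡ word a x (n / a)) (lcp-comm x y) (sym e)) l

          vLess : Decides vLessE s (y <ˢ x)
          vLess = decides-map to from (decides-or
            (decides-lt vW xW) (decides-and (decides-eq vW xW) vShorter))
            where
            to : word a y i < word a x i ⊎ (word a y i ≡ word a x i × length y < length x) → y <ˢ x
            to (inj₁ p) = word-> a x y p
            to (inj₂ (e , l)) = Prefix-< (prefix-yx (sym e) (<⇒≤ l)) l
            from : y <ˢ x → word a y i < word a x i ⊎ (word a y i ≡ word a x i × length y < length x)
            from p with <-cmp (word a y i) (word a x i)
            ... | tri< q _ _ = inj₁ q
            ... | tri> _ _ q = contradiction p (<ˢ-asym (word-< a x y q))
            ... | tri≈ _ e _ = inj₂ (e , ≰⇒> λ l → <ˢ-irrefl (≤ˢ-<ˢ-trans (Prefix⇒≤ˢ (word-≡-Prefix a x y (sym e) l)) p))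

          xLess : Decides xLessE s (x <ˢ y)
          xLess = decides-map to from (decides-or
            (decides-lt xW vW) (decides-and (decides-eq xW vW) xShorter))
            where
            to : word a x i < word a y i ⊎ (word a x i ≡ word a y i × length x < length y) → x <ˢ y
            to (inj₁ p) = word-< a x y p
            to (inj₂ (e , l)) = Prefix-< (word-≡-Prefix a x y e (<⇒≤ l)) l
            from : x <ˢ y → word a x i < word a y i ⊎ (word a x i ≡ word a y i × length x < length y)
            from p with <-cmp (word a x i) (word a y i)
            ... | tri< q _ _ = inj₁ q
            ... | tri> _ _ q = contradiction p (<ˢ-asym (word-> a x y q))
            ... | tri≈ _ e _ = inj₂ (e , ≰⇒> λ l → <ˢ-irrefl (≤ˢ-<ˢ-trans (Prefix⇒≤ˢ (prefix-yx e l)) p))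

          same-key : Decides equalE s (x ≡ y)
          same-key = decides-map to from (decides-and (decides-eq xW vW)
            (decides-and
              (decides-eq Fx≡ Fy≡) (decides-eq Tx≡ Ty≡)))
            where
            to : word a x i ≡ word a y i × length x / a ≡ length y / a × length x % a ≡ length y % a → x ≡ y
            to (e , f , t) = Prefix-≡ (word-≡-Prefix a x y e (≤-reflexive len)) len
              where len = trans (length-shape a x) (trans (cong₂ (λ i j → i + j * a) t f) (sym (length-shape a y)))
            from : x ≡ y → word a x i ≡ word a y i × length x / a ≡ length y / a × length x % a ≡ length y % a
            from refl = refl , refl , refl

          beyond : toℕ (regs s αᴿ) ≡ a → Decides (beyondE σ) s (x <ˢ y × ¬ Prefix _≡_ x y)
          beyond α≡ = decides-map to from (decides-or
            (decides-and
              (decides-eq i≡ Fx≡) (decides-lt (leading x xWordE xW) (leading y vWordE vW)))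
            (decides-and
              (decides-lt i≡ Fx≡) (decides-lt xW vW)))
            where
            t = length x % a
            shift = timesE (charBits σ) (op sub (reg αᴿ) (reg xtailᴿ))
            t≤a : t ≤ a
            t≤a = m%n≤n (length x) a
            shift≡ : toℕ (⟦ shift ⟧ s) ≡ charBits σ * (a ∸ t)
            shift≡ = timesE-toℕ (charBits σ) (op sub (reg αᴿ) (reg xtailᴿ))
              (trans (sub-toℕ (regs s αᴿ) (regs s xtailᴿ) (subst₂ _≤_ (sym Tx≡) (sym α≡) t≤a)) (cong₂ _∸_ α≡ Tx≡))
              (≤-<-trans (≤-trans (*-monoʳ-≤ (charBits σ) (m∸n≤m a t)) B*a≤w) (n<2^n w))
            leading : ∀ z e → toℕ (⟦ e ⟧ s) ≡ word a z i → toℕ (⟦ op shr e shift ⟧ s) ≡ pack t (drop (i * a) z)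
            leading z e p = trans (shr-toℕ (⟦ e ⟧ s) (⟦ shift ⟧ s)) (trans (cong₂ _>>_ p shift≡)
              (trans (cong (λ n → pack n (drop (i * a) z) >> (charBits σ * (a ∸ t))) (sym (m+[n∸m]≡n t≤a)))
                (pack-truncate t (a ∸ t) (drop (i * a) z))))
            to : (i ≡ length x / a × pack t (drop (i * a) x) < pack t (drop (i * a) y)) ⊎ (i < length x / a × word a x i < word a y i) → x <ˢ y × ¬ Prefix _≡_ x y
            to (inj₁ (e , p)) = tail-< a x y p e
            to (inj₂ (l , p)) = word-< a x y p , word-<-¬Prefix a x y p l
            from : x <ˢ y × ¬ Prefix _≡_ x y → (i ≡ length x / a × pack t (drop (i * a) x) < pack t (drop (i * a) y)) ⊎ (i < length x / a × word a x i < word a y i)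
            from (p , np) with m≤n⇒m<n∨m≡n (lcp/≤ˡ a x y)
            ... | inj₂ e = inj₁ (e , ≰⇒> λ q → absurd (tail-≮ a x y (≤⇒≯ q) e))
              where
              absurd : ¬ (y <ˢ x ⊎ Prefix _≡_ x y)
              absurd (inj₁ q) = <ˢ-asym p q
              absurd (inj₂ q) = np q
            ... | inj₁ l with <-cmp (word a x i) (word a y i)
            ...   | tri< q _ _ = inj₂ (l , q)
            ...   | tri> _ _ q = contradiction p (<ˢ-asym (word-> a x y q))
            ...   | tri≈ _ e _ with ≤-<-connex (length x) (length y)
            ...     | inj₁ q = contradiction (word-≡-Prefix a x y e q) np
            ...     | inj₂ q = contradiction (Prefix-< (prefix-yx e (<⇒≤ q)) q) (<ˢ-asym p)

      -- Here `n` counts the shared words still ahead; each iteration consumes one of them, so it is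
      -- also the termination measure.
      scan-runs : ∀ n {s y} → Query s → Current s y → toℕ (regs s iᴿ) + n ≡ lcp x y / a →
                  Runs scanC s (λ s′ τ → (Same s s′ × toℕ (regs s′ iᴿ) ≡ lcp x y / a) × τ ≤ timeBound scanC * suc n)
      scan-runs n {s} {y} qx ky e with scan-test {s} qx ky refl (≤-trans (m≤m+n _ n) (≤-reflexive e))
      ... | decides (no ¬p) t = _ , _ , ⇓done t , (same-refl , done) , ≤-trans (≤-trans (m≤m+n _ _) (≤-reflexive (sym (timeBound≡ scanC)))) (m≤m*n (timeBound scanC) (suc n))
        where
        done = lcp/-stop a x y (toℕ (regs s iᴿ)) (≤-trans (m≤m+n _ n) (≤-reflexive e)) λ p q r → ¬p ((p , q) , r)
      scan-runs n {s} {y} qx ky e | decides (yes ((p , q) , r)) t = go n e (word-step a (toℕ (regs s iᴿ)) x y (≤-trans (m≤m+n _ n) (≤-reflexive e)) p q r)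
        where
        s₁ = setReg iᴿ (⟦ op add (reg iᴿ) (lit 1) ⟧ s) s
        e₁ : Same s s₁
        e₁ = same-setReg iᴿ
        go : ∀ n → toℕ (regs s iᴿ) + n ≡ lcp x y / a → suc (toℕ (regs s iᴿ)) ≤ lcp x y / a →
             Runs scanC s (λ s′ τ → (Same s s′ × toℕ (regs s′ iᴿ) ≡ lcp x y / a) × τ ≤ timeBound scanC * suc n)
        go zero e l = contradiction (trans (sym (+-identityʳ _)) e) (<⇒≢ l)
        go (suc n) e l with scan-runs n (query-same e₁ qx) (current-same y e₁ ky)
            (trans (cong (_+ n) i′≡) (trans (sym (+-suc _ n)) e))
          where
          i′≡ : toℕ (regs s₁ iᴿ) ≡ suc (toℕ (regs s iᴿ))
          i′≡ = trans (add-toℕ (regs s iᴿ) (fromℕ w 1) (subst (_< 2 ^ w) (sym sum) (≤-<-trans (≤-trans l (≤-trans (lcp/≤ˡ a x y) (≤-reflexive (sym (Holds.full≡ qx))))) (toℕ< (regs s xfullᴿ))))) sum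
            where
            sum : toℕ (regs s iᴿ) + toℕ (fromℕ w 1) ≡ suc (toℕ (regs s iᴿ))
            sum = trans (cong (toℕ (regs s iᴿ) +_) (toℕ-lit1 {w})) (+-comm _ 1)
        ... | s′ , τ , run , (e₂ , i≡) , τ≤ = s′ , _ , ⇓loop (λ z → bit-true (trans (sym t) z)) ⇓reg run , (same-trans e₁ e₂ , i≡)
          , ≤-trans (+-mono-≤ (≤-reflexive (sym (timeBound≡ scanC))) τ≤) (≤-reflexive (sym (*-suc (timeBound scanC) (suc n))))

      module _ {L : ℕ} where

        open Float ⌊log₂ L ⌋

        -- The bound with the larger LCP is used. Query and stored key each share at least the given
        -- number of words with that bound, so by the ultrametric inequality the smaller number is a
        -- safe place to start.
        Start : (m⁻ m⁺ q⁻ q⁺ start : ℕ) → Set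
        Start m⁻ m⁺ q⁻ q⁺ start = (m⁺ ≤ m⁻ × start ≡ m⁻ ⊓ unfloat (float q⁻)) ⊎ (m⁻ < m⁺ × start ≡ m⁺ ⊓ unfloat (float q⁺))

        compare-runs : ∀ {s y q⁻ q⁺ m⁻ m⁺} → Query s → Current s y → toℕ (regs s logᴿ) ≡ L →
          toℕ (regs s lcp⁻ᴿ) ≡ m⁻ → toℕ (regs s lcp⁺ᴿ) ≡ m⁺ →
          toℕ (mem s code⁻ᴬ (regs s vᴿ)) ≡ float q⁻ → toℕ (mem s code⁺ᴬ (regs s vᴿ)) ≡ float q⁺ →
          q⁻ < 2 ^ w → q⁺ < 2 ^ w →
          m⁻ ⊓ unfloat (float q⁻) ≤ lcp x y / a → m⁺ ⊓ unfloat (float q⁺) ≤ lcp x y / a →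
          Runs compareC s (λ s′ τ → Same s s′ × toℕ (regs s′ iᴿ) ≡ lcp x y / a
            × Σ[ start ∈ ℕ ] Start m⁻ m⁺ q⁻ q⁺ start × τ ≤ κ-compare * suc (lcp x y / a ∸ start))
        compare-runs {s} {y} {q⁻} {q⁺} {m⁻} {m⁺} qx ky L≡ m⁻≡ m⁺≡ c⁻≡ c⁺≡ q⁻< q⁺< start⁻ start⁺ =
          runs-straight {c = chooseC} _ λ {τ₁} τ₁≤ →
            subst (λ s₁ → Runs (iᴿ ≔ decodeE (reg cᴿ) ⨾ clampC ⨾ scanC) s₁ (λ s′ τ → Q s′ (τ₁ + τ)))
              (sym (exec-decides {c = mᴿ ≔ reg lcp⁺ᴿ ⨾ cᴿ ≔ code⁺ᴬ [ reg vᴿ ]} {d = mᴿ ≔ reg lcp⁻ᴿ ⨾ cᴿ ≔ code⁻ᴬ [ reg vᴿ ]} (decides-lt {e = reg lcp⁻ᴿ} {reg lcp⁺ᴿ} {s} m⁻≡ m⁺≡)))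
              (choose τ₁≤ (m⁻ <? m⁺))
          where
          Q : State w → ℕ → Set
          Q s′ τ = Same s s′ × toℕ (regs s′ iᴿ) ≡ lcp x y / a
            × Σ[ start ∈ ℕ ] Start m⁻ m⁺ q⁻ q⁺ start × τ ≤ κ-compare * suc (lcp x y / a ∸ start)
          rest : ∀ {s₁ τ₁ q m} → τ₁ ≤ timeBound chooseC → Same s s₁ → toℕ (regs s₁ mᴿ) ≡ m → toℕ (regs s₁ cᴿ) ≡ float q →
                 q < 2 ^ w → m ⊓ unfloat (float q) ≤ lcp x y / a → Start m⁻ m⁺ q⁻ q⁺ (m ⊓ unfloat (float q)) →
                 Runs (iᴿ ≔ decodeE (reg cᴿ) ⨾ clampC ⨾ scanC) s₁ (λ s′ τ → Q s′ (τ₁ + τ))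
          rest {s₁} {τ₁} {q} {m} τ₁≤ e₁ m≡ c≡ q< start≤ start =
            runs-straight {c = iᴿ ≔ decodeE (reg cᴿ)} _ λ {τ₂} τ₂≤ →
            runs-straight {c = clampC} _ λ {τ₃} τ₃≤ →
              subst (λ s₃ → Runs scanC s₃ (λ s′ τ → Q s′ (τ₁ + (τ₂ + (τ₃ + τ)))))
                (sym (exec-decides {c = iᴿ ≔ reg mᴿ} {d = skip} (decides-lt {e = reg mᴿ} {reg iᴿ} {s₂} m≡ i₂≡)))
                (runs-map (λ { {s′} {τ} ((e₄ , i≡) , l) → same-trans e₁ (same-trans (same-setReg iᴿ) (same-trans (clamp-same (m <? u)) e₄)) , i≡ , m ⊓ u , start , bound {timeBound chooseC} {timeBound (iᴿ ≔ decodeE (reg cᴿ))} {timeBound clampC} {timeBound scanC} τ₁≤ τ₂≤ τ₃≤ l })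
                  (scan-runs (lcp x y / a ∸ m ⊓ u) (query-same (same-trans e₁ (same-trans (same-setReg iᴿ) (clamp-same (m <? u)))) qx) (current-same y (same-trans e₁ (same-trans (same-setReg iᴿ) (clamp-same (m <? u)))) ky)
                    (trans (cong (_+ (lcp x y / a ∸ m ⊓ u)) (clamp≡ (m <? u))) (m+[n∸m]≡n start≤))))
            where
            u = unfloat (float q)
            s₂ = setReg iᴿ (⟦ decodeE (reg cᴿ) ⟧ s₁) s₁
            i₂≡ : toℕ (regs s₂ iᴿ) ≡ u
            i₂≡ = ⟦decodeE⟧ (reg cᴿ) {s₁} (trans (cong toℕ (regs≡ e₁ logᴿ)) L≡) c≡ q<
            clamp-same : ∀ (d : Dec (m < u)) → Same s₂ (if does d then exec (iᴿ ≔ reg mᴿ) s₂ else s₂)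
            clamp-same (yes _) = same-setReg iᴿ
            clamp-same (no _) = same-refl
            clamp≡ : ∀ (d : Dec (m < u)) → toℕ (regs (if does d then exec (iᴿ ≔ reg mᴿ) s₂ else s₂) iᴿ) ≡ m ⊓ u
            clamp≡ (yes p) = trans m≡ (sym (m≤n⇒m⊓n≡m (<⇒≤ p)))
            clamp≡ (no p) = trans i₂≡ (sym (m≥n⇒m⊓n≡n (≮⇒≥ p)))
            bound : ∀ {A B C D n t₁ t₂ t₃ t₄} → t₁ ≤ A → t₂ ≤ B → t₃ ≤ C → t₄ ≤ D * suc n → t₁ + (t₂ + (t₃ + t₄)) ≤ (A + (B + C) + D) * suc n
            bound {A} {B} {C} {D} {n} {t₁} {t₂} {t₃} {t₄} p₁ p₂ p₃ p₄ = begin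
              t₁ + (t₂ + (t₃ + t₄)) ≤⟨ +-mono-≤ p₁ (+-mono-≤ p₂ (+-mono-≤ p₃ p₄)) ⟩
              A + (B + (C + D * suc n)) ≡⟨ trans (cong (A +_) (sym (+-assoc B C _))) (sym (+-assoc A (B + C) _)) ⟩
              A + (B + C) + D * suc n ≤⟨ +-monoˡ-≤ (D * suc n) (m≤m*n (A + (B + C)) (suc n)) ⟩
              (A + (B + C)) * suc n + D * suc n ≡⟨ *-distribʳ-+ (suc n) (A + (B + C)) D ⟨
              (A + (B + C) + D) * suc n ∎
              where open ≤-Reasoning
          choose : ∀ {τ₁} → τ₁ ≤ timeBound chooseC → (d : Dec (m⁻ < m⁺)) →
                   Runs (iᴿ ≔ decodeE (reg cᴿ) ⨾ clampC ⨾ scanC) (if does d then exec (mᴿ ≔ reg lcp⁺ᴿ ⨾ cᴿ ≔ code⁺ᴬ [ reg vᴿ ]) s else exec (mᴿ ≔ reg lcp⁻ᴿ ⨾ cᴿ ≔ code⁻ᴬ [ reg vᴿ ]) s) (λ s′ τ → Q s′ (τ₁ + τ))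
          choose τ₁≤ (yes p) = rest τ₁≤ (same-trans (same-setReg mᴿ) (same-setReg cᴿ)) m⁺≡ c⁺≡ q⁺< start⁺ (inj₂ (p , refl))
          choose τ₁≤ (no p) = rest τ₁≤ (same-trans (same-setReg mᴿ) (same-setReg cᴿ)) m⁻≡ c⁻≡ q⁻< start⁻ (inj₁ (≮⇒≥ p , refl))

-- Trees and search paths in memory, and where a comparison may resume.

module MemoryLayout where

  open import Defs renaming (_⨾_ to infixr 4 _⨾_; _≔_ to infix 5 _≔_; _[_]≔_ to infix 5 _[_]≔_)
  open StringOrder
  open Words
  open ProgramLogic
  open Zippers
  open Comparison
  open import Data.Bool using (Bool; true; false; if_then_else_; T)
  open import Data.List using ([]; _∷_)
  open import Data.Maybe using (Maybe; just; nothing)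
  open import Data.Nat
  open import Data.Nat.DivMod
  open import Data.Nat.Properties
  open import Data.Product using (_×_; _,_; Σ-syntax; ∃-syntax)
  open import Data.Sum using (inj₁; inj₂)
  open import Data.Unit using (⊤; tt)
  open import Relation.Binary.Definitions using (tri<; tri≈; tri>)
  open import Relation.Binary.PropositionalEquality hiding ([_])
  open import Relation.Nullary using (yes; no; does; contradiction)

  -- The search path is a linked stack threaded through its own nodes. Beside the parent it keeps
  -- the LCPs of the query with the node and with the bounds of the node, from which insertion later
  -- reads new codes.
  parentᴬ dirᴬ lcpᴬ lcp⁻ᴬ lcp⁺ᴬ : Array
  parentᴬ = 10
  dirᴬ    = 11
  lcpᴬ    = 12
  lcp⁻ᴬ   = 13
  lcp⁺ᴬ   = 14

  module _ {w : ℕ} where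

    if-same : ∀ {A : Set} (p : Word w) {u v : A} → (if does (p ≟ʷ p) then u else v) ≡ u
    if-same p with p ≟ʷ p
    ... | yes _ = refl
    ... | no ¬e = contradiction refl ¬e

    if-other : ∀ {A : Set} {p q : Word w} {u v : A} → q ≢ p → (if does (q ≟ʷ p) then u else v) ≡ v
    if-other {p = p} {q} q≢p with q ≟ʷ p
    ... | yes e = contradiction e q≢p
    ... | no _ = refl

    -- Arrays 0 to 9 hold the data structure.
    Agree : Mem w → Mem w → Set
    Agree m m′ = ∀ a p → {T (a <ᵇ 10)} → m′ a p ≡ m a p

    agree-refl : ∀ {m} → Agree m m
    agree-refl _ _ = refl

    agree-trans : ∀ {m m′ m″} → Agree m m′ → Agree m′ m″ → Agree m m″
    agree-trans f g a p {l} = trans (g a p {l}) (f a p {l})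

    -- Arrays 0 to 3 determine the keys.
    record Update (p : Word w) (m m′ : Mem w) : Set where
      field
        low   : ∀ a q → {T (a <ᵇ 4)} → m′ a q ≡ m a q
        other : ∀ a q → q ≢ p → m′ a q ≡ m a q

    open Update public

    update-refl : ∀ {p m} → Update p m m
    update-refl = record { low = λ _ _ → refl ; other = λ _ _ _ → refl }

    update-trans : ∀ {p m m′ m″} → Update p m m′ → Update p m′ m″ → Update p m m″
    update-trans u u′ = record { low = λ a q {l} → trans (low u′ a q {l}) (low u a q {l}) ; other = λ a q e → trans (other u′ a q e) (other u a q e) }

    private
      ≡ᵇ-false : ∀ k a b → T (b <ᵇ suc k) → T (k <ᵇ a) → (b ≡ᵇ a) ≡ false
      ≡ᵇ-false k a b p q with b ≡ᵇ a in e
      ... | false = refl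
      ... | true rewrite ≡ᵇ⇒≡ b a (subst T (sym e) tt) = contradiction (<ᵇ⇒< k a q) (<⇒≱ (<ᵇ⇒< a (suc k) p))

    agree-setMem : ∀ a {_ : T (9 <ᵇ a)} p u (s : State w) → Agree (mem s) (mem (setMem a p u s))
    agree-setMem a {l} p u s b q {l′} rewrite ≡ᵇ-false 9 a b l′ l = refl

    regs-setReg′ : ∀ k n {_ : T (k <ᵇ n)} u (s : State w) r → {T (r <ᵇ suc k)} → regs (setReg n u s) r ≡ regs s r
    regs-setReg′ k n {l} u s r {l′} rewrite ≡ᵇ-false k n r l′ l = refl

    regs-setReg : ∀ n {_ : T (10 <ᵇ n)} u (s : State w) r → {T (r <ᵇ 11)} → regs (setReg n u s) r ≡ regs s r
    regs-setReg n {l} u s r {l′} = regs-setReg′ 10 n {l} u s r {l′}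

    update-setMem : ∀ a {_ : T (3 <ᵇ a)} p u (s : State w) → Update p (mem s) (mem (setMem a p u s))
    update-setMem a {l} p u s = record { low = λ b q {l′} → lo b q l′ ; other = ot }
      where
      lo : ∀ b q → T (b <ᵇ 4) → mem (setMem a p u s) b q ≡ mem s b q
      lo b q l′ rewrite ≡ᵇ-false 3 a b l′ l = refl
      ot : ∀ b q → q ≢ p → mem (setMem a p u s) b q ≡ mem s b q
      ot b q q≢p with b ≡ᵇ a
      ... | false = refl
      ... | true = if-other q≢p

  -- `U` is the set of addresses that an operation may use. Membership is carried by every node of a
  -- tree or path, which yields `uses` and, for updates, the frame condition.
  module Heap (σ w : ℕ) .{{_ : NonTrivial σ}} .{{_ : NonZero (α σ w)}} {R : ℕ} (U : Word w → Set) where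

    open Strings σ w public

    Key : Mem w → Word w → Str σ → Set
    Key m = KeyAt σ w ⟪ m ⟫

    key-cong : ∀ {m m′ p x} → (∀ a q → {T (a <ᵇ 4)} → m′ a q ≡ m a q) → Key m p x → Key m′ p x
    key-cong e = holds-mem (λ i → e textᴬ i) (e baseᴬ _) (e fullᴬ _) (e tailᴬ _)

    key-injective : ∀ {m p x y} → Key m p x → Key m p y → x ≡ y
    key-injective = holds-injective

    node-update : ∀ {m m′ p} {v : Node σ R} {c d} → (∀ i → m′ textᴬ i ≡ m textᴬ i) →
                  m′ baseᴬ p ≡ m baseᴬ p → m′ fullᴬ p ≡ m fullᴬ p → m′ tailᴬ p ≡ m tailᴬ p →
                  m′ rank₁ᴬ p ≡ m rank₁ᴬ p → m′ rank₂ᴬ p ≡ m rank₂ᴬ p →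
                  toℕ (m′ code⁻ᴬ p) ≡ c → toℕ (m′ code⁺ᴬ p) ≡ d →
                  NodeAt σ w ⟪ m ⟫ p v → NodeAt σ w ⟪ m′ ⟫ p (node (key v) (rank v) c d)
    node-update t b f l r₁ r₂ c≡ d≡ n = record
      { nonnull = NodeAt.nonnull n
      ; key≡    = holds-mem t b f l (NodeAt.key≡ n)
      ; rank₁≡  = trans (cong toℕ r₁) (NodeAt.rank₁≡ n)
      ; rank₂≡  = trans (cong toℕ r₂) (NodeAt.rank₂≡ n)
      ; code⁻≡  = c≡
      ; code⁺≡  = d≡
      }

    node-cong : ∀ {m m′ p} {v : Node σ R} → (∀ i → m′ textᴬ i ≡ m textᴬ i) →
                (∀ a → {T (a <ᵇ 10)} → m′ a p ≡ m a p) → NodeAt σ w ⟪ m ⟫ p v → NodeAt σ w ⟪ m′ ⟫ p v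
    node-cong t e n = node-update t (e baseᴬ) (e fullᴬ) (e tailᴬ) (e rank₁ᴬ) (e rank₂ᴬ)
      (trans (cong toℕ (e code⁻ᴬ)) (NodeAt.code⁻≡ n)) (trans (cong toℕ (e code⁺ᴬ)) (NodeAt.code⁺≡ n)) n

    Tr : Mem w → Word w → Tree σ R → Set
    Tr m p leaf           = p ≡ null
    Tr m p (branch l v r) = U p × NodeAt σ w ⟪ m ⟫ p v × Tr m (m leftᴬ p) l × Tr m (m rightᴬ p) r

    sibᴬ : Bool → Array
    sibᴬ d = if d then leftᴬ else rightᴬ

    -- Child pointers towards the hole are left unconstrained, so they may go stale until `relinkC`.
    -- There are two memories because the descent changes scratch arrays only: nodes are described
    -- in `m`, the stack in `sc`.
    Path : Mem w → Mem w → Word w → Ctx → Set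
    Path m sc p []                = p ≡ null
    Path m sc p (frame d v t ∷ π) =
      U p × NodeAt σ w ⟪ m ⟫ p v × Tr m (m (sibᴬ d) p) t × sc dirᴬ p ≡ bit d × Path m sc (sc parentᴬ p) π

    tr-cong : ∀ {m m′ p} t → Agree m m′ → Tr m p t → Tr m′ p t
    tr-cong leaf e z = z
    tr-cong {m} {m′} {p} (branch l v r) e (u , n , tl , tr) = u , node-cong (λ i → e textᴬ i) (λ a {l} → e a p {l}) n
      , subst (λ q → Tr m′ q l) (sym (e leftᴬ p)) (tr-cong l e tl)
      , subst (λ q → Tr m′ q r) (sym (e rightᴬ p)) (tr-cong r e tr)

    private
      sib-agree : ∀ {m m′ : Mem w} d p → Agree m m′ → m′ (sibᴬ d) p ≡ m (sibᴬ d) p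
      sib-agree true p e = e leftᴬ p
      sib-agree false p e = e rightᴬ p

    path-cong : ∀ {m m′ sc p} π → Agree m m′ → Path m sc p π → Path m′ sc p π
    path-cong [] e z = z
    path-cong {m} {m′} {p = p} (frame d v t ∷ π) e (u , n , ts , dir , path) =
      u , node-cong (λ i → e textᴬ i) (λ a {l} → e a p {l}) n
      , subst (λ q → Tr m′ q t) (sym (sib-agree d p e)) (tr-cong t e ts) , dir , path-cong π e path

    Apart : Str σ → Tree σ R → Set
    Apart y = TAll (λ v → y ≢ key v)

    ApartC : Str σ → Ctx → Set
    ApartC y [] = ⊤
    ApartC y (frame d v t ∷ π) = y ≢ key v × Apart y t × ApartC y π

    module _ {p : Word w} {m m′ : Mem w} {y : Str σ} (up : Update p m m′) (kp : Key m p y) where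

      -- At address `p` only the key `y` can be read, so a node with another key lives elsewhere.
      distinct : ∀ {q} {v : Node σ R} → NodeAt σ w ⟪ m ⟫ q v → y ≢ key v → q ≢ p
      distinct n y≢ refl = y≢ (key-injective {m} kp (NodeAt.key≡ n))

      tr-update : ∀ {q} t → Apart y t → Tr m q t → Tr m′ q t
      tr-update leaf _ z = z
      tr-update {q} (branch l v r) (y≢ , al , ar) (u , n , tl , tr) =
        u , node-cong (λ i → low up textᴬ i) (λ a → other up a q q≢p) n
        , subst (λ q → Tr m′ q l) (sym (other up leftᴬ q q≢p)) (tr-update l al tl)
        , subst (λ q → Tr m′ q r) (sym (other up rightᴬ q q≢p)) (tr-update r ar tr)
        where q≢p = distinct n y≢

      path-update : ∀ {sc sc′ q} π → Update p sc sc′ → ApartC y π → Path m sc q π → Path m′ sc′ q π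
      path-update [] _ _ z = z
      path-update {sc} {sc′} {q} (frame d v t ∷ π) up′ (y≢ , at , aπ) (u , n , tr , dir , path) =
        u , node-cong (λ i → low up textᴬ i) (λ a → other up a q q≢p) n
        , subst (λ q → Tr m′ q t) (sym (other up (sibᴬ d) q q≢p)) (tr-update t at tr)
        , trans (other up′ dirᴬ q q≢p) dir
        , subst (λ q → Path m′ sc′ q π) (sym (other up′ parentᴬ q q≢p)) (path-update π up′ aπ path)
        where q≢p = distinct n y≢

    module _ (enc : ℕ → ℕ) where

      zc-apart : ∀ {π} → ZC enc π → ∀ {y} → loOf π <₋ y → y <₊ hiOf π → ApartC y π
      zc-apart [] _ _ = tt
      zc-apart (right {v} {l} {π} c b bl zl zc) {y} p q =
        (λ e → <ˢ⇒≢ p (sym e)) , TAll-map (λ r e → <ˢ⇒≢ (<ˢ-trans r p) (sym e)) l (zt-hi enc l zl)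
        , zc-apart zc (<₋-trans (loOf π) (Codes.lo< c) p) q
      zc-apart (left {v} {r} {π} c b br zr zc) {y} p q =
        <ˢ⇒≢ q , TAll-map (λ s → <ˢ⇒≢ (<ˢ-trans q s)) r (zt-lo enc r zr)
        , zc-apart zc p (<₊-trans (hiOf π) q (Codes.<hi c))

    -- The memory `m` has to agree with the state on reachable nodes only, because insertion writes
    -- its fresh node before the search.
    treeAt⇒tr : ∀ {s : State w} {m p} t → (∀ i → m textᴬ i ≡ mem s textᴬ i) →
                (∀ q → Reach s p q → U q × (∀ a → {T (a <ᵇ 10)} → m a q ≡ mem s a q)) → TreeAt σ w s p t → Tr m p t
    treeAt⇒tr leaf _ f e = e
    treeAt⇒tr {s} {m} {p} (branch l v r) t f (n , tl , tr) with f p (here (NodeAt.nonnull n))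
    ... | u , e = u ,
      record { nonnull = NodeAt.nonnull n ; key≡ = holds-mem t (e baseᴬ) (e fullᴬ) (e tailᴬ) (NodeAt.key≡ n)
             ; rank₁≡ = trans (cong toℕ (e rank₁ᴬ)) (NodeAt.rank₁≡ n) ; rank₂≡ = trans (cong toℕ (e rank₂ᴬ)) (NodeAt.rank₂≡ n)
             ; code⁻≡ = trans (cong toℕ (e code⁻ᴬ)) (NodeAt.code⁻≡ n) ; code⁺≡ = trans (cong toℕ (e code⁺ᴬ)) (NodeAt.code⁺≡ n) }
      , subst (λ q → Tr m q l) (sym (e leftᴬ)) (treeAt⇒tr l t (λ q ρ → f q (left (NodeAt.nonnull n) ρ)) tl)
      , subst (λ q → Tr m q r) (sym (e rightᴬ)) (treeAt⇒tr r t (λ q ρ → f q (right (NodeAt.nonnull n) ρ)) tr)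

    tr⇒treeAt : ∀ {s : State w} {p} t → Tr (mem s) p t → TreeAt σ w s p t
    tr⇒treeAt leaf e = e
    tr⇒treeAt (branch l v r) (u , n , tl , tr) =
      record { nonnull = NodeAt.nonnull n ; key≡ = holds-mem (λ _ → refl) refl refl refl (NodeAt.key≡ n) ; rank₁≡ = NodeAt.rank₁≡ n
             ; rank₂≡ = NodeAt.rank₂≡ n ; code⁻≡ = NodeAt.code⁻≡ n ; code⁺≡ = NodeAt.code⁺≡ n }
      , tr⇒treeAt l tl , tr⇒treeAt r tr

    tr-reach : ∀ {s : State w} {p q} t → Tr (mem s) p t → Reach s p q → U q
    tr-reach leaf refl (here n) = contradiction refl n
    tr-reach leaf refl (left n _) = contradiction refl n
    tr-reach leaf refl (right n _) = contradiction refl n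
    tr-reach (branch l v r) (u , _) (here _) = u
    tr-reach (branch l v r) (_ , _ , tl , _) (left _ ρ) = tr-reach l tl ρ
    tr-reach (branch l v r) (_ , _ , _ , tr) (right _ ρ) = tr-reach r tr ρ

  -- Descent

  pushC : ℕ → Cmd
  pushC d = parentᴬ [ reg vᴿ ]≔ reg prevᴿ ⨾ lcpᴬ [ reg vᴿ ]≔ reg iᴿ ⨾
            lcp⁻ᴬ [ reg vᴿ ]≔ reg lcp⁻ᴿ ⨾ lcp⁺ᴬ [ reg vᴿ ]≔ reg lcp⁺ᴿ ⨾
            dirᴬ [ reg vᴿ ]≔ lit d ⨾ prevᴿ ≔ reg vᴿ

  module _ {w : ℕ} (d : ℕ) (s : State w) where

    private
      v = regs s vᴿ
      s₁ = setMem parentᴬ v (regs s prevᴿ) s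
      s₂ = setMem lcpᴬ v (regs s iᴿ) s₁
      s₃ = setMem lcp⁻ᴬ v (regs s lcp⁻ᴿ) s₂
      s₄ = setMem lcp⁺ᴬ v (regs s lcp⁺ᴿ) s₃

    push-update : Update v (mem s) (mem (exec (pushC d) s))
    push-update = update-trans (update-setMem parentᴬ v (regs s prevᴿ) s) (update-trans (update-setMem lcpᴬ v (regs s iᴿ) s₁)
      (update-trans (update-setMem lcp⁻ᴬ v (regs s lcp⁻ᴿ) s₂) (update-trans (update-setMem lcp⁺ᴬ v (regs s lcp⁺ᴿ) s₃) (update-setMem dirᴬ v (fromℕ w d) s₄))))

    push-agree : Agree (mem s) (mem (exec (pushC d) s))
    push-agree = agree-trans (agree-setMem parentᴬ v (regs s prevᴿ) s) (agree-trans (agree-setMem lcpᴬ v (regs s iᴿ) s₁)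
      (agree-trans (agree-setMem lcp⁻ᴬ v (regs s lcp⁻ᴿ) s₂) (agree-trans (agree-setMem lcp⁺ᴬ v (regs s lcp⁺ᴿ) s₃) (agree-setMem dirᴬ v (fromℕ w d) s₄))))

  goRightC goLeftC : Cmd
  goRightC = pushC 1 ⨾ loᴿ ≔ reg vᴿ ⨾ lcp⁻ᴿ ≔ reg iᴿ ⨾ vᴿ ≔ rightᴬ [ reg vᴿ ]
  goLeftC  = pushC 0 ⨾ hiᴿ ≔ reg vᴿ ⨾ lcp⁺ᴿ ≔ reg iᴿ ⨾ vᴿ ≔ leftᴬ [ reg vᴿ ]

  branchC descendC searchC : Expr → Expr → Cmd
  branchC stopE rightE =
    -- Clearing `vᴿ` ends the loop of `descendC`; the address survives in `foundᴿ`.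
    cond stopE (foundᴿ ≔ reg vᴿ ⨾ vᴿ ≔ lit 0) (cond rightE goRightC goLeftC)
  descendC stopE rightE = while (reg vᴿ) (compareC ⨾ branchC stopE rightE)

  startC : Cmd
  startC = vᴿ ≔ reg rootᴿ ⨾ prevᴿ ≔ lit 0 ⨾ loᴿ ≔ lit 0 ⨾ hiᴿ ≔ lit 0 ⨾
           lcp⁻ᴿ ≔ lit 0 ⨾ lcp⁺ᴿ ≔ lit 0 ⨾ foundᴿ ≔ lit 0

  searchC stopE rightE = startC ⨾ descendC stopE rightE

  κ-search : Expr → Expr → ℕ
  κ-search stopE rightE = 2 + (κ-compare + timeBound (branchC stopE rightE))

  module _ {σ : ℕ} (a : ℕ) .{{_ : NonZero a}} (b : ℕ) (x y : Str σ) where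

    open Float b

    private
      i = lcp x y / a

      0/a : 0 / a ≡ 0
      0/a = 0/n≡0 a

      ultra-⊓ : ∀ z → (lcp x z / a) ⊓ (lcp y z / a) ≤ i
      ultra-⊓ z = subst (_≤ i) (mono-≤-distrib-⊓ (/-monoˡ-≤ a) (lcp x z) (lcp y z))
        (/-monoˡ-≤ a (subst (λ k → lcp x z ⊓ k ≤ lcp x y) (lcp-comm z y) (lcp-ultra x z y)))

    -- Where the comparison of x with y may start, given the LCP of x with a
    -- known string z and the stored one of y with z.
    resume : Maybe (Str σ) → ℕ
    resume z = (lcp∞ x z / a) ⊓ unfloat (float (lcp∞ y z / a))

    resume≤ : ∀ z → resume z ≤ i
    resume≤ nothing = ≤-trans (m⊓n≤m (0 / a) _) (≤-trans (≤-reflexive (0/n≡0 a)) z≤n)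
    resume≤ (just z) = ≤-trans (⊓-monoʳ-≤ (lcp x z / a) (unfloat-float≤ (lcp y z / a))) (ultra-⊓ z)

    -- With exact LCPs, the two smallest among those of `x`, `y`, `z` agree, so `m ⊓ q` accounts for
    -- the smaller of `i` and `m`, and `m ⊔ i` for the larger. Decoding matters only if the decoded
    -- value `d` is below `m`; then the loss is at most `d / 2 ^ b`, and `d < m ≤ Q`.
    resume-loss : ∀ z {Q} → lcp∞ x z / a ≤ Q → i + lcp∞ x z / a ≤ resume z + (lcp∞ x z / a ⊔ i) + (Q >> b)
    resume-loss nothing {Q} _ rewrite 0/a | +-identityʳ i = m≤m+n i (Q >> b)
    resume-loss (just z) {Q} m≤Q = begin
      i + m ≤⟨ exact (<-cmp m q) ⟩
      m ⊓ q + (m ⊔ i) ≤⟨ +-monoˡ-≤ (m ⊔ i) lossy ⟩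
      resume (just z) + (Q >> b) + (m ⊔ i) ≡⟨ +-assoc (resume (just z)) (Q >> b) (m ⊔ i) ⟩
      resume (just z) + ((Q >> b) + (m ⊔ i)) ≡⟨ cong (resume (just z) +_) (+-comm (Q >> b) (m ⊔ i)) ⟩
      resume (just z) + ((m ⊔ i) + (Q >> b)) ≡⟨ +-assoc (resume (just z)) (m ⊔ i) (Q >> b) ⟨
      resume (just z) + (m ⊔ i) + (Q >> b) ∎
      where
      open ≤-Reasoning
      m = lcp x z / a
      q = lcp y z / a
      d = unfloat (float q)
      exact : Relation.Binary.Definitions.Tri (m < q) (m ≡ q) (q < m) → i + m ≤ m ⊓ q + (m ⊔ i)
      exact (tri< m<q _ _) = ≤-trans (≤-reflexive (+-comm i m))
        (+-mono-≤ (≤-reflexive (sym (m≤n⇒m⊓n≡m (<⇒≤ m<q)))) (m≤n⊔m m i))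
      exact (tri≈ _ m≡q _) = ≤-trans (≤-reflexive (+-comm i m))
        (+-mono-≤ (≤-reflexive (sym (m≤n⇒m⊓n≡m (≤-reflexive m≡q)))) (m≤n⊔m m i))
      exact (tri> _ _ q<m) = +-mono-≤ (≤-reflexive (trans i≡q (sym (m≥n⇒m⊓n≡n (<⇒≤ q<m))))) (m≤m⊔n m i)
        where
        i≡q : i ≡ q
        i≡q = cong (_/ a) (trans (lcp-comm x y) (lcp-ultra-< y z x (≰⇒> λ l → <⇒≱ q<m (/-monoˡ-≤ a (subst (_≤ lcp y z) (lcp-comm z x) l)))))
      lossy : m ⊓ q ≤ resume (just z) + (Q >> b)
      lossy with ≤-<-connex m d
      ... | inj₁ m≤d = ≤-trans (m⊓n≤m m q) (≤-trans (≤-reflexive (sym (m≤n⇒m⊓n≡m m≤d))) (m≤m+n _ _))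
      ... | inj₂ d<m = begin
        m ⊓ q ≤⟨ m⊓n≤n m q ⟩
        q ≡⟨ m+[n∸m]≡n (unfloat-float≤ q) ⟨
        d + (q ∸ d) ≤⟨ +-mono-≤ (≤-reflexive (sym (m≥n⇒m⊓n≡n (<⇒≤ d<m)))) (m≤q>>k b (≤-trans (float-loss q) (≤-trans (<⇒≤ d<m) m≤Q))) ⟩
        m ⊓ d + (Q >> b) ∎

-- Amortised analysis of the descent to a boundary.

module TrieDescent where

  open import Defs renaming (_⨾_ to infixr 4 _⨾_; _≔_ to infix 5 _≔_; _[_]≔_ to infix 5 _[_]≔_)
  open StringOrder
  open Words
  open ProgramLogic
  open Zippers
  open Comparison
  open MemoryLayout
  open import Data.Bool using (Bool; true; false; if_then_else_; T)
  open import Data.List using ([]; _∷_; length)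
  open import Data.Maybe using (Maybe; just; nothing)
  open import Data.Nat
  open import Data.Nat.DivMod
  open import Data.Nat.Logarithm using (⌊log₂_⌋)
  open import Data.Nat.Properties
  open import Data.Product using (_×_; _,_; proj₁; proj₂; Σ-syntax; ∃-syntax)
  open import Data.Sum using (_⊎_; inj₁; inj₂)
  open import Data.Unit using (⊤; tt)
  open import Relation.Binary.PropositionalEquality hiding ([_])
  open import Relation.Nullary using (¬_; yes; no)

  module Descent (σ w : ℕ) .{{_ : NonTrivial σ}} .{{_ : NonZero (α σ w)}} {R : ℕ} (U : Word w → Set) (L : ℕ) (x : Str σ) where

    open Heap σ w {R} U public
    open Compare x public
    open Float ⌊log₂ L ⌋ public

    enc : ℕ → ℕ
    enc = LCPCode.encode lcpCode L a

    -- A search for the boundary between the keys satisfying Right and the others.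
    record Mode : Set₁ where
      field
        rightE stopE : Expr
        Right Stop   : Str σ → Set
        right-test   : ∀ {s y} → Query s → Current s y → toℕ (regs s iᴿ) ≡ lcp x y / a →
                       toℕ (regs s αᴿ) ≡ a → Decides rightE s (Right y)
        stop-test    : ∀ {s y} → Query s → Current s y → toℕ (regs s iᴿ) ≡ lcp x y / a →
                       Decides stopE s (Stop y)
        right-down   : ∀ {y z} → y <ˢ z → Right z → Right y
        -- LCPs with `x` do not decrease towards the boundary, so moving a bound never lowers the
        -- potential `lcpMax`.
        right-lcp    : ∀ {y z} → y <ˢ z → Right z → lcp x y ≤ lcp x z
        left-lcp     : ∀ {y z} → y <ˢ z → ¬ Right y → lcp x z ≤ lcp x y

    Lcps : Mem w → Word w → Ctx {σ} {R} → Set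
    Lcps sc p []                = ⊤
    Lcps sc p (frame d v t ∷ π) =
        toℕ (sc lcpᴬ p) ≡ lcp x (key v) / a
      × toℕ (sc lcp⁻ᴬ p) ≡ lcp∞ x (loOf π) / a
      × toℕ (sc lcp⁺ᴬ p) ≡ lcp∞ x (hiOf π) / a
      × Lcps sc (sc parentᴬ p) π

    lcps-update : ∀ {p m sc sc′ y q} π → Update p sc sc′ → Key m p y → ApartC y π →
                  Path m sc q π → Lcps sc q π → Lcps sc′ q π
    lcps-update [] _ _ _ _ _ = tt
    lcps-update {p} {m} {sc} {sc′} {y} {q} (frame d v t ∷ π) up kp (y≢ , _ , aπ) (_ , n , _ , _ , path) (e , e⁻ , e⁺ , es) =
      trans (cong toℕ (other up lcpᴬ q q≢p)) e , trans (cong toℕ (other up lcp⁻ᴬ q q≢p)) e⁻ , trans (cong toℕ (other up lcp⁺ᴬ q q≢p)) e⁺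
      , subst (λ q → Lcps sc′ q π) (sym (other up parentᴬ q q≢p)) (lcps-update π up kp aπ path es)
      where
      q≢p : q ≢ p
      q≢p refl = y≢ (key-injective {m} kp (NodeAt.key≡ n))

    Bound : Mem w → Word w → Maybe (Str σ) → Set
    Bound m p nothing  = p ≡ null
    Bound m p (just y) = U p × p ≢ null × Key m p y

    lcpMax : Ctx {σ} {R} → ℕ
    lcpMax π = lcp∞ x (loOf π) / a ⊔ lcp∞ x (hiOf π) / a

    module Search (M : Mode) (s₀ : State w) (Q : ℕ) where

      open Mode M

      Dirs : Ctx {σ} {R} → Set
      Dirs [] = ⊤
      Dirs (frame true v _ ∷ π) = Right (key v) × ¬ Stop (key v) × Dirs π
      Dirs (frame false v _ ∷ π) = ¬ Right (key v) × ¬ Stop (key v) × Dirs π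

      record Searching (s : State w) (p : Word w) (π : Ctx) (u : Tree σ R) : Set where
        field
          regs₀ : ∀ r → {T (r <ᵇ 11)} → regs s r ≡ regs s₀ r
          mem₀  : Agree (mem s₀) (mem s)
          hl    : Hole enc π u
          tree  : Tr (mem s₀) p u
          path  : Path (mem s₀) (mem s) (regs s prevᴿ) π
          lcps  : Lcps (mem s) (regs s prevᴿ) π
          lo    : Bound (mem s₀) (regs s loᴿ) (loOf π)
          hi    : Bound (mem s₀) (regs s hiᴿ) (hiOf π)
          lcp⁻  : toℕ (regs s lcp⁻ᴿ) ≡ lcp∞ x (loOf π) / a
          lcp⁺  : toℕ (regs s lcp⁺ᴿ) ≡ lcp∞ x (hiOf π) / a
          dirs  : Dirs π
          max≤  : lcpMax π ≤ Q

      open Searching public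

      record Outcome (t : Tree σ R) (s : State w) : Set where
        field
          addr : Word w
          ctx  : Ctx
          subt : Tree σ R
          inv  : Searching s addr ctx subt
          plug≡ : plug ctx subt ≡ t
          kind : (subt ≡ leaf × regs s foundᴿ ≡ null)
               ⊎ (Σ[ l ∈ Tree σ R ] Σ[ v ∈ Node σ R ] Σ[ r ∈ Tree σ R ]
                    subt ≡ branch l v r × Stop (key v) × regs s foundᴿ ≡ addr)

      -- One step costs at most 1 + δ plus the growth of lcpMax.
      δ : ℕ
      δ = Q >> ⌊log₂ L ⌋

      κ : ℕ
      κ = κ-search stopE rightE

      -- `length π * suc δ + lcpMax π` is the potential already paid for on arrival at `π`. Of the
      -- surplus 2, one unit covers the comparison with a node at which the search stops, which is
      -- not pushed, and the other the final loop test.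
      Within : Ctx {σ} {R} → Ctx {σ} {R} → ℕ → Set
      Within π π′ τ = τ + κ * (length π * suc δ + lcpMax π) ≤ κ * ((2 + length π′) * suc δ + Q)

      private
        dirs-lo : ∀ π {y} → Dirs π → loOf π ≡ just y → Right y
        dirs-lo (frame true v _ ∷ π) (r , _) refl = r
        dirs-lo (frame false v _ ∷ π) (_ , _ , ds) e = dirs-lo π ds e

        dirs-hi : ∀ π {y} → Dirs π → hiOf π ≡ just y → ¬ Right y
        dirs-hi (frame true v _ ∷ π) (_ , _ , ds) e = dirs-hi π ds e
        dirs-hi (frame false v _ ∷ π) (r , _) refl = r

        0/a : 0 / a ≡ 0
        0/a = 0/n≡0 a

        grow-right : ∀ π {v t} → Dirs π → loOf π <₋ key v → Right (key v) →
                     lcpMax π ⊔ lcp x (key v) / a ≤ lcpMax (frame true v t ∷ π)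
        grow-right π {v} ds lo< r = ⊔-lub (⊔-monoˡ-≤ (lcp∞ x (hiOf π) / a) (bound (loOf π) refl lo<)) (m≤m⊔n _ _)
          where
          bound : ∀ b → loOf π ≡ b → b <₋ key v → lcp∞ x b / a ≤ lcp x (key v) / a
          bound nothing _ _ = ≤-trans (≤-reflexive 0/a) z≤n
          bound (just y) e l = /-monoˡ-≤ a (right-lcp l r)

        grow-left : ∀ π {v t} → Dirs π → key v <₊ hiOf π → ¬ Right (key v) →
                    lcpMax π ⊔ lcp x (key v) / a ≤ lcpMax (frame false v t ∷ π)
        grow-left π {v} ds <hi r = ⊔-lub (⊔-monoʳ-≤ (lcp∞ x (loOf π) / a) (bound (hiOf π) <hi)) (m≤n⊔m _ _)
          where
          bound : ∀ b → key v <₊ b → lcp∞ x b / a ≤ lcp x (key v) / a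
          bound nothing _ = ≤-trans (≤-reflexive 0/a) z≤n
          bound (just y) l = /-monoˡ-≤ a (left-lcp l r)

        step-cost : ∀ {i m m′ st} → st ≤ i → i + m ≤ st + m′ + δ → i ∸ st + m ≤ m′ + δ
        step-cost {i} {m} {m′} {st} st≤i p = +-cancelˡ-≤ st _ _ (begin
          st + (i ∸ st + m) ≡⟨ +-assoc st (i ∸ st) m ⟨
          st + (i ∸ st) + m ≡⟨ cong (_+ m) (m+[n∸m]≡n st≤i) ⟩
          i + m ≤⟨ p ⟩
          st + m′ + δ ≡⟨ +-assoc st m′ δ ⟩
          st + (m′ + δ) ∎)
          where open ≤-Reasoning

        searching-same : ∀ {s s₁ p π u} → Same s s₁ → Searching s p π u → Searching s₁ p π u
        searching-same {s} {s₁} {π = π} e i = record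
          { regs₀ = λ r {l} → trans (regs≡ e r {<⇒<ᵇ (≤-trans (<ᵇ⇒< r 11 l) (m≤m+n 11 9))}) (regs₀ i r {l})
          ; mem₀  = subst (Agree (mem s₀)) (sym (mem≡ e)) (mem₀ i)
          ; hl    = hl i
          ; tree  = tree i
          ; path  = subst₂ (λ m p → Path (mem s₀) m p π) (sym (mem≡ e)) (sym (regs≡ e prevᴿ)) (path i)
          ; lcps  = subst₂ (λ m p → Lcps m p π) (sym (mem≡ e)) (sym (regs≡ e prevᴿ)) (lcps i)
          ; lo    = subst (λ p → Bound (mem s₀) p (loOf π)) (sym (regs≡ e loᴿ)) (lo i)
          ; hi    = subst (λ p → Bound (mem s₀) p (hiOf π)) (sym (regs≡ e hiᴿ)) (hi i)
          ; lcp⁻  = trans (cong toℕ (regs≡ e lcp⁻ᴿ)) (lcp⁻ i)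
          ; lcp⁺  = trans (cong toℕ (regs≡ e lcp⁺ᴿ)) (lcp⁺ i)
          ; dirs  = dirs i
          ; max≤  = max≤ i
          }

        regs-chain : ∀ d n {l : T (10 <ᵇ n)} n′ {l′ : T (10 <ᵇ n′)} u₁ u₂ u₃ (s : State w) r → {T (r <ᵇ 11)} →
                     regs (setReg vᴿ u₃ (setReg n′ u₂ (setReg n u₁ (exec (pushC d) s)))) r ≡ regs s r
        regs-chain d n {l} n′ {l′} u₁ u₂ u₃ s r {l″} =
          trans (regs-setReg vᴿ u₃ (setReg n′ u₂ (setReg n u₁ (exec (pushC d) s))) r {l″})
          (trans (regs-setReg n′ {l′} u₂ (setReg n u₁ (exec (pushC d) s)) r {l″})
          (trans (regs-setReg n {l} u₁ (exec (pushC d) s) r {l″})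
            (regs-setReg prevᴿ (regs s vᴿ) (exec (parentᴬ [ reg vᴿ ]≔ reg prevᴿ ⨾ lcpᴬ [ reg vᴿ ]≔ reg iᴿ ⨾
            lcp⁻ᴬ [ reg vᴿ ]≔ reg lcp⁻ᴿ ⨾ lcp⁺ᴬ [ reg vᴿ ]≔ reg lcp⁺ᴿ ⨾ dirᴬ [ reg vᴿ ]≔ lit d) s) r {l″})))

      module _ {s : State w} {π l v r} (i : Searching s (regs s vᴿ) π (branch l v r))
               (i≡ : toℕ (regs s iᴿ) ≡ lcp x (key v) / a) (≤Q : lcp x (key v) / a ≤ Q)
               (¬stop : ¬ Stop (key v)) where

        private
          p = regs s vᴿ
          u∈ = proj₁ (tree i)
          nd = proj₁ (proj₂ (tree i))
          cd : Codes enc (loOf π) (hiOf π) v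
          cd with hl i
          ... | hole _ (branch c _ _ _ _) _ = c
          apart : ApartC (key v) π
          apart = zc-apart enc (Hole.zc (hl i)) (Codes.lo< cd) (Codes.<hi cd)

          module Pushed (b : Bool) where
            d = if b then 1 else 0
            m′ = mem (exec (pushC d) s)
            agree′ : Agree (mem s₀) m′
            agree′ = agree-trans (mem₀ i) (push-agree d s)
            parent≡ : m′ parentᴬ p ≡ regs s prevᴿ
            parent≡ = if-same p
            path′ : ∀ t → Tr (mem s₀) (mem s₀ (sibᴬ b) p) t → Path (mem s₀) m′ p (frame b v t ∷ π)
            path′ t tr = u∈ , nd , tr , if-same p ,
              subst (λ q → Path (mem s₀) m′ q π) (sym parent≡) (path-update update-refl (NodeAt.key≡ nd) π (push-update d s) apart (path i))
            lcps′ : ∀ t → Lcps m′ p (frame b v t ∷ π)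
            lcps′ t = trans (cong toℕ (if-same p)) i≡ , trans (cong toℕ (if-same p)) (lcp⁻ i) , trans (cong toℕ (if-same p)) (lcp⁺ i) ,
              subst (λ q → Lcps m′ q π) (sym parent≡) (lcps-update π (push-update d s) (NodeAt.key≡ nd) apart (path i) (lcps i))

        go-right : Right (key v) → Searching (exec goRightC s) (mem s₀ rightᴬ p) (frame true v l ∷ π) r
        go-right ρ = record
          { regs₀ = λ r {l} → trans (regs-chain 1 loᴿ lcp⁻ᴿ p (regs s iᴿ) (mem s rightᴬ p) s r {l}) (regs₀ i r {l})
          ; mem₀  = Pushed.agree′ true
          ; hl    = hole-right enc (hl i)
          ; tree  = proj₂ (proj₂ (proj₂ (tree i)))
          ; path  = Pushed.path′ true l (proj₁ (proj₂ (proj₂ (tree i))))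
          ; lcps  = Pushed.lcps′ true l
          ; lo    = u∈ , NodeAt.nonnull nd , NodeAt.key≡ nd
          ; hi    = hi i
          ; lcp⁻  = i≡
          ; lcp⁺  = lcp⁺ i
          ; dirs  = ρ , ¬stop , dirs i
          ; max≤  = ⊔-lub ≤Q (≤-trans (m≤n⊔m _ _) (max≤ i))
          }

        go-left : ¬ Right (key v) → Searching (exec goLeftC s) (mem s₀ leftᴬ p) (frame false v r ∷ π) l
        go-left ρ = record
          { regs₀ = λ r {l} → trans (regs-chain 0 hiᴿ lcp⁺ᴿ p (regs s iᴿ) (mem s leftᴬ p) s r {l}) (regs₀ i r {l})
          ; mem₀  = Pushed.agree′ false
          ; hl    = hole-left enc (hl i)
          ; tree  = proj₁ (proj₂ (proj₂ (tree i)))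
          ; path  = Pushed.path′ false r (proj₂ (proj₂ (proj₂ (tree i))))
          ; lcps  = Pushed.lcps′ false r
          ; lo    = lo i
          ; hi    = u∈ , NodeAt.nonnull nd , NodeAt.key≡ nd
          ; lcp⁻  = lcp⁻ i
          ; lcp⁺  = i≡
          ; dirs  = ρ , ¬stop , dirs i
          ; max≤  = ⊔-lub (≤-trans (m≤m⊔n _ _) (max≤ i)) ≤Q
          }

      module _ (qx₀ : Query s₀) (log₀ : toℕ (regs s₀ logᴿ) ≡ L) (α₀ : toℕ (regs s₀ αᴿ) ≡ a) where

        private
          query : ∀ {s p π u} → Searching s p π u → Query s
          query i = holds-mem (λ j → mem₀ i textᴬ j) (regs₀ i xbaseᴿ) (regs₀ i xfullᴿ) (regs₀ i xtailᴿ) qx₀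

          current : ∀ {s p π l v r} → Searching s p π (branch l v r) → regs s vᴿ ≡ p → Current s (key v)
          current {s} i refl = holds-mem (λ j → mem₀ i textᴬ j) (mem₀ i baseᴬ _) (mem₀ i fullᴬ _) (mem₀ i tailᴬ _) (NodeAt.key≡ (proj₁ (proj₂ (tree i))))

          q<2^w : ∀ {p} {v : Node σ R} → NodeAt σ w {R = R} ⟪ mem s₀ ⟫ p v → ∀ b → lcp∞ (key v) b / a < 2 ^ w
          q<2^w n nothing = ≤-<-trans (≤-reflexive 0/a) (m^n>0 2 w)
          q<2^w {v = v} n (just y) = ≤-<-trans (≤-trans (lcp/≤ˡ a (key v) y) (≤-reflexive (sym (Holds.full≡ (NodeAt.key≡ n))))) (toℕ< (mem s₀ fullᴬ _))

          cost-step : ∀ {τ₁ τ₂ τ₃ i st len m m′ end} → τ₁ ≤ κ-compare * suc (i ∸ st) → τ₂ ≤ timeBound (branchC stopE rightE) →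
            i ∸ st + m ≤ m′ + δ → τ₃ + κ * (suc len * suc δ + m′) ≤ κ * end →
            2 + ((τ₁ + τ₂) + τ₃) + κ * (len * suc δ + m) ≤ κ * end
          cost-step {τ₁} {τ₂} {τ₃} {i} {st} {len} {m} {m′} {end} p₁ p₂ p₃ p₄ = begin
            2 + ((τ₁ + τ₂) + τ₃) + κ * (len * suc δ + m) ≡⟨ shuffle (2 + (τ₁ + τ₂)) τ₃ _ ⟩
            τ₃ + (2 + (τ₁ + τ₂) + κ * (len * suc δ + m)) ≤⟨ +-monoʳ-≤ τ₃ (+-monoˡ-≤ (κ * (len * suc δ + m)) once) ⟩
            τ₃ + (κ * suc (i ∸ st) + κ * (len * suc δ + m)) ≡⟨ cong (τ₃ +_) (*-distribˡ-+ κ (suc (i ∸ st)) _) ⟨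
            τ₃ + κ * (suc (i ∸ st) + (len * suc δ + m)) ≤⟨ +-monoʳ-≤ τ₃ (*-monoʳ-≤ κ inner) ⟩
            τ₃ + κ * (suc len * suc δ + m′) ≤⟨ p₄ ⟩
            κ * end ∎
            where
            open ≤-Reasoning
            shuffle : ∀ x y z → x + y + z ≡ y + (x + z)
            shuffle x y z = trans (cong (_+ z) (+-comm x y)) (+-assoc y x z)
            once : 2 + (τ₁ + τ₂) ≤ κ * suc (i ∸ st)
            once = begin
              2 + (τ₁ + τ₂) ≤⟨ +-monoʳ-≤ 2 (+-mono-≤ p₁ p₂) ⟩
              2 + (κ-compare * suc (i ∸ st) + B) ≤⟨ +-mono-≤ (m≤m*n 2 (suc (i ∸ st))) (+-monoʳ-≤ (κ-compare * suc (i ∸ st)) (m≤m*n B (suc (i ∸ st)))) ⟩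
              2 * suc (i ∸ st) + (κ-compare * suc (i ∸ st) + B * suc (i ∸ st)) ≡⟨ cong (2 * suc (i ∸ st) +_) (*-distribʳ-+ (suc (i ∸ st)) κ-compare B) ⟨
              2 * suc (i ∸ st) + (κ-compare + B) * suc (i ∸ st) ≡⟨ *-distribʳ-+ (suc (i ∸ st)) 2 (κ-compare + B) ⟨
              κ * suc (i ∸ st) ∎
              where B = timeBound (branchC stopE rightE)
            inner : suc (i ∸ st) + (len * suc δ + m) ≤ suc len * suc δ + m′
            inner = begin
              suc (i ∸ st + (len * suc δ + m)) ≡⟨ cong suc (trans (shuffle′ (i ∸ st) _ m) refl) ⟩
              suc (len * suc δ + (i ∸ st + m)) ≤⟨ s≤s (+-monoʳ-≤ (len * suc δ) p₃) ⟩
              suc (len * suc δ + (m′ + δ)) ≡⟨ cong suc (trans (cong (len * suc δ +_) (+-comm m′ δ)) (trans (sym (+-assoc (len * suc δ) δ m′)) (cong (_+ m′) (+-comm (len * suc δ) δ)))) ⟩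
              suc (δ + len * suc δ + m′) ∎
              where
              shuffle′ : ∀ x y z → x + (y + z) ≡ y + (x + z)
              shuffle′ x y z = trans (sym (+-assoc x y z)) (trans (cong (_+ z) (+-comm x y)) (+-assoc y x z))

          done-cost : ∀ len m → m ≤ Q → 2 + κ * (len * suc δ + m) ≤ κ * ((2 + len) * suc δ + Q)
          done-cost len m m≤Q = begin
            2 + κ * (len * suc δ + m) ≤⟨ +-monoˡ-≤ (κ * (len * suc δ + m)) (m≤m+n 2 (κ-compare + timeBound (branchC stopE rightE))) ⟩
            κ + κ * (len * suc δ + m) ≡⟨ *-suc κ _ ⟨
            κ * suc (len * suc δ + m) ≤⟨ *-monoʳ-≤ κ (+-mono-≤ (+-monoˡ-≤ (len * suc δ) (s≤s z≤n)) m≤Q) ⟩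
            κ * (suc δ + len * suc δ + Q) ≤⟨ *-monoʳ-≤ κ (+-monoˡ-≤ Q (m≤n+m _ (suc δ))) ⟩
            κ * ((2 + len) * suc δ + Q) ∎
            where open ≤-Reasoning

          stop-cost : ∀ len → 2 + κ * (suc len * suc δ + Q) ≤ κ * ((2 + len) * suc δ + Q)
          stop-cost len = begin
            2 + κ * (suc len * suc δ + Q) ≤⟨ +-monoˡ-≤ (κ * (suc len * suc δ + Q)) (≤-trans (m≤m+n 2 (κ-compare + timeBound (branchC stopE rightE))) (m≤m*n κ (suc δ))) ⟩
            κ * suc δ + κ * (suc len * suc δ + Q) ≡⟨ *-distribˡ-+ κ (suc δ) _ ⟨
            κ * (suc δ + (suc len * suc δ + Q)) ≡⟨ cong (κ *_) (+-assoc (suc δ) (suc len * suc δ) Q) ⟨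
            κ * ((2 + len) * suc δ + Q) ∎
            where open ≤-Reasoning

          -- The potential is the larger of the two LCPs, and this is the side that `Start` selects,
          -- so `resume-loss` applies to it.
          progress : ∀ (π : Ctx {σ} {R}) {y : Str σ} {st} → lcpMax π ≤ Q → st ≤ lcp x y / a →
            Start {L} (lcp∞ x (loOf π) / a) (lcp∞ x (hiOf π) / a) (lcp∞ y (loOf π) / a) (lcp∞ y (hiOf π) / a) st →
            lcp x y / a ∸ st + lcpMax π ≤ lcpMax π ⊔ lcp x y / a + δ
          progress π {y} m≤Q st≤i (inj₁ (h≤l , refl)) rewrite m≥n⇒m⊔n≡m h≤l = step-cost st≤i (resume-loss a ⌊log₂ L ⌋ x y (loOf π) m≤Q)
          progress π {y} m≤Q st≤i (inj₂ (l<h , refl)) rewrite m≤n⇒m⊔n≡n (<⇒≤ l<h) = step-cost st≤i (resume-loss a ⌊log₂ L ⌋ x y (hiOf π) m≤Q)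

          start≤ : ∀ (π : Ctx {σ} {R}) {y : Str σ} {st} → Start {L} (lcp∞ x (loOf π) / a) (lcp∞ x (hiOf π) / a) (lcp∞ y (loOf π) / a) (lcp∞ y (hiOf π) / a) st → st ≤ lcp x y / a
          start≤ π {y} (inj₁ (_ , refl)) = resume≤ a ⌊log₂ L ⌋ x y (loOf π)
          start≤ π {y} (inj₂ (_ , refl)) = resume≤ a ⌊log₂ L ⌋ x y (hiOf π)

        -- Structural induction on the subtree in the hole proves termination of the loop along with
        -- its cost.
        descend : ∀ u {π s p} → Searching s p π u → regs s vᴿ ≡ p → regs s foundᴿ ≡ null →
                  TAll (λ v → lcp x (key v) / a ≤ Q) u →
                  Runs (descendC stopE rightE) s (λ s′ τ → Σ[ o ∈ Outcome (plug π u) s′ ] Within π (Outcome.ctx o) τ)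
        descend leaf {π} i v≡ f≡ _ = _ , _ , ⇓done (trans v≡ (tree i)) ,
          record { addr = _ ; ctx = _ ; subt = _ ; inv = i ; plug≡ = refl ; kind = inj₁ (refl , f≡) } , done-cost (length π) _ (max≤ i)
        descend (branch l v r) {π} {s} {p} i v≡ f≡ (≤Q , ≤Ql , ≤Qr)
          with compare-runs {L} {s} {key v} {lcp∞ (key v) (loOf π) / a} {lcp∞ (key v) (hiOf π) / a} (query i) (current i v≡)
                 (trans (cong toℕ (regs₀ i logᴿ)) log₀) (lcp⁻ i) (lcp⁺ i)
                 (trans (cong toℕ (trans (cong (mem s code⁻ᴬ) v≡) (mem₀ i code⁻ᴬ p))) (trans (NodeAt.code⁻≡ nd) (Codes.code⁻≡ cd)))
                 (trans (cong toℕ (trans (cong (mem s code⁺ᴬ) v≡) (mem₀ i code⁺ᴬ p))) (trans (NodeAt.code⁺≡ nd) (Codes.code⁺≡ cd)))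
                 (q<2^w nd (loOf π)) (q<2^w nd (hiOf π))
                 (resume≤ a ⌊log₂ L ⌋ x (key v) (loOf π)) (resume≤ a ⌊log₂ L ⌋ x (key v) (hiOf π))
          where
          nd = proj₁ (proj₂ (tree i))
          cd : Codes enc (loOf π) (hiOf π) v
          cd with hl i
          ... | hole _ (branch c _ _ _ _) _ = c
        ... | s₁ , τ₁ , run₁ , same , i≡ , st , st≡ , τ₁≤ with ⇓exec′ (branchC stopE rightE) s₁ _
        ...   | τ₂ , run₂ , τ₂≤ = finish (stop-test (query i₁) (current i₁ refl) i≡) (right-test (query i₁) (current i₁ refl) i≡ (trans (cong toℕ (regs₀ i₁ αᴿ)) α₀))
          where
          v≡₁ : p ≡ regs s₁ vᴿ
          v≡₁ = sym (trans (regs≡ same vᴿ) v≡)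
          i₁ : Searching s₁ (regs s₁ vᴿ) π (branch l v r)
          i₁ = subst (λ q → Searching s₁ q π (branch l v r)) v≡₁ (searching-same same i)
          p≢null : ⟦ reg vᴿ ⟧ s ≢ null
          p≢null z = NodeAt.nonnull (proj₁ (proj₂ (tree i))) (trans (sym v≡) z)
          f≡₁ : regs s₁ foundᴿ ≡ null
          f≡₁ = trans (regs≡ same foundᴿ) f≡
          prog = progress π {key v} (max≤ i) (start≤ π {key v} st≡) st≡
          Goal : Set
          Goal = Runs (descendC stopE rightE) s (λ s′ τ → Σ[ o ∈ Outcome (plug π (branch l v r)) s′ ] Within π (Outcome.ctx o) τ)
          cd : Codes enc (loOf π) (hiOf π) v
          cd with hl i
          ... | hole _ (branch c _ _ _ _) _ = c
          go : (s₂ : State w) → s₂ ≡ exec (branchC stopE rightE) s₁ → ∀ d t u → fill (frame d v t) u ≡ branch l v r →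
               lcpMax π ⊔ lcp x (key v) / a ≤ lcpMax (frame d v t ∷ π) →
               Runs (descendC stopE rightE) s₂ (λ s′ τ → Σ[ o ∈ Outcome (plug (frame d v t ∷ π) u) s′ ] Within (frame d v t ∷ π) (Outcome.ctx o) τ) → Goal
          go s₂ e d t u fill≡ grow (s₃ , τ₃ , run₃ , o , win) rewrite e = s₃ , _ , ⇓loop p≢null (⇓seq run₁ run₂) run₃
            , subst (λ t → Σ[ o ∈ Outcome (plug π t) s₃ ] Within π (Outcome.ctx o) (2 + (τ₁ + τ₂ + τ₃))) fill≡
                (o , cost-step {i = lcp x (key v) / a} {st} {length π} {lcpMax π} {lcpMax (frame d v t ∷ π)} {(2 + length (Outcome.ctx o)) * suc δ + Q} τ₁≤ τ₂≤ (≤-trans prog (+-monoˡ-≤ δ grow)) win)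
          finish : Decides stopE s₁ (Stop (key v)) → Decides rightE s₁ (Right (key v)) → Goal
          finish D@(decides (yes stop) _) _ = s₂ , _ , ⇓loop p≢null (⇓seq run₁ run₂) (subst (λ s′ → ⟨ descendC stopE rightE , s′ ⟩⇓⟨ s₂ , 2 ⟩) (sym e) (⇓done refl))
            , record { addr = regs s₁ vᴿ ; ctx = π ; subt = branch l v r ; inv = inv₂ ; plug≡ = refl ; kind = inj₂ (l , v , r , refl , stop , refl) }
            , cost-step {i = lcp x (key v) / a} {st} {length π} {lcpMax π} {Q} {(2 + length π) * suc δ + Q} τ₁≤ τ₂≤ (≤-trans prog (+-monoˡ-≤ δ (⊔-lub (max≤ i) ≤Q))) (stop-cost (length π))
            where
            s₂ = exec (foundᴿ ≔ reg vᴿ ⨾ vᴿ ≔ lit 0) s₁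
            e : exec (branchC stopE rightE) s₁ ≡ s₂
            e = exec-decides {c = foundᴿ ≔ reg vᴿ ⨾ vᴿ ≔ lit 0} {d = cond rightE goRightC goLeftC} D
            inv₂ : Searching s₂ (regs s₁ vᴿ) π (branch l v r)
            inv₂ = record
              { regs₀ = λ r {b} → trans (regs-setReg vᴿ null (setReg foundᴿ (regs s₁ vᴿ) s₁) r {b}) (trans (regs-setReg foundᴿ (regs s₁ vᴿ) s₁ r {b}) (regs₀ i₁ r {b}))
              ; mem₀ = mem₀ i₁ ; hl = hl i₁ ; tree = tree i₁ ; path = path i₁ ; lcps = lcps i₁ ; lo = lo i₁ ; hi = hi i₁
              ; lcp⁻ = lcp⁻ i₁ ; lcp⁺ = lcp⁺ i₁ ; dirs = dirs i₁ ; max≤ = max≤ i₁ }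
          finish D@(decides (no ¬stop) _) D′@(decides (yes ρ) _) =
            go (exec goRightC s₁) (sym (trans (exec-decides {c = foundᴿ ≔ reg vᴿ ⨾ vᴿ ≔ lit 0} {d = cond rightE goRightC goLeftC} D) (exec-decides {c = goRightC} {d = goLeftC} D′)))
               true l r refl (grow-right π {v} {l} (dirs i) (Codes.lo< cd) ρ)
               (descend r (go-right i₁ i≡ ≤Q ¬stop ρ) (mem₀ i₁ rightᴬ _) f≡₁ ≤Qr)
          finish D@(decides (no ¬stop) _) D′@(decides (no ρ) _) =
            go (exec goLeftC s₁) (sym (trans (exec-decides {c = foundᴿ ≔ reg vᴿ ⨾ vᴿ ≔ lit 0} {d = cond rightE goRightC goLeftC} D) (exec-decides {c = goRightC} {d = goLeftC} D′)))
               false r l refl (grow-left π {v} {r} (dirs i) (Codes.<hi cd) ρ)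
               (descend l (go-left i₁ i≡ ≤Q ¬stop ρ) (mem₀ i₁ leftᴬ _) f≡₁ ≤Ql)

        search-runs : ∀ {t s} → (∀ r → {T (r <ᵇ 11)} → regs s r ≡ regs s₀ r) → Agree (mem s₀) (mem s) →
                      ZT enc nothing nothing t → Tr (mem s₀) (regs s₀ rootᴿ) t →
                      TAll (λ v → lcp x (key v) / a ≤ Q) t →
                      Runs (searchC stopE rightE) s (λ s′ τ → Σ[ o ∈ Outcome t s′ ]
                        τ ≤ timeBound startC + κ * ((2 + length (Outcome.ctx o)) * suc δ + Q))
        search-runs {t} {s} r₀ m₀ zt tr ≤Q = runs-straight {c = startC} _ λ {τ₁} τ₁≤ →
          runs-map (λ { (o , l) → o , +-mono-≤ τ₁≤ (≤-trans (m≤m+n _ _) l) })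
            (descend t init (r₀ rootᴿ) refl ≤Q)
          where
          null≡ : toℕ (null {w}) ≡ 0 / a
          null≡ = trans (toℕ-null {w}) (sym 0/a)
          unset : ∀ n {l : T (10 <ᵇ n)} u (s′ : State w) → (∀ r → {T (r <ᵇ 11)} → regs s′ r ≡ regs s₀ r) →
                ∀ r → {T (r <ᵇ 11)} → regs (setReg n u s′) r ≡ regs s₀ r
          unset n {l} u s′ e r {b} = trans (regs-setReg n {l} u s′ r {b}) (e r {b})
          s₁ = setReg vᴿ (regs s rootᴿ) s
          s₂ = setReg prevᴿ null s₁
          s₃ = setReg loᴿ null s₂
          s₄ = setReg hiᴿ null s₃
          s₅ = setReg lcp⁻ᴿ null s₄
          s₆ = setReg lcp⁺ᴿ null s₅
          init : Searching (exec startC s) (regs s₀ rootᴿ) [] t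
          init = record
            { regs₀ = λ r {b} → unset foundᴿ null s₆ (λ r {b} → unset lcp⁺ᴿ null s₅ (λ r {b} → unset lcp⁻ᴿ null s₄ (λ r {b} → unset hiᴿ null s₃ (λ r {b} → unset loᴿ null s₂
                (λ r {b} → unset prevᴿ null s₁ (λ r {b} → unset vᴿ (regs s rootᴿ) s (λ r {b} → r₀ r {b}) r {b}) r {b}) r {b}) r {b}) r {b}) r {b}) r {b}
            ; mem₀ = m₀ ; hl = hole [] zt (top-below t) ; tree = tr ; path = refl ; lcps = tt ; lo = refl ; hi = refl
            ; lcp⁻ = null≡ ; lcp⁺ = null≡ ; dirs = tt ; max≤ = ≤-trans (≤-reflexive (cong₂ _⊔_ 0/a 0/a)) z≤n }
            where
            top-below : ∀ t → BelowCT [] t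
            top-below leaf = tt
            top-below (branch _ _ _) = tt

-- The three boundaries of a query and the keys next to them.

module Boundaries where

  open import Defs renaming (_⨾_ to infixr 4 _⨾_; _≔_ to infix 5 _≔_; _[_]≔_ to infix 5 _[_]≔_)
  open StringOrder
  open Words
  open ProgramLogic
  open Zippers
  open Comparison
  open MemoryLayout
  open TrieDescent
  open import Data.Bool using (true; false)
  open import Data.Empty using (⊥)
  open import Data.List using (List; []; _∷_; _++_; length; map)
  open import Data.List.Membership.Propositional using (_∈_)
  open import Data.List.Membership.Propositional.Properties using (∈-map⁻; ∈-map⁺; ∈-++⁺ˡ; ∈-++⁺ʳ)
  open import Data.List.Relation.Binary.Permutation.Propositional using (_↭_; ↭-sym)
  open import Data.List.Relation.Binary.Permutation.Propositional.Properties using (∈-resp-↭)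
  open import Data.List.Relation.Binary.Prefix.Heterogeneous using (Prefix)
  open import Data.List.Relation.Unary.All as All using (All; []; _∷_)
  import Data.List.Relation.Unary.All.Properties as All
  open import Data.List.Relation.Unary.Any using (here; there)
  open import Data.Maybe using (just; nothing)
  open import Data.Nat
  open import Data.Nat.DivMod
  open import Data.Nat.Properties
  open import Data.Product using (_×_; _,_; proj₁; proj₂; Σ-syntax; ∃-syntax)
  open import Data.Sum using (_⊎_; inj₁; inj₂)
  open import Data.Unit using (⊤; tt)
  open import Function using (id)
  open import Relation.Binary.Definitions using (tri<; tri≈; tri>)
  open import Relation.Binary.PropositionalEquality hiding ([_])
  open import Relation.Nullary using (¬_; no; contradiction)
  open import Relation.Nullary.Decidable using (decidable-stable)

  module _ {σ R : ℕ} where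

    -- The frames leading to the boundary between the keys in P and the others.
    Along : (Str σ → Set) → Ctx {σ} {R} → Set
    Along P []                    = ⊤
    Along P (frame true v _ ∷ π)  = P (key v) × Along P π
    Along P (frame false v _ ∷ π) = ¬ P (key v) × Along P π

    along-lo : ∀ {P} π {y} → Along P π → loOf π ≡ just y → P y
    along-lo (frame true v _ ∷ π) (p , _) refl = p
    along-lo (frame false v _ ∷ π) (_ , q) e = along-lo π q e

    along-hi : ∀ {P} π {y} → Along P π → hiOf π ≡ just y → ¬ P y
    along-hi (frame true v _ ∷ π) (_ , q) e = along-hi π q e
    along-hi (frame false v _ ∷ π) (p , _) refl = p

    module _ {enc : ℕ → ℕ} where

      pre≤lo : ∀ {π} → ZC enc π → All (λ e → Σ[ y ∈ Str σ ] loOf π ≡ just y × proj₁ e ≤ˢ y) (pre {σ} {R} π)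
      pre≤lo [] = []
      pre≤lo (right {v} {l} c b bl zl zc) = All.++⁺ (All.map (λ q → _ , refl , inj₁ q) (zc-lo enc zc (Codes.lo< c)))
        (All.++⁺ (All.map⁺ (All.map (λ q → _ , refl , inj₁ q) (TAll⇒All l (zt-hi enc l zl)))) ((_ , refl , inj₂ refl) ∷ []))
      pre≤lo (left c b br zr zc) = pre≤lo zc

      hi≤post : ∀ {π} → ZC enc π → All (λ e → Σ[ y ∈ Str σ ] hiOf π ≡ just y × y ≤ˢ proj₁ e) (post {σ} {R} π)
      hi≤post [] = []
      hi≤post (right c b bl zl zc) = hi≤post zc
      hi≤post (left {v} {r} c b br zr zc) = (_ , refl , inj₂ refl) ∷
        All.++⁺ (All.map⁺ (All.map (λ q → _ , refl , inj₁ q) (TAll⇒All r (zt-lo enc r zr))))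
                (All.map (λ q → _ , refl , inj₁ q) (zc-hi enc zc (Codes.<hi c)))

    lo∈pre : ∀ (π : Ctx {σ} {R}) {y} → loOf π ≡ just y → y ∈ keys (pre π)
    lo∈pre (frame true v l ∷ π) refl = ∈-map⁺ proj₁ (∈-++⁺ʳ (pre π) (∈-++⁺ʳ (entries l) (here refl)))
    lo∈pre (frame false v r ∷ π) e = lo∈pre π e

    hi∈post : ∀ (π : Ctx {σ} {R}) {y} → hiOf π ≡ just y → y ∈ keys (post π)
    hi∈post (frame true v l ∷ π) e = hi∈post π e
    hi∈post (frame false v r ∷ π) refl = here refl

    ∈keys-++ : ∀ (E F : List (Entry σ R)) {y} → y ∈ keys (E ++ F) → y ∈ keys E ⊎ y ∈ keys F
    ∈keys-++ [] F p = inj₂ p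
    ∈keys-++ (e ∷ E) F (here p) = inj₁ (here p)
    ∈keys-++ (e ∷ E) F (there p) with ∈keys-++ E F p
    ... | inj₁ q = inj₁ (there q)
    ... | inj₂ q = inj₂ q

    ∈keys-↭ : ∀ {E F : List (Entry σ R)} {y} → E ↭ F → y ∈ keys E → y ∈ keys F
    ∈keys-↭ p q with ∈-map⁻ proj₁ q
    ... | e , e∈ , refl = ∈-map⁺ proj₁ (∈-resp-↭ p e∈)

  module _ {σ : ℕ} (x : Str σ) where

    -- Three down-closed sets whose boundaries lie just before `x`, just after `x`, and just after
    -- the last extension of `x`. `NotBeyond` is negative so as to be the literal complement of what
    -- `beyondE` tests.
    Less NotMore NotBeyond : Str σ → Set
    Less y      = y <ˢ x
    NotMore y   = ¬ x <ˢ y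
    NotBeyond y = ¬ (x <ˢ y × ¬ Prefix _≡_ x y)

    -- The only property of the ranks on which the time bounds depend.
    Shallow : ∀ {R} → Tree σ R → ℕ → Set
    Shallow t D = ∀ π u → plug π u ≡ t → Along Less π ⊎ Along NotMore π ⊎ Along NotBeyond π → length π ≤ D

    private
      lcp-< : ∀ {y z} → x <ˢ y → y <ˢ z → lcp x z ≤ lcp x y
      lcp-< {y} {z} p q = ≤-trans (≤-reflexive (lcp-between p q)) (m⊓n≤m (lcp x y) (lcp y z))

      lcp-> : ∀ {y z} → y <ˢ z → z <ˢ x → lcp x y ≤ lcp x z
      lcp-> {y} {z} p q = subst₂ _≤_ (lcp-comm y x) (lcp-comm z x) (≤-trans (≤-reflexive (lcp-between p q)) (m⊓n≤n (lcp y z) (lcp z x)))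

      lcp≤self : ∀ y → lcp x y ≤ lcp x x
      lcp≤self y = ≤-trans (lcp≤lengthˡ x y) (≤-reflexive (sym (lcp-self x)))

    less-right : ∀ {y z} → y <ˢ z → Less z → lcp x y ≤ lcp x z
    less-right = lcp->

    less-left : ∀ {y z} → y <ˢ z → ¬ Less y → lcp x z ≤ lcp x y
    less-left {y} {z} p q with <ˢ-cmp x y
    ... | tri< r _ _ = lcp-< r p
    ... | tri≈ _ refl _ = lcp≤self z
    ... | tri> _ _ r = contradiction r q

    more-right : ∀ {y z} → y <ˢ z → NotMore z → lcp x y ≤ lcp x z
    more-right {y} {z} p q with <ˢ-cmp x z
    ... | tri< r _ _ = contradiction r q
    ... | tri≈ _ refl _ = lcp≤self y
    ... | tri> _ _ r = lcp-> p r

    more-left : ∀ {y z} → y <ˢ z → ¬ NotMore y → lcp x z ≤ lcp x y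
    more-left {y} {z} p q with <ˢ-cmp x y
    ... | tri< r _ _ = lcp-< r p
    ... | tri≈ r _ _ = contradiction r q
    ... | tri> r _ _ = contradiction r q

    beyond-down : ∀ {y z} → y <ˢ z → NotBeyond z → NotBeyond y
    beyond-down p q (x<y , ¬px) = q (<ˢ-trans x<y p , λ px → ¬px (Prefix-convex px x<y p))

    -- If `z` extends `x`, then `lcp x z` is all of `x`. When `x <ˢ z` the hypothesis yields the
    -- extension only doubly negated, which the decidability of `_≤?_` makes up for.
    beyond-right : ∀ {y z} → y <ˢ z → NotBeyond z → lcp x y ≤ lcp x z
    beyond-right {y} {z} p q with <ˢ-cmp x z
    ... | tri≈ _ refl _ = lcp≤self y
    ... | tri> _ _ r = lcp-> p r
    ... | tri< r _ _ = decidable-stable (lcp x y ≤? lcp x z) λ ¬l →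
      q (r , λ px → ¬l (≤-trans (lcp≤lengthˡ x y) (≤-reflexive (sym (Prefix-lcp {x = x} {z} px)))))

    beyond-left : ∀ {y z} → y <ˢ z → ¬ NotBeyond y → lcp x z ≤ lcp x y
    beyond-left {y} {z} p q with <ˢ-cmp x y
    ... | tri< r _ _ = lcp-< r p
    ... | tri≈ ¬r _ _ = contradiction (λ r → ¬r (proj₁ r)) q
    ... | tri> ¬r _ _ = contradiction (λ r → ¬r (proj₁ r)) q

  -- Each test leaves the sought node, or null, in hiᴿ or loᴿ.
  filterHiC filterLoC : Expr → Cmd
  filterHiC e = cond (reg hiᴿ) (vᴿ ≔ reg hiᴿ ⨾ iᴿ ≔ reg lcp⁺ᴿ ⨾ cond e (hiᴿ ≔ lit 0) skip) skip
  filterLoC e = cond (reg loᴿ) (vᴿ ≔ reg loᴿ ⨾ iᴿ ≔ reg lcp⁻ᴿ ⨾ cond e (loᴿ ≔ lit 0) skip) skip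

  predecessorC successorC : Cmd
  predecessorC = searchC (lit 0) vLessE ⨾ out₁ᴿ ≔ reg loᴿ
  successorC   = searchC (lit 0) (notE xLessE) ⨾ out₁ᴿ ≔ reg hiᴿ

  -- Each end of the range is sought next to a boundary: the least key not below `x`, and the
  -- greatest key not beyond. If no key extends `x`, the filters replace these by null.
  hiC prefixSearchC : ℕ → Cmd
  loC : Cmd
  hiC σ = filterHiC (beyondE σ) ⨾ out₁ᴿ ≔ reg hiᴿ
  loC = filterLoC vLessE ⨾ out₂ᴿ ≔ reg loᴿ
  prefixSearchC σ = searchC (lit 0) vLessE ⨾ hiC σ ⨾ searchC (lit 0) (notE (beyondE σ)) ⨾ loC

  module Modes (σ w : ℕ) .{{_ : NonTrivial σ}} .{{_ : NonZero (α σ w)}} {R : ℕ} (U : Word w → Set) (L : ℕ) (x : Str σ) where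

    open Descent σ w {R} U L x public

    never : ∀ {s : State w} → Decides (lit 0) s ⊥
    never = decides (no id) refl

    lessMode moreMode beyondMode exactMode : Mode
    lessMode = record
      { rightE = vLessE ; stopE = lit 0 ; Right = Less x ; Stop = λ _ → ⊥
      ; right-test = λ q c i _ → vLess q c i ; stop-test = λ _ _ _ → never
      ; right-down = <ˢ-trans ; right-lcp = less-right x ; left-lcp = less-left x }
    moreMode = record
      { rightE = notE xLessE ; stopE = lit 0 ; Right = NotMore x ; Stop = λ _ → ⊥
      ; right-test = λ q c i _ → decides-not (xLess q c i) ; stop-test = λ _ _ _ → never
      ; right-down = λ p q r → q (<ˢ-trans r p) ; right-lcp = more-right x ; left-lcp = more-left x }
    beyondMode = record
      { rightE = notE (beyondE σ) ; stopE = lit 0 ; Right = NotBeyond x ; Stop = λ _ → ⊥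
      ; right-test = λ q c i α≡ → decides-not (beyond q c i α≡) ; stop-test = λ _ _ _ → never
      ; right-down = beyond-down x ; right-lcp = beyond-right x ; left-lcp = beyond-left x }
    exactMode = record
      { rightE = vLessE ; stopE = equalE ; Right = Less x ; Stop = x ≡_
      ; right-test = λ q c i _ → vLess q c i ; stop-test = λ q c i → same-key q c i
      ; right-down = <ˢ-trans ; right-lcp = less-right x ; left-lcp = less-left x }

    module _ (M : Mode) (s₀ : State w) (Q : ℕ) where
      open Mode M
      open Search M s₀ Q

      dirs⇒along : ∀ π → Dirs π → Along Right π
      dirs⇒along [] _ = tt
      dirs⇒along (frame true v _ ∷ π) (r , _ , ds) = r , dirs⇒along π ds
      dirs⇒along (frame false v _ ∷ π) (r , _ , ds) = r , dirs⇒along π ds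

      module Located {t : Tree σ R} {s : State w} {E : List (Entry σ R)} (E↭ : entries t ↭ E)
                     (o : Outcome t s) (at-leaf : Outcome.subt o ≡ leaf) where
        open Outcome o
        private
          zcᵒ = Hole.zc (hl inv)
          along = dirs⇒along ctx (dirs inv)

          shape : entries t ≡ pre ctx ++ post ctx
          shape = trans (cong entries (sym plug≡)) (trans (entries-plug ctx subt) (cong (λ u → pre ctx ++ entries u ++ post ctx) at-leaf))

          split : ∀ {z} → z ∈ keys E → z ∈ keys (pre ctx) ⊎ z ∈ keys (post ctx)
          split z∈ = ∈keys-++ (pre ctx) (post ctx) (subst (λ e → _ ∈ keys e) shape (∈keys-↭ (↭-sym E↭) z∈))

          join : ∀ {z} → z ∈ keys (pre ctx) ⊎ z ∈ keys (post ctx) → z ∈ keys E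
          join p = ∈keys-↭ E↭ (subst (λ e → _ ∈ keys e) (sym shape) (merge p))
            where
            merge : ∀ {z} → z ∈ keys (pre ctx) ⊎ z ∈ keys (post ctx) → z ∈ keys (pre ctx ++ post ctx)
            merge (inj₁ p) with ∈-map⁻ proj₁ p
            ... | e , e∈ , refl = ∈-map⁺ proj₁ (∈-++⁺ˡ e∈)
            merge (inj₂ p) with ∈-map⁻ proj₁ p
            ... | e , e∈ , refl = ∈-map⁺ proj₁ (∈-++⁺ʳ (pre ctx) e∈)

          below : ∀ {z} → z ∈ keys (pre ctx) → Σ[ y ∈ Str σ ] loOf ctx ≡ just y × z ≤ˢ y
          below p with ∈-map⁻ proj₁ p
          ... | e , e∈ , refl = All.lookup (pre≤lo zcᵒ) e∈

          above : ∀ {z} → z ∈ keys (post ctx) → Σ[ y ∈ Str σ ] hiOf ctx ≡ just y × y ≤ˢ z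
          above p with ∈-map⁻ proj₁ p
          ... | e , e∈ , refl = All.lookup (hi≤post zcᵒ) e∈

          Right-≤ : ∀ {y z} → y ≤ˢ z → Right z → Right y
          Right-≤ (inj₁ p) r = right-down p r
          Right-≤ (inj₂ refl) r = r

        pre-right : ∀ {z} → z ∈ keys (pre ctx) → Right z
        pre-right p with below p
        ... | y , e , l = Right-≤ l (along-lo ctx along e)

        post-left : ∀ {z} → z ∈ keys (post ctx) → ¬ Right z
        post-left p r with above p
        ... | y , e , l = along-hi ctx along e (Right-≤ l r)

        greatest : (loOf ctx ≡ nothing × regs s loᴿ ≡ null × ∀ z → z ∈ keys E → ¬ Right z)
          ⊎ (Σ[ y ∈ Str σ ] loOf ctx ≡ just y × y ∈ keys E × Right y × (∀ z → z ∈ keys E → Right z → z ≤ˢ y)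
              × Bound (mem s₀) (regs s loᴿ) (just y))
        greatest with loOf ctx in e | lo inv
        ... | nothing | b = inj₁ (refl , b , λ z z∈ r → none z z∈ r (split z∈))
          where
          none : ∀ z → z ∈ keys E → Right z → z ∈ keys (pre ctx) ⊎ z ∈ keys (post ctx) → ⊥
          none z z∈ r (inj₁ p) with trans (sym e) (proj₁ (proj₂ (below p)))
          ... | ()
          none z z∈ r (inj₂ p) = post-left p r
        ... | just y | b = inj₂ (y , refl , join (inj₁ (lo∈pre ctx e)) , along-lo ctx along e , (λ z z∈ r → greatest-≤ r (split z∈)) , b)
          where
          greatest-≤ : ∀ {z} → Right z → z ∈ keys (pre ctx) ⊎ z ∈ keys (post ctx) → z ≤ˢ y
          greatest-≤ r (inj₁ p) with below p
          ... | y′ , e′ , l with trans (sym e′) e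
          ...   | refl = l
          greatest-≤ r (inj₂ p) = contradiction r (post-left p)

        least : (hiOf ctx ≡ nothing × regs s hiᴿ ≡ null × ∀ z → z ∈ keys E → ¬ ¬ Right z)
          ⊎ (Σ[ y ∈ Str σ ] hiOf ctx ≡ just y × y ∈ keys E × ¬ Right y × (∀ z → z ∈ keys E → ¬ Right z → y ≤ˢ z)
              × Bound (mem s₀) (regs s hiᴿ) (just y))
        least with hiOf ctx in e | hi inv
        ... | nothing | b = inj₁ (refl , b , λ z z∈ r → none z z∈ r (split z∈))
          where
          none : ∀ z → z ∈ keys E → ¬ Right z → z ∈ keys (pre ctx) ⊎ z ∈ keys (post ctx) → ⊥
          none z z∈ r (inj₁ p) = r (pre-right p)
          none z z∈ r (inj₂ p) with trans (sym e) (proj₁ (proj₂ (above p)))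
          ... | ()
        ... | just y | b = inj₂ (y , refl , join (inj₂ (hi∈post ctx e)) , along-hi ctx along e , (λ z z∈ r → least-≤ r (split z∈)) , b)
          where
          least-≤ : ∀ {z} → ¬ Right z → z ∈ keys (pre ctx) ⊎ z ∈ keys (post ctx) → y ≤ˢ z
          least-≤ r (inj₁ p) = contradiction (pre-right p) r
          least-≤ r (inj₂ p) with above p
          ... | y′ , e′ , l with trans (sym e′) e
          ...   | refl = l

-- Predecessor, successor and prefix search.

module QueryOperations where

  open import Defs renaming (_⨾_ to infixr 4 _⨾_; _≔_ to infix 5 _≔_; _[_]≔_ to infix 5 _[_]≔_)
  open StringOrder
  open Words
  open ProgramLogic
  open Zippers
  open Comparison
  open MemoryLayout
  open TrieDescent
  open Boundaries
  open import Data.Bool using (T)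
  open import Data.Empty using (⊥)
  open import Data.List using (List; length; map)
  open import Data.List.Extrema.Nat using (xs≤max)
  open import Data.List.Membership.Propositional using (_∈_)
  open import Data.List.Relation.Binary.Permutation.Propositional using (_↭_; ↭-sym)
  open import Data.List.Relation.Binary.Permutation.Propositional.Properties using (All-resp-↭)
  import Data.Fin.Properties as Fin
  open import Data.List.Relation.Binary.Prefix.Heterogeneous using (Prefix)
  open import Data.List.Relation.Binary.Prefix.Heterogeneous.Properties using (prefix?)
  open import Data.List.Relation.Unary.All as All using (All)
  import Data.List.Relation.Unary.All.Properties as All
  open import Data.Maybe using (nothing)
  open import Data.Nat
  open import Data.Nat.DivMod
  open import Data.Nat.Logarithm using (⌊log₂_⌋)
  open import Data.Nat.Properties
  open import Data.Product using (_×_; _,_; proj₁; proj₂; Σ-syntax; ∃-syntax)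
  open import Data.Sum using (_⊎_; inj₁; inj₂)
  open import Data.Unit using (tt)
  open import Relation.Binary.Definitions using (tri<; tri≈; tri>)
  open import Relation.Binary.PropositionalEquality hiding ([_])
  open import Relation.Nullary using (¬_; yes; no; contradiction)
  open import Relation.Nullary.Decidable using (decidable-stable)

  β-search : Expr → Expr → ℕ
  β-search stopE rightE = timeBound startC + κ-search stopE rightE

  β-predecessor β-successor : ℕ
  β-predecessor = β-search (lit 0) vLessE + timeBound (out₁ᴿ ≔ reg loᴿ)
  β-successor   = β-search (lit 0) (notE xLessE) + timeBound (out₁ᴿ ≔ reg hiᴿ)

  β-prefix : ℕ → ℕ
  β-prefix σ = β-search (lit 0) vLessE + (timeBound (hiC σ) + (β-search (lit 0) (notE (beyondE σ)) + timeBound loC))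

  module _ {w : ℕ} where

    reach-agree : ∀ {s s′ : State w} {p q} → Agree (mem s) (mem s′) → Reach s p q → Reach s′ p q
    reach-agree e (here n) = here n
    reach-agree {s} {s′} {p} {q} e (left n ρ) = left n (subst (λ z → Reach s′ z q) (sym (e leftᴬ p)) (reach-agree e ρ))
    reach-agree {s} {s′} {p} {q} e (right n ρ) = right n (subst (λ z → Reach s′ z q) (sym (e rightᴬ p)) (reach-agree e ρ))

  module Setting (σ w : ℕ) .{{_ : NonTrivial σ}} .{{_ : NonZero (α σ w)}} {R : ℕ} (U : Word w → Set)
                 (L : ℕ) (E : List (Entry σ R)) (t : Tree σ R) (x : Str σ) where

    open Modes σ w {R} U L x public

    Q δ : ℕ
    Q = lcpWith x (keys E) / a
    δ = Q >> ⌊log₂ L ⌋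

    -- The time allotted to a search path of length D.
    budget : ℕ → ℕ
    budget D = (3 + D) * suc δ + Q

    -- The depth is quantified inside: a run is bounded relative to whatever depth the ranks happen
    -- to give, which keeps correctness free of assumptions on them.
    record Fits (β τ : ℕ) : Set where
      constructor fits
      field
        within : ∀ D → Shallow x t D → τ ≤ β * budget D

    open Fits public

    fits-≤ : ∀ {β τ υ} → τ ≤ υ → Fits β υ → Fits β τ
    fits-≤ l f = fits λ D sh → ≤-trans l (within f D sh)

    fits-+ : ∀ {β γ τ υ} → Fits β τ → Fits γ υ → Fits (β + γ) (τ + υ)
    fits-+ {β} {γ} p q = fits λ D sh → ≤-trans (+-mono-≤ (within p D sh) (within q D sh)) (≤-reflexive (sym (*-distribʳ-+ (budget D) β γ)))

    fits-const : ∀ {β τ} → τ ≤ β → Fits β τ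
    fits-const {β} p = fits λ D _ → ≤-trans p (m≤m*n β (budget D))

    OnPath : Ctx {σ} {R} → Set
    OnPath π = Along (Less x) π ⊎ Along (NotMore x) π ⊎ Along (NotBeyond x) π

    fits-path : ∀ κ {τ} π u → plug π u ≡ t → OnPath π → τ ≤ κ * ((2 + length π) * suc δ + Q) → Fits κ τ
    fits-path κ π u e al l = fits λ D sh → ≤-trans l (*-monoʳ-≤ κ (+-monoˡ-≤ Q (*-monoˡ-≤ (suc δ) (s≤s (s≤s (≤-trans (sh π u e al) (n≤1+n D)))))))

    fits-length : ∀ κ {τ} π u → plug π u ≡ t → OnPath π → τ ≤ κ * suc (length π) → Fits κ τ
    fits-length κ π u e al l = fits λ D sh → ≤-trans l (*-monoʳ-≤ κ (≤-trans (s≤s (sh π u e al))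
      (≤-trans (≤-trans (m≤n+m (suc D) 2) (m≤m*n (3 + D) (suc δ))) (m≤m+n _ Q))))

    keys≤Q : ∀ {E′ : Tree σ R} → entries E′ ↭ E → TAll (λ v → lcp x (key v) / a ≤ Q) E′
    keys≤Q {E′} p = TAll-map {P = λ v → lcp x (key v) ≤ lcpWith x (keys E)} (λ l → /-monoˡ-≤ a l) E′ (All⇒TAll E′ (All.map⁻ (All-resp-↭ (↭-sym p) (All.map⁻ (All.map⁻ (xs≤max 0 (map (lcp x) (keys E))))))))

  module Queries (σ w : ℕ) .{{_ : NonTrivial σ}} .{{_ : NonZero (α σ w)}} {R : ℕ}
                 (L : ℕ) (E : List (Entry σ R)) (t : Tree σ R) (x : Str σ) (r : Rank R) (s : State w)
                 (zip : ZipTrie (LCPCode.encode lcpCode L (α σ w)) E t)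
                 (loaded : Loaded σ w L s t)
                 (query : Holds σ w s (regs s xbaseᴿ) (regs s xfullᴿ) (regs s xtailᴿ) x) where

    open Setting σ w {R} (IsNode s) L E t x public

    zt₀ : ZT enc nothing nothing t
    zt₀ = zipTrie⇒ZT enc zip

    tr₀ : Tr (mem s) (regs s rootᴿ) t
    tr₀ = treeAt⇒tr t (λ _ → refl) (λ q ρ → ρ , λ _ → refl) (Loaded.tree loaded)

    record Unchanged (s′ : State w) : Set where
      field
        mem′  : Agree (mem s) (mem s′)
        regs′ : ∀ r → {T (r <ᵇ 9)} → regs s′ r ≡ regs s r

    open Unchanged

    Located : Mem w → (Str σ → Set) → (Str σ → Str σ → Set) → Word w → Set
    Located m P _≼_ p = (p ≡ null × ∀ y → y ∈ keys E → ¬ P y)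
      ⊎ (Σ[ y ∈ Str σ ] y ∈ keys E × P y × (∀ z → z ∈ keys E → P z → y ≼ z) × IsNode s p × Key m p y)

    isNode′ : ∀ {s′ p} → Unchanged s′ → IsNode s p → IsNode s′ p
    isNode′ {s′} {p} u ρ = subst (λ q → Reach s′ q p) (sym (regs′ u rootᴿ)) (reach-agree (mem′ u) ρ)

    finds : ∀ {m s′ P _≼_ p} → Unchanged s′ → Agree m (mem s′) → Located m P _≼_ p → Finds σ w s′ P _≼_ (keys E) p
    finds u e (inj₁ q) = inj₁ q
    finds u e (inj₂ (y , y∈ , py , best , ρ , k)) = inj₂ (y , y∈ , py , best , isNode′ u ρ ,
      holds-mem (λ i → e textᴬ i) (e baseᴬ _) (e fullᴬ _) (e tailᴬ _) k)

    private
      tree′ : ∀ {s′} → Unchanged s′ → Tr (mem s′) (regs s′ rootᴿ) t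
      tree′ {s′} u = subst (λ p → Tr (mem s′) p t) (sym (regs′ u rootᴿ)) (tr-cong t (mem′ u) tr₀)

      loaded′ : ∀ {s′} → Unchanged s′ → Loaded σ w L s′ t
      loaded′ u = record { tree = tr⇒treeAt t (tree′ u) ; log≡ = trans (cong toℕ (regs′ u logᴿ)) (Loaded.log≡ loaded)
                         ; α≡ = trans (cong toℕ (regs′ u αᴿ)) (Loaded.α≡ loaded) }

      asc⇒agree : ∀ {s′} → Unchanged s′ → ∀ a p → textᴬ < a → a ≤ code⁺ᴬ → mem s′ a p ≡ mem s a p
      asc⇒agree u a p _ l = mem′ u a p {<⇒<ᵇ (s≤s l)}

    module _ {s′ : State w} (u : Unchanged s′) where

      prefix-post : Output σ w prefixSearch (keys E) x s′ → Post σ w prefixSearch L enc E x r s s′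
      prefix-post out = record { tree = t ; zipTrie = zip ; loaded = loaded′ u ; uses = λ p ρ → tr-reach t (tree′ u) ρ
        ; text = λ i → mem′ u textᴬ i ; frame = λ a p l l′ _ → asc⇒agree u a p l l′ ; output = out }

      predecessor-post : Output σ w predecessor (keys E) x s′ → Post σ w predecessor L enc E x r s s′
      predecessor-post out = record { tree = t ; zipTrie = zip ; loaded = loaded′ u ; uses = λ p ρ → tr-reach t (tree′ u) ρ
        ; text = λ i → mem′ u textᴬ i ; frame = λ a p l l′ _ → asc⇒agree u a p l l′ ; output = out }

      successor-post : Output σ w successor (keys E) x s′ → Post σ w successor L enc E x r s s′
      successor-post out = record { tree = t ; zipTrie = zip ; loaded = loaded′ u ; uses = λ p ρ → tr-reach t (tree′ u) ρ
        ; text = λ i → mem′ u textᴬ i ; frame = λ a p l l′ _ → asc⇒agree u a p l l′ ; output = out }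

    module _ (M : Mode) (never-stops : ∀ y → ¬ Mode.Stop M y)
             (al : ∀ π → Along (Mode.Right M) π → OnPath π) where
      open Mode M

      query-search : ∀ {s₁} → Unchanged s₁ →
        Runs (searchC stopE rightE) s₁ (λ s′ τ → (Σ[ o ∈ Search.Outcome M s₁ Q t s′ ] Search.Outcome.subt o ≡ leaf)
          × Fits (β-search stopE rightE) τ)
      query-search {s₁} u = runs-map finish (Search.search-runs M s₁ Q
        (holds-mem (λ i → mem′ u textᴬ i) (regs′ u xbaseᴿ) (regs′ u xfullᴿ) (regs′ u xtailᴿ) query)
        (trans (cong toℕ (regs′ u logᴿ)) (Loaded.log≡ loaded)) (trans (cong toℕ (regs′ u αᴿ)) (Loaded.α≡ loaded))
        (λ r → refl) agree-refl zt₀ (tree′ u) (keys≤Q {t} (ZipTrie.stores zip)))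
        where
        finish : ∀ {s′ τ} → (Σ[ o ∈ Search.Outcome M s₁ Q t s′ ] τ ≤ timeBound startC + κ-search stopE rightE * ((2 + length (Search.Outcome.ctx o)) * suc δ + Q)) →
                 (Σ[ o ∈ Search.Outcome M s₁ Q t s′ ] Search.Outcome.subt o ≡ leaf) × Fits (β-search stopE rightE) τ
        finish {s′} {τ} (o , l) = (o , at-leaf (Search.Outcome.kind o)) ,
          fits-≤ l (fits-+ (fits-const ≤-refl) (fits-path (κ-search stopE rightE) (Search.Outcome.ctx o) (Search.Outcome.subt o) (Search.Outcome.plug≡ o)
              (al (Search.Outcome.ctx o) (dirs⇒along M s₁ Q (Search.Outcome.ctx o) (Search.dirs (Search.Outcome.inv o)))) ≤-refl))
          where
          at-leaf : (Search.Outcome.subt o ≡ leaf × regs s′ foundᴿ ≡ null)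
               ⊎ (Σ[ l ∈ Tree σ R ] Σ[ v ∈ Node σ R ] Σ[ r ∈ Tree σ R ]
                    Search.Outcome.subt o ≡ branch l v r × Stop (key v) × regs s′ foundᴿ ≡ Search.Outcome.addr o) → Search.Outcome.subt o ≡ leaf
          at-leaf (inj₁ (e , _)) = e
          at-leaf (inj₂ (_ , v , _ , _ , st , _)) = contradiction st (never-stops (key v))

      unchanged : ∀ {s₁ s′} → Unchanged s₁ → (o : Search.Outcome M s₁ Q t s′) → Unchanged s′
      unchanged {s₁} u o = record { mem′ = agree-trans (mem′ u) (Search.mem₀ (Search.Outcome.inv o))
        ; regs′ = λ r {l} → trans (Search.regs₀ (Search.Outcome.inv o) r {<⇒<ᵇ (≤-trans (<ᵇ⇒< r 9 l) (m≤m+n 9 2))}) (regs′ u r {l}) }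

    unchanged-refl : Unchanged s
    unchanged-refl = record { mem′ = agree-refl ; regs′ = λ _ → refl }

    set-unchanged : ∀ {s₁} n {_ : T (8 <ᵇ n)} v → Unchanged s₁ → Unchanged (setReg n v s₁)
    set-unchanged {s₁} n {l} v u = record { mem′ = mem′ u ; regs′ = λ r {b} → trans (regs-setReg′ 8 n {l} v s₁ r {b}) (regs′ u r {b}) }

    module _ {M : Mode} {s₀ s′ : State w} (o : Search.Outcome M s₀ Q t s′) (at-leaf : Search.Outcome.subt o ≡ leaf) where
      open Mode M
      module Bounds = Modes.Located σ w {R} (IsNode s) L x M s₀ Q (ZipTrie.stores zip) o at-leaf

      greatest-located : Located (mem s₀) Right (λ y z → z ≤ˢ y) (regs s′ loᴿ)
      greatest-located with Bounds.greatest
      ... | inj₁ (_ , n , none) = inj₁ (n , none)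
      ... | inj₂ (y , _ , y∈ , ry , best , ρ , _ , k) = inj₂ (y , y∈ , ry , best , ρ , k)

      least-located : ∀ {P : Str σ → Set} → (∀ z → P z → ¬ Right z) → (∀ z → ¬ Right z → P z) →
                      Located (mem s₀) P _≤ˢ_ (regs s′ hiᴿ)
      least-located f g with Bounds.least
      ... | inj₁ (_ , n , none) = inj₁ (n , λ z z∈ p → none z z∈ (f z p))
      ... | inj₂ (y , _ , y∈ , ry , best , ρ , _ , k) = inj₂ (y , y∈ , g y ry , (λ z z∈ p → best z z∈ (f z p)) , ρ , k)

    no-stop : ∀ (y : Str σ) → ¬ ⊥
    no-stop _ ()

    predecessor-runs : Runs predecessorC s (λ s′ τ → Post σ w predecessor L enc E x r s s′
      × Fits β-predecessor τ)
    predecessor-runs = runs-seq (query-search lessMode no-stop (λ _ → inj₁) unchanged-refl) λ {s₁} ((o , e) , f) →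
      runs-map (λ { (refl , l) → predecessor-post (u o) (finds (u o) (mem′ (u o)) (greatest-located o e))
                               , fits-+ f (fits-const l) })
        (runs-exec (out₁ᴿ ≔ reg loᴿ) s₁ tt)
      where
      u : ∀ {s₁} → Search.Outcome lessMode s Q t s₁ → Unchanged (setReg out₁ᴿ (regs s₁ loᴿ) s₁)
      u {s₁} o = set-unchanged out₁ᴿ (regs s₁ loᴿ) (unchanged lessMode no-stop (λ _ → inj₁) unchanged-refl o)

    successor-runs : Runs successorC s (λ s′ τ → Post σ w successor L enc E x r s s′
      × Fits β-successor τ)
    successor-runs = runs-seq (query-search moreMode no-stop (λ _ z → inj₂ (inj₁ z)) unchanged-refl) λ {s₁} ((o , e) , f) →
      runs-map (λ { (refl , l) → successor-post (u o) (finds (u o) (mem′ (u o)) (least-located o e (λ z p q → q p) more))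
                               , fits-+ f (fits-const l) })
        (runs-exec (out₁ᴿ ≔ reg hiᴿ) s₁ tt)
      where
      u : ∀ {s₁} → Search.Outcome moreMode s Q t s₁ → Unchanged (setReg out₁ᴿ (regs s₁ hiᴿ) s₁)
      u {s₁} o = set-unchanged out₁ᴿ (regs s₁ hiᴿ) (unchanged moreMode no-stop (λ _ z → inj₂ (inj₁ z)) unchanged-refl o)
      more : ∀ z → ¬ NotMore x z → x <ˢ z
      more z p with <ˢ-cmp x z
      ... | tri< q _ _ = q
      ... | tri≈ q _ _ = contradiction q p
      ... | tri> q _ _ = contradiction q p

    private
      not-beyond : ∀ {y} → ¬ y <ˢ x → ¬ (x <ˢ y × ¬ Prefix _≡_ x y) → Prefix _≡_ x y
      not-beyond {y} p q with <ˢ-cmp x y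
      ... | tri< l _ _ = decidable-stable (prefix? Fin._≟_ x y) λ np → q (l , np)
      ... | tri≈ _ refl _ = Prefix-refl
      ... | tri> _ _ l = contradiction l p

      prefix-not-less : ∀ {y} → Prefix _≡_ x y → ¬ y <ˢ x
      prefix-not-less p q = <ˢ-irrefl (≤ˢ-<ˢ-trans (Prefix⇒≤ˢ p) q)

      in-query : ∀ {s₁} → Unchanged s₁ → Query s₁
      in-query u = holds-mem (λ i → mem′ u textᴬ i) (regs′ u xbaseᴿ) (regs′ u xfullᴿ) (regs′ u xtailᴿ) query

      at-node : ∀ {s₁ p y} → Agree (mem s) (mem s₁) → Key (mem s) p y → regs s₁ vᴿ ≡ p → Current s₁ y
      at-node u k refl = holds-mem (λ i → u textᴬ i) (u baseᴬ _) (u fullᴬ _) (u tailᴬ _) k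

    -- Let `y` be the least key not below `x`. If `y` is beyond the range, then so is every later
    -- key by convexity, and the answer is null. The test needs no scan, since the descent has left
    -- the LCP of `x` and `y` in `lcp⁺ᴿ`.
    hi-filter : ∀ {s₁} (o : Search.Outcome lessMode s Q t s₁) → Search.Outcome.subt o ≡ leaf →
                let s₂ = exec (hiC σ) s₁ in Unchanged s₂ × Located (mem s) (Prefix _≡_ x) _≤ˢ_ (regs s₂ out₁ᴿ)
    hi-filter {s₁} o e with Bounds.least o e
    ... | inj₁ (_ , n , none) = subst (λ s₂ → Unchanged (setReg out₁ᴿ (regs s₂ hiᴿ) s₂) × Located (mem s) (Prefix _≡_ x) _≤ˢ_ (regs s₂ hiᴿ))
        (sym (exec-null {e = reg hiᴿ} {vᴿ ≔ reg hiᴿ ⨾ iᴿ ≔ reg lcp⁺ᴿ ⨾ cond (beyondE σ) (hiᴿ ≔ lit 0) skip} {skip} {s₁} n))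
        (set-unchanged out₁ᴿ (regs s₁ hiᴿ) u₁ , inj₁ (n , λ z z∈ p → none z z∈ (prefix-not-less p)))
      where u₁ = unchanged lessMode no-stop (λ _ → inj₁) unchanged-refl o
    ... | inj₂ (y , hi≡ , y∈ , ¬y<x , best , ρ , nn , k) = subst Goal (sym (exec-nonnull {e = reg hiᴿ} {vᴿ ≔ reg hiᴿ ⨾ iᴿ ≔ reg lcp⁺ᴿ ⨾ cond (beyondE σ) (hiᴿ ≔ lit 0) skip} {skip} {s₁} nn)) (cases D)
      where
      u₁ = unchanged lessMode no-stop (λ _ → inj₁) unchanged-refl o
      s₂ = setReg iᴿ (regs s₁ lcp⁺ᴿ) (setReg vᴿ (regs s₁ hiᴿ) s₁)
      u₂ : Unchanged s₂
      u₂ = set-unchanged iᴿ (regs s₁ lcp⁺ᴿ) (set-unchanged vᴿ (regs s₁ hiᴿ) u₁)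
      Goal : State w → Set
      Goal s₂ = Unchanged (setReg out₁ᴿ (regs s₂ hiᴿ) s₂) × Located (mem s) (Prefix _≡_ x) _≤ˢ_ (regs s₂ hiᴿ)
      D : Decides (beyondE σ) s₂ (x <ˢ y × ¬ Prefix _≡_ x y)
      D = beyond (in-query u₂) (at-node {s₂} (mem′ u₂) k refl)
            (trans (Search.lcp⁺ (Search.Outcome.inv o)) (cong (λ b → lcp∞ x b / a) hi≡)) (trans (cong toℕ (regs′ u₂ αᴿ)) (Loaded.α≡ loaded))
      cases : Decides (beyondE σ) s₂ (x <ˢ y × ¬ Prefix _≡_ x y) → Goal (exec (cond (beyondE σ) (hiᴿ ≔ lit 0) skip) s₂)
      cases D@(decides (yes (x<y , np)) _) = subst Goal (sym (exec-decides {c = hiᴿ ≔ lit 0} {d = skip} D))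
        (set-unchanged out₁ᴿ null (set-unchanged hiᴿ null u₂) , inj₁ (refl , none))
        where
        none : ∀ z → z ∈ keys E → ¬ Prefix _≡_ x z
        none z z∈ pz with best z z∈ (prefix-not-less pz)
        ... | inj₁ y<z = np (Prefix-convex pz x<y y<z)
        ... | inj₂ refl = np pz
      cases D@(decides (no nb) _) = subst Goal (sym (exec-decides {c = hiᴿ ≔ lit 0} {d = skip} D))
        (set-unchanged out₁ᴿ (regs s₁ hiᴿ) u₂ , inj₂ (y , y∈ , not-beyond ¬y<x nb , (λ z z∈ pz → best z z∈ (prefix-not-less pz)) , ρ , k))

    -- Here `y` is the greatest key not beyond the range. If it precedes `x`, then a stored
    -- extension of `x` would be at most `y` and would precede `x` as well, which is absurd.
    lo-filter : ∀ {s₀ s₁} → Unchanged s₀ → (o : Search.Outcome beyondMode s₀ Q t s₁) → Search.Outcome.subt o ≡ leaf →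
                let s₂ = exec loC s₁ in Unchanged s₂ × Agree (mem s₀) (mem s₂) × regs s₂ out₁ᴿ ≡ regs s₁ out₁ᴿ × Located (mem s₀) (Prefix _≡_ x) (λ y z → z ≤ˢ y) (regs s₂ out₂ᴿ)
    lo-filter {s₀} {s₁} u₀ o e with Bounds.greatest o e
    ... | inj₁ (_ , n , none) = subst (λ s₂ → Unchanged (setReg out₂ᴿ (regs s₂ loᴿ) s₂) × Agree (mem s₀) (mem s₂) × regs s₂ out₁ᴿ ≡ regs s₁ out₁ᴿ × Located (mem s₀) (Prefix _≡_ x) (λ y z → z ≤ˢ y) (regs s₂ loᴿ))
        (sym (exec-null {e = reg loᴿ} {vᴿ ≔ reg loᴿ ⨾ iᴿ ≔ reg lcp⁻ᴿ ⨾ cond vLessE (loᴿ ≔ lit 0) skip} {skip} {s₁} n))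
        (set-unchanged out₂ᴿ (regs s₁ loᴿ) u₁ , Search.mem₀ (Search.Outcome.inv o) , refl , inj₁ (n , λ z z∈ p → none z z∈ λ q → proj₂ q p))
      where u₁ = unchanged beyondMode no-stop (λ _ z → inj₂ (inj₂ z)) u₀ o
    ... | inj₂ (y , lo≡ , y∈ , nb , best , ρ , nn , k) = subst Goal (sym (exec-nonnull {e = reg loᴿ} {vᴿ ≔ reg loᴿ ⨾ iᴿ ≔ reg lcp⁻ᴿ ⨾ cond vLessE (loᴿ ≔ lit 0) skip} {skip} {s₁} nn)) (cases D)
      where
      m₀ = Search.mem₀ (Search.Outcome.inv o)
      u₁ = unchanged beyondMode no-stop (λ _ z → inj₂ (inj₂ z)) u₀ o
      s₂ = setReg iᴿ (regs s₁ lcp⁻ᴿ) (setReg vᴿ (regs s₁ loᴿ) s₁)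
      u₂ : Unchanged s₂
      u₂ = set-unchanged iᴿ (regs s₁ lcp⁻ᴿ) (set-unchanged vᴿ (regs s₁ loᴿ) u₁)
      Goal : State w → Set
      Goal s₂ = Unchanged (setReg out₂ᴿ (regs s₂ loᴿ) s₂) × Agree (mem s₀) (mem s₂) × regs s₂ out₁ᴿ ≡ regs s₁ out₁ᴿ × Located (mem s₀) (Prefix _≡_ x) (λ y z → z ≤ˢ y) (regs s₂ loᴿ)
      D : Decides vLessE s₂ (y <ˢ x)
      D = vLess (in-query u₂) (holds-mem (λ i → m₀ textᴬ i) (m₀ baseᴬ _) (m₀ fullᴬ _) (m₀ tailᴬ _) k)
            (trans (Search.lcp⁻ (Search.Outcome.inv o)) (cong (λ b → lcp∞ x b / a) lo≡))
      cases : Decides vLessE s₂ (y <ˢ x) → Goal (exec (cond vLessE (loᴿ ≔ lit 0) skip) s₂)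
      cases D@(decides (yes y<x) _) = subst Goal (sym (exec-decides {c = loᴿ ≔ lit 0} {d = skip} D))
        (set-unchanged out₂ᴿ null (set-unchanged loᴿ null u₂) , m₀ , refl , inj₁ (refl , λ z z∈ pz →
          prefix-not-less pz (≤ˢ-<ˢ-trans (best z z∈ λ q → proj₂ q pz) y<x)))
      cases D@(decides (no ¬y<x) _) = subst Goal (sym (exec-decides {c = loᴿ ≔ lit 0} {d = skip} D))
        (set-unchanged out₂ᴿ (regs s₁ loᴿ) u₂ , m₀ , refl , inj₂ (y , y∈ , not-beyond ¬y<x nb , (λ z z∈ pz → best z z∈ λ q → proj₂ q pz) , ρ , k))

    prefix-runs : Runs (prefixSearchC σ) s (λ s′ τ → Post σ w prefixSearch L enc E x r s s′ × Fits (β-prefix σ) τ)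
    prefix-runs = runs-seq (query-search lessMode no-stop (λ _ → inj₁) unchanged-refl) λ {s₁} {τ₁} ((o₁ , e₁) , f₁) →
      runs-straight {c = (hiC σ)} _ λ {τ₂} l₂ →
      runs-seq (query-search beyondMode no-stop (λ _ z → inj₂ (inj₂ z)) (proj₁ (hi-filter o₁ e₁))) λ {s₃} {τ₃} ((o₃ , e₃) , f₃) →
      runs-map (λ { {_} {τ₄} (refl , l₄) → finish o₁ e₁ o₃ e₃ , fits-+ f₁ (fits-+ (fits-const l₂) (fits-+ f₃ (fits-const l₄))) })
        (runs-exec loC s₃ _)
      where
      finish : ∀ {s₁ s₃} (o₁ : Search.Outcome lessMode s Q t s₁) → Search.Outcome.subt o₁ ≡ leaf →
               (o₃ : Search.Outcome beyondMode (exec (hiC σ) s₁) Q t s₃) → Search.Outcome.subt o₃ ≡ leaf →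
               Post σ w prefixSearch L enc E x r s (exec loC s₃)
      finish {s₁} {s₃} o₁ e₁ o₃ e₃ with hi-filter o₁ e₁
      ... | u₂ , first with lo-filter u₂ o₃ e₃
      ...   | u₄ , m₄ , out≡ , second = prefix-post u₄ (finds u₄ (mem′ u₄) (subst (Located (mem s) (Prefix _≡_ x) _≤ˢ_) (sym (trans out≡ (Search.regs₀ (Search.Outcome.inv o₃) out₁ᴿ))) first)
                                      , finds u₄ m₄ second)

-- Restoring child pointers along a search path.

module Relinking where

  open import Defs renaming (_⨾_ to infixr 4 _⨾_; _≔_ to infix 5 _≔_; _[_]≔_ to infix 5 _[_]≔_)
  open StringOrder
  open Words
  open ProgramLogic
  open Zippers
  open Comparison
  open MemoryLayout
  open TrieDescent
  open Boundaries
  open QueryOperations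
  open import Data.Bool using (true; false; T)
  open import Data.List using (List; []; _∷_; length)
  open import Data.Maybe using (just)
  open import Data.Nat
  open import Data.Nat.DivMod
  open import Data.Nat.Properties
  open import Data.Product using (_×_; _,_; proj₁; proj₂; Σ-syntax; ∃-syntax)
  open import Data.Sum using (inj₁; inj₂)
  open import Data.Unit using (⊤; tt)
  open import Relation.Binary.PropositionalEquality hiding ([_])
  open import Relation.Nullary using (¬_; contradiction)

  curᴿ : Reg
  curᴿ = 26

  -- All child pointers on the path are rewritten, even those still correct: this costs no more than
  -- the path length and spares a case distinction at the place where the tree changed.
  relinkBodyC relinkC : Cmd
  relinkBodyC =
    cond (dirᴬ [ reg prevᴿ ]) (rightᴬ [ reg prevᴿ ]≔ reg curᴿ) (leftᴬ [ reg prevᴿ ]≔ reg curᴿ) ⨾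
    curᴿ ≔ reg prevᴿ ⨾ prevᴿ ≔ parentᴬ [ reg prevᴿ ]
  relinkC = while (reg prevᴿ) relinkBodyC ⨾ rootᴿ ≔ reg curᴿ

  κ-relink : ℕ
  κ-relink = 2 + timeBound relinkBodyC

  module _ {σ R : ℕ} (enc : ℕ → ℕ) where

    hole-pop : ∀ {f : Frame {σ} {R}} {π u} → Hole enc (f ∷ π) u → Hole enc π (fill f u)
    hole-pop {u = u} (hole (right c b bl zl zc) z t) = hole zc (branch c bl (belowCT⇒below u t) zl z) b
    hole-pop {u = u} (hole (left c b br zr zc) z t) = hole zc (branch c (belowCT⇒below u t) br z zr) b

  module Rebuild (σ w : ℕ) .{{_ : NonTrivial σ}} .{{_ : NonZero (α σ w)}} {R : ℕ} (U : Word w → Set)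
                 (L : ℕ) (E : List (Entry σ R)) (t : Tree σ R) (x : Str σ) where

    open Setting σ w {R} U L E t x public

    -- Only nodes in U are written.
    record Kept (m m′ : Mem w) : Set where
      field
        text₌  : ∀ i → m′ textᴬ i ≡ m textᴬ i
        frame₌ : ∀ a p → {T (a <ᵇ 10)} → ¬ U p → m′ a p ≡ m a p

    open Kept public

    kept-trans : ∀ {m m′ m″} → Kept m m′ → Kept m′ m″ → Kept m m″
    kept-trans k k′ = record { text₌ = λ i → trans (text₌ k′ i) (text₌ k i)
                             ; frame₌ = λ a p {l} n → trans (frame₌ k′ a p {l} n) (frame₌ k a p {l} n) }

    kept-agree : ∀ {m m′} → Agree m m′ → Kept m m′
    kept-agree e = record { text₌ = λ i → e textᴬ i ; frame₌ = λ a p {l} _ → e a p {l} }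

    kept-update : ∀ {p m m′} → U p → Update p m m′ → Kept m m′
    kept-update u e = record { text₌ = λ i → low e textᴬ i ; frame₌ = λ a q n → other e a q λ { refl → n u } }

    apart-right : ∀ {y hi} t → ZT {σ} {R} enc (just y) hi t → Apart y t
    apart-right t z = TAll-map <ˢ⇒≢ t (zt-lo enc t z)

    apart-left : ∀ {y lo} t → ZT {σ} {R} enc lo (just y) t → Apart y t
    apart-left t z = TAll-map (λ p e → <ˢ⇒≢ p (sym e)) t (zt-hi enc t z)

    hole-apart : ∀ d {v t π u} → Hole enc (frame d v t ∷ π) u → Apart (key v) t × Apart (key v) u × ApartC (key v) π
    hole-apart true {v} {l} {π} {u} (hole (right c b bl zl zc) z _) = apart-left l zl , apart-right u z , zc-apart enc zc (Codes.lo< c) (Codes.<hi c)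
    hole-apart false {v} {r} {π} {u} (hole (left c b br zr zc) z _) = apart-right r zr , apart-left u z , zc-apart enc zc (Codes.lo< c) (Codes.<hi c)

    -- The pointer written at `p` is the one that `Path` left open. The write cannot reach the
    -- subtrees or the rest of the path, whose keys differ from the key at `p`.
    relink-loop : ∀ π {u s} → Hole enc π u → Tr (mem s) (regs s curᴿ) u → Path (mem s) (mem s) (regs s prevᴿ) π →
      Runs (while (reg prevᴿ) relinkBodyC) s (λ s′ τ → (Tr (mem s′) (regs s′ curᴿ) (plug π u) × Kept (mem s) (mem s′)
        × (∀ r → {T (r <ᵇ 11)} → regs s′ r ≡ regs s r)) × τ ≤ κ-relink * suc (length π))
    relink-loop [] h tr z = _ , _ , ⇓done z , (tr , kept-agree agree-refl , λ _ → refl) ,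
      ≤-trans (m≤m+n 2 (timeBound relinkBodyC)) (≤-reflexive (sym (*-identityʳ κ-relink)))
    relink-loop (frame d v t ∷ π) {u} {s} h tr (U∈ , n , ts , dir , path) = step d refl (⇓exec′ relinkBodyC s _)
      where
      p = regs s prevᴿ
      Goal : Set
      Goal = Runs (while (reg prevᴿ) relinkBodyC) s (λ s′ τ → (Tr (mem s′) (regs s′ curᴿ) (plug (frame d v t ∷ π) u) × Kept (mem s) (mem s′)
        × (∀ r → {T (r <ᵇ 11)} → regs s′ r ≡ regs s r)) × τ ≤ κ-relink * suc (suc (length π)))
      apart = hole-apart d h
      s₁ : Array → State w
      s₁ b = setReg prevᴿ (mem s parentᴬ p) (setReg curᴿ p (setMem b p (regs s curᴿ) s))
      regs₁ : ∀ b r → {T (r <ᵇ 11)} → regs (s₁ b) r ≡ regs s r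
      regs₁ b r {l} = trans (regs-setReg prevᴿ (mem s parentᴬ p) (setReg curᴿ p (setMem b p (regs s curᴿ) s)) r {l}) (regs-setReg curᴿ p (setMem b p (regs s curᴿ) s) r {l})
      continue : ∀ b {τ₁} → Update p (mem s) (mem (s₁ b)) → ⟨ relinkBodyC , s ⟩⇓⟨ s₁ b , τ₁ ⟩ → τ₁ ≤ timeBound relinkBodyC →
                 Runs (while (reg prevᴿ) relinkBodyC) (s₁ b) (λ s′ τ → (Tr (mem s′) (regs s′ curᴿ) (plug π (fill (frame d v t) u)) × Kept (mem (s₁ b)) (mem s′)
                   × (∀ r → {T (r <ᵇ 11)} → regs s′ r ≡ regs (s₁ b) r)) × τ ≤ κ-relink * suc (length π)) → Goal
      continue b up run₁ l₁ (s₂ , τ₂ , run₂ , (tr₂ , k₂ , r₂) , l₂) = s₂ , _ , ⇓loop (NodeAt.nonnull n) run₁ run₂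
        , (tr₂ , kept-trans (kept-update U∈ up) k₂ , λ r {l} → trans (r₂ r {l}) (regs₁ b r {l}))
        , ≤-trans (+-mono-≤ (+-monoʳ-≤ 2 l₁) l₂) (≤-reflexive (sym (*-suc κ-relink (suc (length π)))))
      step : ∀ d′ → d ≡ d′ → Σ[ τ ∈ ℕ ] ⟨ relinkBodyC , s ⟩⇓⟨ exec relinkBodyC s , τ ⟩ × τ ≤ timeBound relinkBodyC → Goal
      step true refl (τ₁ , run₁ , l₁) = continue rightᴬ up (subst (λ s′ → ⟨ relinkBodyC , s ⟩⇓⟨ s′ , τ₁ ⟩)
          (cong (exec (curᴿ ≔ reg prevᴿ ⨾ prevᴿ ≔ parentᴬ [ reg prevᴿ ])) (exec-cond {e = dirᴬ [ reg prevᴿ ]} {rightᴬ [ reg prevᴿ ]≔ reg curᴿ} {leftᴬ [ reg prevᴿ ]≔ reg curᴿ} dir)) run₁) l₁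
        (relink-loop π (hole-pop enc h)
          (U∈ , node-update (λ _ → refl) refl refl refl refl refl (NodeAt.code⁻≡ n) (NodeAt.code⁺≡ n) n
            , tr-update up (NodeAt.key≡ n) t (proj₁ apart) ts
            , subst (λ q → Tr (mem (s₁ rightᴬ)) q u) (sym (if-same p)) (tr-update up (NodeAt.key≡ n) u (proj₁ (proj₂ apart)) tr))
          (path-update up (NodeAt.key≡ n) π up (proj₂ (proj₂ apart)) path))
        where
        up : Update p (mem s) (mem (s₁ rightᴬ))
        up = update-setMem rightᴬ p (regs s curᴿ) s
      step false refl (τ₁ , run₁ , l₁) = continue leftᴬ up (subst (λ s′ → ⟨ relinkBodyC , s ⟩⇓⟨ s′ , τ₁ ⟩)
          (cong (exec (curᴿ ≔ reg prevᴿ ⨾ prevᴿ ≔ parentᴬ [ reg prevᴿ ])) (exec-cond {e = dirᴬ [ reg prevᴿ ]} {rightᴬ [ reg prevᴿ ]≔ reg curᴿ} {leftᴬ [ reg prevᴿ ]≔ reg curᴿ} dir)) run₁) l₁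
        (relink-loop π (hole-pop enc h)
          (U∈ , node-update (λ _ → refl) refl refl refl refl refl (NodeAt.code⁻≡ n) (NodeAt.code⁺≡ n) n
            , subst (λ q → Tr (mem (s₁ leftᴬ)) q u) (sym (if-same p)) (tr-update up (NodeAt.key≡ n) u (proj₁ (proj₂ apart)) tr)
            , tr-update up (NodeAt.key≡ n) t (proj₁ apart) ts)
          (path-update up (NodeAt.key≡ n) π up (proj₂ (proj₂ apart)) path))
        where
        up : Update p (mem s) (mem (s₁ leftᴬ))
        up = update-setMem leftᴬ p (regs s curᴿ) s

    relink-runs : ∀ π {u s} → Hole enc π u → Tr (mem s) (regs s curᴿ) u → Path (mem s) (mem s) (regs s prevᴿ) π →
      Runs relinkC s (λ s′ τ → (Tr (mem s′) (regs s′ rootᴿ) (plug π u) × Kept (mem s) (mem s′)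
        × regs s′ logᴿ ≡ regs s logᴿ × regs s′ αᴿ ≡ regs s αᴿ)
        × τ ≤ κ-relink * suc (length π) + timeBound (rootᴿ ≔ reg curᴿ))
    relink-runs π h tr path = runs-seq (relink-loop π h tr path) λ {s₁} ((tr₁ , k₁ , r₁) , l₁) →
      runs-map (λ { (refl , l₂) → (tr₁ , k₁ , r₁ logᴿ , r₁ αᴿ) , +-mono-≤ l₁ l₂ }) (runs-exec (rootᴿ ≔ reg curᴿ) s₁ _)

    -- No frame holds `x` itself, so such a path leads to the boundaries of `Less` and of `NotMore`
    -- alike (`around⇒along`).
    Around : Ctx {σ} {R} → Set
    Around [] = ⊤
    Around (frame true v _ ∷ π)  = key v <ˢ x × Around π
    Around (frame false v _ ∷ π) = x <ˢ key v × Around π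

    around-lo : ∀ π → Around π → loOf π <₋ x
    around-lo [] _ = tt
    around-lo (frame true v _ ∷ π) (p , _) = p
    around-lo (frame false v _ ∷ π) (_ , q) = around-lo π q

    around-hi : ∀ π → Around π → x <₊ hiOf π
    around-hi [] _ = tt
    around-hi (frame true v _ ∷ π) (_ , q) = around-hi π q
    around-hi (frame false v _ ∷ π) (p , _) = p

    dirs⇒around : ∀ {s₀} π → Search.Dirs exactMode s₀ Q π → Around π
    dirs⇒around [] _ = tt
    dirs⇒around {s₀} (frame true v _ ∷ π) (p , _ , q) = p , dirs⇒around {s₀} π q
    dirs⇒around {s₀} (frame false v _ ∷ π) (p , ne , q) with ≮ˢ⇒≥ˢ p
    ... | inj₁ l = l , dirs⇒around {s₀} π q
    ... | inj₂ e = contradiction e ne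

    around⇒along : ∀ π → Around π → Along (Less x) π × Along (NotMore x) π
    around⇒along [] _ = tt , tt
    around⇒along (frame true v _ ∷ π) (p , q) with around⇒along π q
    ... | l , m = (p , l) , (<ˢ-asym p , m)
    around⇒along (frame false v _ ∷ π) (p , q) with around⇒along π q
    ... | l , m = (<ˢ-asym p , l) , ((λ n → n p) , m)

-- Unzipping the search path for an insertion.

module InsertionPath where

  open import Defs renaming (_⨾_ to infixr 4 _⨾_; _≔_ to infix 5 _≔_; _[_]≔_ to infix 5 _[_]≔_)
  open StringOrder
  open Words
  open ProgramLogic
  open Zippers
  open Comparison
  open MemoryLayout
  open TrieDescent
  open Boundaries
  open QueryOperations
  open Relinking
  open import Data.Bool using (true; false; if_then_else_; T)
  import Data.Fin as Fin
  import Data.Fin.Properties as Fin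
  open import Data.List using (List; []; _∷_; _++_; length)
  open import Data.List.Properties using (++-assoc)
  open import Data.List.Membership.Propositional using (_∈_)
  open import Data.Maybe using (just)
  open import Data.Nat
  open import Data.Nat.DivMod
  open import Data.Nat.Properties
  open import Data.Product using (_×_; _,_; proj₁; proj₂; Σ-syntax; ∃-syntax)
  open import Data.Sum using (_⊎_; inj₁; inj₂)
  open import Data.Unit using (tt)
  open import Relation.Binary.PropositionalEquality hiding ([_])
  open import Relation.Nullary using (yes; no; contradiction)

  smallᴿ largeᴿ : Reg
  smallᴿ = 24
  largeᴿ = 25

  beatsE unwindE : Expr
  beatsE = op or (op lt (rank₁ᴬ [ reg prevᴿ ]) (reg xrank₁ᴿ))
    (op and (op eq (rank₁ᴬ [ reg prevᴿ ]) (reg xrank₁ᴿ))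
      (op or (op lt (rank₂ᴬ [ reg prevᴿ ]) (reg xrank₂ᴿ))
        -- Equal ranks are won by the smaller key, and `x` is smaller than the ancestor exactly if
        -- the path turned left there, so no strings are compared.
        (op and (op eq (rank₂ᴬ [ reg prevᴿ ]) (reg xrank₂ᴿ)) (notE (dirᴬ [ reg prevᴿ ])))))
  -- Both conjuncts are always evaluated; at the null address `beatsE` reads arbitrary words, which
  -- the first conjunct masks.
  unwindE = op and (op lt (lit 0) (reg prevᴿ)) beatsE

  toSmallC toLargeC popC unwindBodyC unwindC makeC createC insertC : Cmd
  toSmallC = rightᴬ [ reg prevᴿ ]≔ reg smallᴿ ⨾ code⁺ᴬ [ reg prevᴿ ]≔ encodeE (lcpᴬ [ reg prevᴿ ]) ⨾ smallᴿ ≔ reg prevᴿ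
  toLargeC = leftᴬ [ reg prevᴿ ]≔ reg largeᴿ ⨾ code⁻ᴬ [ reg prevᴿ ]≔ encodeE (lcpᴬ [ reg prevᴿ ]) ⨾ largeᴿ ≔ reg prevᴿ
  popC = lcp⁻ᴿ ≔ lcp⁻ᴬ [ reg prevᴿ ] ⨾ lcp⁺ᴿ ≔ lcp⁺ᴬ [ reg prevᴿ ] ⨾ prevᴿ ≔ parentᴬ [ reg prevᴿ ]
  unwindBodyC = cond (dirᴬ [ reg prevᴿ ]) toSmallC toLargeC ⨾ popC
  unwindC = while unwindE unwindBodyC
  makeC = leftᴬ [ reg freshᴿ ]≔ reg smallᴿ ⨾ rightᴬ [ reg freshᴿ ]≔ reg largeᴿ ⨾
          code⁻ᴬ [ reg freshᴿ ]≔ encodeE (reg lcp⁻ᴿ) ⨾ code⁺ᴬ [ reg freshᴿ ]≔ encodeE (reg lcp⁺ᴿ) ⨾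
          curᴿ ≔ reg freshᴿ
  createC = baseᴬ [ reg freshᴿ ]≔ reg xbaseᴿ ⨾ fullᴬ [ reg freshᴿ ]≔ reg xfullᴿ ⨾ tailᴬ [ reg freshᴿ ]≔ reg xtailᴿ ⨾
            rank₁ᴬ [ reg freshᴿ ]≔ reg xrank₁ᴿ ⨾ rank₂ᴬ [ reg freshᴿ ]≔ reg xrank₂ᴿ
  insertC = createC ⨾ searchC equalE vLessE ⨾
            cond (reg foundᴿ) skip ((smallᴿ ≔ lit 0 ⨾ largeᴿ ≔ lit 0) ⨾ unwindC ⨾ makeC ⨾ relinkC)

  module Insertion (σ w : ℕ) .{{_ : NonTrivial σ}} .{{_ : NonZero (α σ w)}} {R : ℕ} (U : Word w → Set)
                   (L : ℕ) (E : List (Entry σ R)) (t : Tree σ R) (x : Str σ) (r : Rank R)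
                   (s₀ : State w) (log₀ : toℕ (regs s₀ logᴿ) ≡ L)
                   (rank₁₀ : toℕ (regs s₀ xrank₁ᴿ) ≡ proj₁ r) (rank₂₀ : toℕ (regs s₀ xrank₂ᴿ) ≡ Fin.toℕ (proj₂ r))
                   (P S : List (Entry σ R)) where

    open Rebuild σ w {R} U L E t x public

    private
      f = regs s₀ freshᴿ

    -- `A` and `B` collect what lies below and above `x` in the part of the path already unzipped.
    -- `x` bounds both before it is in the tree; `P` and `S` pin down the sequence of entries on
    -- either side of it.
    record Unwinding (s : State w) (π : Ctx) (A B : Tree σ R) : Set where
      field
        regs₀  : ∀ r → {T (r <ᵇ 11)} → regs s r ≡ regs s₀ r
        kept   : Kept (mem s₀) (mem s)
        zc     : ZC enc π
        around : Around π
        zA     : ZT enc (loOf π) (just x) A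
        zB     : ZT enc (just x) (hiOf π) B
        topA   : BelowCT π A
        topB   : BelowCT π B
        xA     : Below (x , r) A
        xB     : Below (x , r) B
        trA    : Tr (mem s) (regs s smallᴿ) A
        trB    : Tr (mem s) (regs s largeᴿ) B
        path   : Path (mem s) (mem s) (regs s prevᴿ) π
        lcps   : Lcps (mem s) (regs s prevᴿ) π
        lcp⁻   : toℕ (regs s lcp⁻ᴿ) ≡ lcp∞ x (loOf π) / a
        lcp⁺   : toℕ (regs s lcp⁺ᴿ) ≡ lcp∞ x (hiOf π) / a
        keyF   : Key (mem s) f x
        rank₁F : mem s rank₁ᴬ f ≡ mem s₀ rank₁ᴬ f
        rank₂F : mem s rank₂ᴬ f ≡ mem s₀ rank₂ᴬ f
        pre≡   : pre π ++ entries A ≡ P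
        post≡  : entries B ++ post π ≡ S

    private
      regs-pop : ∀ n {l : T (10 <ᵇ n)} u₁ u₂ u₃ u₄ (s : State w) r → {T (r <ᵇ 11)} →
                 regs (setReg prevᴿ u₄ (setReg lcp⁺ᴿ u₃ (setReg lcp⁻ᴿ u₂ (setReg n u₁ s)))) r ≡ regs s r
      regs-pop n {l} u₁ u₂ u₃ u₄ s r {b} = trans (regs-setReg prevᴿ u₄ (setReg lcp⁺ᴿ u₃ (setReg lcp⁻ᴿ u₂ (setReg n u₁ s))) r {b})
        (trans (regs-setReg lcp⁺ᴿ u₃ (setReg lcp⁻ᴿ u₂ (setReg n u₁ s)) r {b}) (trans (regs-setReg lcp⁻ᴿ u₂ (setReg n u₁ s) r {b}) (regs-setReg n {l} u₁ s r {b})))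

      code-x : ∀ (y : Str σ) → float (lcp x y / a) ≡ enc (lcp∞ y (just x))
      code-x y = cong (λ k → float (k / a)) (lcp-comm x y)

    module _ {s : State w} {π v l A B} (i : Unwinding s (frame true v l ∷ π) A B) (beats : (x , r) Beats entry v) where
      open Unwinding i
      private
        p = regs s prevᴿ
        U∈ = proj₁ path
        nd = proj₁ (proj₂ path)
        tl = proj₁ (proj₂ (proj₂ path))
        path↑ = proj₂ (proj₂ (proj₂ (proj₂ path)))
        s₁ = setMem rightᴬ p (regs s smallᴿ) s
        s₂ = exec (toSmallC ⨾ popC) s
        c = ⟦ encodeE (lcpᴬ [ reg prevᴿ ]) ⟧ s₁
        v′ = node (key v) (rank v) (code⁻ v) (enc (lcp∞ (key v) (just x)))
        up : Update p (mem s) (mem s₂)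
        up = update-trans (update-setMem rightᴬ p (regs s smallᴿ) s) (update-setMem code⁺ᴬ p c s₁)
        c≡ : toℕ c ≡ enc (lcp∞ (key v) (just x))
        c≡ = trans (⟦encodeE⟧ (lcpᴬ [ reg prevᴿ ]) {s₁} (trans (cong toℕ (regs₀ logᴿ)) log₀) (proj₁ lcps)) (code-x (key v))
        popped : Codes enc (loOf π) (hiOf π) v × BelowC π (entry v) × Below (entry v) l × ZT enc (loOf π) (just (key v)) l × ZC enc π
        popped with Unwinding.zc i
        ... | right k bc bl zl zc↑ = k , bc , bl , zl , zc↑
        k = proj₁ popped
        apartπ = zc-apart enc (proj₂ (proj₂ (proj₂ (proj₂ popped)))) (Codes.lo< k) (Codes.<hi k)
        v<x = proj₁ around
        f≢p : f ≢ p
        f≢p e = <ˢ⇒≢ v<x (key-injective {mem s} (NodeAt.key≡ nd) (subst (λ q → Key (mem s) q x) e keyF))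

      -- Moving `v` below `x` makes `x` its new upper bound, and their LCP was recorded at `v` on
      -- the way down. The lower bound of `v`, and with it `code⁻`, stays.
      unwind-right : Unwinding s₂ π (branch l v′ A) B
      unwind-right = record
        { regs₀ = λ r {b} → trans (regs-pop smallᴿ p (mem s lcp⁻ᴬ p) (mem s lcp⁺ᴬ p) (mem s parentᴬ p) (setMem code⁺ᴬ p c s₁) r {b}) (regs₀ r {b})
        ; kept = kept-trans kept (kept-update U∈ up)
        ; zc = proj₂ (proj₂ (proj₂ (proj₂ popped)))
        ; around = proj₂ around
        ; zA = branch (codes (Codes.lo< k) v<x (Codes.code⁻≡ k) refl) (proj₁ (proj₂ (proj₂ popped))) (belowCT⇒below A topA) (proj₁ (proj₂ (proj₂ (proj₂ popped)))) zA
        ; zB = zB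
        ; topA = proj₁ (proj₂ popped)
        ; topB = belowC-trans π B (proj₁ (proj₂ popped)) (belowCT⇒below B topB)
        ; xA = beats
        ; xB = xB
        ; trA = U∈ , node-update (λ _ → refl) refl refl refl refl refl (NodeAt.code⁻≡ nd) (trans (cong toℕ (if-same p)) c≡) nd
            , tr-update up (NodeAt.key≡ nd) l (apart-left l (proj₁ (proj₂ (proj₂ (proj₂ popped))))) tl
            , subst (λ q → Tr (mem s₂) q A) (sym (if-same p)) (tr-update up (NodeAt.key≡ nd) A (apart-right A zA) trA)
        ; trB = tr-update up (NodeAt.key≡ nd) B (TAll-map (λ q → <ˢ⇒≢ (<ˢ-trans v<x q)) B (zt-lo enc B zB)) trB
        ; path = path-update up (NodeAt.key≡ nd) π up apartπ path↑
        ; lcps = lcps-update π up (NodeAt.key≡ nd) apartπ path↑ (proj₂ (proj₂ (proj₂ lcps)))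
        ; lcp⁻ = proj₁ (proj₂ lcps)
        ; lcp⁺ = proj₁ (proj₂ (proj₂ lcps))
        ; keyF = key-cong (low up) keyF
        ; rank₁F = trans (other up rank₁ᴬ f f≢p) rank₁F
        ; rank₂F = trans (other up rank₂ᴬ f f≢p) rank₂F
        ; pre≡ = trans (trans (cong (pre π ++_) (trans (entries-branch l v′ A) (sym (++-assoc (entries l) (entry v ∷ []) (entries A)))))
                   (sym (++-assoc (pre π) (entries l ++ entry v ∷ []) (entries A)))) pre≡
        ; post≡ = post≡
        }

    module _ {s : State w} {π v l A B} (i : Unwinding s (frame false v l ∷ π) A B) (beats : (x , r) Beats entry v) where
      open Unwinding i
      private
        p = regs s prevᴿ
        U∈ = proj₁ path
        nd = proj₁ (proj₂ path)
        tl = proj₁ (proj₂ (proj₂ path))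
        path↑ = proj₂ (proj₂ (proj₂ (proj₂ path)))
        s₁ = setMem leftᴬ p (regs s largeᴿ) s
        s₂ = exec (toLargeC ⨾ popC) s
        c = ⟦ encodeE (lcpᴬ [ reg prevᴿ ]) ⟧ s₁
        v′ = node (key v) (rank v) (enc (lcp∞ (key v) (just x))) (code⁺ v)
        up : Update p (mem s) (mem s₂)
        up = update-trans (update-setMem leftᴬ p (regs s largeᴿ) s) (update-setMem code⁻ᴬ p c s₁)
        c≡ : toℕ c ≡ enc (lcp∞ (key v) (just x))
        c≡ = trans (⟦encodeE⟧ (lcpᴬ [ reg prevᴿ ]) {s₁} (trans (cong toℕ (regs₀ logᴿ)) log₀) (proj₁ lcps)) (code-x (key v))
        popped : Codes enc (loOf π) (hiOf π) v × BelowC π (entry v) × Below (entry v) l × ZT enc (just (key v)) (hiOf π) l × ZC enc π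
        popped with Unwinding.zc i
        ... | left k bc bl zl zc↑ = k , bc , bl , zl , zc↑
        k = proj₁ popped
        apartπ = zc-apart enc (proj₂ (proj₂ (proj₂ (proj₂ popped)))) (Codes.lo< k) (Codes.<hi k)
        x<v = proj₁ around
        f≢p : f ≢ p
        f≢p e = <ˢ⇒≢ x<v (key-injective {mem s} (subst (λ q → Key (mem s) q x) e keyF) (NodeAt.key≡ nd))

      unwind-left : Unwinding s₂ π A (branch B v′ l)
      unwind-left = record
        { regs₀ = λ r {b} → trans (regs-pop largeᴿ p (mem s lcp⁻ᴬ p) (mem s lcp⁺ᴬ p) (mem s parentᴬ p) (setMem code⁻ᴬ p c s₁) r {b}) (regs₀ r {b})
        ; kept = kept-trans kept (kept-update U∈ up)
        ; zc = proj₂ (proj₂ (proj₂ (proj₂ popped)))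
        ; around = proj₂ around
        ; zA = zA
        ; zB = branch (codes x<v (Codes.<hi k) refl (Codes.code⁺≡ k)) (belowCT⇒below B topB) (proj₁ (proj₂ (proj₂ popped))) zB (proj₁ (proj₂ (proj₂ (proj₂ popped))))
        ; topA = belowC-trans π A (proj₁ (proj₂ popped)) (belowCT⇒below A topA)
        ; topB = proj₁ (proj₂ popped)
        ; xA = xA
        ; xB = beats
        ; trA = tr-update up (NodeAt.key≡ nd) A (TAll-map (λ q e → <ˢ⇒≢ (<ˢ-trans q x<v) (sym e)) A (zt-hi enc A zA)) trA
        ; trB = U∈ , node-update (λ _ → refl) refl refl refl refl refl (trans (cong toℕ (if-same p)) c≡) (NodeAt.code⁺≡ nd) nd
            , subst (λ q → Tr (mem s₂) q B) (sym (if-same p)) (tr-update up (NodeAt.key≡ nd) B (apart-left B zB) trB)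
            , tr-update up (NodeAt.key≡ nd) l (apart-right l (proj₁ (proj₂ (proj₂ (proj₂ popped))))) tl
        ; path = path-update up (NodeAt.key≡ nd) π up apartπ path↑
        ; lcps = lcps-update π up (NodeAt.key≡ nd) apartπ path↑ (proj₂ (proj₂ (proj₂ lcps)))
        ; lcp⁻ = proj₁ (proj₂ lcps)
        ; lcp⁺ = proj₁ (proj₂ (proj₂ lcps))
        ; keyF = key-cong (low up) keyF
        ; rank₁F = trans (other up rank₁ᴬ f f≢p) rank₁F
        ; rank₂F = trans (other up rank₂ᴬ f f≢p) rank₂F
        ; pre≡ = pre≡
        ; post≡ = trans (trans (cong (_++ post π) (entries-branch B v′ l)) (++-assoc (entries B) (entry v ∷ entries l) (post π))) post≡
        }

    private
      RawBeats : State w → Set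
      RawBeats s = toℕ (mem s rank₁ᴬ (regs s prevᴿ)) < toℕ (regs s xrank₁ᴿ)
        ⊎ (toℕ (mem s rank₁ᴬ (regs s prevᴿ)) ≡ toℕ (regs s xrank₁ᴿ)
          × (toℕ (mem s rank₂ᴬ (regs s prevᴿ)) < toℕ (regs s xrank₂ᴿ)
            ⊎ (toℕ (mem s rank₂ᴬ (regs s prevᴿ)) ≡ toℕ (regs s xrank₂ᴿ)
              × toℕ (mem s dirᴬ (regs s prevᴿ)) ≡ toℕ (null {w}))))

      unwind-test : ∀ s → Decides unwindE s (toℕ (null {w}) < toℕ (regs s prevᴿ) × RawBeats s)
      unwind-test s = decides-and (decides-lt refl refl) (decides-or (decides-lt refl refl) (decides-and (decides-eq refl refl)
        (decides-or (decides-lt refl refl) (decides-and (decides-eq refl refl) (decides-eq refl refl)))))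

      module _ {s : State w} {d v l π A B} (i : Unwinding s (frame d v l ∷ π) A B) where
        open Unwinding i
        nd′ = proj₁ (proj₂ path)
        dir≡ = proj₁ (proj₂ (proj₂ (proj₂ path)))
        r₁≡ : toℕ (regs s xrank₁ᴿ) ≡ proj₁ r
        r₁≡ = trans (cong toℕ (regs₀ xrank₁ᴿ)) rank₁₀
        r₂≡ : toℕ (regs s xrank₂ᴿ) ≡ Fin.toℕ (proj₂ r)
        r₂≡ = trans (cong toℕ (regs₀ xrank₂ᴿ)) rank₂₀

        raw⇒beats : RawBeats s → (x , r) Beats entry v
        raw⇒beats (inj₁ p) = inj₁ (inj₁ (subst₂ _<_ (NodeAt.rank₁≡ nd′) r₁≡ p))
        raw⇒beats (inj₂ (e , inj₁ p)) = inj₁ (inj₂ (trans (sym (NodeAt.rank₁≡ nd′)) (trans e r₁≡) , subst₂ _<_ (NodeAt.rank₂≡ nd′) r₂≡ p))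
        raw⇒beats (inj₂ (e , inj₂ (e′ , z))) = inj₂ (cong₂ _,_ (trans (sym r₁≡) (trans (sym e) (NodeAt.rank₁≡ nd′)))
          (Fin.toℕ-injective (trans (sym r₂≡) (trans (sym e′) (NodeAt.rank₂≡ nd′)))) , side d refl)
          where
          side : ∀ d′ → d ≡ d′ → x <ˢ key v
          side true refl = contradiction (toℕ≡0⇒null (trans z (toℕ-null {w}))) λ n → bit-true (trans (sym dir≡) n)
          side false refl = proj₁ around

        beats⇒raw : (x , r) Beats entry v → RawBeats s
        beats⇒raw (inj₁ (inj₁ p)) = inj₁ (subst₂ _<_ (sym (NodeAt.rank₁≡ nd′)) (sym r₁≡) p)
        beats⇒raw (inj₁ (inj₂ (e , p))) = inj₂ (trans (NodeAt.rank₁≡ nd′) (trans e (sym r₁≡)) , inj₁ (subst₂ _<_ (sym (NodeAt.rank₂≡ nd′)) (sym r₂≡) p))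
        beats⇒raw (inj₂ (refl , x<v)) = inj₂ (trans (NodeAt.rank₁≡ nd′) (sym r₁≡) , inj₂ (trans (NodeAt.rank₂≡ nd′) (sym r₂≡) , side d refl))
          where
          side : ∀ d′ → d ≡ d′ → toℕ (mem s dirᴬ (regs s prevᴿ)) ≡ toℕ (null {w})
          side true refl = contradiction x<v (<ˢ-asym (proj₁ around))
          side false refl = cong toℕ dir≡

        positive : toℕ (null {w}) < toℕ (regs s prevᴿ)
        positive = subst (_< toℕ (regs s prevᴿ)) (sym (toℕ-null {w})) (n≢0⇒n>0 λ z → NodeAt.nonnull nd′ (toℕ≡0⇒null z))

    -- The loop may stop at the first ancestor that `x` does not beat: keys differ, so by totality
    -- that ancestor beats `x`, which is all that heap order requires of the new node upwards.
    unwind-runs : ∀ π {A B s} → Unwinding s π A B →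
      Runs unwindC s (λ s′ τ → (Σ[ π′ ∈ Ctx ] Σ[ A′ ∈ Tree σ R ] Σ[ B′ ∈ Tree σ R ]
        Unwinding s′ π′ A′ B′ × BelowC π′ (x , r) × length π′ ≤ length π) × τ ≤ timeBound unwindC * suc (length π))
    unwind-runs π {A} {B} {s} i with unwind-test s
    unwind-runs π {A} {B} {s} i | decides (no ¬p) e = _ , _ , ⇓done e , (π , A , B , i , stop π i , ≤-refl) ,
      ≤-trans (≤-trans (m≤m+n _ _) (≤-reflexive (sym (timeBound≡ unwindC)))) (m≤m*n (timeBound unwindC) (suc (length π)))
      where
      stop : ∀ π → Unwinding s π A B → BelowC π (x , r)
      stop [] _ = tt
      stop (frame d v l ∷ π) i = beats-total (x , r) (entry v) (apart d i) λ b → ¬p (positive i , beats⇒raw i b)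
        where
        apart : ∀ d → Unwinding s (frame d v l ∷ π) A B → x ≢ key v
        apart true i e = <ˢ⇒≢ (proj₁ (Unwinding.around i)) (sym e)
        apart false i = <ˢ⇒≢ (proj₁ (Unwinding.around i))
    unwind-runs [] {s = s} i | decides (yes (p , _)) e = contradiction (subst (toℕ (null {w}) <_) (cong toℕ (Unwinding.path i)) p) (<-irrefl refl)
    unwind-runs (frame d v l ∷ π) {A} {B} {s} i | decides (yes (_ , raw)) e = step d refl (⇓exec unwindBodyC s _)
      where
      Goal : Set
      Goal = Runs unwindC s (λ s′ τ → (Σ[ π′ ∈ Ctx ] Σ[ A′ ∈ Tree σ R ] Σ[ B′ ∈ Tree σ R ]
        Unwinding s′ π′ A′ B′ × BelowC π′ (x , r) × length π′ ≤ suc (length π)) × τ ≤ timeBound unwindC * suc (suc (length π)))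
      continue : ∀ {A′ B′ s₁ τ₁} → ⟨ unwindBodyC , s ⟩⇓⟨ s₁ , τ₁ ⟩ → τ₁ ≤ maxCost unwindBodyC → Unwinding s₁ π A′ B′ → Goal
      continue run₁ l₁ i₁ with unwind-runs π i₁
      ... | s₂ , τ₂ , run₂ , (π′ , A′ , B′ , i₂ , b , len) , l₂ = s₂ , _ , ⇓loop (λ z → bit-true (trans (sym e) z)) run₁ run₂
        , (π′ , A′ , B′ , i₂ , b , m≤n⇒m≤1+n len)
        , ≤-trans (+-mono-≤ (≤-trans (s≤s (+-monoʳ-≤ (cost unwindE) l₁)) (≤-reflexive (sym (timeBound≡ unwindC)))) l₂)
                  (≤-reflexive (sym (*-suc (timeBound unwindC) (suc (length π)))))
      dirTest : ∀ d → Unwinding s (frame d v l ∷ π) A B → exec unwindBodyC s ≡ exec popC (if d then exec toSmallC s else exec toLargeC s)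
      dirTest d i = cong (exec popC) (exec-cond {e = dirᴬ [ reg prevᴿ ]} {toSmallC} {toLargeC} (proj₁ (proj₂ (proj₂ (proj₂ (Unwinding.path i))))))
      step : ∀ d′ → d ≡ d′ → Σ[ τ ∈ ℕ ] ⟨ unwindBodyC , s ⟩⇓⟨ exec unwindBodyC s , τ ⟩ × τ ≤ maxCost unwindBodyC → Goal
      step true refl (τ₁ , run₁ , l₁) = continue (subst (λ s′ → ⟨ unwindBodyC , s ⟩⇓⟨ s′ , τ₁ ⟩) (dirTest true i) run₁) l₁ (unwind-right i (raw⇒beats i raw))
      step false refl (τ₁ , run₁ , l₁) = continue (subst (λ s′ → ⟨ unwindBodyC , s ⟩⇓⟨ s′ , τ₁ ⟩) (dirTest false i) run₁) l₁ (unwind-left i (raw⇒beats i raw))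

-- Correctness and time of insertion.

module InsertOperation where

  open import Defs renaming (_⨾_ to infixr 4 _⨾_; _≔_ to infix 5 _≔_; _[_]≔_ to infix 5 _[_]≔_)
  open StringOrder
  open Words
  open ProgramLogic
  open Zippers
  open Comparison
  open MemoryLayout
  open TrieDescent
  open Boundaries
  open QueryOperations
  open Relinking
  open InsertionPath
  open import Data.Bool using (true; false; T)
  open import Data.List using (List; _∷_; _++_; length)
  open import Data.List.Properties using (++-assoc)
  open import Data.List.Membership.Propositional using (_∈_)
  open import Data.List.Membership.Propositional.Properties using (∈-map⁻; ∈-map⁺; ∈-++⁺ˡ; ∈-++⁺ʳ)
  import Data.List.Membership.DecPropositional as DecMembership
  open import Data.List.Relation.Binary.Permutation.Propositional using (_↭_; ↭-sym; ↭-trans; ↭-reflexive; prep)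
  open import Data.List.Relation.Binary.Permutation.Propositional.Properties using (shift)
  open import Data.List.Relation.Unary.All as All using (All; _∷_)
  open import Data.List.Relation.Unary.Any using (here)
  open import Data.Maybe using (nothing)
  open import Data.Nat
  open import Data.Nat.DivMod hiding (result)
  open import Data.Nat.Properties
  open import Data.Product using (_×_; _,_; proj₁; proj₂; Σ-syntax; ∃-syntax)
  open import Data.Sum using (_⊎_; inj₁; inj₂)
  open import Data.Unit using (tt)
  open import Relation.Binary.PropositionalEquality hiding ([_])
  open import Relation.Nullary using (¬_; yes; no; contradiction)

  β-unwind β-insert : ℕ
  β-unwind = 3 + (timeBound (smallᴿ ≔ lit 0 ⨾ largeᴿ ≔ lit 0) + (timeBound unwindC + (timeBound makeC + (κ-relink + timeBound (rootᴿ ≔ reg curᴿ)))))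
  β-insert = timeBound createC + (β-search equalE vLessE + β-unwind)

  module _ {σ R : ℕ} {x : Str σ} {r : Rank R} where

    open DecMembership (_≟ˢ_ {σ}) using (_∈?_)

    insert-∈ : ∀ {E} → x ∈ keys E → result insert x r E ≡ E
    insert-∈ {E} p with x ∈? keys E
    ... | yes _ = refl
    ... | no ¬p = contradiction p ¬p

    insert-∉ : ∀ {E} → ¬ x ∈ keys E → result insert x r E ≡ (x , r) ∷ E
    insert-∉ {E} ¬p with x ∈? keys E
    ... | yes p = contradiction p ¬p
    ... | no _ = refl

    ∈-plug : ∀ π l (v : Node σ R) r → key v ∈ keys (entries (plug π (branch l v r)))
    ∈-plug π l v r = subst (λ e → key v ∈ keys e) (sym (entries-plug π (branch l v r)))
      (∈-map⁺ proj₁ (∈-++⁺ʳ (pre π) (∈-++⁺ˡ (subst (entry v ∈_) (sym (entries-branch l v r)) (∈-++⁺ʳ (entries l) (here refl))))))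

  zt⇒zipTrie : ∀ {σ R enc} {E : List (Entry σ R)} {t} → ZT enc nothing nothing t → entries t ↭ E → ZipTrie enc E t
  zt⇒zipTrie {enc = enc} {t = t} z p = record { stores = p ; search = zt⇒search enc t z ; heap = zt⇒heap enc t z ; lcps = zt⇒lcps enc t z }

  module Inserting (σ w : ℕ) .{{_ : NonTrivial σ}} .{{_ : NonZero (α σ w)}} {R : ℕ}
                   (L : ℕ) (E : List (Entry σ R)) (t : Tree σ R) (x : Str σ) (r : Rank R) (s : State w)
                   (zip : ZipTrie (LCPCode.encode lcpCode L (α σ w)) E t)
                   (loaded : Loaded σ w L s t)
                   (query : Holds σ w s (regs s xbaseᴿ) (regs s xfullᴿ) (regs s xtailᴿ) x)
                   (args : InsertArgs σ w s r) where

    open Rebuild σ w {R} (MayUse σ w insert s) L E t x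

    private
      f = regs s freshᴿ
      f≢null = proj₁ args
      f-new = proj₁ (proj₂ args)
      rank₁₀ = proj₁ (proj₂ (proj₂ args))
      rank₂₀ = proj₂ (proj₂ (proj₂ args))
      s₁ = exec createC s
      m₁ = mem s₁
      log₀ = Loaded.log≡ loaded

      fresh-only : ∀ a q → q ≢ f → m₁ a q ≡ mem s a q
      fresh-only a q n = trans (other (update-setMem′ rank₂ᴬ (regs s xrank₂ᴿ) t₄) a q n)
        (trans (other (update-setMem′ rank₁ᴬ (regs s xrank₁ᴿ) t₃) a q n)
        (trans (written tailᴬ (regs s xtailᴿ) t₂ a q n) (trans (written fullᴬ (regs s xfullᴿ) t₁ a q n) (written baseᴬ (regs s xbaseᴿ) s a q n))))
        where
        t₁ = setMem baseᴬ f (regs s xbaseᴿ) s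
        t₂ = setMem fullᴬ f (regs s xfullᴿ) t₁
        t₃ = setMem tailᴬ f (regs s xtailᴿ) t₂
        t₄ = setMem rank₁ᴬ f (regs s xrank₁ᴿ) t₃
        update-setMem′ : ∀ a {l : T (3 <ᵇ a)} u s → Update f (mem s) (mem (setMem a f u s))
        update-setMem′ a {l} u s = update-setMem a {l} f u s
        written : ∀ b u (s : State w) a q → q ≢ f → mem (setMem b f u s) a q ≡ mem s a q
        written b u s a q n with a ≡ᵇ b
        ... | false = refl
        ... | true = if-other n

      kept₁ : Kept (mem s) m₁
      kept₁ = record { text₌ = λ _ → refl ; frame₌ = λ a p n → fresh-only a p λ { refl → n (inj₂ refl) } }

      keyF : Key m₁ f x
      keyF = holds-mem (λ _ → refl) (if-same f) (if-same f) (if-same f) query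

      tr₁ : Tr m₁ (regs s₁ rootᴿ) t
      tr₁ = treeAt⇒tr t (λ _ → refl) (λ q ρ → inj₁ ρ , λ a → fresh-only a q λ { refl → f-new ρ }) (Loaded.tree loaded)

      zt₀ : ZT enc nothing nothing t
      zt₀ = zipTrie⇒ZT enc zip

      open module S₁ = Search exactMode s₁ Q using (Outcome; Searching)

      post-from : ∀ {s′ t′ E′} → result insert x r E ≡ E′ → ZipTrie enc E′ t′ → Tr (mem s′) (regs s′ rootᴿ) t′ → Kept (mem s) (mem s′) →
                  regs s′ logᴿ ≡ regs s logᴿ → regs s′ αᴿ ≡ regs s αᴿ → Post σ w insert L enc E x r s s′
      post-from {s′} {t′} e z tr k l a≡ = record
        { tree = t′ ; zipTrie = subst (λ E → ZipTrie enc E t′) (sym e) z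
        ; loaded = record { tree = tr⇒treeAt t′ tr ; log≡ = trans (cong toℕ l) (Loaded.log≡ loaded) ; α≡ = trans (cong toℕ a≡) (Loaded.α≡ loaded) }
        ; uses = λ p ρ → tr-reach t′ tr ρ ; text = text₌ k
        ; frame = λ a p l l′ n → frame₌ k a p {<⇒<ᵇ (s≤s l′)} n ; output = tt }

    -- `createC` precedes the search, so that the fresh address already carries the key `x` and is
    -- separated from the nodes of the path by its key. If `x` turns out to be present, the node
    -- written stays unlinked.
    insert-runs : Runs insertC s (λ s′ τ → Post σ w insert L enc E x r s s′ × Fits β-insert τ)
    insert-runs = runs-straight {c = createC} _ λ {τ₁} l₁ →
      runs-seq (S₁.search-runs query₁ log₀ (Loaded.α≡ loaded) (λ _ → refl) agree-refl zt₀ tr₁ (keys≤Q {t} (ZipTrie.stores zip))) λ {s₂} {τ₂} (o , l₂) →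
        runs-map (λ { {s′} {τ₃} (p , f₃) → p , fits-+ {timeBound createC} (fits-const l₁) (fits-+ (search-fits o l₂) f₃) }) (main o (Outcome.kind o))
      where
      query₁ : Query s₁
      query₁ = holds-mem (λ _ → refl) refl refl refl query
      alongᵒ : ∀ {s₂} (o : Outcome t s₂) → OnPath (Outcome.ctx o)
      alongᵒ o = inj₁ (dirs⇒along exactMode s₁ Q (Outcome.ctx o) (S₁.dirs (Outcome.inv o)))
      search-fits : ∀ {s₂ τ} (o : Outcome t s₂) → τ ≤ timeBound startC + κ-search equalE vLessE * ((2 + length (Outcome.ctx o)) * suc δ + Q) → Fits (β-search equalE vLessE) τ
      search-fits o l = fits-≤ l (fits-+ (fits-const ≤-refl)
        (fits-path (κ-search equalE vLessE) (Outcome.ctx o) (Outcome.subt o) (Outcome.plug≡ o) (alongᵒ o) ≤-refl))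
      Rest : Cmd
      Rest = cond (reg foundᴿ) skip ((smallᴿ ≔ lit 0 ⨾ largeᴿ ≔ lit 0) ⨾ unwindC ⨾ makeC ⨾ relinkC)
      main : ∀ {s₂} (o : Outcome t s₂) → (Outcome.subt o ≡ leaf × regs s₂ foundᴿ ≡ null)
               ⊎ (Σ[ l ∈ Tree σ R ] Σ[ v ∈ Node σ R ] Σ[ r ∈ Tree σ R ] Outcome.subt o ≡ branch l v r × x ≡ key v × regs s₂ foundᴿ ≡ Outcome.addr o) →
             Runs Rest s₂ (λ s′ τ → Post σ w insert L enc E x r s s′ × Fits β-unwind τ)
      main {s₂} o (inj₂ (l , v , r′ , e , refl , f≡)) = runs-nonnull nonnull (s₂ , 0 , ⇓skip ,
          post-from (insert-∈ x∈) zip (subst (λ p → Tr (mem s₂) p t) (sym (S₁.regs₀ i rootᴿ)) (tr-cong t (S₁.mem₀ i) tr₁))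
            (kept-trans kept₁ (kept-agree (S₁.mem₀ i))) (S₁.regs₀ i logᴿ) (S₁.regs₀ i αᴿ)
        , fits-const {β-unwind} (≤-trans (m≤m+n 2 1) (m≤m+n 3 _)))
        where
        i = Outcome.inv o
        nonnull : regs s₂ foundᴿ ≢ null
        nonnull z with subst (Tr (mem s₁) (Outcome.addr o)) e (S₁.tree i)
        ... | _ , n , _ = NodeAt.nonnull n (trans (sym f≡) z)
        x∈ : x ∈ keys E
        x∈ = ∈keys-↭ (ZipTrie.stores zip) (subst (λ t → x ∈ keys (entries t)) (trans (cong (plug (Outcome.ctx o)) (sym e)) (Outcome.plug≡ o)) (∈-plug {x = x} {r = r} (Outcome.ctx o) l v r′))
      main {s₂} o (inj₁ (e , f≡)) = runs-null f≡ (runs-straight {c = smallᴿ ≔ lit 0 ⨾ largeᴿ ≔ lit 0} _ λ {τ₁} l₁ →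
        runs-seq (I.unwind-runs π start) λ {s₄} {τ₂} ((π′ , A , B , u , b , len) , l₂) →
        runs-straight {c = makeC} _ λ {τ₃} l₃ →
        runs-map (λ { {s′} {τ₄} (q , l₄) → finish u b q , fits-+ (fits-const {3} (m≤m+n 2 1)) (fits-+ (fits-const l₁)
            (fits-+ (fits-length (timeBound unwindC) π leaf plug-leaf (alongᵒ o) l₂) (fits-+ (fits-const l₃)
            (fits-≤ l₄ (fits-+ (fits-length κ-relink π leaf plug-leaf (alongᵒ o) (*-monoʳ-≤ κ-relink (s≤s len))) (fits-const ≤-refl)))))) })
          (relink-runs π′ (new-hole u b) (new-tree u) (new-path u)))
        where
        i = Outcome.inv o
        π = Outcome.ctx o
        module I = Insertion σ w {R} (MayUse σ w insert s) L E t x r s₁ log₀ rank₁₀ rank₂₀ (pre π) (post π)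
        open I using (Unwinding)
        plug-leaf : plug π leaf ≡ t
        plug-leaf = trans (cong (plug π) (sym e)) (Outcome.plug≡ o)
        aroundᵒ : Around π
        aroundᵒ = dirs⇒around {s₁} π (S₁.dirs i)
        s₃ = exec (smallᴿ ≔ lit 0 ⨾ largeᴿ ≔ lit 0) s₂
        m₂ = S₁.mem₀ i
        shape : entries t ≡ pre π ++ post π
        shape = trans (cong entries (sym plug-leaf)) (entries-plug π leaf)
        start : Unwinding s₃ π leaf leaf
        start = record
          { regs₀ = λ r {b} → trans (regs-setReg largeᴿ null (setReg smallᴿ null s₂) r {b}) (trans (regs-setReg smallᴿ null s₂ r {b}) (S₁.regs₀ i r {b}))
          ; kept = kept-agree m₂ ; zc = Hole.zc (S₁.hl i) ; around = aroundᵒ ; zA = leaf ; zB = leaf ; topA = tt ; topB = tt ; xA = tt ; xB = tt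
          ; trA = refl ; trB = refl ; path = path-cong π m₂ (S₁.path i) ; lcps = S₁.lcps i ; lcp⁻ = S₁.lcp⁻ i ; lcp⁺ = S₁.lcp⁺ i
          ; keyF = holds-mem (λ j → m₂ textᴬ j) (m₂ baseᴬ f) (m₂ fullᴬ f) (m₂ tailᴬ f) keyF ; rank₁F = m₂ rank₁ᴬ f ; rank₂F = m₂ rank₂ᴬ f
          ; pre≡ = Data.List.Properties.++-identityʳ (pre π) ; post≡ = refl }
        x∉ : ¬ x ∈ keys E
        x∉ p with ∈keys-++ (pre π) (post π) (subst (λ es → x ∈ keys es) shape (∈keys-↭ (↭-sym (ZipTrie.stores zip)) p))
        ... | inj₁ q with ∈-map⁻ proj₁ q
        ...   | _ , y∈ , refl = <ˢ-irrefl (All.lookup (zc-lo enc (Hole.zc (S₁.hl i)) (around-lo π aroundᵒ)) y∈)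
        x∉ p | inj₂ q with ∈-map⁻ proj₁ q
        ...   | _ , y∈ , refl = <ˢ-irrefl (All.lookup (zc-hi enc (Hole.zc (S₁.hl i)) (around-hi π aroundᵒ)) y∈)

        module _ {s₄ π′ A B} (u : Unwinding s₄ π′ A B) (b : BelowC π′ (x , r)) where
          open Unwinding u
          xn : Node σ R
          xn = node x r (enc (lcp∞ x (loOf π′))) (enc (lcp∞ x (hiOf π′)))
          new-hole : Hole enc π′ (branch A xn B)
          new-hole = hole (Unwinding.zc u) (branch (codes (around-lo π′ around) (around-hi π′ around) refl refl) xA xB zA zB) b

        module _ {s₄ π′ A B} (u : Unwinding s₄ π′ A B) where
          open Unwinding u
          private
            s₅ = exec makeC s₄
            f′ = regs s₄ freshᴿ
            f′≡ : f′ ≡ f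
            f′≡ = regs₀ freshᴿ
            xn′ : Node σ R
            xn′ = node x r (enc (lcp∞ x (loOf π′))) (enc (lcp∞ x (hiOf π′)))
            t₁ = setMem leftᴬ f′ (regs s₄ smallᴿ) s₄
            t₂ = setMem rightᴬ f′ (regs s₄ largeᴿ) t₁
            t₃ = setMem code⁻ᴬ f′ (⟦ encodeE (reg lcp⁻ᴿ) ⟧ t₂) t₂
            log₄ = trans (cong toℕ (regs₀ logᴿ)) log₀
            up : Update f′ (mem s₄) (mem s₅)
            up = update-trans (update-setMem leftᴬ f′ (regs s₄ smallᴿ) s₄) (update-trans (update-setMem rightᴬ f′ (regs s₄ largeᴿ) t₁)
              (update-trans (update-setMem code⁻ᴬ f′ (⟦ encodeE (reg lcp⁻ᴿ) ⟧ t₂) t₂) (update-setMem code⁺ᴬ f′ (⟦ encodeE (reg lcp⁺ᴿ) ⟧ t₃) t₃)))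
            keyF′ : Key (mem s₄) f′ x
            keyF′ = subst (λ q → Key (mem s₄) q x) (sym f′≡) (Unwinding.keyF u)
            Uf : MayUse σ w insert s f′
            Uf = inj₂ f′≡

          new-kept : Kept (mem s) (mem s₅)
          new-kept = kept-trans kept₁ (kept-trans kept (kept-update Uf up))

          new-path : Path (mem s₅) (mem s₅) (regs s₅ prevᴿ) π′
          new-path = path-update up keyF′ π′ up (zc-apart enc (Unwinding.zc u) (around-lo π′ around) (around-hi π′ around)) path

          new-tree : Tr (mem s₅) (regs s₅ curᴿ) (branch A xn′ B)
          new-tree = Uf , record
              { nonnull = λ z → f≢null (trans (sym f′≡) z) ; key≡ = key-cong (low up) keyF′
              ; rank₁≡ = trans (cong toℕ (trans (cong (mem s₄ rank₁ᴬ) f′≡) (trans rank₁F (if-same f)))) rank₁₀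
              ; rank₂≡ = trans (cong toℕ (trans (cong (mem s₄ rank₂ᴬ) f′≡) (trans rank₂F (if-same f)))) rank₂₀
              ; code⁻≡ = trans (cong toℕ (if-same f′)) (⟦encodeE⟧ (reg lcp⁻ᴿ) {t₂} log₄ lcp⁻)
              ; code⁺≡ = trans (cong toℕ (if-same f′)) (⟦encodeE⟧ (reg lcp⁺ᴿ) {t₃} log₄ lcp⁺) }
            , subst (λ q → Tr (mem s₅) q A) (sym (if-same f′)) (tr-update up keyF′ A (apart-left A zA) trA)
            , subst (λ q → Tr (mem s₅) q B) (sym (if-same f′)) (tr-update up keyF′ B (apart-right B zB) trB)

          finish : BelowC π′ (x , r) → ∀ {s′} → Tr (mem s′) (regs s′ rootᴿ) (plug π′ (branch A xn′ B)) × Kept (mem s₅) (mem s′)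
            × regs s′ logᴿ ≡ regs s₅ logᴿ × regs s′ αᴿ ≡ regs s₅ αᴿ → Post σ w insert L enc E x r s s′
          finish b (tr , k , l , a≡) = post-from (insert-∉ x∉) (zt⇒zipTrie (hole-plug enc (new-hole u b)) contents) tr
            (kept-trans new-kept k) (trans l (regs₀ logᴿ)) (trans a≡ (regs₀ αᴿ))
            where
            -- The final tree reads `pre π`, then `x`, then `post π`, since unwinding preserves the
            -- sequence of entries on either side of the boundary.
            contents : entries (plug π′ (branch A xn′ B)) ↭ (x , r) ∷ E
            contents = ↭-trans (↭-reflexive (trans (entries-plug π′ (branch A xn′ B)) (trans
                (cong (λ es → pre π′ ++ es ++ post π′) (entries-branch A xn′ B))
                (trans (cong (pre π′ ++_) (++-assoc (entries A) ((x , r) ∷ entries B) (post π′)))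
                  (trans (sym (++-assoc (pre π′) (entries A) _)) (cong₂ (λ p q → p ++ (x , r) ∷ q) pre≡ post≡))))))
              (↭-trans (shift (x , r) (pre π) (post π)) (prep (x , r) (↭-trans (↭-reflexive (sym shape)) (ZipTrie.stores zip))))

-- Zipping the subtrees of a removed node, and deletion.

module DeleteOperation where

  open import Defs renaming (_⨾_ to infixr 4 _⨾_; _≔_ to infix 5 _≔_; _[_]≔_ to infix 5 _[_]≔_)
  open StringOrder
  open Words
  open ProgramLogic
  open Zippers
  open Comparison
  open MemoryLayout
  open TrieDescent
  open Boundaries
  open QueryOperations
  open Relinking
  open InsertionPath
  open InsertOperation
  open import Data.Bool using (true; false; if_then_else_; T)
  open import Data.List using (List; []; _∷_; _++_; length; map; filter)
  open import Data.List.Properties using (++-assoc; ++-identityʳ; filter-++; filter-all; filter-reject)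
  open import Data.List.Membership.Propositional using (_∈_)
  open import Data.List.Relation.Binary.Permutation.Propositional using (_↭_; ↭-sym; ↭-trans; ↭-reflexive)
  open import Data.List.Relation.Binary.Permutation.Propositional.Properties using (filter-↭)
  open import Data.List.Relation.Unary.All as All using (All; []; _∷_)
  import Data.List.Relation.Unary.All.Properties as All
  open import Data.Maybe using (just; nothing)
  open import Data.Nat
  open import Data.Nat.DivMod hiding (result)
  open import Data.Nat.Properties
  open import Data.Product using (_×_; _,_; proj₁; proj₂; Σ-syntax; ∃-syntax)
  open import Data.Sum using (_⊎_; inj₁; inj₂)
  open import Data.Unit using (tt)
  open import Relation.Binary.PropositionalEquality hiding ([_])
  open import Relation.Nullary using (¬_; Dec; yes; no; does; contradiction)
  open import Relation.Nullary.Decidable using (¬?)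

  cpᴿ cqᴿ : Reg
  cpᴿ = 27
  cqᴿ = 28

  rankLessE chooseE mergeE : Expr
  rankLessE = op or (op lt (rank₁ᴬ [ reg smallᴿ ]) (rank₁ᴬ [ reg largeᴿ ]))
    (op and (op eq (rank₁ᴬ [ reg smallᴿ ]) (rank₁ᴬ [ reg largeᴿ ])) (op lt (rank₂ᴬ [ reg smallᴿ ]) (rank₂ᴬ [ reg largeᴿ ])))
  chooseE = op or (op eq (reg smallᴿ) (lit 0)) (op and (op lt (lit 0) (reg largeᴿ)) rankLessE)
  mergeE = op or (op lt (lit 0) (reg smallᴿ)) (op lt (lit 0) (reg largeᴿ))

  -- Zipping proceeds downwards without linking children: each chosen node is pushed onto the path
  -- stack, and `relinkC` sets the pointers at the end. `cpᴿ` and `cqᴿ` hold the codes of the LCPs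
  -- of the removed key with the current bounds.
  linkSmallC linkLargeC takeSmallC takeLargeC mergeBodyC mergeC detachC deleteC : Cmd
  linkSmallC = code⁺ᴬ [ reg smallᴿ ]≔ reg mᴿ ⨾ cpᴿ ≔ reg cᴿ ⨾ parentᴬ [ reg smallᴿ ]≔ reg prevᴿ ⨾
               dirᴬ [ reg smallᴿ ]≔ lit 1 ⨾ prevᴿ ≔ reg smallᴿ ⨾ smallᴿ ≔ rightᴬ [ reg smallᴿ ]
  linkLargeC = code⁻ᴬ [ reg largeᴿ ]≔ reg mᴿ ⨾ cqᴿ ≔ reg cᴿ ⨾ parentᴬ [ reg largeᴿ ]≔ reg prevᴿ ⨾
               dirᴬ [ reg largeᴿ ]≔ lit 0 ⨾ prevᴿ ≔ reg largeᴿ ⨾ largeᴿ ≔ leftᴬ [ reg largeᴿ ]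
  takeSmallC = cᴿ ≔ code⁺ᴬ [ reg smallᴿ ] ⨾ cond (op lt (reg cqᴿ) (reg cᴿ)) (mᴿ ≔ reg cqᴿ) (mᴿ ≔ reg cᴿ) ⨾ linkSmallC
  takeLargeC = cᴿ ≔ code⁻ᴬ [ reg largeᴿ ] ⨾ cond (op lt (reg cpᴿ) (reg cᴿ)) (mᴿ ≔ reg cpᴿ) (mᴿ ≔ reg cᴿ) ⨾ linkLargeC
  mergeBodyC = cond chooseE takeLargeC takeSmallC
  mergeC = while mergeE mergeBodyC
  detachC = smallᴿ ≔ leftᴬ [ reg foundᴿ ] ⨾ largeᴿ ≔ rightᴬ [ reg foundᴿ ] ⨾
            cpᴿ ≔ code⁻ᴬ [ reg foundᴿ ] ⨾ cqᴿ ≔ code⁺ᴬ [ reg foundᴿ ]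
  deleteC = searchC equalE vLessE ⨾
            cond (reg foundᴿ) (detachC ⨾ mergeC ⨾ curᴿ ≔ lit 0 ⨾ relinkC) skip

  β-merge β-delete : ℕ
  β-merge = 3 + (timeBound detachC + ((timeBound mergeC + timeBound mergeC) + (timeBound (curᴿ ≔ lit 0)
              + ((κ-relink + κ-relink) + timeBound (rootᴿ ≔ reg curᴿ)))))
  β-delete = β-search equalE vLessE + β-merge

  module _ {w : ℕ} .{{_ : NonZero w}} where

    exec-min : ∀ f g {s : State w} → Σ[ u ∈ Word w ] toℕ u ≡ toℕ (regs s f) ⊓ toℕ (regs s g)
               × exec (cond (op lt (reg f) (reg g)) (mᴿ ≔ reg f) (mᴿ ≔ reg g)) s ≡ setReg mᴿ u s
    exec-min f g {s} = choose (decides-lt {e = reg f} {reg g} {s} refl refl)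
      where
      choose : Decides (op lt (reg f) (reg g)) s (toℕ (regs s f) < toℕ (regs s g)) → _
      choose D@(decides (yes l) _) = regs s f , sym (m≤n⇒m⊓n≡m (<⇒≤ l)) , exec-decides {c = mᴿ ≔ reg f} {d = mᴿ ≔ reg g} D
      choose D@(decides (no l) _) = regs s g , sym (m≥n⇒m⊓n≡n (≮⇒≥ l)) , exec-decides {c = mᴿ ≔ reg f} {d = mᴿ ≔ reg g} D

  module _ {σ R : ℕ} where

    rspine lspine : Tree σ R → ℕ
    rspine leaf = 0
    rspine (branch l v r) = suc (rspine r)
    lspine leaf = 0
    lspine (branch l v r) = suc (lspine l)

    rctx lctx : Tree σ R → Ctx → Ctx
    rctx leaf π = π
    rctx (branch l v r) π = rctx r (frame true v l ∷ π)
    lctx leaf π = π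
    lctx (branch l v r) π = lctx l (frame false v r ∷ π)

    plug-rctx : ∀ t π → plug (rctx t π) leaf ≡ plug π t
    plug-rctx leaf π = refl
    plug-rctx (branch l v r) π = plug-rctx r (frame true v l ∷ π)

    plug-lctx : ∀ t π → plug (lctx t π) leaf ≡ plug π t
    plug-lctx leaf π = refl
    plug-lctx (branch l v r) π = plug-lctx l (frame false v r ∷ π)

    length-rctx : ∀ t π → length (rctx t π) ≡ rspine t + length π
    length-rctx leaf π = refl
    length-rctx (branch l v r) π = trans (length-rctx r (frame true v l ∷ π)) (+-suc (rspine r) (length π))

    length-lctx : ∀ t π → length (lctx t π) ≡ lspine t + length π
    length-lctx leaf π = refl
    length-lctx (branch l v r) π = trans (length-lctx l (frame false v r ∷ π)) (+-suc (lspine l) (length π))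

    along-rctx : ∀ {P} t π → TAll (λ v → P (key v)) t → Along P π → Along P (rctx t π)
    along-rctx leaf π _ al = al
    along-rctx (branch l v r) π (p , _ , q) al = along-rctx r (frame true v l ∷ π) q (p , al)

    along-lctx : ∀ {P} t π → TAll (λ v → ¬ P (key v)) t → Along P π → Along P (lctx t π)
    along-lctx leaf π _ al = al
    along-lctx (branch l v r) π (p , q , _) al = along-lctx l (frame false v r ∷ π) q (p , al)

  module Merge (σ w : ℕ) .{{_ : NonTrivial σ}} .{{_ : NonZero (α σ w)}} {R : ℕ} (U : Word w → Set)
               (L : ℕ) (E : List (Entry σ R)) (t : Tree σ R) (x : Str σ) (s₀ : State w)
               (P S : List (Entry σ R)) where

    open Rebuild σ w {R} U L E t x public

    -- The removed key `x` remains the common bound of `A` and `B`, because their stored codes still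
    -- refer to it; `cp` and `cq` connect `x` to the bounds of the hole.
    record Merging (s : State w) (π : Ctx) (A B : Tree σ R) : Set where
      field
        regs₀  : ∀ r → {T (r <ᵇ 11)} → regs s r ≡ regs s₀ r
        kept   : Kept (mem s₀) (mem s)
        zcπ    : ZC enc π
        around : Around π
        zA     : ZT enc (loOf π) (just x) A
        zB     : ZT enc (just x) (hiOf π) B
        topA   : BelowCT π A
        topB   : BelowCT π B
        trA    : Tr (mem s) (regs s smallᴿ) A
        trB    : Tr (mem s) (regs s largeᴿ) B
        path   : Path (mem s) (mem s) (regs s prevᴿ) π
        cp     : toℕ (regs s cpᴿ) ≡ enc (lcp∞ x (loOf π))
        cq     : toℕ (regs s cqᴿ) ≡ enc (lcp∞ x (hiOf π))
        pre≡   : pre π ++ entries A ≡ P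
        post≡  : entries B ++ post π ≡ S

    private
      enc-⊓ : ∀ m n → enc (m ⊓ n) ≡ enc m ⊓ enc n
      enc-⊓ m n = trans (cong float (mono-≤-distrib-⊓ (/-monoˡ-≤ a) m n)) (float-⊓ (m / a) (n / a))

      enc-0 : enc 0 ≡ 0
      enc-0 = trans (cong float (0/n≡0 a)) float-0

      -- Since the code is monotone, stored codes can be combined without decoding.
      code-hi : ∀ {y} hi → y <ˢ x → x <₊ hi → enc (lcp∞ x hi) ⊓ enc (lcp y x) ≡ enc (lcp∞ y hi)
      code-hi {y} nothing p q = trans (cong (_⊓ enc (lcp y x)) enc-0) (sym enc-0)
      code-hi {y} (just z) p q = trans (⊓-comm (enc (lcp x z)) (enc (lcp y x))) (trans (sym (enc-⊓ (lcp y x) (lcp x z))) (cong enc (sym (lcp-between p q))))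

      code-lo : ∀ {y} lo → x <ˢ y → lo <₋ x → enc (lcp∞ x lo) ⊓ enc (lcp y x) ≡ enc (lcp∞ y lo)
      code-lo {y} nothing p q = trans (cong (_⊓ enc (lcp y x)) enc-0) (sym enc-0)
      code-lo {y} (just z) p q = trans (sym (enc-⊓ (lcp x z) (lcp y x))) (cong enc (trans (cong₂ _⊓_ (lcp-comm x z) (lcp-comm y x))
        (trans (sym (lcp-between q p)) (lcp-comm z y))))

      regs-link : ∀ n {l : T (10 <ᵇ n)} n′ {l′ : T (10 <ᵇ n′)} u₁ u₂ u₃ u₄ u₅ (s : State w) r → {T (r <ᵇ 11)} →
                  regs (setReg n′ u₅ (setReg prevᴿ u₄ (setReg n u₃ (setReg mᴿ u₂ (setReg cᴿ u₁ s))))) r ≡ regs s r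
      regs-link n {l} n′ {l′} u₁ u₂ u₃ u₄ u₅ s r {b} =
        trans (regs-setReg n′ {l′} u₅ (setReg prevᴿ u₄ (setReg n u₃ (setReg mᴿ u₂ (setReg cᴿ u₁ s)))) r {b})
        (trans (regs-setReg prevᴿ u₄ (setReg n u₃ (setReg mᴿ u₂ (setReg cᴿ u₁ s))) r {b})
        (trans (regs-setReg n {l} u₃ (setReg mᴿ u₂ (setReg cᴿ u₁ s)) r {b})
        (trans (regs-setReg mᴿ u₂ (setReg cᴿ u₁ s) r {b}) (regs-setReg cᴿ u₁ s r {b}))))

    module _ {s : State w} {π l v r B} (i : Merging s π (branch l v r) B) (beats : Below (entry v) B) where
      open Merging i
      private
        p = regs s smallᴿ
        U∈ = proj₁ trA
        nd = proj₁ (proj₂ trA)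
        tl = proj₁ (proj₂ (proj₂ trA))
        tr′ = proj₂ (proj₂ (proj₂ trA))
        c = mem s code⁺ᴬ p
        s₁ = setReg cᴿ c s
        min = exec-min cqᴿ cᴿ {s₁}
        u = proj₁ min
        s₂ = exec linkSmallC (setReg mᴿ u s₁)
        v′ = node (key v) (rank v) (code⁻ v) (enc (lcp∞ (key v) (hiOf π)))
        parts : Codes enc (loOf π) (just x) v × Below (entry v) l × Below (entry v) r × ZT enc (loOf π) (just (key v)) l × ZT enc (just (key v)) (just x) r
        parts with zA
        ... | branch k bl br zl zr = k , bl , br , zl , zr
        k = proj₁ parts
        v<x = Codes.<hi k
        v<hi = <₊-trans (hiOf π) v<x (around-hi π around)
        m₁ = setMem code⁺ᴬ p u s
        m₂ = setMem parentᴬ p (regs s prevᴿ) m₁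
        up : Update p (mem s) (mem s₂)
        up = update-trans (update-setMem code⁺ᴬ p u s) (update-trans (update-setMem parentᴬ p (regs s prevᴿ) m₁) (update-setMem dirᴬ p (fromℕ w 1) m₂))
        u≡ : toℕ u ≡ enc (lcp∞ (key v) (hiOf π))
        u≡ = trans (proj₁ (proj₂ min)) (trans (cong₂ _⊓_ cq (trans (NodeAt.code⁺≡ nd) (Codes.code⁺≡ k))) (code-hi (hiOf π) v<x (around-hi π around)))

      small-state : State w
      small-state = s₂

      take-small-state : exec takeSmallC s ≡ s₂
      take-small-state = cong (exec linkSmallC) (proj₂ (proj₂ min))

      -- The new upper bound of `v` is that of the hole, with `x` in between, so `lcp-between` gives
      -- the new code. The old `code⁺` of `v` referred to `x` and becomes `cp`, since `v` is the
      -- next lower bound.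
      take-small : Merging s₂ (frame true v′ l ∷ π) r B
      take-small = record
        { regs₀ = λ r {b} → trans (regs-link cpᴿ smallᴿ c u c p (mem s rightᴬ p) s r {b}) (regs₀ r {b})
        ; kept = kept-trans kept (kept-update U∈ up)
        ; zcπ = right (codes (Codes.lo< k) v<hi (Codes.code⁻≡ k) refl) topA (proj₁ (proj₂ parts)) (proj₁ (proj₂ (proj₂ (proj₂ parts)))) zcπ
        ; around = v<x , around
        ; zA = proj₂ (proj₂ (proj₂ (proj₂ parts)))
        ; zB = zB
        ; topA = belowCT-∷ enc true v′ l π r (proj₁ (proj₂ (proj₂ parts)))
        ; topB = belowCT-∷ enc true v′ l π B beats
        ; trA = tr-update up (NodeAt.key≡ nd) r (apart-right r (proj₂ (proj₂ (proj₂ (proj₂ parts))))) tr′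
        ; trB = tr-update up (NodeAt.key≡ nd) B (TAll-map (λ q → <ˢ⇒≢ (<ˢ-trans v<x q)) B (zt-lo enc B zB)) trB
        ; path = U∈ , node-update (λ _ → refl) refl refl refl refl refl (NodeAt.code⁻≡ nd) (trans (cong toℕ (if-same p)) u≡) nd
            , tr-update up (NodeAt.key≡ nd) l (apart-left l (proj₁ (proj₂ (proj₂ (proj₂ parts))))) tl
            , if-same p
            , subst (λ q → Path (mem s₂) (mem s₂) q π) (sym (if-same p))
                (path-update up (NodeAt.key≡ nd) π up (zc-apart enc zcπ (Codes.lo< k) v<hi) path)
        ; cp = trans (NodeAt.code⁺≡ nd) (trans (Codes.code⁺≡ k) (cong enc (lcp-comm (key v) x)))
        ; cq = cq
        ; pre≡ = trans (trans (++-assoc (pre π) (entries l ++ entry v ∷ []) (entries r)) (cong (pre π ++_)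
                   (trans (++-assoc (entries l) (entry v ∷ []) (entries r)) (sym (entries-branch l v r))))) pre≡
        ; post≡ = post≡
        }

    module _ {s : State w} {π l v r A} (i : Merging s π A (branch l v r)) (beats : Below (entry v) A) where
      open Merging i
      private
        p = regs s largeᴿ
        U∈ = proj₁ trB
        nd = proj₁ (proj₂ trB)
        tl = proj₁ (proj₂ (proj₂ trB))
        tr′ = proj₂ (proj₂ (proj₂ trB))
        c = mem s code⁻ᴬ p
        s₁ = setReg cᴿ c s
        min = exec-min cpᴿ cᴿ {s₁}
        u = proj₁ min
        s₂ = exec linkLargeC (setReg mᴿ u s₁)
        v′ = node (key v) (rank v) (enc (lcp∞ (key v) (loOf π))) (code⁺ v)
        parts : Codes enc (just x) (hiOf π) v × Below (entry v) l × Below (entry v) r × ZT enc (just x) (just (key v)) l × ZT enc (just (key v)) (hiOf π) r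
        parts with zB
        ... | branch k bl br zl zr = k , bl , br , zl , zr
        k = proj₁ parts
        x<v = Codes.lo< k
        lo<v = <₋-trans (loOf π) (around-lo π around) x<v
        m₁ = setMem code⁻ᴬ p u s
        m₂ = setMem parentᴬ p (regs s prevᴿ) m₁
        up : Update p (mem s) (mem s₂)
        up = update-trans (update-setMem code⁻ᴬ p u s) (update-trans (update-setMem parentᴬ p (regs s prevᴿ) m₁) (update-setMem dirᴬ p (fromℕ w 0) m₂))
        u≡ : toℕ u ≡ enc (lcp∞ (key v) (loOf π))
        u≡ = trans (proj₁ (proj₂ min)) (trans (cong₂ _⊓_ cp (trans (NodeAt.code⁻≡ nd) (Codes.code⁻≡ k))) (code-lo (loOf π) x<v (around-lo π around)))

      large-state : State w
      large-state = s₂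

      take-large-state : exec takeLargeC s ≡ s₂
      take-large-state = cong (exec linkLargeC) (proj₂ (proj₂ min))

      take-large : Merging s₂ (frame false v′ r ∷ π) A l
      take-large = record
        { regs₀ = λ r {b} → trans (regs-link cqᴿ largeᴿ c u c p (mem s leftᴬ p) s r {b}) (regs₀ r {b})
        ; kept = kept-trans kept (kept-update U∈ up)
        ; zcπ = left (codes lo<v (Codes.<hi k) refl (Codes.code⁺≡ k)) topB (proj₁ (proj₂ (proj₂ parts))) (proj₂ (proj₂ (proj₂ (proj₂ parts)))) zcπ
        ; around = x<v , around
        ; zA = zA
        ; zB = proj₁ (proj₂ (proj₂ (proj₂ parts)))
        ; topA = belowCT-∷ enc false v′ r π A beats
        ; topB = belowCT-∷ enc false v′ r π l (proj₁ (proj₂ parts))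
        ; trA = tr-update up (NodeAt.key≡ nd) A (TAll-map (λ q e → <ˢ⇒≢ (<ˢ-trans q x<v) (sym e)) A (zt-hi enc A zA)) trA
        ; trB = tr-update up (NodeAt.key≡ nd) l (apart-left l (proj₁ (proj₂ (proj₂ (proj₂ parts))))) tl
        ; path = U∈ , node-update (λ _ → refl) refl refl refl refl refl (trans (cong toℕ (if-same p)) u≡) (NodeAt.code⁺≡ nd) nd
            , tr-update up (NodeAt.key≡ nd) r (apart-right r (proj₂ (proj₂ (proj₂ (proj₂ parts))))) tr′
            , if-same p
            , subst (λ q → Path (mem s₂) (mem s₂) q π) (sym (if-same p))
                (path-update up (NodeAt.key≡ nd) π up (zc-apart enc zcπ lo<v (Codes.<hi k)) path)
        ; cp = cp
        ; cq = trans (NodeAt.code⁻≡ nd) (trans (Codes.code⁻≡ k) (cong enc (lcp-comm (key v) x)))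
        ; pre≡ = pre≡
        ; post≡ = trans (trans (sym (++-assoc (entries l) (entry v ∷ entries r) (post π))) (cong (_++ post π) (sym (entries-branch l v r)))) post≡
        }

    private
      RawLess : State w → Set
      RawLess s = toℕ (mem s rank₁ᴬ (regs s smallᴿ)) < toℕ (mem s rank₁ᴬ (regs s largeᴿ))
        ⊎ (toℕ (mem s rank₁ᴬ (regs s smallᴿ)) ≡ toℕ (mem s rank₁ᴬ (regs s largeᴿ))
          × toℕ (mem s rank₂ᴬ (regs s smallᴿ)) < toℕ (mem s rank₂ᴬ (regs s largeᴿ)))

      choose-test : ∀ s → Decides chooseE s (toℕ (regs s smallᴿ) ≡ toℕ (null {w}) ⊎ (toℕ (null {w}) < toℕ (regs s largeᴿ) × RawLess s))
      choose-test s = decides-or (decides-eq refl refl) (decides-and (decides-lt refl refl)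
        (decides-or (decides-lt refl refl) (decides-and (decides-eq refl refl) (decides-lt refl refl))))

      merge-test : ∀ (s : State w) → Decides mergeE s (toℕ (null {w}) < toℕ (regs s smallᴿ) ⊎ toℕ (null {w}) < toℕ (regs s largeᴿ))
      merge-test s = decides-or (decides-lt refl refl) (decides-lt refl refl)

      positive : ∀ {m p l v r} → Tr m p (branch l v r) → toℕ (null {w}) < toℕ p
      positive {p = p} (_ , n , _) = subst (_< toℕ p) (sym (toℕ-null {w})) (n≢0⇒n>0 λ z → NodeAt.nonnull n (toℕ≡0⇒null z))

      not-null : ∀ {m p l v r} → Tr m p (branch l v r) → toℕ p ≢ toℕ (null {w})
      not-null tr e = <-irrefl (sym e) (positive tr)

      module _ {s : State w} {π l v r l′ v′ r′} (i : Merging s π (branch l v r) (branch l′ v′ r′)) where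
        open Merging i
        ndA = proj₁ (proj₂ trA)
        ndB = proj₁ (proj₂ trB)

        raw⇒large : RawLess s → entry v′ Beats entry v
        raw⇒large (inj₁ p) = inj₁ (inj₁ (subst₂ _<_ (NodeAt.rank₁≡ ndA) (NodeAt.rank₁≡ ndB) p))
        raw⇒large (inj₂ (e , p)) = inj₁ (inj₂ (trans (sym (NodeAt.rank₁≡ ndA)) (trans e (NodeAt.rank₁≡ ndB)) , subst₂ _<_ (NodeAt.rank₂≡ ndA) (NodeAt.rank₂≡ ndB) p))

        -- Equal ranks fall on this side as they should: keys of `A` are smaller than keys of `B`,
        -- and the smaller key wins a tie.
        ¬raw⇒small : ¬ RawLess s → entry v Beats entry v′
        ¬raw⇒small n = beats-total (entry v′) (entry v) (λ e → <ˢ⇒≢ v<v′ (sym e)) not-large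
          where
          v<v′ : key v <ˢ key v′
          v<v′ = <ˢ-trans (proj₁ (zt-hi enc (branch l v r) zA)) (proj₁ (zt-lo enc (branch l′ v′ r′) zB))
          not-large : ¬ entry v′ Beats entry v
          not-large (inj₁ (inj₁ p)) = n (inj₁ (subst₂ _<_ (sym (NodeAt.rank₁≡ ndA)) (sym (NodeAt.rank₁≡ ndB)) p))
          not-large (inj₁ (inj₂ (e , p))) = n (inj₂ (trans (NodeAt.rank₁≡ ndA) (trans e (sym (NodeAt.rank₁≡ ndB))) , subst₂ _<_ (sym (NodeAt.rank₂≡ ndA)) (sym (NodeAt.rank₂≡ ndB)) p))
          not-large (inj₂ (_ , p)) = <ˢ-asym p v<v′

    Merged : ℕ → ℕ → State w → ℕ → Set
    Merged len n s′ τ = (Σ[ π′ ∈ Ctx ] Merging s′ π′ leaf leaf × length π′ ≤ len + n) × τ ≤ timeBound mergeC * suc n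

    private
      enter : ∀ (s : State w) {s₁ len n} → toℕ (null {w}) < toℕ (regs s smallᴿ) ⊎ toℕ (null {w}) < toℕ (regs s largeᴿ) →
              exec mergeBodyC s ≡ s₁ → Runs mergeC s₁ (Merged (suc len) n) → Runs mergeC s (Merged len (suc n))
      enter s {s₁} {len} {n} p e (s₂ , τ₂ , run₂ , (π′ , i , l) , l₂) with merge-test s | ⇓exec mergeBodyC s _
      ... | decides (no ¬p) _ | _ = contradiction p ¬p
      ... | decides (yes _) t | τ₁ , run₁ , l₁ = s₂ , _ , ⇓loop (λ z → bit-true (trans (sym t) z)) (subst (λ s′ → ⟨ mergeBodyC , s ⟩⇓⟨ s′ , τ₁ ⟩) e run₁) run₂
        , (π′ , i , ≤-trans l (≤-reflexive (sym (+-suc len n))))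
        , ≤-trans (+-mono-≤ (≤-trans (s≤s (+-monoʳ-≤ (cost mergeE) l₁)) (≤-reflexive (sym (timeBound≡ mergeC)))) l₂) (≤-reflexive (sym (*-suc (timeBound mergeC) (suc n))))

      chosen : ∀ {s} (D : Decides chooseE s (toℕ (regs s smallᴿ) ≡ toℕ (null {w}) ⊎ (toℕ (null {w}) < toℕ (regs s largeᴿ) × RawLess s))) →
               exec mergeBodyC s ≡ (if does (dec D) then exec takeLargeC s else exec takeSmallC s)
      chosen D = exec-decides {c = takeLargeC} {d = takeSmallC} D

      both : ∀ {s π l v r l′ v′ r′} (i : Merging s π (branch l v r) (branch l′ v′ r′)) →
             (∀ (beats : entry v′ Beats entry v) → Runs mergeC (large-state i beats) (Merged (suc (length π)) (suc (rspine r) + lspine l′))) →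
             (∀ (beats : entry v Beats entry v′) → Runs mergeC (small-state i beats) (Merged (suc (length π)) (rspine r + suc (lspine l′)))) →
             Runs mergeC s (Merged (length π) (suc (rspine r) + suc (lspine l′)))
      both {s} {π} {l} {v} {r} {l′} {v′} {r′} i f g with choose-test s
      ... | decides (yes (inj₁ p)) _ = contradiction p (not-null (Merging.trA i))
      ... | D@(decides (yes (inj₂ (_ , raw))) _) =
        subst (λ n → Runs mergeC s (Merged (length π) (suc n))) (sym (+-suc (rspine r) (lspine l′)))
          (enter s (inj₁ (positive (Merging.trA i))) (trans (chosen D) (take-large-state i (raw⇒large i raw))) (f (raw⇒large i raw)))
      ... | D@(decides (no ¬p) _) =
        enter s (inj₁ (positive (Merging.trA i))) (trans (chosen D) (take-small-state i small)) (g small)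
        where small = ¬raw⇒small i λ raw → ¬p (inj₂ (positive (Merging.trB i) , raw))

    -- Each step moves one node from the right spine of `A` or the left spine of `B` onto the path,
    -- so the sum of their lengths counts the steps.
    merge-runs : ∀ A B {π s} → Merging s π A B → Runs mergeC s (Merged (length π) (rspine A + lspine B))
    merge-runs leaf leaf {π} {s} i with merge-test s
    ... | decides (yes (inj₁ p)) _ = contradiction (subst (toℕ (null {w}) <_) (cong toℕ (Merging.trA i)) p) (<-irrefl refl)
    ... | decides (yes (inj₂ p)) _ = contradiction (subst (toℕ (null {w}) <_) (cong toℕ (Merging.trB i)) p) (<-irrefl refl)
    ... | decides (no _) t = _ , _ , ⇓done t , (π , i , m≤m+n _ 0) , ≤-trans (≤-trans (m≤m+n _ _) (≤-reflexive (sym (timeBound≡ mergeC)))) (m≤m*n (timeBound mergeC) 1)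
    merge-runs leaf (branch l v r) {π} {s} i with choose-test s
    ... | decides (no ¬p) _ = contradiction (inj₁ (cong toℕ (Merging.trA i))) ¬p
    ... | D@(decides (yes _) _) = enter s (inj₂ (positive (Merging.trB i))) (trans (chosen D) (take-large-state i tt))
      (merge-runs leaf l (take-large i tt))
    merge-runs (branch l v r) leaf {π} {s} i with choose-test s
    ... | decides (yes (inj₁ p)) _ = contradiction p (not-null (Merging.trA i))
    ... | decides (yes (inj₂ (p , _))) _ = contradiction (subst (toℕ (null {w}) <_) (cong toℕ (Merging.trB i)) p) (<-irrefl refl)
    ... | D@(decides (no _) _) = enter s (inj₁ (positive (Merging.trA i))) (trans (chosen D) (take-small-state i tt))
      (merge-runs r leaf (take-small i tt))
    merge-runs A@(branch l v r) B@(branch l′ v′ r′) i =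
      both i (λ beats → merge-runs A l′ (take-large i beats)) (λ beats → merge-runs r B (take-small i beats))

  module Deleting (σ w : ℕ) .{{_ : NonTrivial σ}} .{{_ : NonZero (α σ w)}} {R : ℕ}
                  (L : ℕ) (E : List (Entry σ R)) (t : Tree σ R) (x : Str σ) (r : Rank R) (s : State w)
                  (zip : ZipTrie (LCPCode.encode lcpCode L (α σ w)) E t)
                  (loaded : Loaded σ w L s t)
                  (query : Holds σ w s (regs s xbaseᴿ) (regs s xfullᴿ) (regs s xtailᴿ) x) where

    open Rebuild σ w {R} (IsNode s) L E t x

    private
      tr₀ : Tr (mem s) (regs s rootᴿ) t
      tr₀ = treeAt⇒tr t (λ _ → refl) (λ q ρ → ρ , λ _ → refl) (Loaded.tree loaded)

      zt₀ : ZT enc nothing nothing t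
      zt₀ = zipTrie⇒ZT enc zip

      open module S₁ = Search exactMode s Q using (Outcome)

      keep? : (e : Entry σ R) → Dec (¬ proj₁ e ≡ x)
      keep? e = ¬? (proj₁ e ≟ˢ x)

      post-from : ∀ {s′ t′ E′} → result delete x r E ↭ E′ → ZT enc nothing nothing t′ → entries t′ ↭ E′ → Tr (mem s′) (regs s′ rootᴿ) t′ → Kept (mem s) (mem s′) →
                  regs s′ logᴿ ≡ regs s logᴿ → regs s′ αᴿ ≡ regs s αᴿ → Post σ w delete L enc E x r s s′
      post-from {s′} {t′} e z p tr k l a≡ = record
        { tree = t′ ; zipTrie = zt⇒zipTrie z (↭-trans p (↭-sym e))
        ; loaded = record { tree = tr⇒treeAt t′ tr ; log≡ = trans (cong toℕ l) (Loaded.log≡ loaded) ; α≡ = trans (cong toℕ a≡) (Loaded.α≡ loaded) }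
        ; uses = λ p ρ → tr-reach t′ tr ρ ; text = text₌ k
        ; frame = λ a p l l′ n → frame₌ k a p {<⇒<ᵇ (s≤s l′)} n ; output = tt }

      alongᵒ : ∀ {s₂} (o : Outcome t s₂) → OnPath (Outcome.ctx o)
      alongᵒ o = inj₁ (dirs⇒along exactMode s Q (Outcome.ctx o) (S₁.dirs (Outcome.inv o)))

      around-keys : ∀ π → ZC enc π → Around π → All (λ e → ¬ proj₁ e ≡ x) (pre π) × All (λ e → ¬ proj₁ e ≡ x) (post π)
      around-keys π z ar = All.map <ˢ⇒≢ (zc-lo enc z (around-lo π ar)) , All.map (λ p e → <ˢ⇒≢ p (sym e)) (zc-hi enc z (around-hi π ar))

      absent : ∀ {s₂} (o : Outcome t s₂) → Outcome.subt o ≡ leaf → result delete x r E ↭ E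
      absent o e = ↭-trans (filter-↭ keep? (↭-sym (ZipTrie.stores zip))) (↭-trans (↭-reflexive (trans (cong (filter keep?) shape) (trans (filter-all keep? (All.++⁺ (proj₁ ne) (proj₂ ne))) (sym shape)))) (ZipTrie.stores zip))
        where
        π = Outcome.ctx o
        ne = around-keys π (Hole.zc (S₁.hl (Outcome.inv o))) (dirs⇒around {s} π (S₁.dirs (Outcome.inv o)))
        shape : entries t ≡ pre π ++ post π
        shape = trans (cong entries (sym (trans (cong (plug π) (sym e)) (Outcome.plug≡ o)))) (entries-plug π leaf)

      Rest : Cmd
      Rest = cond (reg foundᴿ) (detachC ⨾ mergeC ⨾ curᴿ ≔ lit 0 ⨾ relinkC) skip

      module Detach {s₂ : State w} (o : Outcome t s₂) {l v r′} (e : Outcome.subt o ≡ branch l v r′) (x≡ : x ≡ key v) (f≡ : regs s₂ foundᴿ ≡ Outcome.addr o) where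
        i = Outcome.inv o
        π = Outcome.ctx o
        p = regs s₂ foundᴿ
        m₂ = S₁.mem₀ i
        s₃ = exec detachC s₂
        whole : plug π (branch l v r′) ≡ t
        whole = trans (cong (plug π) (sym e)) (Outcome.plug≡ o)
        at : Tr (mem s₂) p (branch l v r′)
        at = subst₂ (Tr (mem s₂)) (sym f≡) e (tr-cong (Outcome.subt o) m₂ (S₁.tree i))
        nd = proj₁ (proj₂ at)
        aroundᵒ : Around π
        aroundᵒ = dirs⇒around {s} π (S₁.dirs i)
        holeᵒ : Hole enc π (branch l v r′)
        holeᵒ = subst (Hole enc π) e (S₁.hl i)
        parts : Codes enc (loOf π) (hiOf π) v × Below (entry v) l × Below (entry v) r′ × ZT enc (loOf π) (just (key v)) l × ZT enc (just (key v)) (hiOf π) r′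
        parts with Hole.zt holeᵒ
        ... | branch k bl br zl zr = k , bl , br , zl , zr
        zl : ZT enc (loOf π) (just x) l
        zl = subst (λ y → ZT enc (loOf π) (just y) l) (sym x≡) (proj₁ (proj₂ (proj₂ (proj₂ parts))))
        zr : ZT enc (just x) (hiOf π) r′
        zr = subst (λ y → ZT enc (just y) (hiOf π) r′) (sym x≡) (proj₂ (proj₂ (proj₂ (proj₂ parts))))
        P S : List (Entry σ R)
        P = pre π ++ entries l
        S = entries r′ ++ post π
        module M = Merge σ w {R} (IsNode s) L E t x s P S

        nonnull : p ≢ null
        nonnull = NodeAt.nonnull nd

        start : M.Merging s₃ π l r′
        start = record
          { regs₀ = λ r {b} → trans (regs-setReg cqᴿ (mem s₂ code⁺ᴬ p) (setReg cpᴿ (mem s₂ code⁻ᴬ p) (setReg largeᴿ (mem s₂ rightᴬ p) (setReg smallᴿ (mem s₂ leftᴬ p) s₂))) r {b})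
              (trans (regs-setReg cpᴿ (mem s₂ code⁻ᴬ p) (setReg largeᴿ (mem s₂ rightᴬ p) (setReg smallᴿ (mem s₂ leftᴬ p) s₂)) r {b})
              (trans (regs-setReg largeᴿ (mem s₂ rightᴬ p) (setReg smallᴿ (mem s₂ leftᴬ p) s₂) r {b}) (trans (regs-setReg smallᴿ (mem s₂ leftᴬ p) s₂ r {b}) (S₁.regs₀ i r {b}))))
          ; kept = record { text₌ = λ j → m₂ textᴬ j ; frame₌ = λ a p {b} _ → m₂ a p {b} }
          ; zcπ = Hole.zc (S₁.hl i) ; around = aroundᵒ ; zA = zl ; zB = zr
          ; topA = belowC-trans π l (Hole.top holeᵒ) (proj₁ (proj₂ parts)) ; topB = belowC-trans π r′ (Hole.top holeᵒ) (proj₁ (proj₂ (proj₂ parts)))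
          ; trA = proj₁ (proj₂ (proj₂ at)) ; trB = proj₂ (proj₂ (proj₂ at)) ; path = path-cong π m₂ (S₁.path i)
          ; cp = trans (NodeAt.code⁻≡ nd) (trans (Codes.code⁻≡ (proj₁ parts)) (cong (λ y → enc (lcp∞ y (loOf π))) (sym x≡)))
          ; cq = trans (NodeAt.code⁺≡ nd) (trans (Codes.code⁺≡ (proj₁ parts)) (cong (λ y → enc (lcp∞ y (hiOf π))) (sym x≡)))
          ; pre≡ = refl ; post≡ = refl }

        remaining : result delete x r E ↭ P ++ S
        remaining = ↭-trans (filter-↭ keep? (↭-sym (ZipTrie.stores zip))) (↭-reflexive (trans (cong (filter keep?) shape)
          (trans (filter-++ keep? P (entry v ∷ S)) (cong₂ _++_ (filter-all keep? allP)
            (trans (filter-reject keep? {entry v} {S} (λ n → n (sym x≡))) (filter-all keep? allS))))))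
          where
          ne = around-keys π (Hole.zc (S₁.hl i)) aroundᵒ
          allP : All (λ e → ¬ proj₁ e ≡ x) P
          allP = All.++⁺ (proj₁ ne) (All.map⁺ (All.map <ˢ⇒≢ (TAll⇒All l (zt-hi enc l zl))))
          allS : All (λ e → ¬ proj₁ e ≡ x) S
          allS = All.++⁺ (All.map⁺ (All.map (λ p e → <ˢ⇒≢ p (sym e)) (TAll⇒All r′ (zt-lo enc r′ zr)))) (proj₂ ne)
          shape : entries t ≡ P ++ entry v ∷ S
          shape = trans (cong entries (sym whole)) (trans (entries-plug π (branch l v r′)) (trans
            (cong (λ es → pre π ++ es ++ post π) (entries-branch l v r′))
            (trans (cong (pre π ++_) (++-assoc (entries l) (entry v ∷ entries r′) (post π))) (sym (++-assoc (pre π) (entries l) (entry v ∷ S))))))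

        finish : ∀ {s₄ π′ s′} → M.Merging s₄ π′ leaf leaf → Tr (mem s′) (regs s′ rootᴿ) (plug π′ leaf) × Kept (mem (setReg curᴿ null s₄)) (mem s′)
          × regs s′ logᴿ ≡ regs s₄ logᴿ × regs s′ αᴿ ≡ regs s₄ αᴿ → Post σ w delete L enc E x r s s′
        finish {s₄} {π′} m (tr , k , lg , a≡) = post-from remaining (hole-plug enc (hole (M.Merging.zcπ m) leaf tt)) (↭-reflexive contents) tr
          (kept-trans (record { text₌ = M.Kept.text₌ (M.Merging.kept m) ; frame₌ = λ a p {b} → M.Kept.frame₌ (M.Merging.kept m) a p {b} }) k)
          (trans lg (M.Merging.regs₀ m logᴿ)) (trans a≡ (M.Merging.regs₀ m αᴿ))
          where
          contents : entries (plug π′ leaf) ≡ P ++ S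
          contents = trans (entries-plug π′ leaf) (cong₂ _++_ (trans (sym (++-identityʳ (pre π′))) (M.Merging.pre≡ m)) (M.Merging.post≡ m))

        -- Each spine of the removed node extends a search path for its key.
        ρA ρB : Ctx
        ρA = rctx l (frame false v r′ ∷ π)
        ρB = lctx r′ (frame true v l ∷ π)

        -- A search for the boundary of `Less` passes `v` on the left, as `v` is not below `x`, and
        -- then turns right throughout `l`.
        on-ρA : OnPath ρA
        on-ρA = inj₁ (along-rctx l (frame false v r′ ∷ π) (zt-hi enc l zl) ((λ q → <ˢ⇒≢ q (sym x≡)) , proj₁ (around⇒along π aroundᵒ)))

        -- A search for the boundary of `NotMore` passes `v` on the right and then turns left
        -- throughout `r′`.
        on-ρB : OnPath ρB
        on-ρB = inj₂ (inj₁ (along-lctx r′ (frame true v l ∷ π) (TAll-map (λ q n → n q) r′ (zt-lo enc r′ zr)) ((λ q → <ˢ⇒≢ q x≡) , proj₂ (around⇒along π aroundᵒ))))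

        -- Zipping walks both spines and relinking climbs the zipped path, so either costs at most
        -- two search paths.
        twice : ∀ κ {τ} → τ ≤ κ * suc (length π + (rspine l + lspine r′)) → Fits (κ + κ) τ
        twice κ {τ} b = fits-≤ (≤-trans b (≤-trans (*-monoʳ-≤ κ sum) (≤-reflexive (*-distribˡ-+ κ (suc (length ρA)) (suc (length ρB))))))
          (fits-+ (fits-length κ ρA leaf (trans (plug-rctx l (frame false v r′ ∷ π)) whole) on-ρA ≤-refl)
                  (fits-length κ ρB leaf (trans (plug-lctx r′ (frame true v l ∷ π)) whole) on-ρB ≤-refl))
          where
          open ≤-Reasoning
          sum : suc (length π + (rspine l + lspine r′)) ≤ suc (length ρA) + suc (length ρB)
          sum = begin
            suc (length π + (rspine l + lspine r′)) ≡⟨ cong suc (trans (sym (+-assoc (length π) (rspine l) (lspine r′))) (cong (_+ lspine r′) (+-comm (length π) (rspine l)))) ⟩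
            suc (rspine l + length π + lspine r′) ≤⟨ s≤s (+-mono-≤ (+-monoʳ-≤ (rspine l) (n≤1+n (length π))) (m≤m+n (lspine r′) (suc (length π)))) ⟩
            suc (rspine l + suc (length π) + (lspine r′ + suc (length π))) ≡⟨ cong₂ (λ m n → suc (m + n)) (length-rctx l (frame false v r′ ∷ π)) (length-lctx r′ (frame true v l ∷ π)) ⟨
            suc (length ρA + length ρB) ≤⟨ +-monoʳ-≤ (suc (length ρA)) (n≤1+n (length ρB)) ⟩
            suc (length ρA) + suc (length ρB) ∎

        rest-runs : Runs Rest s₂ (λ s′ τ → Post σ w delete L enc E x r s s′ × Fits β-merge τ)
        rest-runs = runs-nonnull nonnull (runs-straight {c = detachC} _ λ {τ₁} l₁ →
          runs-seq (M.merge-runs l r′ start) λ {s₄} {τ₂} ((π′ , m , len) , l₂) →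
          runs-straight {c = curᴿ ≔ lit 0} _ λ {τ₃} l₃ →
          runs-map (λ { {s′} {τ₄} (q , l₄) → finish m q , fits-+ (fits-const {3} (m≤m+n 2 1)) (fits-+ (fits-const l₁)
              (fits-+ (twice (timeBound mergeC) (≤-trans l₂ (*-monoʳ-≤ (timeBound mergeC) (s≤s (m≤n+m _ (length π))))))
              (fits-+ (fits-const l₃) (fits-≤ l₄ (fits-+ (twice κ-relink (*-monoʳ-≤ κ-relink (s≤s len))) (fits-const ≤-refl)))))) })
            (relink-runs π′ (hole (M.Merging.zcπ m) leaf tt) refl (M.Merging.path m)))

    delete-runs : Runs deleteC s (λ s′ τ → Post σ w delete L enc E x r s s′ × Fits β-delete τ)
    delete-runs = runs-seq (S₁.search-runs query (Loaded.log≡ loaded) (Loaded.α≡ loaded) (λ _ → refl) agree-refl zt₀ tr₀ (keys≤Q {t} (ZipTrie.stores zip))) λ {s₂} {τ₂} (o , l₂) →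
      runs-map (λ { (p , f₃) → p , fits-+ (fits-≤ l₂ (fits-+ (fits-const ≤-refl)
          (fits-path (κ-search equalE vLessE) (Outcome.ctx o) (Outcome.subt o) (Outcome.plug≡ o) (alongᵒ o) ≤-refl))) f₃ }) (main o (Outcome.kind o))
      where
      main : ∀ {s₂} (o : Outcome t s₂) → (Outcome.subt o ≡ leaf × regs s₂ foundᴿ ≡ null)
               ⊎ (Σ[ l ∈ Tree σ R ] Σ[ v ∈ Node σ R ] Σ[ r ∈ Tree σ R ] Outcome.subt o ≡ branch l v r × x ≡ key v × regs s₂ foundᴿ ≡ Outcome.addr o) →
             Runs Rest s₂ (λ s′ τ → Post σ w delete L enc E x r s s′ × Fits β-merge τ)
      main {s₂} o (inj₁ (e , f≡)) = runs-null f≡ (s₂ , 0 , ⇓skip ,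
          post-from (absent o e) zt₀ (ZipTrie.stores zip) (subst (λ p → Tr (mem s₂) p t) (sym (S₁.regs₀ i rootᴿ)) (tr-cong t (S₁.mem₀ i) tr₀))
            (kept-agree (S₁.mem₀ i)) (S₁.regs₀ i logᴿ) (S₁.regs₀ i αᴿ)
        , fits-const {β-merge} (≤-trans (m≤m+n 2 1) (m≤m+n 3 _)))
        where i = Outcome.inv o
      main o (inj₂ (l , v , r′ , e , x≡ , f≡)) = Detach.rest-runs o e x≡ f≡

-- Truncated expectations over geometric ranks.

module Expectations where

  open import Defs using (geometric)
  open import Data.List as List using (List; []; _∷_; map)
  open import Data.List.Relation.Binary.Permutation.Propositional using (_↭_; refl; prep; swap; trans)
  open import Data.Nat as ℕ using (ℕ; zero; suc)
  open import Data.Product using (_×_; _,_; proj₁)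
  open import Data.Rational using (ℚ; 0ℚ; 1ℚ; ½; _+_; _*_; _≤_; nonNegative)
  open import Data.Rational.Properties
  open import Data.Rational.Solver using (module +-*-Solver)
  open import Function using (_∘_)
  open import Relation.Binary.PropositionalEquality as ≡ using (_≡_; cong; cong₂; sym; subst)
  open import Relation.Nullary.Decidable using (from-yes)
  open +-*-Solver using (solve; _:+_; _:*_; _:=_; con)

  *-mono-≤ˡ : ∀ {p q} r → 0ℚ ≤ r → p ≤ q → r * p ≤ r * q
  *-mono-≤ˡ r 0≤r = *-monoˡ-≤-nonNeg r {{nonNegative 0≤r}}

  *-mono-≤ʳ : ∀ {p q} r → 0ℚ ≤ r → p ≤ q → p * r ≤ q * r
  *-mono-≤ʳ r 0≤r = *-monoʳ-≤-nonNeg r {{nonNegative 0≤r}}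

  *-nonneg : ∀ {p q} → 0ℚ ≤ p → 0ℚ ≤ q → 0ℚ ≤ p * q
  *-nonneg {p} {q} 0≤p 0≤q = subst (_≤ p * q) (*-zeroʳ p) (*-mono-≤ˡ p 0≤p 0≤q)

  +-nonneg : ∀ {p q} → 0ℚ ≤ p → 0ℚ ≤ q → 0ℚ ≤ p + q
  +-nonneg {p} {q} 0≤p 0≤q = subst (_≤ p + q) (+-identityʳ 0ℚ) (+-mono-≤ 0≤p 0≤q)

  0≤½ : 0ℚ ≤ ½
  0≤½ = from-yes (0ℚ ≤? ½)

  pow : ℚ → ℕ → ℚ
  pow q zero    = 1ℚ
  pow q (suc n) = q * pow q n

  0≤1 : 0ℚ ≤ 1ℚ
  0≤1 = from-yes (0ℚ ≤? 1ℚ)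

  pow-nonneg : ∀ {q} → 0ℚ ≤ q → ∀ n → 0ℚ ≤ pow q n
  pow-nonneg 0≤q zero = 0≤1
  pow-nonneg 0≤q (suc n) = *-nonneg 0≤q (pow-nonneg 0≤q n)

  pow-+ : ∀ q m n → pow q (m ℕ.+ n) ≡ pow q m * pow q n
  pow-+ q zero n = sym (*-identityˡ (pow q n))
  pow-+ q (suc m) n = ≡.trans (cong (q *_) (pow-+ q m n)) (sym (*-assoc q (pow q m) (pow q n)))

  pow-≤1 : ∀ {q} → 0ℚ ≤ q → q ≤ 1ℚ → ∀ n → pow q n ≤ 1ℚ
  pow-≤1 0≤q q≤1 zero = ≤-refl
  pow-≤1 {q} 0≤q q≤1 (suc n) = ≤-trans (*-mono-≤ˡ q 0≤q (pow-≤1 0≤q q≤1 n)) (≤-trans (≤-reflexive (*-identityʳ q)) q≤1)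

  pow-≥1 : ∀ {q} → 1ℚ ≤ q → ∀ n → 1ℚ ≤ pow q n
  pow-≥1 1≤q zero = ≤-refl
  pow-≥1 {q} 1≤q (suc n) = ≤-trans 1≤q (≤-trans (≤-reflexive (sym (*-identityʳ q))) (*-mono-≤ˡ q (≤-trans 0≤1 1≤q) (pow-≥1 1≤q n)))

  pow-anti : ∀ {q} → 0ℚ ≤ q → q ≤ 1ℚ → ∀ {m n} → m ℕ.≤ n → pow q n ≤ pow q m
  pow-anti 0≤q q≤1 {n = n} ℕ.z≤n = pow-≤1 0≤q q≤1 n
  pow-anti {q} 0≤q q≤1 (ℕ.s≤s l) = *-mono-≤ˡ q 0≤q (pow-anti 0≤q q≤1 l)

  pow-mono : ∀ {q} → 1ℚ ≤ q → ∀ {m n} → m ℕ.≤ n → pow q m ≤ pow q n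
  pow-mono 1≤q {n = n} ℕ.z≤n = pow-≥1 1≤q n
  pow-mono {q} 1≤q (ℕ.s≤s l) = *-mono-≤ˡ q (≤-trans 0≤1 1≤q) (pow-mono 1≤q l)

  -- Truncated expectations

  -- The geometric distribution restricted to values below N.
  𝔼 : ℕ → (ℕ → ℚ) → ℚ
  𝔼 zero    f = 0ℚ
  𝔼 (suc N) f = ½ * (f 0 + 𝔼 N (f ∘ suc))

  𝔼-cong : ∀ N {f g} → (∀ k → f k ≡ g k) → 𝔼 N f ≡ 𝔼 N g
  𝔼-cong zero e = ≡.refl
  𝔼-cong (suc N) e = cong (½ *_) (cong₂ _+_ (e 0) (𝔼-cong N (e ∘ suc)))

  𝔼-mono : ∀ N {f g} → (∀ k → f k ≤ g k) → 𝔼 N f ≤ 𝔼 N g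
  𝔼-mono zero e = ≤-refl
  𝔼-mono (suc N) e = *-mono-≤ˡ ½ 0≤½ (+-mono-≤ (e 0) (𝔼-mono N (e ∘ suc)))

  𝔼-+ : ∀ N (f g : ℕ → ℚ) → 𝔼 N (λ k → f k + g k) ≡ 𝔼 N f + 𝔼 N g
  𝔼-+ zero f g = ≡.refl
  𝔼-+ (suc N) f g = ≡.trans (cong (λ e → ½ * (f 0 + g 0 + e)) (𝔼-+ N (f ∘ suc) (g ∘ suc)))
    (solve 5 (λ h a b c d → h :* (a :+ b :+ (c :+ d)) := h :* (a :+ c) :+ h :* (b :+ d)) ≡.refl
      ½ (f 0) (g 0) (𝔼 N (f ∘ suc)) (𝔼 N (g ∘ suc)))

  𝔼-* : ∀ N c (f : ℕ → ℚ) → 𝔼 N (λ k → c * f k) ≡ c * 𝔼 N f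
  𝔼-* zero c f = sym (*-zeroʳ c)
  𝔼-* (suc N) c f = ≡.trans (cong (λ e → ½ * (c * f 0 + e)) (𝔼-* N c (f ∘ suc)))
    (solve 4 (λ h c a b → h :* (c :* a :+ c :* b) := c :* (h :* (a :+ b))) ≡.refl ½ c (f 0) (𝔼 N (f ∘ suc)))

  -- An inequality, since truncation loses the mass of the ranks from `N` on.
  𝔼-const : ∀ N {c} → 0ℚ ≤ c → 𝔼 N (λ _ → c) ≤ c
  𝔼-const zero 0≤c = 0≤c
  𝔼-const (suc N) {c} 0≤c = ≤-trans (*-mono-≤ˡ ½ 0≤½ (+-mono-≤ (≤-refl {c}) (𝔼-const N 0≤c)))
    (≤-reflexive (≡.trans (solve 2 (λ h c → h :* (c :+ c) := (h :+ h) :* c) ≡.refl ½ c) (*-identityˡ c)))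

  𝔼-0 : ∀ N → 𝔼 N (λ _ → 0ℚ) ≡ 0ℚ
  𝔼-0 zero = ≡.refl
  𝔼-0 (suc N) = cong (λ e → ½ * (0ℚ + e)) (𝔼-0 N)

  𝔼-swap : ∀ M N (f : ℕ → ℕ → ℚ) → 𝔼 M (λ k → 𝔼 N (f k)) ≡ 𝔼 N (λ j → 𝔼 M (λ k → f k j))
  𝔼-swap zero N f = sym (𝔼-0 N)
  𝔼-swap (suc M) N f = sym (≡.trans (𝔼-* N ½ (λ j → f 0 j + 𝔼 M (λ k → f (suc k) j)))
    (cong (½ *_) (≡.trans (𝔼-+ N (f 0) (λ j → 𝔼 M (λ k → f (suc k) j))) (cong (𝔼 N (f 0) +_) (sym (𝔼-swap M N (f ∘ suc)))))))

  module _ {A : Set} (N : ℕ) where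

    𝔼s : List A → (List (A × ℕ) → ℚ) → ℚ
    𝔼s []       F = F []
    𝔼s (y ∷ ys) F = 𝔼 N (λ k → 𝔼s ys (λ l → F ((y , k) ∷ l)))

    𝔼s-mono : ∀ ys {F G} → (∀ l → map proj₁ l ≡ ys → F l ≤ G l) → 𝔼s ys F ≤ 𝔼s ys G
    𝔼s-mono [] e = e [] ≡.refl
    𝔼s-mono (y ∷ ys) e = 𝔼-mono N λ k → 𝔼s-mono ys λ l p → e ((y , k) ∷ l) (cong (y ∷_) p)

    𝔼s-cong : ∀ ys {F G} → (∀ l → F l ≡ G l) → 𝔼s ys F ≡ 𝔼s ys G
    𝔼s-cong [] e = e []
    𝔼s-cong (y ∷ ys) e = 𝔼-cong N λ k → 𝔼s-cong ys λ l → e ((y , k) ∷ l)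

    𝔼s-+ : ∀ ys (F G : List (A × ℕ) → ℚ) → 𝔼s ys (λ l → F l + G l) ≡ 𝔼s ys F + 𝔼s ys G
    𝔼s-+ [] F G = ≡.refl
    𝔼s-+ (y ∷ ys) F G = ≡.trans (𝔼-cong N λ k → 𝔼s-+ ys (λ l → F ((y , k) ∷ l)) (λ l → G ((y , k) ∷ l))) (𝔼-+ N (λ k → 𝔼s ys (λ l → F ((y , k) ∷ l))) (λ k → 𝔼s ys (λ l → G ((y , k) ∷ l))))

    𝔼s-* : ∀ ys c (F : List (A × ℕ) → ℚ) → 𝔼s ys (λ l → c * F l) ≡ c * 𝔼s ys F
    𝔼s-* [] c F = ≡.refl
    𝔼s-* (y ∷ ys) c F = ≡.trans (𝔼-cong N λ k → 𝔼s-* ys c (λ l → F ((y , k) ∷ l))) (𝔼-* N c (λ k → 𝔼s ys (λ l → F ((y , k) ∷ l))))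

    𝔼s-const : ∀ ys {c} → 0ℚ ≤ c → 𝔼s ys (λ _ → c) ≤ c
    𝔼s-const [] _ = ≤-refl
    𝔼s-const (y ∷ ys) 0≤c = ≤-trans (𝔼-mono N λ k → 𝔼s-const ys 0≤c) (𝔼-const N 0≤c)

    𝔼-𝔼s-swap : ∀ ys (F : ℕ → List (A × ℕ) → ℚ) → 𝔼 N (λ k → 𝔼s ys (F k)) ≡ 𝔼s ys (λ l → 𝔼 N (λ k → F k l))
    𝔼-𝔼s-swap [] F = ≡.refl
    𝔼-𝔼s-swap (y ∷ ys) F = ≡.trans (𝔼-swap N N (λ k j → 𝔼s ys (λ l → F k ((y , j) ∷ l))))
      (𝔼-cong N λ j → 𝔼-𝔼s-swap ys (λ k l → F k ((y , j) ∷ l)))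

    -- Ranks are independent and identically distributed, so for a functional that ignores order the
    -- keys may be assumed sorted.
    𝔼s-↭ : ∀ {xs ys} F → (∀ {l m} → l ↭ m → F l ≡ F m) → xs ↭ ys → 𝔼s xs F ≡ 𝔼s ys F
    𝔼s-↭ F inv refl = ≡.refl
    𝔼s-↭ F inv (prep x p) = 𝔼-cong N λ k → 𝔼s-↭ (λ l → F ((x , k) ∷ l)) (λ q → inv (prep (x , k) q)) p
    𝔼s-↭ {x ∷ y ∷ xs} {_ ∷ _ ∷ ys} F inv (swap x y p) = ≡.trans (𝔼-swap N N (λ k j → 𝔼s xs (λ l → F ((x , k) ∷ (y , j) ∷ l))))
      (𝔼-cong N λ j → 𝔼-cong N λ k → ≡.trans (𝔼s-cong xs λ l → inv (swap (x , k) (y , j) refl))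
        (𝔼s-↭ (λ l → F ((y , j) ∷ (x , k) ∷ l)) (λ q → inv (prep _ (prep _ q))) p))
    𝔼s-↭ F inv (trans p q) = ≡.trans (𝔼s-↭ F inv p) (𝔼s-↭ F inv q)

-- The supermartingale of record weights.

module RecordWeights where

  open Expectations
  open import Data.Bool using (if_then_else_)
  open import Data.Empty using (⊥-elim)
  open import Data.List as List using (List; []; _∷_; map; filter; length)
  open import Data.List.Properties using (filter-accept; filter-reject)
  open import Data.List.Relation.Binary.Permutation.Propositional using (_↭_; refl; prep; swap; trans; ↭-sym)
  open import Data.List.Relation.Binary.Permutation.Propositional.Properties using (All-resp-↭; filter-↭; ↭-length)
  open import Data.List.Relation.Unary.All as All using (All; []; _∷_; all?)
  import Data.List.Relation.Unary.All.Properties as All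
  open import Data.List.Relation.Unary.AllPairs using (AllPairs; []; _∷_)
  open import Data.Nat as ℕ using (ℕ; zero; suc; _⊔_)
  import Data.Nat.Properties as ℕ
  open import Data.Product using (_×_; _,_; proj₁; proj₂; Σ-syntax)
  open import Data.Sum using (inj₁; inj₂)
  open import Data.Rational using (ℚ; 0ℚ; 1ℚ; ½; _+_; _*_; _≤_; _<_; _/_)
  open import Data.Integer using (+_)
  open import Data.Rational.Properties
  open import Data.Rational.Solver using (module +-*-Solver)
  open import Relation.Binary.Definitions using (Tri; tri<; tri≈; tri>)
  open import Relation.Binary.PropositionalEquality as ≡ using (_≡_; _≢_; cong; cong₂; sym)
  open import Relation.Nullary using (¬_; Dec; yes; no; does; contradiction)
  open import Relation.Nullary.Decidable using (from-yes; _×-dec_; _→-dec_)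
  open import Relation.Unary using (Decidable)
  open +-*-Solver using (solve; _:+_; _:*_; _:=_)

  module _ {B : Set} {P Q : B → Set} (P? : Decidable P) (Q? : Decidable Q) where

    count-cong : ∀ {l} → All (λ e → (P e → Q e) × (Q e → P e)) l → length (filter P? l) ≡ length (filter Q? l)
    count-cong [] = ≡.refl
    count-cong {e ∷ l} ((f , g) ∷ es) with P? e | Q? e
    ... | yes p | yes q = cong suc (count-cong es)
    ... | yes p | no ¬q = contradiction (f p) ¬q
    ... | no ¬p | yes q = contradiction (g q) ¬p
    ... | no ¬p | no ¬q = count-cong es

  -- Forced by the geometric distribution: if a rank reaches the current maximum, its excess `k`
  -- over it is again geometric, the mean of `½ ^ k` is `2 / 3`, and this factor compensates it
  -- exactly.
  3/2 : ℚ
  3/2 = + 3 / 2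

  0≤3/2 : 0ℚ ≤ 3/2
  0≤3/2 = from-yes (0ℚ ≤? 3/2)

  -- The factor by which a rank k changes the weight when the maximum so far is m.
  growth : ℕ → ℕ → ℚ
  growth zero    k       = 3/2 * pow ½ k
  growth (suc m) zero    = 1ℚ
  growth (suc m) (suc k) = growth m k

  -- The geometric distribution is memoryless, so the maximum can be lowered step by step. The base
  -- case is the fixed point `½ * (3/2 + ½ * 1) = 1`.
  𝔼-growth : ∀ N m → 𝔼 N (growth m) ≤ 1ℚ
  𝔼-growth zero m = 0≤1
  𝔼-growth (suc N) zero = begin
    ½ * (3/2 * 1ℚ + 𝔼 N (λ k → 3/2 * (½ * pow ½ k))) ≡⟨ cong (λ e → ½ * (3/2 * 1ℚ + e)) (≡.trans (𝔼-cong N λ k → solve 3 (λ a b c → a :* (b :* c) := b :* (a :* c)) ≡.refl 3/2 ½ (pow ½ k)) (𝔼-* N ½ (growth 0))) ⟩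
    ½ * (3/2 * 1ℚ + ½ * 𝔼 N (growth 0)) ≤⟨ *-mono-≤ˡ ½ 0≤½ (+-mono-≤ (≤-refl {3/2 * 1ℚ}) (*-mono-≤ˡ ½ 0≤½ (𝔼-growth N 0))) ⟩
    ½ * (3/2 * 1ℚ + ½ * 1ℚ) ≡⟨⟩
    1ℚ ∎
    where open ≤-Reasoning
  𝔼-growth (suc N) (suc m) = begin
    ½ * (1ℚ + 𝔼 N (growth m)) ≤⟨ *-mono-≤ˡ ½ 0≤½ (+-mono-≤ (≤-refl {1ℚ}) (𝔼-growth N m)) ⟩
    ½ * (1ℚ + 1ℚ) ≡⟨⟩
    1ℚ ∎
    where open ≤-Reasoning

  growth-below : ∀ {k m} → k ℕ.< m → growth m k ≡ 1ℚ
  growth-below {zero} {suc m} _ = ≡.refl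
  growth-below {suc k} {suc m} (ℕ.s≤s l) = growth-below l

  growth-above : ∀ {k m} → m ℕ.≤ k → pow ½ m * growth m k ≡ 3/2 * pow ½ k
  growth-above {k} {zero} _ = *-identityˡ (3/2 * pow ½ k)
  growth-above {suc k} {suc m} (ℕ.s≤s l) = ≡.trans (*-assoc ½ (pow ½ m) (growth m k)) (≡.trans (cong (½ *_) (growth-above l))
    (solve 3 (λ a b c → a :* (b :* c) := b :* (a :* c)) ≡.refl ½ 3/2 (pow ½ k)))

  module Records {A : Set} (_≺_ : A → A → Set) (≺-cmp : ∀ x y → Tri (x ≺ y) (x ≡ y) (y ≺ x))
                 (≺-trans : ∀ {x y z} → x ≺ y → y ≺ z → x ≺ z) {D : A → Set} (D? : Decidable D) where

    private
      _≺?_ : ∀ x y → Dec (x ≺ y)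
      x ≺? y with ≺-cmp x y
      ... | tri< p _ _ = yes p
      ... | tri≈ ¬p _ _ = no ¬p
      ... | tri> ¬p _ _ = no ¬p

      ≺-irrefl : ∀ {x} → ¬ x ≺ x
      ≺-irrefl {x} p with ≺-cmp x x
      ... | tri< _ ¬e _ = ¬e ≡.refl
      ... | tri≈ ¬p _ _ = ¬p p
      ... | tri> ¬p _ _ = ¬p p

    -- The comparison is with later elements in the order `≺`, which in the applications are nearer
    -- to the boundary. Equality is allowed: among equal first components the second or the key may
    -- decide either way.
    Record : List (A × ℕ) → A × ℕ → Set
    Record l (y , k) = D y × All (λ e → D (proj₁ e) → y ≺ proj₁ e → proj₂ e ℕ.≤ k) l

    record? : ∀ l → Decidable (Record l)
    record? l (y , k) = D? y ×-dec all? (λ e → D? (proj₁ e) →-dec (y ≺? proj₁ e →-dec proj₂ e ℕ.≤? k)) l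

    records : List (A × ℕ) → ℕ
    records l = length (filter (record? l) l)

    highest : List (A × ℕ) → ℕ
    highest [] = 0
    highest ((y , k) ∷ l) = if does (D? y) then k ⊔ highest l else highest l

    records-↭ : ∀ {l m} → l ↭ m → records l ≡ records m
    records-↭ {l} {m} p = ≡.trans (↭-length (filter-↭ (record? l) p))
      (count-cong (record? l) (record? m) {m} (All.tabulate λ _ → (λ { (d , a) → d , All-resp-↭ p a }) , (λ { (d , a) → d , All-resp-↭ (↭-sym p) a })))

    highest-↭ : ∀ {l m} → l ↭ m → highest l ≡ highest m
    highest-↭ refl = ≡.refl
    highest-↭ (prep (y , k) p) with D? y
    ... | yes _ = cong (k ⊔_) (highest-↭ p)
    ... | no _ = highest-↭ p
    highest-↭ {_ ∷ _ ∷ l} {_ ∷ _ ∷ m} (swap (y , k) (z , j) p) with D? y | D? z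
    ... | yes _ | yes _ = ≡.trans (sym (ℕ.⊔-assoc k j (highest l))) (≡.trans (cong₂ _⊔_ (ℕ.⊔-comm k j) (highest-↭ p)) (ℕ.⊔-assoc j k (highest m)))
    ... | yes _ | no _ = cong (k ⊔_) (highest-↭ p)
    ... | no _ | yes _ = cong (j ⊔_) (highest-↭ p)
    ... | no _ | no _ = highest-↭ p
    highest-↭ (trans p q) = ≡.trans (highest-↭ p) (highest-↭ q)

    highest≤ : ∀ {M l} → All (λ e → proj₂ e ℕ.≤ M) l → highest l ℕ.≤ M
    highest≤ [] = ℕ.z≤n
    highest≤ {l = (y , k) ∷ l} (p ∷ ps) with D? y
    ... | yes _ = ℕ.⊔-lub p (highest≤ ps)
    ... | no _ = highest≤ ps

    ≤highest : ∀ l → All (λ e → D (proj₁ e) → proj₂ e ℕ.≤ highest l) l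
    ≤highest [] = []
    ≤highest ((y , k) ∷ l) with D? y
    ... | yes d = (λ _ → ℕ.m≤m⊔n k (highest l)) ∷ All.map (λ f d → ℕ.≤-trans (f d) (ℕ.m≤n⊔m k (highest l))) (≤highest l)
    ... | no ¬d = (λ d → contradiction d ¬d) ∷ ≤highest l

    highest-lub : ∀ {k} l → All (λ e → D (proj₁ e) → proj₂ e ℕ.≤ k) l → highest l ℕ.≤ k
    highest-lub [] _ = ℕ.z≤n
    highest-lub ((y , j) ∷ l) (f ∷ fs) with D? y
    ... | yes d = ℕ.⊔-lub (f d) (highest-lub l fs)
    ... | no _ = highest-lub l fs

    weight : List (A × ℕ) → ℚ
    weight l = pow 3/2 (records l) * pow ½ (highest l)

    weight-↭ : ∀ {l m} → l ↭ m → weight l ≡ weight m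
    weight-↭ p = cong₂ (λ r h → pow 3/2 r * pow ½ h) (records-↭ p) (highest-↭ p)

    weight-nonneg : ∀ l → 0ℚ ≤ weight l
    weight-nonneg l = *-nonneg (pow-nonneg 0≤3/2 (records l)) (pow-nonneg 0≤½ (highest l))

    module _ {y : A} {k : ℕ} {l : List (A × ℕ)} (first : All (λ e → y ≺ proj₁ e) l) where

      private
        l′ = (y , k) ∷ l

        rest : length (filter (record? l′) l) ≡ records l
        rest = count-cong (record? l′) (record? l) (All.map (λ { y≺z → (λ { (d , _ ∷ a) → d , a })
          , (λ { (d , a) → d , (λ _ z≺y → ⊥-elim (≺-irrefl (≺-trans y≺z z≺y))) ∷ a }) }) first)

      weight-skip : ¬ D y → weight l′ ≡ weight l
      weight-skip ¬d = cong₂ (λ r h → pow 3/2 r * pow ½ h) recs high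
        where
        recs : records l′ ≡ records l
        recs = ≡.trans (cong length (filter-reject (record? l′) {y , k} {l} λ r → ¬d (proj₁ r))) rest
        high : highest l′ ≡ highest l
        high with D? y
        ... | yes d = contradiction d ¬d
        ... | no _ = ≡.refl

      -- The first element is farthest from the boundary: it affects no other record, and is one
      -- itself exactly if its rank reaches the maximum of the rest.
      weight-step : D y → weight l′ ≡ weight l * growth (highest l) k
      weight-step d with ℕ.≤-<-connex (highest l) k
      ... | inj₁ m≤k = ≡.trans (cong₂ (λ r h → pow 3/2 r * pow ½ h) recs high) (≡.trans
          (solve 3 (λ a b c → (a :* b) :* c := b :* (a :* c)) ≡.refl 3/2 (pow 3/2 (records l)) (pow ½ k))
          (≡.trans (cong (pow 3/2 (records l) *_) (sym (growth-above m≤k))) (sym (*-assoc (pow 3/2 (records l)) (pow ½ (highest l)) (growth (highest l) k)))))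
        where
        recs : records l′ ≡ suc (records l)
        recs = ≡.trans (cong length (filter-accept (record? l′) {y , k} {l}
          (d , (λ _ p → contradiction p ≺-irrefl) ∷ All.map (λ f d _ → ℕ.≤-trans (f d) m≤k) (≤highest l)))) (cong suc rest)
        high : highest l′ ≡ k
        high with D? y
        ... | yes _ = ℕ.m≥n⇒m⊔n≡m m≤k
        ... | no ¬d = contradiction d ¬d
      ... | inj₂ k<m = ≡.trans (cong₂ (λ r h → pow 3/2 r * pow ½ h) recs high)
          (≡.trans (sym (*-identityʳ (weight l))) (cong (weight l *_) (sym (growth-below k<m))))
        where
        lower : All (λ e → D (proj₁ e) → y ≺ proj₁ e → proj₂ e ℕ.≤ k) l → All (λ e → D (proj₁ e) → proj₂ e ℕ.≤ k) l
        lower a = All.zipWith (λ { (f , p) d → f d p }) (a , first)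
        recs : records l′ ≡ records l
        recs = ≡.trans (cong length (filter-reject (record? l′) {y , k} {l}
          λ { (_ , _ ∷ a) → ℕ.<⇒≱ k<m (highest-lub l (lower a)) })) rest
        high : highest l′ ≡ highest l
        high with D? y
        ... | yes _ = ℕ.m≤n⇒m⊔n≡n (ℕ.<⇒≤ k<m)
        ... | no ¬d = contradiction d ¬d

    private
      insert : ∀ y ys → AllPairs _≺_ ys → All (y ≢_) ys → Σ[ zs ∈ List A ] (y ∷ ys ↭ zs × AllPairs _≺_ zs)
      insert y [] _ _ = y ∷ [] , refl , [] ∷ []
      insert y (z ∷ ys) (z≺ ∷ s) (y≢z ∷ ne) with ≺-cmp y z
      ... | tri< p _ _ = y ∷ z ∷ ys , refl , (p ∷ All.map (≺-trans p) z≺) ∷ z≺ ∷ s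
      ... | tri≈ _ e _ = contradiction e y≢z
      ... | tri> _ _ p with insert y ys s ne
      ...   | zs , q , s′ = z ∷ zs , trans (swap y z refl) (prep z q) , All-resp-↭ q (p ∷ z≺) ∷ s′

      sort : ∀ ys → AllPairs _≢_ ys → Σ[ zs ∈ List A ] (ys ↭ zs × AllPairs _≺_ zs)
      sort [] _ = [] , refl , []
      sort (y ∷ ys) (ne ∷ u) with sort ys u
      ... | zs , p , s with insert y zs s (All-resp-↭ p ne)
      ...   | zs′ , q , s′ = zs′ , trans (prep y p) q , s′

      sorted : ∀ N ys → AllPairs _≺_ ys → 𝔼s N ys weight ≤ 1ℚ
      sorted N [] _ = ≤-refl
      sorted N (y ∷ ys) (first ∷ s) = step (D? y)
        where
        open ≤-Reasoning
        step : Dec (D y) → 𝔼s N (y ∷ ys) weight ≤ 1ℚ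
        step (no ¬d) = begin
          𝔼 N (λ k → 𝔼s N ys (λ l → weight ((y , k) ∷ l))) ≤⟨ 𝔼-mono N (λ k → 𝔼s-mono N ys λ { l ≡.refl → ≤-reflexive (weight-skip (All.map⁻ first) ¬d) }) ⟩
          𝔼 N (λ _ → 𝔼s N ys weight) ≤⟨ 𝔼-mono N (λ _ → sorted N ys s) ⟩
          𝔼 N (λ _ → 1ℚ) ≤⟨ 𝔼-const N 0≤1 ⟩
          1ℚ ∎
        step (yes d) = begin
          𝔼 N (λ k → 𝔼s N ys (λ l → weight ((y , k) ∷ l))) ≤⟨ 𝔼-mono N (λ k → 𝔼s-mono N ys λ { l ≡.refl → ≤-reflexive (weight-step (All.map⁻ first) d) }) ⟩
          -- The rank of the farthest key has to be averaged with the ranks of all others fixed,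
          -- hence the exchange of expectations.
          𝔼 N (λ k → 𝔼s N ys (λ l → weight l * growth (highest l) k)) ≡⟨ 𝔼-𝔼s-swap N ys (λ k l → weight l * growth (highest l) k) ⟩
          𝔼s N ys (λ l → 𝔼 N (λ k → weight l * growth (highest l) k)) ≡⟨ 𝔼s-cong N ys (λ l → 𝔼-* N (weight l) (growth (highest l))) ⟩
          𝔼s N ys (λ l → weight l * 𝔼 N (growth (highest l))) ≤⟨ 𝔼s-mono N ys (λ l _ → ≤-trans (*-mono-≤ˡ (weight l) (weight-nonneg l) (𝔼-growth N (highest l))) (≤-reflexive (*-identityʳ (weight l)))) ⟩
          𝔼s N ys weight ≤⟨ sorted N ys s ⟩
          1ℚ ∎

    -- Reading the ranks from the far end of the order, the weight is a supermartingale.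
    𝔼s-weight : ∀ N ys → AllPairs _≢_ ys → 𝔼s N ys weight ≤ 1ℚ
    𝔼s-weight N ys u with sort ys u
    ... | zs , p , s = ≤-trans (≤-reflexive (𝔼s-↭ N weight weight-↭ p)) (sorted N zs s)

-- Finite sums over outcomes and Markov's inequality.

module MarkovBound where

  open import Defs using (Rank; prob; geometric; FailsWithProbability≤)
  open Expectations
  import Data.Integer as ℤ
  import Data.Integer.Properties as ℤ
  open import Data.Integer using (+_)
  open import Data.Integer.Tactic.RingSolver using (solve-∀)
  open import Data.List as List using (List; []; _∷_; _++_; map; foldr; concatMap; allFin; length)
  open import Data.List.Properties using (length-tabulate)
  open import Data.List.Membership.Propositional using (_∈_)
  open import Data.List.Membership.Propositional.Properties using (∈-∃++; ∈-++⁻; ∈-++⁺ˡ; ∈-++⁺ʳ; ∈-allFin; ∈-concatMap⁺; ∈-map⁺)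
  open import Data.List.Relation.Unary.All as All using (All; []; _∷_)
  open import Data.List.Relation.Unary.Any as Any using (here; there)
  open import Data.List.Relation.Unary.AllPairs using ([]; _∷_)
  open import Data.List.Relation.Unary.Unique.Propositional using (Unique)
  open import Data.Nat as ℕ using (ℕ; zero; suc)
  import Data.Nat.Properties as ℕ
  open import Data.Product using (_×_; _,_; proj₁; Σ-syntax)
  open import Data.Rational using (ℚ; 0ℚ; 1ℚ; ½; _+_; _*_; _≤_; _<_; _/_; toℚᵘ)
  open import Data.Rational.Properties
  open import Data.Rational.Solver using (module +-*-Solver)
  import Data.Rational.Unnormalised as ℚᵘ
  import Data.Rational.Unnormalised.Properties as ℚᵘ
  open import Data.Sum using (inj₁; inj₂)
  open import Data.Vec as Vec using (Vec; []; _∷_; toList; zipWith)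
  open import Function using (_∘_)
  open import Relation.Binary.PropositionalEquality as ≡ using (_≡_; cong; cong₂; sym)
  open import Relation.Nullary using (¬_; contradiction)
  open +-*-Solver using (solve; _:+_; _:*_; _:=_)

  natQ : ℕ → ℚ
  natQ zero    = 0ℚ
  natQ (suc n) = 1ℚ + natQ n

  natQ-nonneg : ∀ n → 0ℚ ≤ natQ n
  natQ-nonneg zero = ≤-refl
  natQ-nonneg (suc n) = +-nonneg 0≤1 (natQ-nonneg n)

  natQ-mono : ∀ {m n} → m ℕ.≤ n → natQ m ≤ natQ n
  natQ-mono {n = n} ℕ.z≤n = natQ-nonneg n
  natQ-mono (ℕ.s≤s l) = +-mono-≤ (≤-refl {1ℚ}) (natQ-mono l)

  natQ-+ : ∀ m n → natQ (m ℕ.+ n) ≡ natQ m + natQ n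
  natQ-+ zero n = sym (+-identityˡ (natQ n))
  natQ-+ (suc m) n = ≡.trans (cong (λ e → 1ℚ + e) (natQ-+ m n)) (sym (+-assoc 1ℚ (natQ m) (natQ n)))

  ½^*natQ : ∀ a → pow ½ a * natQ (2 ℕ.^ a) ≡ 1ℚ
  ½^*natQ zero = ≡.refl
  ½^*natQ (suc a) = ≡.trans (cong (½ * pow ½ a *_) (≡.trans (natQ-+ (2 ℕ.^ a) (2 ℕ.^ a ℕ.+ 0)) (cong (λ n → natQ (2 ℕ.^ a) + natQ n) (ℕ.+-identityʳ (2 ℕ.^ a)))))
    (≡.trans (solve 3 (λ h p n → h :* p :* (n :+ n) := (h :+ h) :* (p :* n)) ≡.refl ½ (pow ½ a) (natQ (2 ℕ.^ a))) (≡.trans (*-identityˡ (pow ½ a * natQ (2 ℕ.^ a))) (½^*natQ a)))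

  natQ*unit : ∀ n m .{{_ : ℕ.NonZero m}} → natQ n * (+ 1 / m) ≡ + n / m
  natQ*unit n (suc d) = go n
    where
    go : ∀ n → natQ n * (+ 1 / suc d) ≡ + n / suc d
    go zero = ≡.trans (*-zeroˡ (+ 1 / suc d)) (sym (0/n≡0 (suc d)))
    go (suc n) = ≡.trans (*-distribʳ-+ (+ 1 / suc d) 1ℚ (natQ n)) (≡.trans (cong₂ _+_ (*-identityˡ (+ 1 / suc d)) (go n)) (toℚᵘ-injective (begin
      toℚᵘ (+ 1 / suc d + + n / suc d) ≈⟨ toℚᵘ-homo-+ (+ 1 / suc d) (+ n / suc d) ⟩
      toℚᵘ (+ 1 / suc d) ℚᵘ.+ toℚᵘ (+ n / suc d) ≈⟨ ℚᵘ.+-cong (toℚᵘ-fromℚᵘ (ℚᵘ.mkℚᵘ (+ 1) d)) (toℚᵘ-fromℚᵘ (ℚᵘ.mkℚᵘ (+ n) d)) ⟩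
      ℚᵘ.mkℚᵘ (+ 1) d ℚᵘ.+ ℚᵘ.mkℚᵘ (+ n) d ≈⟨ ℚᵘ.*≡* (common-denominator (+ suc d) (+ n)) ⟩
      ℚᵘ.mkℚᵘ (+ suc n) d ≈⟨ toℚᵘ-fromℚᵘ (ℚᵘ.mkℚᵘ (+ suc n) d) ⟨
      toℚᵘ (+ suc n / suc d) ∎)))
      where
      open ℚᵘ.≃-Reasoning
      common-denominator : ∀ D m → (ℤ.1ℤ ℤ.* D ℤ.+ m ℤ.* D) ℤ.* D ≡ (ℤ.1ℤ ℤ.+ m) ℤ.* (D ℤ.* D)
      common-denominator = solve-∀

  natQ*inverse : ∀ n .{{_ : ℕ.NonZero n}} → natQ n * (+ 1 / n) ≡ 1ℚ
  natQ*inverse n@(suc d) = ≡.trans (natQ*unit n n) (toℚᵘ-injective (ℚᵘ.≃-trans (toℚᵘ-fromℚᵘ (ℚᵘ.mkℚᵘ (+ n) d)) (ℚᵘ.*≡* (ℤ.*-comm (+ n) (+ 1)))))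

  0≤1/ : ∀ n .{{_ : ℕ.NonZero n}} → 0ℚ ≤ + 1 / n
  0≤1/ n = nonNegative⁻¹ (+ 1 / n) {{normalize-nonNeg 1 n}}

  -- Finite sums

  module _ {A : Set} (f : A → ℚ) where

    sumQ : List A → ℚ
    sumQ = foldr (λ x → _+_ (f x)) 0ℚ

    sumQ-++ : ∀ xs ys → sumQ (xs ++ ys) ≡ sumQ xs + sumQ ys
    sumQ-++ [] ys = sym (+-identityˡ (sumQ ys))
    sumQ-++ (x ∷ xs) ys = ≡.trans (cong (_+_ (f x)) (sumQ-++ xs ys)) (sym (+-assoc (f x) (sumQ xs) (sumQ ys)))

    -- As `xs` has no repetitions, each of its members can be cancelled against an occurrence of its
    -- own in `ys`; the terms left over are nonnegative.
    sumQ-⊆ : (∀ x → 0ℚ ≤ f x) → ∀ {xs ys} → Unique xs → (∀ {x} → x ∈ xs → x ∈ ys) → sumQ xs ≤ sumQ ys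
    sumQ-⊆ 0≤f {[]} {ys} _ _ = nonneg ys
      where
      nonneg : ∀ ys → 0ℚ ≤ sumQ ys
      nonneg [] = ≤-refl
      nonneg (y ∷ ys) = +-nonneg (0≤f y) (nonneg ys)
    sumQ-⊆ 0≤f {x ∷ xs} (x∉ ∷ u) sub with ∈-∃++ (sub (here ≡.refl))
    ... | ys , zs , ≡.refl = ≤-trans (+-mono-≤ (≤-refl {f x}) (sumQ-⊆ 0≤f u sub′)) (≤-reflexive (begin
      f x + sumQ (ys ++ zs) ≡⟨ cong (_+_ (f x)) (sumQ-++ ys zs) ⟩
      f x + (sumQ ys + sumQ zs) ≡⟨ solve 3 (λ a b c → a :+ (b :+ c) := b :+ (a :+ c)) ≡.refl (f x) (sumQ ys) (sumQ zs) ⟩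
      sumQ ys + (f x + sumQ zs) ≡⟨ sumQ-++ ys (x ∷ zs) ⟨
      sumQ (ys ++ x ∷ zs) ∎))
      where
      open ≡.≡-Reasoning
      sub′ : ∀ {z} → z ∈ xs → z ∈ ys ++ zs
      sub′ z∈ with ∈-++⁻ ys (sub (there z∈))
      ... | inj₁ p = ∈-++⁺ˡ p
      ... | inj₂ (here e) = contradiction (sym e) (All.lookup x∉ z∈)
      ... | inj₂ (there p) = ∈-++⁺ʳ ys p

  module _ {A : Set} where

    sumQ-cong : ∀ {f g : A → ℚ} → (∀ x → f x ≡ g x) → ∀ xs → sumQ f xs ≡ sumQ g xs
    sumQ-cong e [] = ≡.refl
    sumQ-cong e (x ∷ xs) = cong₂ _+_ (e x) (sumQ-cong e xs)

    sumQ-mono : ∀ {f g : A → ℚ} {xs} → All (λ x → f x ≤ g x) xs → sumQ f xs ≤ sumQ g xs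
    sumQ-mono [] = ≤-refl
    sumQ-mono (p ∷ ps) = +-mono-≤ p (sumQ-mono ps)

    sumQ-* : ∀ c (f : A → ℚ) xs → sumQ (λ x → c * f x) xs ≡ c * sumQ f xs
    sumQ-* c f [] = sym (*-zeroʳ c)
    sumQ-* c f (x ∷ xs) = ≡.trans (cong (_+_ (c * f x)) (sumQ-* c f xs)) (sym (*-distribˡ-+ c (f x) (sumQ f xs)))

    sumQ-const : ∀ c (xs : List A) → sumQ (λ _ → c) xs ≡ natQ (length xs) * c
    sumQ-const c [] = sym (*-zeroˡ c)
    sumQ-const c (x ∷ xs) = ≡.trans (cong (_+_ c) (sumQ-const c xs)) (≡.trans (cong (_+ natQ (length xs) * c) (sym (*-identityˡ c))) (sym (*-distribʳ-+ c 1ℚ (natQ (length xs)))))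

  module _ {A B : Set} (f : B → ℚ) where

    sumQ-map : ∀ (g : A → B) xs → sumQ f (map g xs) ≡ sumQ (f ∘ g) xs
    sumQ-map g [] = ≡.refl
    sumQ-map g (x ∷ xs) = cong (_+_ (f (g x))) (sumQ-map g xs)

    sumQ-concatMap : ∀ (g : A → List B) xs → sumQ f (concatMap g xs) ≡ sumQ (λ x → sumQ f (g x)) xs
    sumQ-concatMap g [] = ≡.refl
    sumQ-concatMap g (x ∷ xs) = ≡.trans (sumQ-++ f (g x) (concatMap g xs)) (cong (_+_ (sumQ f (g x))) (sumQ-concatMap g xs))

  levels : ℕ → List ℕ
  levels zero    = []
  levels (suc N) = 0 ∷ map suc (levels N)

  ∈-levels : ∀ {k N} → k ℕ.< N → k ∈ levels N
  ∈-levels {zero} {suc N} _ = here ≡.refl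
  ∈-levels {suc k} {suc N} (ℕ.s≤s l) = there (∈-map⁺ suc (∈-levels l))

  sumQ-levels : ∀ N g → sumQ (λ k → geometric k * g k) (levels N) ≡ 𝔼 N g
  sumQ-levels zero g = ≡.refl
  sumQ-levels (suc N) g = ≡.trans (cong (_+_ (½ * g 0)) (≡.trans (sumQ-map (λ k → geometric k * g k) suc (levels N))
    (≡.trans (sumQ-cong (λ k → *-assoc ½ (geometric k) (g (suc k))) (levels N)) (≡.trans (sumQ-* ½ (λ k → geometric k * g (suc k)) (levels N)) (cong (½ *_) (sumQ-levels N (g ∘ suc)))))))
    (sym (*-distribˡ-+ ½ (g 0) (𝔼 N (g ∘ suc))))

  module _ {R : ℕ} .{{_ : ℕ.NonZero R}} where

    geometric-nonneg : ∀ k → 0ℚ ≤ geometric k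
    geometric-nonneg zero = 0≤½
    geometric-nonneg (suc k) = *-nonneg 0≤½ (geometric-nonneg k)

    prob-nonneg : ∀ {m} (ρ : Vec (Rank R) m) → 0ℚ ≤ prob ρ
    prob-nonneg [] = 0≤1
    prob-nonneg ((k , _) ∷ ρ) = *-nonneg (*-nonneg (geometric-nonneg k) (0≤1/ R)) (prob-nonneg ρ)

    -- Any finite family of outcomes lies in such a box, over which sums factor into iterated
    -- truncated expectations.
    box : ℕ → ∀ m → List (Vec (Rank R) m)
    box N zero    = [] ∷ []
    box N (suc m) = concatMap (λ k → concatMap (λ u → map ((k , u) ∷_) (box N m)) (allFin R)) (levels N)

    Under : ℕ → ∀ {m} → Vec (Rank R) m → Set
    Under N ρ = All (λ e → proj₁ e ℕ.< N) (toList ρ)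

    ∈-box : ∀ {N m} (ρ : Vec (Rank R) m) → Under N ρ → ρ ∈ box N m
    ∈-box [] [] = here ≡.refl
    ∈-box {N} {suc m} ((k , u) ∷ ρ) (l ∷ ls) = ∈-concatMap⁺ (λ k → concatMap (λ u → map ((k , u) ∷_) (box N m)) (allFin R))
      (Any.map (λ { ≡.refl → ∈-concatMap⁺ (λ u → map ((k , u) ∷_) (box N m)) (Any.map (λ { ≡.refl → ∈-map⁺ ((k , u) ∷_) (∈-box ρ ls) }) (∈-allFin u)) }) (∈-levels l))

    bounded : ∀ {m} (ρ : Vec (Rank R) m) → Σ[ N ∈ ℕ ] Under N ρ
    bounded [] = 0 , []
    bounded ((k , _) ∷ ρ) with bounded ρ
    ... | N , p = suc k ℕ.⊔ N , ℕ.m≤m⊔n (suc k) N ∷ All.map (λ l → ℕ.≤-trans l (ℕ.m≤n⊔m (suc k) N)) p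

    all-bounded : ∀ {m} (ρs : List (Vec (Rank R) m)) → Σ[ N ∈ ℕ ] All (Under N) ρs
    all-bounded [] = 0 , []
    all-bounded (ρ ∷ ρs) with bounded ρ | all-bounded ρs
    ... | M , p | N , q = M ℕ.⊔ N , All.map (λ l → ℕ.≤-trans l (ℕ.m≤m⊔n M N)) p ∷ All.map (All.map (λ l → ℕ.≤-trans l (ℕ.m≤n⊔m M N))) q

    module _ {A : Set} where

      pairs : ∀ {m} → Vec A m → Vec (Rank R) m → List (A × ℕ)
      pairs ys ρ = toList (zipWith (λ y e → y , proj₁ e) ys ρ)

      -- `F` sees first rank components only, so the `R` values of each second component give `R`
      -- equal terms of weight `1 / R`.
      sumQ-box : ∀ N {m} (ys : Vec A m) F → sumQ (λ ρ → prob ρ * F (pairs ys ρ)) (box N m) ≡ 𝔼s N (toList ys) F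
      sumQ-box N [] F = ≡.trans (+-identityʳ (1ℚ * F [])) (*-identityˡ (F []))
      sumQ-box N {suc m} (y ∷ ys) F = begin
        sumQ f (box N (suc m)) ≡⟨ sumQ-concatMap f (λ k → concatMap (λ u → map ((k , u) ∷_) (box N m)) (allFin R)) (levels N) ⟩
        sumQ (λ k → sumQ f (concatMap (λ u → map ((k , u) ∷_) (box N m)) (allFin R))) (levels N) ≡⟨ sumQ-cong level (levels N) ⟩
        sumQ (λ k → geometric k * S k) (levels N) ≡⟨ sumQ-levels N S ⟩
        𝔼 N S ∎
        where
        open ≡.≡-Reasoning
        f : Vec (Rank R) (suc m) → ℚ
        f ρ = prob ρ * F (pairs (y ∷ ys) ρ)
        S : ℕ → ℚ
        S k = 𝔼s N (toList ys) (λ l → F ((y , k) ∷ l))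
        inner : ∀ k u → sumQ f (map ((k , u) ∷_) (box N m)) ≡ geometric k * (+ 1 / R) * S k
        inner k u = begin
          sumQ f (map ((k , u) ∷_) (box N m)) ≡⟨ sumQ-map f ((k , u) ∷_) (box N m) ⟩
          sumQ (λ ρ → geometric k * (+ 1 / R) * prob ρ * F ((y , k) ∷ pairs ys ρ)) (box N m) ≡⟨ sumQ-cong (λ ρ → *-assoc (geometric k * (+ 1 / R)) (prob ρ) (F ((y , k) ∷ pairs ys ρ))) (box N m) ⟩
          sumQ (λ ρ → geometric k * (+ 1 / R) * (prob ρ * F ((y , k) ∷ pairs ys ρ))) (box N m) ≡⟨ sumQ-* (geometric k * (+ 1 / R)) (λ ρ → prob ρ * F ((y , k) ∷ pairs ys ρ)) (box N m) ⟩
          geometric k * (+ 1 / R) * sumQ (λ ρ → prob ρ * F ((y , k) ∷ pairs ys ρ)) (box N m) ≡⟨ cong (geometric k * (+ 1 / R) *_) (sumQ-box N ys (λ l → F ((y , k) ∷ l))) ⟩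
          geometric k * (+ 1 / R) * S k ∎
        level : ∀ k → sumQ f (concatMap (λ u → map ((k , u) ∷_) (box N m)) (allFin R)) ≡ geometric k * S k
        level k = begin
          sumQ f (concatMap (λ u → map ((k , u) ∷_) (box N m)) (allFin R)) ≡⟨ sumQ-concatMap f (λ u → map ((k , u) ∷_) (box N m)) (allFin R) ⟩
          sumQ (λ u → sumQ f (map ((k , u) ∷_) (box N m))) (allFin R) ≡⟨ sumQ-cong (inner k) (allFin R) ⟩
          sumQ (λ _ → geometric k * (+ 1 / R) * S k) (allFin R) ≡⟨ sumQ-const (geometric k * (+ 1 / R) * S k) (allFin R) ⟩
          natQ (length (allFin R)) * (geometric k * (+ 1 / R) * S k) ≡⟨ cong (λ n → natQ n * (geometric k * (+ 1 / R) * S k)) (length-tabulate {n = R} (λ i → i)) ⟩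
          natQ R * (geometric k * (+ 1 / R) * S k) ≡⟨ solve 4 (λ n g r s → n :* (g :* r :* s) := n :* r :* (g :* s)) ≡.refl (natQ R) (geometric k) (+ 1 / R) (S k) ⟩
          natQ R * (+ 1 / R) * (geometric k * S k) ≡⟨ cong (_* (geometric k * S k)) (natQ*inverse R) ⟩
          1ℚ * (geometric k * S k) ≡⟨ *-identityˡ (geometric k * S k) ⟩
          geometric k * S k ∎

      -- On a bad outcome `F` is at least 1, so its probability is at most its term in the
      -- expectation; enlarging the family to a box adds nonnegative terms. The bound is required
      -- for all `N` because the box depends on the family.
      markov : ∀ {m ε} {P : Vec (Rank R) m → Set} (ys : Vec A m) (F : List (A × ℕ) → ℚ) → (∀ l → 0ℚ ≤ F l) →
               (∀ ρ → ¬ P ρ → 1ℚ ≤ F (pairs ys ρ)) → (∀ N → 𝔼s N (toList ys) F ≤ ε) → FailsWithProbability≤ ε P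
      markov {m} {ε} {P} ys F 0≤F big small ρs u bad with all-bounded ρs
      ... | N , under = begin
        sumQ prob ρs ≤⟨ sumQ-mono (All.map (λ {ρ} b → ≤-trans (≤-reflexive (sym (*-identityʳ (prob ρ)))) (*-mono-≤ˡ (prob ρ) (prob-nonneg ρ) (big ρ b))) bad) ⟩
        sumQ (λ ρ → prob ρ * F (pairs ys ρ)) ρs ≤⟨ sumQ-⊆ (λ ρ → prob ρ * F (pairs ys ρ)) (λ ρ → *-nonneg (prob-nonneg ρ) (0≤F (pairs ys ρ))) u (λ {ρ} ρ∈ → ∈-box ρ (All.lookup under ρ∈)) ⟩
        sumQ (λ ρ → prob ρ * F (pairs ys ρ)) (box N m) ≡⟨ sumQ-box N ys F ⟩
        𝔼s N (toList ys) F ≤⟨ small N ⟩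
        ε ∎
        where open ≤-Reasoning

-- Ancestors of a boundary as records.

module PathRecords where

  open import Defs
  open StringOrder
  open Zippers
  open Boundaries
  open RecordWeights
  open import Data.Bool using (true; false)
  open import Data.List using (List; []; _∷_; _++_; length; map; filter)
  open import Data.List.Properties using (map-++; filter-++; length-++; filter-accept)
  open import Data.List.Relation.Unary.All as All using (All; []; _∷_)
  import Data.List.Relation.Unary.All.Properties as All
  open import Data.Maybe using (nothing)
  open import Data.Nat
  open import Data.Nat.Properties
  open import Data.Product using (_×_; _,_; proj₁; proj₂)
  open import Data.Sum using (inj₁; inj₂)
  open import Data.Unit using (tt)
  open import Function using (flip)
  open import Relation.Binary.Definitions using (Tri; tri<; tri≈; tri>)
  open import Relation.Binary.PropositionalEquality hiding ([_])
  open import Relation.Nullary using (¬_; contradiction)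
  open import Relation.Nullary.Decidable using (¬?)
  open import Relation.Unary using (Decidable)

  module _ {σ R : ℕ} where

    rank₁Of : Entry σ R → Str σ × ℕ
    rank₁Of e = proj₁ e , proj₁ (proj₂ e)

    rights lefts : Ctx {σ} {R} → ℕ
    rights [] = 0
    rights (frame true _ _ ∷ π) = suc (rights π)
    rights (frame false _ _ ∷ π) = rights π
    lefts [] = 0
    lefts (frame true _ _ ∷ π) = lefts π
    lefts (frame false _ _ ∷ π) = suc (lefts π)

    length≡rights+lefts : ∀ π → length π ≡ rights π + lefts π
    length≡rights+lefts [] = refl
    length≡rights+lefts (frame true _ _ ∷ π) = cong suc (length≡rights+lefts π)
    length≡rights+lefts (frame false _ _ ∷ π) = trans (cong suc (length≡rights+lefts π)) (sym (+-suc (rights π) (lefts π)))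

    module _ (enc : ℕ → ℕ) where

      zt-unplug : ∀ π {u : Tree σ R} → ZT enc nothing nothing (plug π u) → Hole enc π u
      zt-unplug [] {leaf} z = hole [] z tt
      zt-unplug [] {branch _ _ _} z = hole [] z tt
      zt-unplug (frame true v l ∷ π) z = hole-right enc (zt-unplug π z)
      zt-unplug (frame false v r ∷ π) z = hole-left enc (zt-unplug π z)

    private
      <ˢ-cmp-flip : (x y : Str σ) → Tri (y <ˢ x) (x ≡ y) (x <ˢ y)
      <ˢ-cmp-flip x y with <ˢ-cmp x y
      ... | tri< a b c = tri> c b a
      ... | tri≈ a b c = tri≈ c b a
      ... | tri> a b c = tri< c b a

    module Spines {D : Str σ → Set} (D? : Decidable D) where

      module Below = Records (_<ˢ_ {σ}) <ˢ-cmp <ˢ-trans D?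
      module Above = Records (flip (_<ˢ_ {σ})) <ˢ-cmp-flip (λ p q → <ˢ-trans q p) (λ y → ¬? (D? y))

      module _ (down : ∀ {y z} → y <ˢ z → D z → D y) {enc : ℕ → ℕ} where

        private
          down-≤ : ∀ {y z} → y ≤ˢ z → D z → D y
          down-≤ (inj₁ p) = down p

          down-≤ (inj₂ refl) d = d

          dominated : ∀ l (v : Node σ R) r → ∀ {lo hi} → ZT enc lo hi (branch l v r) →
                      All (λ e → key v ≢ proj₁ e → proj₁ (proj₂ e) ≤ proj₁ (rank v)) (entries (branch l v r))
          dominated l v r (branch _ bl br zl zr) = subst (All _) (sym (entries-branch l v r)) (All.++⁺
            (All.map⁺ (All.map (λ b _ → beats⇒rank₁≥ b) (TAll⇒All l (zt-below enc l zl bl))))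
            ((λ ne → contradiction refl ne) ∷ All.map⁺ (All.map (λ b _ → beats⇒rank₁≥ b) (TAll⇒All r (zt-below enc r zr br)))))

          -- Entries before the subtree of `v` are smaller than `v`, those in the subtree are
          -- dominated by heap order, and those after it are at or past the upper bound, hence
          -- outside `D`.
          below-record : ∀ π {v l u} → Hole enc π (branch l v u) → Along D π → D (key v) →
                         Below.Record (map rank₁Of (entries (plug π (branch l v u)))) (rank₁Of (entry v))
          below-record π {v} {l} {u} h al d = d , All.map⁺ (subst (All _) (sym (entries-plug π (branch l v u))) (All.++⁺
            (All.map (λ p _ q → contradiction q (<ˢ-asym p)) (zc-lo enc (Hole.zc h) lo<v))
            (All.++⁺ (All.map (λ f _ q → f (<ˢ⇒≢ q)) (dominated l v u (Hole.zt h)))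
              (All.map (λ { (y , e , p) dz _ → contradiction (down-≤ p dz) (along-hi π al e) }) (hi≤post (Hole.zc h))))))
            where
            lo<v : loOf π <₋ key v
            lo<v with Hole.zt h
            ... | branch c _ _ _ _ = Codes.lo< c

          above-record : ∀ π {v l u} → Hole enc π (branch l v u) → Along D π → ¬ D (key v) →
                         Above.Record (map rank₁Of (entries (plug π (branch l v u)))) (rank₁Of (entry v))
          above-record π {v} {l} {u} h al d = d , All.map⁺ (subst (All _) (sym (entries-plug π (branch l v u))) (All.++⁺
            (All.map (λ { (y , e , p) ¬dz _ → contradiction (down-≤ p (along-lo π al e)) ¬dz }) (pre≤lo (Hole.zc h)))
            (All.++⁺ (All.map (λ f _ q → f λ e → <ˢ⇒≢ q (sym e)) (dominated l v u (Hole.zt h)))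
              (All.map (λ p _ q → contradiction q (<ˢ-asym p)) (zc-hi enc (Hole.zc h) v<hi)))))
            where
            v<hi : key v <₊ hiOf π
            v<hi with Hole.zt h
            ... | branch c _ _ _ _ = Codes.<hi c

          module Count {P : Str σ × ℕ → Set} (P? : Decidable P) where

            count : List (Entry σ R) → ℕ
            count E = length (filter P? (map rank₁Of E))

            count-++ : ∀ E F → count (E ++ F) ≡ count E + count F
            count-++ E F = trans (cong (λ l → length (filter P? l)) (map-++ rank₁Of E F))
              (trans (cong length (filter-++ P? (map rank₁Of E) (map rank₁Of F))) (length-++ (filter P? (map rank₁Of E))))

            count-hit : ∀ e F → P (rank₁Of e) → count (e ∷ F) ≡ suc (count F)
            count-hit e F p = cong length (filter-accept P? {xs = map rank₁Of F} p)

        -- Each right turn contributes an entry of its own to `pre π`, so records are counted in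
        -- place and need not be shown distinct.
        rights≤records : ∀ π u → ZT enc nothing nothing (plug π u) → Along D π →
                         rights π ≤ Below.records (map rank₁Of (entries (plug π u)))
        rights≤records π u z al = ≤-trans (bound π u refl al) (≤-trans (m≤m+n (count (pre π)) _)
          (≤-reflexive (sym (trans (cong count (entries-plug π u)) (count-++ (pre π) _)))))
          where
          t = plug π u
          open Count (Below.record? (map rank₁Of (entries t)))
          -- The record predicate stays that of the whole tree `t` while the path shrinks.
          bound : ∀ π′ u′ → plug π′ u′ ≡ t → Along D π′ → rights π′ ≤ count (pre π′)
          bound [] u′ e _ = z≤n
          bound (frame true v l ∷ π′) u′ e (d , al) = begin
            suc (rights π′) ≡⟨ +-comm 1 (rights π′) ⟩
            rights π′ + 1 ≤⟨ +-mono-≤ (bound π′ (branch l v u′) e al) (≤-reflexive (sym hit)) ⟩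
            count (pre π′) + count (entry v ∷ []) ≤⟨ +-monoʳ-≤ (count (pre π′)) (m≤n+m _ (count (entries l))) ⟩
            count (pre π′) + (count (entries l) + count (entry v ∷ [])) ≡⟨ cong (count (pre π′) +_) (count-++ (entries l) (entry v ∷ [])) ⟨
            count (pre π′) + count (entries l ++ entry v ∷ []) ≡⟨ count-++ (pre π′) (entries l ++ entry v ∷ []) ⟨
            count (pre π′ ++ entries l ++ entry v ∷ []) ∎
            where
            open ≤-Reasoning
            hit : count (entry v ∷ []) ≡ 1
            hit = count-hit (entry v) [] (subst (λ t → Below.Record (map rank₁Of (entries t)) (rank₁Of (entry v))) e
              (below-record π′ (zt-unplug enc π′ (subst (ZT enc nothing nothing) (sym e) z)) al d))
          bound (frame false v r ∷ π′) u′ e (_ , al) = bound π′ (branch u′ v r) e al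

        lefts≤records : ∀ π u → ZT enc nothing nothing (plug π u) → Along D π →
                        lefts π ≤ Above.records (map rank₁Of (entries (plug π u)))
        lefts≤records π u z al = ≤-trans (bound π u refl al) (≤-trans (m≤n+m (count (post π)) (count (entries u)))
          (≤-trans (≤-reflexive (sym (count-++ (entries u) (post π)))) (≤-trans (m≤n+m _ (count (pre π)))
            (≤-reflexive (sym (trans (cong count (entries-plug π u)) (count-++ (pre π) _)))))))
          where
          t = plug π u
          open Count (Above.record? (map rank₁Of (entries t)))
          bound : ∀ π′ u′ → plug π′ u′ ≡ t → Along D π′ → lefts π′ ≤ count (post π′)
          bound [] u′ e _ = z≤n
          bound (frame true v l ∷ π′) u′ e (_ , al) = bound π′ (branch l v u′) e al
          bound (frame false v r ∷ π′) u′ e (d , al) = begin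
            suc (lefts π′) ≤⟨ s≤s (bound π′ (branch u′ v r) e al) ⟩
            suc (count (post π′)) ≤⟨ s≤s (m≤n+m (count (post π′)) (count (entries r))) ⟩
            suc (count (entries r) + count (post π′)) ≡⟨ cong suc (count-++ (entries r) (post π′)) ⟨
            suc (count (entries r ++ post π′)) ≡⟨ count-hit (entry v) (entries r ++ post π′) hit ⟨
            count (entry v ∷ entries r ++ post π′) ∎
            where
            open ≤-Reasoning
            hit : Above.Record (map rank₁Of (entries t)) (rank₁Of (entry v))
            hit = subst (λ t → Above.Record (map rank₁Of (entries t)) (rank₁Of (entry v))) e
              (above-record π′ (zt-unplug enc π′ (subst (ZT enc nothing nothing) (sym e) z)) al d)

-- Metadata size, and the event of small ranks and few records.

module GoodEvent where

  open import Defs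
  open StringOrder
  open Words
  open Zippers
  open Boundaries
  open QueryOperations
  open Expectations using (𝔼; 𝔼s; 𝔼-mono; 𝔼-+; 𝔼-const; 𝔼s-+; 𝔼s-*; 𝔼s-const; 𝔼-cong; pow; pow-+; pow-nonneg; pow-mono; pow-anti; *-nonneg; +-nonneg; *-mono-≤ˡ; *-mono-≤ʳ; 0≤½; 0≤1)
  open RecordWeights
  open MarkovBound
  open PathRecords
  open import Data.Fin as Fin using (Fin)
  import Data.Fin.Properties as Fin
  open import Data.List as List using (List; []; _∷_; length; map)
  open import Data.List.Membership.Propositional using (_∈_)
  open import Data.List.Relation.Binary.Permutation.Propositional.Properties using () renaming (map⁺ to ↭-map⁺)
  open import Data.List.Relation.Binary.Prefix.Heterogeneous.Properties using (prefix?)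
  open import Data.List.Relation.Unary.All as All using (All; []; _∷_)
  import Data.List.Relation.Unary.All.Properties as All
  open import Data.List.Relation.Unary.Any using (here; there)
  open import Data.List.Relation.Unary.Unique.Propositional using (Unique)
  open import Data.Maybe using (Maybe; just; nothing)
  open import Data.Nat
  open import Data.Nat.DivMod hiding (result)
  open import Data.Nat.Logarithm using (⌊log₂_⌋; ⌊log₂⌋-mono-≤; ⌊log₂[2^n]⌋≡n)
  open import Data.Nat.Properties
  open import Data.Product using (_×_; _,_; proj₁; proj₂; Σ-syntax; ∃-syntax)
  open import Data.Rational as ℚ using (ℚ; 0ℚ; 1ℚ; ½)
  import Data.Rational.Properties as ℚ
  open import Data.Sum using (_⊎_; inj₁; inj₂)
  open import Data.Unit using (⊤; tt)
  open import Data.Vec as Vec using ([]; _∷_)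
  open import Relation.Binary.Definitions using (tri<; tri≈; tri>)
  open import Relation.Binary.PropositionalEquality hiding ([_])
  open import Relation.Nullary using (¬_; Dec; yes; no)
  open import Relation.Nullary.Decidable using (¬?; _×-dec_; from-yes)
  open import Relation.Unary using (Decidable)

  -- The metadata

  log-* : ∀ m n → ⌊log₂ m * n ⌋ ≤ suc (⌊log₂ m ⌋ + ⌊log₂ n ⌋)
  log-* m n = s≤s⁻¹ (m<2^k⇒⌊log₂m⌋<k {m * n} {2 + (⌊log₂ m ⌋ + ⌊log₂ n ⌋)} (begin-strict
    m * n <⟨ *-mono-< (n<2^[1+⌊log₂n⌋] m) (n<2^[1+⌊log₂n⌋] n) ⟩
    2 ^ suc ⌊log₂ m ⌋ * 2 ^ suc ⌊log₂ n ⌋ ≡⟨ ^-distribˡ-+-* 2 (suc ⌊log₂ m ⌋) (suc ⌊log₂ n ⌋) ⟨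
    2 ^ (suc ⌊log₂ m ⌋ + suc ⌊log₂ n ⌋) ≡⟨ cong (λ k → 2 ^ suc k) (+-suc ⌊log₂ m ⌋ ⌊log₂ n ⌋) ⟩
    2 ^ (2 + (⌊log₂ m ⌋ + ⌊log₂ n ⌋)) ∎))
    where open ≤-Reasoning

  log-suc : ∀ n → ⌊log₂ suc n ⌋ ≤ suc ⌊log₂ n ⌋
  log-suc n = subst (⌊log₂ suc n ⌋ ≤_) (⌊log₂[2^n]⌋≡n (suc ⌊log₂ n ⌋)) (⌊log₂⌋-mono-≤ (n<2^[1+⌊log₂n⌋] n))

  log-^ : ∀ m c → ⌊log₂ m ^ c ⌋ ≤ c * suc ⌊log₂ m ⌋
  log-^ m zero = z≤n
  log-^ m (suc c) = ≤-trans (log-* m (m ^ c)) (s≤s (+-monoʳ-≤ ⌊log₂ m ⌋ (log-^ m c)))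

  private
    absorb : ∀ A l u → suc A + (l + u) ≤ suc A * (1 + l + u)
    absorb A l u = begin
      suc A + (l + u) ≤⟨ +-monoʳ-≤ (suc A) (m≤m+n (l + u) (A * (l + u))) ⟩
      suc A + suc A * (l + u) ≡⟨ *-suc (suc A) (l + u) ⟨
      suc A * (1 + l + u) ∎
      where open ≤-Reasoning

  -- One summand for each stored field: first rank, second rank, and the two codes.
  κ-metadata : (c K d : ℕ) → ℕ
  κ-metadata c K d = (3 + ⌊log₂ 2 + d ⌋) + (2 + ⌊log₂ K ⌋ + 2 * c) + (6 + ⌊log₂ K ⌋) + (6 + ⌊log₂ K ⌋)

  module MetadataBound (c K d n L R : ℕ) (tuned : Tuned c K n L R) (u : ℕ) where

    private
      l = ⌊log₂ n ⌋
      S = 1 + ⌊log₂ l ⌋ + u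

    rank₁-bits : ∀ {r} → r < (2 + d) * suc l → bits r ≤ (3 + ⌊log₂ 2 + d ⌋) * S
    rank₁-bits {r} p = begin
      suc ⌊log₂ r ⌋ ≤⟨ s≤s (⌊log₂⌋-mono-≤ (<⇒≤ p)) ⟩
      suc ⌊log₂ (2 + d) * suc l ⌋ ≤⟨ s≤s (log-* (2 + d) (suc l)) ⟩
      2 + (⌊log₂ 2 + d ⌋ + ⌊log₂ suc l ⌋) ≤⟨ +-monoʳ-≤ 2 (+-monoʳ-≤ ⌊log₂ 2 + d ⌋ (log-suc l)) ⟩
      2 + (⌊log₂ 2 + d ⌋ + suc ⌊log₂ l ⌋) ≡⟨ cong (2 +_) (+-suc ⌊log₂ 2 + d ⌋ ⌊log₂ l ⌋) ⟩
      3 + ⌊log₂ 2 + d ⌋ + ⌊log₂ l ⌋ ≤⟨ +-monoʳ-≤ (3 + ⌊log₂ 2 + d ⌋) (m≤m+n ⌊log₂ l ⌋ u) ⟩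
      3 + ⌊log₂ 2 + d ⌋ + (⌊log₂ l ⌋ + u) ≤⟨ absorb (2 + ⌊log₂ 2 + d ⌋) ⌊log₂ l ⌋ u ⟩
      (3 + ⌊log₂ 2 + d ⌋) * S ∎
      where open ≤-Reasoning

    rank₂-bits : ∀ {r} → r < R → bits r ≤ (2 + ⌊log₂ K ⌋ + 2 * c) * S
    rank₂-bits {r} p = begin
      suc ⌊log₂ r ⌋ ≤⟨ s≤s (⌊log₂⌋-mono-≤ (≤-trans (<⇒≤ p) (Tuned.R≤ tuned))) ⟩
      suc ⌊log₂ K * suc l ^ c ⌋ ≤⟨ s≤s (log-* K (suc l ^ c)) ⟩
      2 + (⌊log₂ K ⌋ + ⌊log₂ suc l ^ c ⌋) ≤⟨ +-monoʳ-≤ 2 (+-monoʳ-≤ ⌊log₂ K ⌋ (≤-trans (log-^ (suc l) c) (*-monoʳ-≤ c (s≤s (log-suc l))))) ⟩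
      2 + (⌊log₂ K ⌋ + c * (2 + ⌊log₂ l ⌋)) ≤⟨ +-mono-≤ (m≤m*n (2 + ⌊log₂ K ⌋) S) (*-monoʳ-≤ c double) ⟩
      (2 + ⌊log₂ K ⌋) * S + c * (2 * S) ≡⟨ cong ((2 + ⌊log₂ K ⌋) * S +_) (trans (sym (*-assoc c 2 S)) (cong (_* S) (*-comm c 2))) ⟩
      (2 + ⌊log₂ K ⌋) * S + 2 * c * S ≡⟨ *-distribʳ-+ S (2 + ⌊log₂ K ⌋) (2 * c) ⟨
      (2 + ⌊log₂ K ⌋ + 2 * c) * S ∎
      where
      open ≤-Reasoning
      double : 2 + ⌊log₂ l ⌋ ≤ 2 * S
      double = ≤-trans (+-monoʳ-≤ 2 (m≤m+n ⌊log₂ l ⌋ u)) (absorb 1 ⌊log₂ l ⌋ u)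

    -- A code is below `(2 + exponent q) * 2 ^ ⌊log₂ L ⌋`. The first factor costs the double
    -- logarithm of `q`, the second `⌊log₂ L ⌋` bits, which `Tuned` ties to the double logarithm of
    -- `n`.
    code-bits : ∀ q → ⌊log₂ ⌊log₂ q ⌋ ⌋ ≤ u → bits (Float.float ⌊log₂ L ⌋ q) ≤ (6 + ⌊log₂ K ⌋) * S
    code-bits q p = begin
      suc ⌊log₂ float q ⌋ ≤⟨ s≤s (⌊log₂⌋-mono-≤ (<⇒≤ (float< q))) ⟩
      suc ⌊log₂ (2 + exponent q) * 2 ^ ⌊log₂ L ⌋ ⌋ ≤⟨ s≤s (log-* (2 + exponent q) (2 ^ ⌊log₂ L ⌋)) ⟩
      2 + (⌊log₂ 2 + exponent q ⌋ + ⌊log₂ 2 ^ ⌊log₂ L ⌋ ⌋) ≡⟨ cong (λ k → 2 + (⌊log₂ 2 + exponent q ⌋ + k)) (⌊log₂[2^n]⌋≡n ⌊log₂ L ⌋) ⟩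
      2 + (⌊log₂ 2 + exponent q ⌋ + ⌊log₂ L ⌋) ≤⟨ +-monoʳ-≤ 2 (+-mono-≤ small large) ⟩
      2 + (2 + u + (2 + ⌊log₂ K ⌋ + ⌊log₂ l ⌋)) ≡⟨ cong (2 +_) (trans (+-comm (2 + u) _) (trans (+-assoc (2 + ⌊log₂ K ⌋) ⌊log₂ l ⌋ (2 + u))
         (trans (cong (2 + ⌊log₂ K ⌋ +_) (trans (+-comm ⌊log₂ l ⌋ (2 + u)) (cong (2 +_) (+-comm u ⌊log₂ l ⌋)))) (trans (sym (+-assoc (2 + ⌊log₂ K ⌋) 2 _)) (cong (_+ (⌊log₂ l ⌋ + u)) (+-comm (2 + ⌊log₂ K ⌋) 2)))))) ⟩
      6 + ⌊log₂ K ⌋ + (⌊log₂ l ⌋ + u) ≤⟨ absorb (5 + ⌊log₂ K ⌋) ⌊log₂ l ⌋ u ⟩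
      (6 + ⌊log₂ K ⌋) * S ∎
      where
      open ≤-Reasoning
      open Float ⌊log₂ L ⌋
      small : ⌊log₂ 2 + exponent q ⌋ ≤ 2 + u
      small = ≤-trans (log-suc (suc (exponent q))) (s≤s (≤-trans (log-suc (exponent q)) (s≤s (≤-trans (⌊log₂⌋-mono-≤ (exponent≤ q)) p))))
      large : ⌊log₂ L ⌋ ≤ 2 + ⌊log₂ K ⌋ + ⌊log₂ l ⌋
      large = ≤-trans (⌊log₂⌋-mono-≤ (Tuned.≤log tuned)) (≤-trans (log-* K (suc l)) (s≤s (≤-trans (+-monoʳ-≤ ⌊log₂ K ⌋ (log-suc l)) (≤-reflexive (+-suc ⌊log₂ K ⌋ ⌊log₂ l ⌋)))))

    total-bits : ∀ {p q r s} → p ≤ (3 + ⌊log₂ 2 + d ⌋) * S → q ≤ (2 + ⌊log₂ K ⌋ + 2 * c) * S → r ≤ (6 + ⌊log₂ K ⌋) * S → s ≤ (6 + ⌊log₂ K ⌋) * S →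
                 p + q + r + s ≤ κ-metadata c K d * S
    total-bits {p} {q} {r} {s} p≤ q≤ r≤ s≤ = begin
      p + q + r + s ≤⟨ +-mono-≤ (+-mono-≤ (+-mono-≤ p≤ q≤) r≤) s≤ ⟩
      A * S + B * S + D * S + D * S ≡⟨ cong (λ e → e + D * S + D * S) (*-distribʳ-+ S A B) ⟨
      (A + B) * S + D * S + D * S ≡⟨ cong (_+ D * S) (*-distribʳ-+ S (A + B) D) ⟨
      (A + B + D) * S + D * S ≡⟨ *-distribʳ-+ S (A + B + D) D ⟨
      κ-metadata c K d * S ∎
      where
      open ≤-Reasoning
      A = 3 + ⌊log₂ 2 + d ⌋
      B = 2 + ⌊log₂ K ⌋ + 2 * c
      D = 6 + ⌊log₂ K ⌋

  -- The bounds ±∞ count as members.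
  _∈∞_ : ∀ {σ} → Maybe (Str σ) → List (Str σ) → Set
  nothing ∈∞ ys = ⊤
  just y  ∈∞ ys = y ∈ ys

  module _ {σ R : ℕ} (enc : ℕ → ℕ) (Ks : List (Str σ)) where

    zt-codes : ∀ {lo hi} (t : Tree σ R) → ZT enc lo hi t → lo ∈∞ Ks → hi ∈∞ Ks → TAll (λ v → key v ∈ Ks) t →
               TAll (λ v → Σ[ lo ∈ Maybe (Str σ) ] Σ[ hi ∈ Maybe (Str σ) ] Codes enc lo hi v × lo ∈∞ Ks × hi ∈∞ Ks) t
    zt-codes leaf leaf _ _ _ = tt
    zt-codes {lo} {hi} (branch l v r) (branch k _ _ zl zr) lo∈ hi∈ (v∈ , l∈ , r∈) =
      (lo , hi , k , lo∈ , hi∈) , zt-codes l zl lo∈ v∈ l∈ , zt-codes r zr v∈ hi∈ r∈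

  -- The good event

  <⇒≱ℚ : ∀ {p q} → p ℚ.< q → ¬ q ℚ.≤ p
  <⇒≱ℚ p<q q≤p = ℚ.<-irrefl refl (ℚ.<-≤-trans p<q q≤p)

  module _ {B : Set} where

    total : List (B → ℚ) → B → ℚ
    total []       l = 0ℚ
    total (w ∷ ws) l = w l ℚ.+ total ws l

    total-nonneg : ∀ {ws} → All (λ w → ∀ l → 0ℚ ℚ.≤ w l) ws → ∀ l → 0ℚ ℚ.≤ total ws l
    total-nonneg [] l = ℚ.≤-refl
    total-nonneg (p ∷ ps) l = +-nonneg (p l) (total-nonneg ps l)

    term≤total : ∀ {w ws} → All (λ w → ∀ l → 0ℚ ℚ.≤ w l) ws → w ∈ ws → ∀ l → w l ℚ.≤ total ws l
    term≤total {w} {_ ∷ ws} (p ∷ ps) (here refl) l = ℚ.≤-trans (ℚ.≤-reflexive (sym (ℚ.+-identityʳ (w l)))) (ℚ.+-mono-≤ (ℚ.≤-refl {w l}) (total-nonneg ps l))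
    term≤total {w} {w′ ∷ ws} (p ∷ ps) (there w∈) l = ℚ.≤-trans (term≤total ps w∈ l) (ℚ.≤-trans (ℚ.≤-reflexive (sym (ℚ.+-identityˡ (total ws l)))) (ℚ.+-mono-≤ (p l) (ℚ.≤-refl {total ws l})))

  -- The indicator of `M ≤ k`, by a recursion that matches that of `𝔼`.
  over : ℕ → ℕ → ℚ
  over zero    k       = 1ℚ
  over (suc M) zero    = 0ℚ
  over (suc M) (suc k) = over M k

  over-nonneg : ∀ M k → 0ℚ ℚ.≤ over M k
  over-nonneg zero k = 0≤1
  over-nonneg (suc M) zero = ℚ.≤-refl
  over-nonneg (suc M) (suc k) = over-nonneg M k

  over≡1 : ∀ {M k} → M ≤ k → over M k ≡ 1ℚ
  over≡1 z≤n = refl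
  over≡1 (s≤s l) = over≡1 l

  𝔼-over : ∀ N M → 𝔼 N (over M) ℚ.≤ pow ½ M
  𝔼-over N zero = 𝔼-const N 0≤1
  𝔼-over zero (suc M) = pow-nonneg 0≤½ (suc M)
  𝔼-over (suc N) (suc M) = *-mono-≤ˡ ½ 0≤½ (ℚ.≤-trans (ℚ.≤-reflexive (ℚ.+-identityˡ (𝔼 N (over M)))) (𝔼-over N M))

  module _ {A : Set} where

    𝔼s-total : ∀ {N} {ys : List A} {ws} → All (λ w → 𝔼s N ys w ℚ.≤ 1ℚ) ws → 𝔼s N ys (total ws) ℚ.≤ natQ (length ws)
    𝔼s-total {N} {ys} [] = 𝔼s-const N ys ℚ.≤-refl
    𝔼s-total {N} {ys} {w ∷ ws} (p ∷ ps) = ℚ.≤-trans (ℚ.≤-reflexive (𝔼s-+ N ys w (total ws))) (ℚ.+-mono-≤ p (𝔼s-total {N} {ys} ps))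

    overs : ℕ → List (A × ℕ) → ℚ
    overs M []            = 0ℚ
    overs M ((_ , k) ∷ l) = over M k ℚ.+ overs M l

    overs-nonneg : ∀ M l → 0ℚ ℚ.≤ overs M l
    overs-nonneg M [] = ℚ.≤-refl
    overs-nonneg M ((_ , k) ∷ l) = +-nonneg (over-nonneg M k) (overs-nonneg M l)

    overs<1 : ∀ M l → overs M l ℚ.< 1ℚ → All (λ e → proj₂ e < M) l
    overs<1 M [] _ = []
    overs<1 M ((y , k) ∷ l) p = ≰⇒> (λ M≤k → <⇒≱ℚ p (ℚ.≤-trans (ℚ.≤-reflexive (sym (trans (cong (ℚ._+ 0ℚ) (over≡1 M≤k)) (ℚ.+-identityʳ 1ℚ)))) (ℚ.+-mono-≤ (ℚ.≤-refl {over M k}) (overs-nonneg M l))))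
      ∷ overs<1 M l (ℚ.≤-<-trans (ℚ.≤-trans (ℚ.≤-reflexive (sym (ℚ.+-identityˡ (overs M l)))) (ℚ.+-mono-≤ (over-nonneg M k) (ℚ.≤-refl {overs M l}))) p)

    𝔼s-overs : ∀ N M ys → 𝔼s N ys (overs M) ℚ.≤ natQ (length ys) ℚ.* pow ½ M
    𝔼s-overs N M [] = ℚ.≤-reflexive (sym (ℚ.*-zeroˡ (pow ½ M)))
    𝔼s-overs N M (y ∷ ys) = begin
      𝔼 N (λ k → 𝔼s N ys (λ l → over M k ℚ.+ overs M l)) ≡⟨ 𝔼-cong N (λ k → 𝔼s-+ N ys (λ _ → over M k) (overs M)) ⟩
      𝔼 N (λ k → 𝔼s N ys (λ _ → over M k) ℚ.+ 𝔼s N ys (overs M)) ≤⟨ 𝔼-mono N (λ k → ℚ.+-mono-≤ (𝔼s-const N ys (over-nonneg M k)) (𝔼s-overs N M ys)) ⟩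
      𝔼 N (λ k → over M k ℚ.+ c) ≡⟨ 𝔼-+ N (over M) (λ _ → c) ⟩
      𝔼 N (over M) ℚ.+ 𝔼 N (λ _ → c) ≤⟨ ℚ.+-mono-≤ (𝔼-over N M) (𝔼-const N (*-nonneg (natQ-nonneg (length ys)) (pow-nonneg 0≤½ M))) ⟩
      pow ½ M ℚ.+ c ≡⟨ cong (ℚ._+ c) (sym (ℚ.*-identityˡ (pow ½ M))) ⟩
      1ℚ ℚ.* pow ½ M ℚ.+ c ≡⟨ sym (ℚ.*-distribʳ-+ (pow ½ M) 1ℚ (natQ (length ys))) ⟩
      natQ (suc (length ys)) ℚ.* pow ½ M ∎
      where
      open ℚ.≤-Reasoning
      c = natQ (length ys) ℚ.* pow ½ M

  -- Two records gain a factor `9 / 4` and one level of the highest rank loses a factor 2, so twice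
  -- as many records as levels still win: `9 / 8 ≥ 1`.
  3/2-growth : ∀ m → 1ℚ ℚ.≤ pow 3/2 (m + m) ℚ.* pow ½ m
  3/2-growth zero = ℚ.≤-refl
  3/2-growth (suc m) = begin
    1ℚ ≤⟨ from-yes (1ℚ ℚ.≤? (3/2 ℚ.* 3/2 ℚ.* ½ ℚ.* 1ℚ)) ⟩
    3/2 ℚ.* 3/2 ℚ.* ½ ℚ.* 1ℚ ≤⟨ *-mono-≤ˡ (3/2 ℚ.* 3/2 ℚ.* ½) (from-yes (0ℚ ℚ.≤? (3/2 ℚ.* 3/2 ℚ.* ½))) (3/2-growth m) ⟩
    3/2 ℚ.* 3/2 ℚ.* ½ ℚ.* (pow 3/2 (m + m) ℚ.* pow ½ m) ≡⟨ solve 4 (λ t h p q → t :* t :* h :* (p :* q) := t :* (t :* p) :* (h :* q)) refl 3/2 ½ (pow 3/2 (m + m)) (pow ½ m) ⟩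
    3/2 ℚ.* (3/2 ℚ.* pow 3/2 (m + m)) ℚ.* (½ ℚ.* pow ½ m) ≡⟨ cong (λ k → 3/2 ℚ.* pow 3/2 k ℚ.* (½ ℚ.* pow ½ m)) (sym (+-suc m m)) ⟩
    pow 3/2 (suc m + suc m) ℚ.* pow ½ (suc m) ∎
    where
    open ℚ.≤-Reasoning
    open import Data.Rational.Solver using (module +-*-Solver)
    open +-*-Solver using (solve; _:*_; _:=_)

  -- Of the records, `2 * M` offset the highest rank, and the other `2 * e` supply the factor
  -- `2 ^ e` that lets Markov's inequality give probability `½ ^ e`.
  many-records : ∀ M e {r h} → h ≤ M → (M + e) + (M + e) ≤ r → 1ℚ ℚ.≤ pow ½ e ℚ.* (pow 3/2 r ℚ.* pow ½ h)
  many-records M e {r} {h} h≤M T≤r = begin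
    1ℚ ≤⟨ 3/2-growth (M + e) ⟩
    pow 3/2 ((M + e) + (M + e)) ℚ.* pow ½ (M + e) ≤⟨ *-mono-≤ʳ (pow ½ (M + e)) (pow-nonneg 0≤½ (M + e)) (pow-mono (from-yes (1ℚ ℚ.≤? 3/2)) T≤r) ⟩
    pow 3/2 r ℚ.* pow ½ (M + e) ≡⟨ cong (pow 3/2 r ℚ.*_) (pow-+ ½ M e) ⟩
    pow 3/2 r ℚ.* (pow ½ M ℚ.* pow ½ e) ≤⟨ *-mono-≤ˡ (pow 3/2 r) (pow-nonneg 0≤3/2 r) (*-mono-≤ʳ (pow ½ e) (pow-nonneg 0≤½ e) (pow-anti 0≤½ (from-yes (½ ℚ.≤? 1ℚ)) h≤M)) ⟩
    pow 3/2 r ℚ.* (pow ½ h ℚ.* pow ½ e) ≡⟨ solve 3 (λ p q s → p :* (q :* s) := s :* (p :* q)) refl (pow 3/2 r) (pow ½ h) (pow ½ e) ⟩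
    pow ½ e ℚ.* (pow 3/2 r ℚ.* pow ½ h) ∎
    where
    open ℚ.≤-Reasoning
    open import Data.Rational.Solver using (module +-*-Solver)
    open +-*-Solver using (solve; _:*_; _:=_)

  module Event {σ : ℕ} (x : Str σ) where

    _<ˢ?_ : (y z : Str σ) → Dec (y <ˢ z)
    y <ˢ? z with <ˢ-cmp y z
    ... | tri< p _ _ = yes p
    ... | tri≈ ¬p _ _ = no ¬p
    ... | tri> ¬p _ _ = no ¬p

    less? : Decidable (Less x)
    less? y = y <ˢ? x

    notMore? : Decidable (NotMore x)
    notMore? y = ¬? (x <ˢ? y)

    notBeyond? : Decidable (NotBeyond x)
    notBeyond? y = ¬? ((x <ˢ? y) ×-dec ¬? (prefix? Fin._≟_ x y))

    module _ (M e : ℕ) where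

      private
        T = (M + e) + (M + e)

      module _ {R : ℕ} where

        module A = Spines {σ} {R} less?
        module B = Spines {σ} {R} notMore?
        module C = Spines {σ} {R} notBeyond?

        weights : List (List (Str σ × ℕ) → ℚ)
        weights = A.Below.weight ∷ A.Above.weight ∷ B.Below.weight ∷ B.Above.weight ∷ C.Below.weight ∷ C.Above.weight ∷ []

        weights-nonneg : All (λ w → ∀ l → 0ℚ ℚ.≤ w l) weights
        weights-nonneg = A.Below.weight-nonneg ∷ A.Above.weight-nonneg ∷ B.Below.weight-nonneg ∷ B.Above.weight-nonneg
          ∷ C.Below.weight-nonneg ∷ C.Above.weight-nonneg ∷ []

        -- Markov's inequality and the union bound in one functional: it is below 1 only if no rank
        -- reaches `M` and each of the six weights is below `2 ^ e`, and its expectation is bounded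
        -- by the sum of the failure bounds.
        badness : List (Str σ × ℕ) → ℚ
        badness l = pow ½ e ℚ.* total weights l ℚ.+ overs M l

        private
          scaled-nonneg : ∀ l → 0ℚ ℚ.≤ pow ½ e ℚ.* total weights l
          scaled-nonneg l = *-nonneg (pow-nonneg 0≤½ e) (total-nonneg weights-nonneg l)

        badness-nonneg : ∀ l → 0ℚ ℚ.≤ badness l
        badness-nonneg l = +-nonneg (scaled-nonneg l) (overs-nonneg M l)

        module _ {l : List (Str σ × ℕ)} (good : badness l ℚ.< 1ℚ) where

          ranks<M : All (λ e → proj₂ e < M) l
          ranks<M = overs<1 M l (ℚ.≤-<-trans (ℚ.≤-trans (ℚ.≤-reflexive (sym (ℚ.+-identityˡ (overs M l)))) (ℚ.+-mono-≤ (scaled-nonneg l) (ℚ.≤-refl {overs M l}))) good)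

          few : ∀ {r h} → h ≤ M → pow 3/2 r ℚ.* pow ½ h ℚ.≤ total weights l → r ≤ T
          few h≤M w≤ = ≮⇒≥ λ T<r → <⇒≱ℚ good (ℚ.≤-trans (many-records M e h≤M (<⇒≤ T<r))
            (ℚ.≤-trans (*-mono-≤ˡ (pow ½ e) (pow-nonneg 0≤½ e) w≤)
            (ℚ.≤-trans (ℚ.≤-reflexive (sym (ℚ.+-identityʳ (pow ½ e ℚ.* total weights l)))) (ℚ.+-mono-≤ (ℚ.≤-refl {pow ½ e ℚ.* total weights l}) (overs-nonneg M l)))))

          private
            ranks≤M : All (λ e → proj₂ e ≤ M) l
            ranks≤M = All.map <⇒≤ ranks<M
            pick : ∀ {w} → w ∈ weights → w l ℚ.≤ total weights l
            pick w∈ = term≤total weights-nonneg w∈ l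

          fewA : A.Below.records l ≤ T × A.Above.records l ≤ T
          fewA = few (A.Below.highest≤ ranks≤M) (pick (here refl)) , few (A.Above.highest≤ ranks≤M) (pick (there (here refl)))

          fewB : B.Below.records l ≤ T × B.Above.records l ≤ T
          fewB = few (B.Below.highest≤ ranks≤M) (pick (there (there (here refl)))) , few (B.Above.highest≤ ranks≤M) (pick (there (there (there (here refl)))))

          fewC : C.Below.records l ≤ T × C.Above.records l ≤ T
          fewC = few (C.Below.highest≤ ranks≤M) (pick (there (there (there (there (here refl)))))) , few (C.Above.highest≤ ranks≤M) (pick (there (there (there (there (there (here refl)))))))

        -- Right turns and left turns of a path are records on the two sides of its boundary, and
        -- each count is at most `T`.
        shallow : ∀ {enc E} {t : Tree σ R} → ZipTrie enc E t → badness (map rank₁Of E) ℚ.< 1ℚ → Shallow x t (T + T)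
        shallow {enc} {E} z good π u refl along = ≤-trans (≤-reflexive (length≡rights+lefts π)) (cases along)
          where
          zᵗ = zipTrie⇒ZT enc z
          perm = ↭-map⁺ rank₁Of (ZipTrie.stores z)
          cases : Along (Less x) π ⊎ Along (NotMore x) π ⊎ Along (NotBeyond x) π → rights π + lefts π ≤ T + T
          cases (inj₁ al) = +-mono-≤ (≤-trans (A.rights≤records <ˢ-trans π u zᵗ al) (≤-trans (≤-reflexive (A.Below.records-↭ perm)) (proj₁ (fewA {map rank₁Of E} good))))
                                     (≤-trans (A.lefts≤records <ˢ-trans π u zᵗ al) (≤-trans (≤-reflexive (A.Above.records-↭ perm)) (proj₂ (fewA {map rank₁Of E} good))))
          cases (inj₂ (inj₁ al)) = +-mono-≤ (≤-trans (B.rights≤records (λ p q r → q (<ˢ-trans r p)) π u zᵗ al) (≤-trans (≤-reflexive (B.Below.records-↭ perm)) (proj₁ (fewB {map rank₁Of E} good))))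
                                     (≤-trans (B.lefts≤records (λ p q r → q (<ˢ-trans r p)) π u zᵗ al) (≤-trans (≤-reflexive (B.Above.records-↭ perm)) (proj₂ (fewB {map rank₁Of E} good))))
          cases (inj₂ (inj₂ al)) = +-mono-≤ (≤-trans (C.rights≤records (beyond-down x) π u zᵗ al) (≤-trans (≤-reflexive (C.Below.records-↭ perm)) (proj₁ (fewC {map rank₁Of E} good))))
                                     (≤-trans (C.lefts≤records (beyond-down x) π u zᵗ al) (≤-trans (≤-reflexive (C.Above.records-↭ perm)) (proj₂ (fewC {map rank₁Of E} good))))

        𝔼s-badness : ∀ N ys → Unique ys → 𝔼s N ys badness ℚ.≤ pow ½ e ℚ.* natQ 6 ℚ.+ natQ (length ys) ℚ.* pow ½ M
        𝔼s-badness N ys uniq = ℚ.≤-trans (ℚ.≤-reflexive (𝔼s-+ N ys (λ l → pow ½ e ℚ.* total weights l) (overs M))) (ℚ.+-mono-≤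
          (ℚ.≤-trans (ℚ.≤-reflexive (𝔼s-* N ys (pow ½ e) (total weights))) (*-mono-≤ˡ (pow ½ e) (pow-nonneg 0≤½ e) (𝔼s-total {N = N} {ys} {weights}
            (A.Below.𝔼s-weight N ys uniq ∷ A.Above.𝔼s-weight N ys uniq ∷ B.Below.𝔼s-weight N ys uniq ∷ B.Above.𝔼s-weight N ys uniq
              ∷ C.Below.𝔼s-weight N ys uniq ∷ C.Above.𝔼s-weight N ys uniq ∷ []))))
          (𝔼s-overs N M ys))

-- Assembly of the programs, the constants and the failure probability.

open import Defs renaming (_⨾_ to infixr 4 _⨾_; _≔_ to infix 5 _≔_; _[_]≔_ to infix 5 _[_]≔_)
open StringOrder
open Words
open ProgramLogic
open Zippers
open Comparison
open MemoryLayout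
open Boundaries
open QueryOperations
open Relinking
open InsertionPath
open InsertOperation
open DeleteOperation
open Expectations using (𝔼-mono; 𝔼-const; pow; pow-+; pow-nonneg; pow-≤1; *-nonneg; *-mono-≤ˡ; *-mono-≤ʳ; 0≤½)
open MarkovBound
open PathRecords
open GoodEvent
open import Data.Fin as Fin using (Fin)
import Data.Fin.Properties as Fin
open import Data.List as List using (List; []; _∷_; map; filter)
open import Data.List.Extrema.Nat using (xs≤max)
open import Data.List.Membership.Propositional using (_∈_)
open import Data.List.Membership.Propositional.Properties using (∈-map⁺; ∈-filter⁺)
open import Data.List.Relation.Binary.Permutation.Propositional using (↭-sym)
open import Data.List.Relation.Binary.Permutation.Propositional.Properties using (All-resp-↭)
open import Data.List.Relation.Unary.All as All using (All; []; _∷_)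
import Data.List.Relation.Unary.All.Properties as All
open import Data.List.Relation.Unary.Unique.Propositional using (Unique)
open import Data.Maybe using (Maybe; just; nothing)
open import Data.Nat
open import Data.Nat.DivMod hiding (result)
open import Data.Nat.Logarithm using (⌊log₂_⌋; ⌊log₂⌋-mono-≤)
open import Data.Nat.Properties
open import Data.Product using (_×_; _,_; proj₁; proj₂; Σ-syntax; ∃-syntax)
open import Data.Rational as ℚ using (ℚ; 0ℚ; 1ℚ; ½)
import Data.Rational.Properties as ℚ
open import Data.Rational.Solver using (module +-*-Solver)
open import Data.Unit using (⊤; tt)
open import Data.Vec as Vec using (Vec; []; _∷_; toList)
open import Data.Vec.Properties using (length-toList)
open import Relation.Binary.PropositionalEquality hiding ([_])
open import Relation.Nullary.Decidable using (¬?; from-yes; decidable-stable)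
open +-*-Solver using (solve; _:+_; _:*_; _:=_)

program : ℕ → Operation → Cmd
program σ prefixSearch = prefixSearchC σ
program σ predecessor  = predecessorC
program σ successor    = successorC
program σ insert       = insertC
program σ delete       = deleteC

κ-total : ℕ → ℕ
κ-total σ = β-prefix σ + (β-predecessor + (β-successor + (β-insert + β-delete)))

module _ (σ w : ℕ) .{{_ : NonTrivial σ}} .{{_ : NonZero (α σ w)}} where

  -- The `budget` of `Setting`, detached from its module so that one bound covers all five
  -- operations.
  allotted : ∀ {R} → ℕ → List (Entry σ R) → Str σ → ℕ → ℕ
  allotted L E x D = (3 + D) * suc (lcpWith x (keys E) / α σ w >> ⌊log₂ L ⌋) + lcpWith x (keys E) / α σ w

  -- Postcondition and time belong to the same run, so correctness and speed share one analysis.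
  performs : ∀ {R} (o : Operation) (L : ℕ) (E : List (Entry σ R)) (t : Tree σ R) (x : Str σ) (r : Rank R) (s : State w) →
             ZipTrie (LCPCode.encode lcpCode L (α σ w)) E t → Pre σ w o L t x r s →
             Runs (program σ o) s (λ s′ τ → Post σ w o L (LCPCode.encode lcpCode L (α σ w)) E x r s s′
               × ∀ D → Shallow x t D → τ ≤ κ-total σ * allotted L E x D)
  performs prefixSearch L E t x r s z p = runs-map (λ { (q , f) → q , λ D sh → ≤-trans (Setting.within f D sh)
      (*-monoˡ-≤ (allotted L E x D) (m≤m+n (β-prefix σ) _)) })
    (Queries.prefix-runs σ w L E t x r s z (Pre.loaded p) (Pre.query p))
  performs predecessor L E t x r s z p = runs-map (λ { (q , f) → q , λ D sh → ≤-trans (Setting.within f D sh)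
      (*-monoˡ-≤ (allotted L E x D) (≤-trans (m≤m+n β-predecessor _) (m≤n+m _ (β-prefix σ)))) })
    (Queries.predecessor-runs σ w L E t x r s z (Pre.loaded p) (Pre.query p))
  performs successor L E t x r s z p = runs-map (λ { (q , f) → q , λ D sh → ≤-trans (Setting.within f D sh)
      (*-monoˡ-≤ (allotted L E x D) (≤-trans (m≤m+n β-successor _) (≤-trans (m≤n+m _ β-predecessor) (m≤n+m _ (β-prefix σ))))) })
    (Queries.successor-runs σ w L E t x r s z (Pre.loaded p) (Pre.query p))
  performs insert L E t x r s z p = runs-map (λ { (q , f) → q , λ D sh → ≤-trans (Setting.within f D sh)
      (*-monoˡ-≤ (allotted L E x D) (≤-trans (m≤m+n β-insert β-delete) (≤-trans (m≤n+m _ β-successor) (≤-trans (m≤n+m _ β-predecessor) (m≤n+m _ (β-prefix σ)))))) })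
    (Inserting.insert-runs σ w L E t x r s z (Pre.loaded p) (Pre.query p) (Pre.args p refl))
  performs delete L E t x r s z p = runs-map (λ { (q , f) → q , λ D sh → ≤-trans (Setting.within f D sh)
      (*-monoˡ-≤ (allotted L E x D) (≤-trans (m≤n+m β-delete β-insert) (≤-trans (m≤n+m _ β-successor) (≤-trans (m≤n+m _ β-predecessor) (m≤n+m _ (β-prefix σ)))))) })
    (Deleting.delete-runs σ w L E t x r s z (Pre.loaded p) (Pre.query p))

  correct : Correct σ w lcpCode (program σ)
  correct o L R E t x r s z p with performs o L E t x r s z p
  ... | s′ , τ , run , post , _ = s′ , τ , run , post

-- The time bound

private
  reach : ℕ → ℕ
  reach d = (2 + d) + (4 + d)

κ-path : (K d : ℕ) → ℕ
κ-path K d = c₁ + (c₁ * ((1 + K) * 2) + 1)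
  -- The 3 is that of `budget`; the 4 stems from two counts of records, each at most twice `M + e`.
  where c₁ = 3 + 4 * reach d

module _ (K d l L : ℕ) (log≤ : l ≤ K * (1 + L)) (Q : ℕ) where

  private
    a′ = suc l
    M+e = (2 + d) * a′ + (4 + d) * a′
    T = M+e + M+e
    b = ⌊log₂ L ⌋
    c₁ = 3 + 4 * reach d

    path≤ : 3 + (T + T) ≤ c₁ * a′
    path≤ = begin
      3 + (T + T) ≡⟨ cong (λ m → 3 + (m + m + (m + m))) (*-distribʳ-+ a′ (2 + d) (4 + d)) ⟨
      3 + (m + m + (m + m)) ≡⟨ cong (3 +_) (trans (+-assoc m m (m + m)) (cong (λ k → m + (m + (m + k))) (sym (+-identityʳ m)))) ⟩
      3 + 4 * m ≤⟨ +-mono-≤ (m≤m*n 3 a′) (≤-reflexive (sym (*-assoc 4 (reach d) a′))) ⟩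
      3 * a′ + 4 * reach d * a′ ≡⟨ *-distribʳ-+ a′ 3 (4 * reach d) ⟨
      c₁ * a′ ∎
      where
      open ≤-Reasoning
      m = reach d * a′

    -- Each of `O(log n)` nodes may lose `Q / 2 ^ b`. Since `2 ^ suc b` exceeds `L`, and `log n` is
    -- at most `K * (1 + L)`, the losses add up to `O(Q)`; this is what fixes the length of the
    -- mantissa.
    log-loss : a′ * (Q >> b) ≤ (1 + K) * 2 * Q
    log-loss = begin
      a′ * (Q >> b) ≤⟨ *-monoˡ-≤ (Q >> b) scale ⟩
      (1 + K) * (2 * 2 ^ b) * (Q >> b) ≡⟨ trans (cong (_* (Q >> b)) (sym (*-assoc (1 + K) 2 (2 ^ b)))) (*-assoc ((1 + K) * 2) (2 ^ b) (Q >> b)) ⟩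
      (1 + K) * 2 * (2 ^ b * (Q >> b)) ≤⟨ *-monoʳ-≤ ((1 + K) * 2) (≤-trans (≤-reflexive (*-comm (2 ^ b) (Q >> b))) (>>-lower b Q)) ⟩
      (1 + K) * 2 * Q ∎
      where
      open ≤-Reasoning
      scale : a′ ≤ (1 + K) * (2 * 2 ^ b)
      scale = ≤-trans (≤-trans (s≤s log≤) (+-monoˡ-≤ (K * (1 + L)) (s≤s z≤n))) (*-monoʳ-≤ (1 + K) (n<2^[1+⌊log₂n⌋] L))

  path-time : (3 + (T + T)) * suc (Q >> b) + Q ≤ κ-path K d * (1 + Q + l)
  path-time = begin
    (3 + (T + T)) * suc (Q >> b) + Q ≤⟨ +-monoˡ-≤ Q (*-monoˡ-≤ (suc (Q >> b)) path≤) ⟩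
    c₁ * a′ * suc (Q >> b) + Q ≡⟨ cong (_+ Q) (trans (*-suc (c₁ * a′) (Q >> b)) (cong (c₁ * a′ +_) (*-assoc c₁ a′ (Q >> b)))) ⟩
    c₁ * a′ + c₁ * (a′ * (Q >> b)) + Q ≤⟨ +-monoˡ-≤ Q (+-monoʳ-≤ (c₁ * a′) (*-monoʳ-≤ c₁ log-loss)) ⟩
    c₁ * a′ + c₁ * ((1 + K) * 2 * Q) + Q ≡⟨ cong₂ (λ p q → c₁ * a′ + p + q) (sym (*-assoc c₁ ((1 + K) * 2) Q)) (sym (*-identityˡ Q)) ⟩
    c₁ * a′ + c₁ * ((1 + K) * 2) * Q + 1 * Q ≤⟨ +-mono-≤ (+-mono-≤ (*-monoʳ-≤ c₁ a′≤) (*-monoʳ-≤ (c₁ * ((1 + K) * 2)) Q≤)) (*-monoʳ-≤ 1 Q≤) ⟩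
    c₁ * S + c₁ * ((1 + K) * 2) * S + 1 * S ≡⟨ trans (+-assoc (c₁ * S) _ (1 * S)) (trans (cong (c₁ * S +_) (sym (*-distribʳ-+ S (c₁ * ((1 + K) * 2)) 1))) (sym (*-distribʳ-+ S c₁ (c₁ * ((1 + K) * 2) + 1)))) ⟩
    κ-path K d * S ∎
    where
    open ≤-Reasoning
    S = 1 + Q + l
    a′≤ : a′ ≤ S
    a′≤ = s≤s (m≤n+m l Q)
    Q≤ : Q ≤ S
    Q≤ = ≤-trans (n≤1+n Q) (m≤m+n (1 + Q) l)

-- The failure probability

module _ (n d : ℕ) .{{_ : NonZero n}} where

  private
    l = ⌊log₂ n ⌋
    a′ = suc l
    h = pow ½ a′
    D = pow ½ (d * a′)

    0≤D : 0ℚ ℚ.≤ D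
    0≤D = pow-nonneg 0≤½ (d * a′)

    0≤h : 0ℚ ℚ.≤ h
    0≤h = pow-nonneg 0≤½ a′

    h≤½ : h ℚ.≤ ½
    h≤½ = ℚ.≤-trans (*-mono-≤ˡ ½ 0≤½ (pow-≤1 0≤½ (from-yes (½ ℚ.≤? 1ℚ)) l)) (ℚ.≤-reflexive (ℚ.*-identityʳ ½))

    n≤2^a′ : n ≤ 2 ^ a′
    n≤2^a′ = <⇒≤ (n<2^[1+⌊log₂n⌋] n)

    D≤ : D ℚ.≤ 1/ n ^ d
    D≤ = begin
      D ≡⟨ ℚ.*-identityʳ D ⟨
      D ℚ.* 1ℚ ≡⟨ cong (D ℚ.*_) (natQ*inverse (n ^ d)) ⟨
      D ℚ.* (natQ (n ^ d) ℚ.* 1/ n ^ d) ≡⟨ ℚ.*-assoc D (natQ (n ^ d)) (1/ n ^ d) ⟨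
      D ℚ.* natQ (n ^ d) ℚ.* 1/ n ^ d ≤⟨ *-mono-≤ʳ (1/ n ^ d) (0≤1/ (n ^ d)) (*-mono-≤ˡ D 0≤D (natQ-mono (≤-trans (^-monoˡ-≤ d n≤2^a′) (≤-reflexive (trans (^-*-assoc 2 a′ d) (cong (2 ^_) (*-comm a′ d))))))) ⟩
      D ℚ.* natQ (2 ^ (d * a′)) ℚ.* 1/ n ^ d ≡⟨ cong (ℚ._* 1/ n ^ d) (½^*natQ (d * a′)) ⟩
      1ℚ ℚ.* 1/ n ^ d ≡⟨ ℚ.*-identityˡ (1/ n ^ d) ⟩
      1/ n ^ d ∎
      where
      open ℚ.≤-Reasoning
      instance
        n^d≢0 : NonZero (n ^ d)
        n^d≢0 = m^n≢0 n d

    -- Of the two factors `h` beyond `D`, one absorbs the `n` keys of the union bound and the other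
    -- is at most one half.
    high : natQ n ℚ.* pow ½ ((2 + d) * a′) ℚ.≤ ½ ℚ.* D
    high = begin
      natQ n ℚ.* pow ½ ((2 + d) * a′) ≡⟨ cong (natQ n ℚ.*_) (trans (pow-+ ½ a′ (a′ + d * a′)) (cong (h ℚ.*_) (pow-+ ½ a′ (d * a′)))) ⟩
      natQ n ℚ.* (h ℚ.* (h ℚ.* D)) ≡⟨ solve 3 (λ n h D → n :* (h :* (h :* D)) := h :* n :* (h :* D)) refl (natQ n) h D ⟩
      h ℚ.* natQ n ℚ.* (h ℚ.* D) ≤⟨ *-mono-≤ʳ (h ℚ.* D) (*-nonneg 0≤h 0≤D) (ℚ.≤-trans (*-mono-≤ˡ h 0≤h (natQ-mono n≤2^a′)) (ℚ.≤-reflexive (½^*natQ a′))) ⟩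
      1ℚ ℚ.* (h ℚ.* D) ≡⟨ ℚ.*-identityˡ (h ℚ.* D) ⟩
      h ℚ.* D ≤⟨ *-mono-≤ʳ D 0≤D h≤½ ⟩
      ½ ℚ.* D ∎
      where open ℚ.≤-Reasoning

    -- The six weights are absorbed by four factors of at most one half: `6 / 16 ≤ 1 / 2`, whereas
    -- three would leave `6 / 8`.
    long : pow ½ ((4 + d) * a′) ℚ.* natQ 6 ℚ.≤ ½ ℚ.* D
    long = begin
      pow ½ ((4 + d) * a′) ℚ.* natQ 6 ≡⟨ cong (ℚ._* natQ 6) (trans (pow-+ ½ a′ (a′ + (a′ + (a′ + d * a′)))) (cong (h ℚ.*_) (trans (pow-+ ½ a′ (a′ + (a′ + d * a′)))
        (cong (h ℚ.*_) (trans (pow-+ ½ a′ (a′ + d * a′)) (cong (h ℚ.*_) (pow-+ ½ a′ (d * a′)))))))) ⟩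
      h ℚ.* (h ℚ.* (h ℚ.* (h ℚ.* D))) ℚ.* natQ 6 ≤⟨ *-mono-≤ʳ (natQ 6) (natQ-nonneg 6) (step (*-nonneg 0≤h (*-nonneg 0≤h (*-nonneg 0≤h 0≤D))) (step (*-nonneg 0≤h (*-nonneg 0≤h 0≤D)) (step (*-nonneg 0≤h 0≤D) (step 0≤D ℚ.≤-refl)))) ⟩
      ½ ℚ.* (½ ℚ.* (½ ℚ.* (½ ℚ.* D))) ℚ.* natQ 6 ≡⟨ solve 3 (λ c D m → c :* (c :* (c :* (c :* D))) :* m := (c :* c :* c :* c :* m) :* D) refl ½ D (natQ 6) ⟩
      ½ ℚ.* ½ ℚ.* ½ ℚ.* ½ ℚ.* natQ 6 ℚ.* D ≤⟨ *-mono-≤ʳ D 0≤D (from-yes ((½ ℚ.* ½ ℚ.* ½ ℚ.* ½ ℚ.* natQ 6) ℚ.≤? ½)) ⟩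
      ½ ℚ.* D ∎
      where
      open ℚ.≤-Reasoning
      step : ∀ {p q} → 0ℚ ℚ.≤ p → p ℚ.≤ q → h ℚ.* p ℚ.≤ ½ ℚ.* q
      step {p} {q} 0≤p p≤q = ℚ.≤-trans (*-mono-≤ʳ p 0≤p h≤½) (*-mono-≤ˡ ½ 0≤½ p≤q)

  union-bound : pow ½ ((4 + d) * a′) ℚ.* natQ 6 ℚ.+ natQ n ℚ.* pow ½ ((2 + d) * a′) ℚ.≤ 1/ n ^ d
  union-bound = begin
    pow ½ ((4 + d) * a′) ℚ.* natQ 6 ℚ.+ natQ n ℚ.* pow ½ ((2 + d) * a′) ≤⟨ ℚ.+-mono-≤ long high ⟩
    ½ ℚ.* D ℚ.+ ½ ℚ.* D ≡⟨ ℚ.*-distribʳ-+ D ½ ½ ⟨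
    1ℚ ℚ.* D ≡⟨ ℚ.*-identityˡ D ⟩
    D ≤⟨ D≤ ⟩
    1/ n ^ d ∎
    where open ℚ.≤-Reasoning

module _ (σ w : ℕ) .{{_ : NonTrivial σ}} .{{_ : NonZero (α σ w)}} {c K d n L R : ℕ} (tuned : Tuned c K n L R)
         {E : List (Entry σ R)} {t : Tree σ R} (z : ZipTrie (LCPCode.encode lcpCode L (α σ w)) E t) (x : Str σ) where

  private
    a′ = suc ⌊log₂ n ⌋
    M = (2 + d) * a′
    e = (4 + d) * a′
    D = ((M + e) + (M + e)) + ((M + e) + (M + e))
    enc = LCPCode.encode lcpCode L (α σ w)
    open Event x using (badness; shallow; ranks<M)

  module _ (good : badness M e {R} (map rank₁Of E) ℚ.< 1ℚ) where

    fast : ∀ r → Fast σ w (program σ) (κ-total σ * κ-path K d) n L E t x r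
    fast r o s s′ τ p run with performs σ w o L E t x r s z p
    ... | _ , _ , run′ , _ , bound with deterministic run run′
    ...   | refl , refl = begin
      τ ≤⟨ bound D (shallow M e z good) ⟩
      κ-total σ * allotted σ w L E x D ≤⟨ *-monoʳ-≤ (κ-total σ) (path-time K d ⌊log₂ n ⌋ L (Tuned.log≤ tuned) (lcpWith x (keys E) / α σ w)) ⟩
      κ-total σ * (κ-path K d * (1 + lcpWith x (keys E) / α σ w + ⌊log₂ n ⌋)) ≡⟨ *-assoc (κ-total σ) (κ-path K d) _ ⟨
      κ-total σ * κ-path K d * (1 + lcpWith x (keys E) / α σ w + ⌊log₂ n ⌋) ∎
      where open ≤-Reasoning

    compact : Compact σ w (κ-metadata c K d) n E t
    compact = All.zipWith (λ { {v} (r< , (lo , hi , k , lo∈ , hi∈)) → small v r< lo hi k lo∈ hi∈ })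
      (ranks , TAll⇒All t (zt-codes enc (keys E) t (zipTrie⇒ZT enc z) tt tt keys∈))
      where
      ranks : All (λ v → proj₁ (rank v) < M) (nodes t)
      ranks = All.map⁻ (All-resp-↭ (↭-sym (ZipTrie.stores z)) (All.map⁻ (ranks<M M e {R} {map rank₁Of E} good)))
      keys∈ : TAll (λ v → key v ∈ keys E) t
      keys∈ = All⇒TAll t (All.map⁻ (All-resp-↭ (↭-sym (ZipTrie.stores z)) (All.map⁻ {f = proj₁} (All.tabulate (λ y∈ → y∈)))))
      -- The bounds at a node are infinite or stored keys other than its own, so their LCPs with its
      -- key are at most the maximum over `others`.
      small : ∀ v → proj₁ (rank v) < M → ∀ lo hi → Codes enc lo hi v → lo ∈∞ keys E → hi ∈∞ keys E →
              metadataBits v ≤ κ-metadata c K d * (1 + ⌊log₂ ⌊log₂ n ⌋ ⌋ + ⌊log₂ ⌊log₂ lcpWith (key v) (filter (λ y → ¬? (y ≟ˢ key v)) (keys E)) / α σ w ⌋ ⌋)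
      small v r< lo hi k lo∈ hi∈ = B.total-bits (B.rank₁-bits r<) (B.rank₂-bits (Fin.toℕ<n (proj₂ (rank v))))
        (subst (λ q → bits q ≤ (6 + ⌊log₂ K ⌋) * (1 + ⌊log₂ ⌊log₂ n ⌋ ⌋ + u)) (sym (Codes.code⁻≡ k)) (B.code-bits (lcp∞ (key v) lo / α σ w) (loglog lo lo∈ (outside-lo lo (Codes.lo< k)))))
        (subst (λ q → bits q ≤ (6 + ⌊log₂ K ⌋) * (1 + ⌊log₂ ⌊log₂ n ⌋ ⌋ + u)) (sym (Codes.code⁺≡ k)) (B.code-bits (lcp∞ (key v) hi / α σ w) (loglog hi hi∈ (outside-hi hi (Codes.<hi k)))))
        where
        others = filter (λ y → ¬? (y ≟ˢ key v)) (keys E)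
        u = ⌊log₂ ⌊log₂ lcpWith (key v) others / α σ w ⌋ ⌋
        module B = MetadataBound c K d n L R tuned u
        Other : Maybe (Str σ) → Set
        Other nothing = ⊤
        Other (just y) = y ≢ key v
        outside-lo : ∀ b → b <₋ key v → Other b
        outside-lo nothing _ = tt
        outside-lo (just y) p = <ˢ⇒≢ p
        outside-hi : ∀ b → key v <₊ b → Other b
        outside-hi nothing _ = tt
        outside-hi (just y) p q = <ˢ⇒≢ p (sym q)
        lcp≤ : ∀ b → b ∈∞ keys E → Other b → lcp∞ (key v) b ≤ lcpWith (key v) others
        lcp≤ nothing _ _ = z≤n
        lcp≤ (just y) y∈ y≢ = All.lookup (xs≤max 0 (map (lcp (key v)) others)) (∈-map⁺ (lcp (key v)) (∈-filter⁺ (λ y → ¬? (y ≟ˢ key v)) y∈ y≢))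
        loglog : ∀ b → b ∈∞ keys E → Other b → ⌊log₂ ⌊log₂ lcp∞ (key v) b / α σ w ⌋ ⌋ ≤ u
        loglog b b∈ o = ⌊log₂⌋-mono-≤ (⌊log₂⌋-mono-≤ (/-monoˡ-≤ (α σ w) (lcp≤ b b∈ o)))

pairs≡ : ∀ {σ R m} .{{_ : NonZero R}} (ks : Vec (Str σ) m) (ranks : Vec (Rank R) m) → pairs ks ranks ≡ map rank₁Of (toList (Vec.zip ks ranks))
pairs≡ [] [] = refl
pairs≡ (k ∷ ks) (r ∷ ranks) = cong ((k , proj₁ r) ∷_) (pairs≡ ks ranks)

theorem4p1 :
    ∀ (σ : ℕ) → .{{_ : NonTrivial σ}} →
    Σ[ code ∈ LCPCode ] Σ[ program ∈ (Operation → Cmd) ]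
      (∀ (w : ℕ) → .{{_ : NonZero (α σ w)}} → Correct σ w code program)
      × (∀ (c K d : ℕ) → ∃[ C ]
          ∀ (w n L R : ℕ) →
          .{{_ : NonZero (α σ w)}} → .{{_ : NonZero n}} → .{{_ : NonZero R}} →
          Tuned c K n L R →
          ∀ (ks : Vec (Str σ) n) → Unique (toList ks) →
          ∀ (x : Str σ) →
          FailsWithProbability≤ {R = R} (1/ n ^ d)
            (Good σ w code program C L ks x))
theorem4p1 σ = lcpCode , program σ , (λ w → correct σ w) , λ c K d →
  -- One constant serves time and space, so the two are added.
  let C = κ-total σ * κ-path K d + κ-metadata c K d in C , λ w n L R tuned ks unique x →
  let M = (2 + d) * suc ⌊log₂ n ⌋
      e = (4 + d) * suc ⌊log₂ n ⌋
      bad = Event.badness x M e {R}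
      -- The rank of x itself does not matter.
      F = λ { [] → 0ℚ ; (_ ∷ l) → bad l }
  in markov (x ∷ ks) F
    (λ { [] → ℚ.≤-refl ; (_ ∷ l) → Event.badness-nonneg x M e {R} l })
    -- The rational comparison is decidable, so it may be proved by refuting its negation, although
    -- `Good` itself is not decided.
    (λ { (r ∷ ranks) ¬good → decidable-stable (1ℚ ℚ.≤? bad (pairs ks ranks)) λ ¬1≤ → ¬good λ t z →
      let good = subst (λ l → bad l ℚ.< 1ℚ) (pairs≡ ks ranks) (ℚ.≰⇒> ¬1≤) in
      (λ o s s′ τ p run → ≤-trans (fast σ w {c} {K} {d} tuned z x good r o s s′ τ p run) (*-monoˡ-≤ _ (m≤m+n (κ-total σ * κ-path K d) (κ-metadata c K d))))
      , All.map (λ l → ≤-trans l (*-monoˡ-≤ _ (m≤n+m (κ-metadata c K d) (κ-total σ * κ-path K d)))) (compact σ w {c} {K} {d} tuned z x good) })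
    λ N → ℚ.≤-trans (𝔼-mono N λ _ → ℚ.≤-trans (Event.𝔼s-badness x M e {R} N (toList ks) unique)
        (ℚ.≤-trans (ℚ.≤-reflexive (cong (λ m → pow ½ e ℚ.* natQ 6 ℚ.+ natQ m ℚ.* pow ½ M) (length-toList ks))) (union-bound n d)))
      (𝔼-const N (0≤1/ (n ^ d) {{m^n≢0 n d}}))
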